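{- Fix an integer $r>0$, an integer $p\ge1$, and partitions $\beta_1,\beta_2$. Let $1^p$ denote the single-column partition of length $p$. Then \[ \tau^r_{1^p,\emptyset}\cdot\tau^r_{\beta_1,\beta_2}=\sum_{\lambda}\Big(\tau^r_{\lambda,\beta_2}+\sum_{(\gamma_1,\gamma_2)}\tau^r_{\gamma_1,\gamma_2}\Big), \] where $\lambda$ runs over partitions with $\lambda/\beta_1$ a vertical strip of length $p$, and the inner sum runs over pairs $(\gamma_1,\gamma_2)$ such that for some $q\ge1$, $\gamma_1/\lambda$ and $\beta_2/\gamma_2$ are vertical strips of length $q$, $T_{\gamma_1/\lambda}\in\mathrm{RW}_{\gamma_1/\lambda}(\beta_2/\gamma_2)$, the arrow $a_{T_{\gamma_1/\lambda}}:(\lambda,\beta_2)\to(\gamma_1,\gamma_2)$ satisfies the $r$-th row rule, and the tableau $S=\mathrm{Slide}_{T_{\lambda/\beta_1}}(T_{\gamma_1/\lambda})$ satisfies the reverse $r$-th row rule with respect to $\beta_2/\gamma_2$ (i.e. $R_r(i)>\mathrm{row}_S(i)$ for all $i$).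
   Context: Tableaux: English Young diagrams (rows numbered top to bottom, columns left to right). A skew shape is a vertical strip of length $q$ if it has $q$ boxes, no two in the same row; for a vertical strip $\mu/\nu$, $T_{\mu/\nu}$ is the tableau labelling its boxes $1,2,\dots$ from top to bottom. $\mathrm{rl}(\alpha/\beta)$ writes $1,\dots,|\alpha/\beta|$ into $\alpha/\beta$ right to left along rows, rows top to bottom. $\mathrm{RW}_{\gamma/\delta}(\alpha/\beta)$: standard tableaux $T$ of shape $\gamma/\delta$ such that if $i,i+1$ share a row of $\mathrm{rl}(\alpha/\beta)$ then $i+1$ is strictly right of and weakly above $i$ in $T$, and if $i$ is directly above $j$ in a column of $\mathrm{rl}(\alpha/\beta)$ then $j$ is strictly below and weakly left of $i$ in $T$. Quiver and bases: $s_{\alpha_1,\alpha_2}=s_{\alpha_1}(x)s_{\alpha_2}(y)$ in $\Lambda_1\otimes_{\mathbb Z}\Lambda_2$. Arrows $a_T:(\alpha_1,\alpha_2)\to(\beta_1,\beta_2)$ between distinct pairs for each $T\in\mathrm{RW}_{\beta_1/\alpha_1}(\alpha_2/\beta_2)$. The $r$-th row rule filling of a partition has $r+i-j$ in row $i$, column $j$; for $a_T$ and each $i$, $R_r(i)$ is the entry of the row rule filling of $\alpha_2$ at the box of $\alpha_2/\beta_2$ labelled $i$ in $\mathrm{rl}(\alpha_2/\beta_2)$ and $\mathrm{row}_T(i)$ the row of $i$ in $T$; the $r$-th row rule is $R_r(i)\le\mathrm{row}_T(i)$ for all $i$, the reverse one $R_r(i)>\mathrm{row}_T(i)$ for all $i$.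 $\tau^r_{\alpha_1,\alpha_2}=s_{\alpha_1,\alpha_2}-\sum_a\tau^r_{t(a)}$ recursively in $|\alpha_2|$, over arrows with source $(\alpha_1,\alpha_2)$ satisfying the $r$-th row rule, $t(a)$ the target. Infusion: for $\alpha\subseteq\beta\subseteq\gamma$ and standard $T_1$ of shape $\beta/\alpha$, $T_2$ of shape $\gamma/\beta$, go through the boxes of $T_1$ in decreasing order of labels and perform a jeu-de-taquin slide of the current $T_2$ into each; the result is $\mathrm{Slide}_{T_1}(T_2)$. -}

module Defs where

open import Data.Nat as ℕ using (ℕ; zero; suc; _+_; _∸_; _≡ᵇ_; _<ᵇ_; _≤ᵇ_; _⊓_)
open import Data.Integer as ℤ using (ℤ; +_)
open import Data.Bool using (Bool; true; false; _∧_; _∨_; not; if_then_else_)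
open import Data.List using (List; []; _∷_; _++_; map; concatMap; foldr; length; upTo; zip; reverse)
open import Data.Product using (_×_; _,_; proj₁; proj₂)
open import Data.Nat.ListAction using (sum)
open import Data.Maybe using (Maybe; just; nothing)

filterB : {A : Set} → (A → Bool) → List A → List A
filterB p [] = []
filterB p (x ∷ xs) = if p x then x ∷ filterB p xs else filterB p xs

allB : {A : Set} → (A → Bool) → List A → Bool
allB p [] = true
allB p (x ∷ xs) = p x ∧ allB p xs

anyB : {A : Set} → (A → Bool) → List A → Bool
anyB p [] = false
anyB p (x ∷ xs) = p x ∨ anyB p xs

_⇒ᵇ_ : Bool → Bool → Bool
a ⇒ᵇ b = not a ∨ b

fromTo : ℕ → ℕ → List ℕ
fromTo a b = map (λ k → a + k) (upTo (suc b ∸ a))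

nth : {A : Set} → List A → ℕ → Maybe A
nth [] _ = nothing
nth (x ∷ xs) zero = just x
nth (x ∷ xs) (suc n) = nth xs n

setAt : {A : Set} → ℕ → A → List A → List A
setAt _ _ [] = []
setAt zero y (x ∷ xs) = y ∷ xs
setAt (suc n) y (x ∷ xs) = x ∷ setAt n y xs

eqList : List ℕ → List ℕ → Bool
eqList [] [] = true
eqList (x ∷ xs) (y ∷ ys) = (x ≡ᵇ y) ∧ eqList xs ys
eqList _ _ = false

consec : {A : Set} → List A → List (A × A)
consec [] = []
consec (x ∷ []) = []
consec (x ∷ y ∷ xs) = (x , y) ∷ consec (y ∷ xs)

allPairs : {A : Set} → List A → List (A × A)
allPairs xs = concatMap (λ x → map (λ y → (x , y)) xs) xs

Part : Set
Part = List ℕ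

isPartition : List ℕ → Bool
isPartition [] = true
isPartition (x ∷ []) = 1 ≤ᵇ x
isPartition (x ∷ y ∷ xs) = (y ≤ᵇ x) ∧ (1 ≤ᵇ x) ∧ isPartition (y ∷ xs)

size : Part → ℕ
size = sum

-- containment β ⊆ α of Young diagrams (missing parts are 0)
_⊆ᵇ_ : Part → Part → Bool
[] ⊆ᵇ _ = true
(x ∷ xs) ⊆ᵇ [] = (x ≡ᵇ 0) ∧ (xs ⊆ᵇ [])
(x ∷ xs) ⊆ᵇ (y ∷ ys) = (x ≤ᵇ y) ∧ (xs ⊆ᵇ ys)

-- all partitions of n with parts ≤ m (first argument is fuel, ≥ n)
ptsF : ℕ → ℕ → ℕ → List Part
ptsF _ zero _ = [] ∷ []
ptsF zero (suc n) _ = []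
ptsF (suc f) (suc n) m =
  concatMap (λ k → map (k ∷_) (ptsF f (suc n ∸ k) k)) (fromTo 1 (m ⊓ suc n))

partitionsOf : ℕ → List Part
partitionsOf n = ptsF n n n

subPartitions : Part → List Part
subPartitions α = filterB (_⊆ᵇ α) (concatMap partitionsOf (upTo (suc (size α))))

column : ℕ → Part
column zero = []
column (suc p) = 1 ∷ column p

-- Boxes (row i, column j), both 1-indexed, English convention

Box : Set
Box = ℕ × ℕ

eqBox : Box → Box → Bool
eqBox (a , b) (c , d) = (a ≡ᵇ c) ∧ (b ≡ᵇ d)

row col : Box → ℕ
row = proj₁
col = proj₂

boxesAux : ℕ → List ℕ → List ℕ → List Box
boxesAux i [] _ = []
boxesAux i (a ∷ as) [] = map (λ j → (i , j)) (fromTo 1 a) ++ boxesAux (suc i) as []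
boxesAux i (a ∷ as) (b ∷ bs) = map (λ j → (i , j)) (fromTo (suc b) a) ++ boxesAux (suc i) as bs

boxes : Part → Part → List Box
boxes α β = boxesAux 1 α β

rlAux : ℕ → List ℕ → List ℕ → List Box
rlAux i [] _ = []
rlAux i (a ∷ as) [] = reverse (map (λ j → (i , j)) (fromTo 1 a)) ++ rlAux (suc i) as []
rlAux i (a ∷ as) (b ∷ bs) = reverse (map (λ j → (i , j)) (fromTo (suc b) a)) ++ rlAux (suc i) as bs

-- rl(α/β): the k-th element (k = 0,1,..) is the box carrying label k+1
-- (right to left along rows, rows top to bottom)
rl : Part → Part → List Box
rl α β = rlAux 1 α β

inShape : List Box → Box → Bool
inShape bs b = anyB (eqBox b) bs

distinctRows : List Box → Bool
distinctRows [] = true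
distinctRows (b ∷ bs) = allB (λ c → not (row b ≡ᵇ row c)) bs ∧ distinctRows bs

isVStrip : Part → Part → ℕ → Bool
isVStrip μ ν q = (ν ⊆ᵇ μ) ∧ (length (boxes μ ν) ≡ᵇ q) ∧ distinctRows (boxes μ ν)

-- Tableaux.  A standard tableau with n boxes is the list of positions of
-- its labels:  the k-th element (k = 0..n-1) is the box labelled k+1.

Tab : Set
Tab = List Box

eqTab : Tab → Tab → Bool
eqTab [] [] = true
eqTab (x ∷ xs) (y ∷ ys) = eqBox x y ∧ eqTab xs ys
eqTab _ _ = false

indexOf : Box → Tab → Maybe ℕ
indexOf b [] = nothing
indexOf b (c ∷ cs) = if eqBox b c then just 0 else Data.Maybe.map suc (indexOf b cs)
  where import Data.Maybe

labelLess : Tab → Box → Box → Bool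
labelLess t b c with indexOf b t | indexOf c t
... | just x | just y = x <ᵇ y
... | _ | _ = false

insertions : {A : Set} → A → List A → List (List A)
insertions x [] = (x ∷ []) ∷ []
insertions x (y ∷ ys) = (x ∷ y ∷ ys) ∷ map (y ∷_) (insertions x ys)

perms : {A : Set} → List A → List (List A)
perms [] = [] ∷ []
perms (x ∷ xs) = concatMap (insertions x) (perms xs)

increasing : Part → Part → Tab → Bool
increasing γ δ t = allB ok (boxes γ δ)
  where
  ok : Box → Bool
  ok (i , j) = (inShape (boxes γ δ) (i , suc j) ⇒ᵇ labelLess t (i , j) (i , suc j))
             ∧ (inShape (boxes γ δ) (suc i , j) ⇒ᵇ labelLess t (i , j) (suc i , j))

SYT : Part → Part → List Tab
SYT γ δ = filterB (increasing γ δ) (perms (boxes γ δ))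

isStd : Part → Part → Tab → Bool
isStd γ δ t = anyB (eqTab t) (SYT γ δ)

-- T_{μ/ν} for a vertical strip: labels 1,2,... top to bottom
Tstrip : Part → Part → Tab
Tstrip μ ν = boxes μ ν

RW : Part → Part → Part → Part → Tab → Bool
RW γ δ α β t =
  isStd γ δ t ∧ (length t ≡ᵇ length L) ∧ allB rowCond (consec Z) ∧ allB colCond (allPairs Z)
  where
  L = rl α β
  Z = zip L t
  rowCond : (Box × Box) × (Box × Box) → Bool
  rowCond ((b , x) , (c , y)) =
    (row b ≡ᵇ row c) ⇒ᵇ ((col x <ᵇ col y) ∧ (row y ≤ᵇ row x))
  colCond : (Box × Box) × (Box × Box) → Bool
  colCond ((b , x) , (c , y)) =
    ((suc (row b) ≡ᵇ row c) ∧ (col b ≡ᵇ col c)) ⇒ᵇ ((row x <ᵇ row y) ∧ (col y ≤ᵇ col x))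

-- Row rules.  R_r(i) = r + (row) - (column) of the box labelled i in rl(α₂/β₂).

Rr : ℕ → Box → ℤ
Rr r (i , j) = + (r + i) ℤ.- + j

rowRule : ℕ → Part → Part → Tab → Bool
rowRule r α₂ β₂ t = allB (λ bx → Rr r (proj₁ bx) ℤ.≤ᵇ + row (proj₂ bx)) (zip (rl α₂ β₂) t)

reverseRowRule : ℕ → Part → Part → Tab → Bool
reverseRowRule r α₂ β₂ t =
  allB (λ bx → not (Rr r (proj₁ bx) ℤ.≤ᵇ + row (proj₂ bx))) (zip (rl α₂ β₂) t)

-- Arrows a_T : (α₁,α₂) → (β₁,β₂), T ∈ RW_{β₁/α₁}(α₂/β₂), (β₁,β₂) ≠ (α₁,α₂)

Arrow : Set
Arrow = Part × Part × Tab

arrowsFrom : Part → Part → List Arrow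
arrowsFrom α₁ α₂ =
  concatMap (λ β₂ →
    concatMap (λ β₁ →
      if eqList β₁ α₁ ∧ eqList β₂ α₂ then []
      else map (λ t → (β₁ , β₂ , t)) (filterB (RW β₁ α₁ α₂ β₂) (SYT β₁ α₁)))
    (filterB (α₁ ⊆ᵇ_) (partitionsOf (size α₁ + (size α₂ ∸ size β₂)))))
  (subPartitions α₂)

-- Λ₁ ⊗ Λ₂ embedded in ℤ[[x₁,x₂,…,y₁,y₂,…]]: an element is given by its
-- coefficient function, (exponents of x) ↦ (exponents of y) ↦ coefficient.

Series : Set
Series = List ℕ → List ℕ → ℤ

zeroS : Series
zeroS _ _ = + 0

_⊕_ : Series → Series → Series
(f ⊕ g) a b = f a b ℤ.+ g a b

_⊖_ : Series → Series → Series
(f ⊖ g) a b = f a b ℤ.- g a b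

sumS : List Series → Series
sumS = foldr _⊕_ zeroS

splits : List ℕ → List (List ℕ × List ℕ)
splits [] = ([] , []) ∷ []
splits (n ∷ a) =
  concatMap (λ k → map (λ uv → (k ∷ proj₁ uv , (n ∸ k) ∷ proj₂ uv)) (splits a)) (upTo (suc n))

_⊗_ : Series → Series → Series
(f ⊗ g) a b =
  foldr ℤ._+_ (+ 0)
    (concatMap (λ a' → map (λ b' → f (proj₁ a') (proj₁ b') ℤ.* g (proj₂ a') (proj₂ b')) (splits b))
               (splits a))

fillings : ℕ → ℕ → List (List ℕ)
fillings zero m = [] ∷ []
fillings (suc n) m = concatMap (λ v → map (v ∷_) (fillings n m)) (fromTo 1 m)

count : ℕ → List ℕ → ℕ
count k [] = 0
count k (v ∷ vs) = (if k ≡ᵇ v then 1 else 0) + count k vs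

-- vs lists the entries of the boxes of α in the order of `boxes α []`
semistandard : Part → List ℕ → Bool
semistandard α vs = allB ok bs
  where
  bs = boxes α []
  val : Box → Maybe ℕ
  val b with indexOf b bs
  ... | just k = nth vs k
  ... | nothing = nothing
  le lt : Box → Box → Bool
  le b c with val b | val c
  ... | just x | just y = x ≤ᵇ y
  ... | _ | _ = false
  lt b c with val b | val c
  ... | just x | just y = x <ᵇ y
  ... | _ | _ = false
  ok : Box → Bool
  ok (i , j) = (inShape bs (i , suc j) ⇒ᵇ le (i , j) (i , suc j))
             ∧ (inShape bs (suc i , j) ⇒ᵇ lt (i , j) (suc i , j))

hasContent : List ℕ → List ℕ → Bool
hasContent a vs = allB (λ v → (1 ≤ᵇ v) ∧ (v ≤ᵇ length a)) vs
                ∧ eqList (map (λ k → count k vs) (fromTo 1 (length a))) a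

-- Kostka number: coefficient of x^a in s_α(x)
kostka : Part → List ℕ → ℕ
kostka α a = length (filterB (λ vs → semistandard α vs ∧ hasContent a vs)
                              (fillings (size α) (length a)))

-- s_{α₁,α₂} = s_{α₁}(x) s_{α₂}(y)
schur₂ : Part → Part → Series
schur₂ α₁ α₂ a b = + kostka α₁ a ℤ.* + kostka α₂ b

-- τ^r, by recursion on |α₂| (fuel f; f = |α₂|+1 always suffices since
-- every arrow strictly decreases |α₂|)

τF : ℕ → ℕ → Part → Part → Series
τF r zero α₁ α₂ = schur₂ α₁ α₂
τF r (suc f) α₁ α₂ =
  schur₂ α₁ α₂ ⊖ sumS (map (λ a → τF r f (proj₁ a) (proj₁ (proj₂ a)))
                           (filterB (λ a → rowRule r α₂ (proj₁ (proj₂ a)) (proj₂ (proj₂ a)))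
                                    (arrowsFrom α₁ α₂)))

τ : ℕ → Part → Part → Series
τ r α₁ α₂ = τF r (suc (size α₂)) α₁ α₂

slideLoop : ℕ → Box → Tab → Tab
slideLoop zero h t = t
slideLoop (suc f) (i , j) t with indexOf (i , suc j) t | indexOf (suc i , j) t
... | nothing | nothing = t
... | just a | nothing = slideLoop f (i , suc j) (setAt a (i , j) t)
... | nothing | just b = slideLoop f (suc i , j) (setAt b (i , j) t)
... | just a | just b =
  if a <ᵇ b then slideLoop f (i , suc j) (setAt a (i , j) t)
            else slideLoop f (suc i , j) (setAt b (i , j) t)

slideInto : Box → Tab → Tab
slideInto c t = slideLoop (suc (length t)) c t

-- Slide_{T₁}(T₂): boxes of T₁ in decreasing order of labels
-- (foldr treats the last element of T₁, i.e. the largest label, first)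
Slide : Tab → Tab → Tab
Slide t₁ t₂ = foldr slideInto t₂ t₁

lambdas : Part → ℕ → List Part
lambdas β₁ p = filterB (λ l → isVStrip l β₁ p) (partitionsOf (size β₁ + p))

innerPairs : ℕ → Part → Part → Part → List (Part × Part)
innerPairs r β₁ β₂ l =
  concatMap (λ γ₂ → let q = size β₂ ∸ size γ₂ in
    if (1 ≤ᵇ q) ∧ isVStrip β₂ γ₂ q
    then map (λ γ₁ → (γ₁ , γ₂)) (filterB (cond γ₂ q) (partitionsOf (size l + q)))
    else [])
  (subPartitions β₂)
  where
  cond : Part → ℕ → Part → Bool
  cond γ₂ q γ₁ =
    isVStrip γ₁ l q
    ∧ RW γ₁ l β₂ γ₂ (Tstrip γ₁ l)
    ∧ rowRule r β₂ γ₂ (Tstrip γ₁ l)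
    ∧ reverseRowRule r β₂ γ₂ (Slide (Tstrip l β₁) (Tstrip γ₁ l))

-- Over the arrows t out of (β₁, β₂) that obey the row rule, together with a trivial arrow from (β₁, β₂) to itself,
-- the τ of the targets add up to s_{β₁,β₂}.  Multiply this by τ_{1^p,∅} = s_{1^p,∅}, apply the Pieri rule, and expand
-- every s_{λ,β₂} in the same way.  By induction on |β₂| the theorem becomes a bijection between
--   the pairs of a vertical strip λ/β₁ and an arrow (λ, β₂) → (γ₁, γ₂), and
--   the pairs of an arrow (β₁, β₂) → (δ₁, δ₂) and a term τ_{γ₁,γ₂} of the formula for (δ₁, δ₂).
-- It is given by tableau infusion.  An arrow is recorded as the chain of partitions that starts from its inner shape and
-- adds the boxes of T row by row of rl(α₂/β₂).  The links of the chain are then horizontal strips, and the row rule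
-- says that row i leaves the rows above a certain dam unchanged.  The vertical strip λ/β₁ is moved through
-- the chain one link at a time; entries that would be pushed above the dam are absorbed by the vertical strip.  At the end
-- that strip is γ₁/δ₁, and the absorbed entries come from the strip δ₂/γ₂.
-- The Pieri rule comes from local growth rules in the same manner, for dual RSK insertion.

module Submission where

open import Defs
open import Data.Bool using (Bool; T; _∧_; _∨_; false; if_then_else_; not; true)
open import Data.List using (List; []; _++_; _∷_; applyUpTo; concatMap; drop; foldr; length; map; reverse; upTo; zip)
open import Data.Nat as ℕ using (_*_; _+_; _<?_; _<_; _<ᵇ_; _∸_; _≟_; _≡ᵇ_; _≤?_; _≤_; _≤ᵇ_; _⊓_; suc; s≤s; zero; z≤n; ℕ)
open import Data.Product using (_,_; _×_; proj₁; proj₂; ∃-syntax)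
open import Relation.Binary.PropositionalEquality as ≡ using (_≡_; _≢_; cong; cong₂; module ≡-Reasoning; refl; subst; subst₂; sym; trans)
open import Data.Empty using (⊥; ⊥-elim)
open import Data.Fin using (Fin; suc; zero)
open import Data.Integer as ℤ using (ℤ)
import Data.Integer.Properties as ℤₚ
open import Data.Integer.Tactic.RingSolver using (solve-∀)
open import Data.List.Membership.Propositional using (_∈_; _∉_)
open import Data.List.Membership.Propositional.Properties using (∈-++⁺ʳ; ∈-++⁺ˡ; ∈-++⁻; ∈-map⁺; ∈-map⁻; ∈-upTo⁺; ∈-upTo⁻; ∈-∃++)
open import Data.List.Membership.Propositional.Properties.WithK using (unique∧set⇒bag)
open import Data.List.Properties using (++-assoc; length-++; length-applyUpTo; length-map; length-reverse; length-upTo; unfold-reverse; ∷-injectiveˡ)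
open import Data.List.Relation.Binary.BagAndSetEquality using (∼bag⇒↭)
open import Data.List.Relation.Binary.Permutation.Propositional as ↭ using (_↭_; prep; swap; ↭-refl; ↭-sym; ↭-trans; ↭⇒↭ₛ)
open import Data.List.Relation.Binary.Permutation.Propositional.Properties using (drop-∷; shift; ↭-length; ∈-resp-↭)
import Data.List.Relation.Binary.Permutation.Setoid.Properties as PermS
open import Data.List.Relation.Unary.All as All using (All; []; _∷_)
import Data.List.Relation.Unary.All.Properties as AllP
open import Data.List.Relation.Unary.AllPairs as AllPairs using (AllPairs; []; _∷_)
import Data.List.Relation.Unary.AllPairs.Properties as AP
open import Data.List.Relation.Unary.Any using (here; there)
open import Data.List.Relation.Unary.Any.Properties using (reverse⁺; reverse⁻)
open import Data.List.Relation.Unary.Unique.Propositional using (Unique)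
import Data.List.Relation.Unary.Unique.Propositional.Properties as Uniq
open import Data.Maybe as Maybe using (Maybe; just; nothing)
open import Data.Nat.DivMod using (_%_; _/_)
open import Data.Nat.Properties
open import Data.Sum using (_⊎_; inj₁; inj₂)
open import Data.Unit using (tt; ⊤)
open import Data.Vec as Vec using (Vec; []; _∷_; lookup)
open import Data.Vec.N-ary using (N-ary; _$ⁿ_; curryⁿ; ∀ⁿ)
open import Function using (_∘_)
open import Function.Bundles using (mk⇔)
open import Relation.Binary using (tri<; tri>; tri≈)
open import Relation.Nullary using (Dec; no; yes; ¬_)
open import Relation.Nullary.Decidable using (_×-dec_)
open import Data.List.Membership.DecPropositional _≟_ using (_∈?_)

-- The intermediate partition λ of a term τ_{γ₁,γ₂} in the formula for (δ₁, δ₂) is invisible in an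
-- infusion, which only yields the strips γ₁/δ₁ and δ₂/γ₂. A local condition, `Linked`, mediates
-- between the two. An entry of row i absorbed at its dam, between rows y and y + 1, leaves two
-- boxes of the vertical strip in these rows, one directly above the other; later dams lie strictly
-- lower, so the pair survives to the end. On the other side, the row rule for `T` and the reverse
-- rule for the slid tableau `S` say that the box belonging to row i starts below the dam and ends
-- above it, and a slide crosses there only if the two rows are linked. Conversely, if the rows at
-- all dams are linked, exactly one λ fits. So the terms become conditions on γ₁/δ₁ and δ₂/γ₂ alone,
-- and these are what is needed to run the infusion backwards. The delicate point of the infusion
-- itself is column strictness of the filling. A violation caused by one carry forces another in a
-- neighbouring row, and so on, past the last row in one direction and up against a dam in the
-- other.

module Linear where

  -- Linear arithmetic over ℕ

  infixl 8 _⊞_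
  infixr 9 _⊠_
  infix 7 _≼_ _≺_ _≐_
  infix 6 [_]⊢_ [_∣_]⊢_
  infixr 5 _&_
  infixr 4 _⇒_

  data Exp (n : ℕ) : Set where
    K   : ℕ → Exp n
    V   : Fin n → Exp n
    _⊞_ : Exp n → Exp n → Exp n
    _⊠_ : ℕ → Exp n → Exp n

  data Hyp (n : ℕ) : Set where
    _≼_ _≐_ : Exp n → Exp n → Hyp n

  _≺_ : ∀ {n} → Exp n → Exp n → Hyp n
  a ≺ b = (K 1 ⊞ a) ≼ b

  -- The numeral is a Farkas certificate: its decimal digits, the last one first, are the
  -- multiplicities of the negated goal and of the hypotheses, the last one first.
  data Prob (n : ℕ) : Set where
    [_]⊢_ : ℕ → Hyp n → Prob n
    [_∣_]⊢_ : ℕ → ℕ → Hyp n → Prob n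
    [_]⊢absurd : ℕ → Prob n
    _&_ : Prob n → Prob n → Prob n
    _⇒_ : Hyp n → Prob n → Prob n

  ⟦_⟧ : ∀ {n} → Exp n → Vec ℕ n → ℕ
  ⟦ K c ⟧ ρ = c
  ⟦ V i ⟧ ρ = lookup ρ i
  ⟦ a ⊞ b ⟧ ρ = ⟦ a ⟧ ρ + ⟦ b ⟧ ρ
  ⟦ k ⊠ a ⟧ ρ = k * ⟦ a ⟧ ρ

  ⟦_⟧ᴴ : ∀ {n} → Hyp n → Vec ℕ n → Set
  ⟦ a ≼ b ⟧ᴴ ρ = ⟦ a ⟧ ρ ≤ ⟦ b ⟧ ρ
  ⟦ a ≐ b ⟧ᴴ ρ = ⟦ a ⟧ ρ ≡ ⟦ b ⟧ ρ

  ⟦_⟧ᴾ : ∀ {n} → Prob n → Vec ℕ n → Set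
  ⟦ [ _ ]⊢ g ⟧ᴾ ρ = ⟦ g ⟧ᴴ ρ
  ⟦ [ _ ∣ _ ]⊢ g ⟧ᴾ ρ = ⟦ g ⟧ᴴ ρ
  ⟦ [ _ ]⊢absurd ⟧ᴾ ρ = ⊥
  ⟦ p & q ⟧ᴾ ρ = ⟦ p ⟧ᴾ ρ × ⟦ q ⟧ᴾ ρ
  ⟦ h ⇒ p ⟧ᴾ ρ = ⟦ h ⟧ᴴ ρ → ⟦ p ⟧ᴾ ρ

  dot : List ℕ → List ℕ → ℕ
  dot [] _ = 0
  dot (c ∷ cs) [] = 0
  dot (c ∷ cs) (x ∷ xs) = c * x + dot cs xs

  addL : List ℕ → List ℕ → List ℕ
  addL [] ys = ys
  addL (x ∷ xs) [] = x ∷ xs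
  addL (x ∷ xs) (y ∷ ys) = (x + y) ∷ addL xs ys

  scaleL : ℕ → List ℕ → List ℕ
  scaleL k = map (k *_)

  unit : ∀ {n} → Fin n → List ℕ
  unit zero = 1 ∷ []
  unit (suc i) = 0 ∷ unit i

  norm : ∀ {n} → Exp n → List ℕ
  norm (K c) = c ∷ []
  norm (V i) = 0 ∷ unit i
  norm (a ⊞ b) = addL (norm a) (norm b)
  norm (k ⊠ a) = scaleL k (norm a)

  -- All variables range over ℕ, so comparing coefficients is enough to compare affine forms, and a
  -- certificate has no entries for the signs of variables. The constant term is the coefficient of
  -- a leading variable with value 1.
  dominated : List ℕ → List ℕ → Bool
  dominated [] _ = true
  dominated (x ∷ xs) [] = (x ≡ᵇ 0) ∧ dominated xs []
  dominated (x ∷ xs) (y ∷ ys) = (x ≤ᵇ y) ∧ dominated xs ys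

  Ineq : Set
  Ineq = List ℕ × List ℕ

  combine : List ℕ → List Ineq → Ineq
  combine [] _ = [] , []
  combine (c ∷ cs) [] = [] , []
  combine (c ∷ cs) ((l , r) ∷ hs) with combine cs hs
  ... | (l′ , r′) = addL (scaleL c l) l′ , addL (scaleL c r) r′

  -- The weighted sum of the hypotheses is an inequality `l ≤ r`; it is absurd as soon as `1 + r` is
  -- dominated by `l`.
  verify : List ℕ → List Ineq → Bool
  verify cs hs with combine cs hs
  ... | (l , r) = dominated (addL (1 ∷ []) r) l

  +-interchange : ∀ a b c d → (a + b) + (c + d) ≡ (a + c) + (b + d)
  +-interchange a b c d = trans (+-assoc a b (c + d)) (trans (cong (a +_) (trans (sym (+-assoc b c d))
    (trans (cong (_+ d) (+-comm b c)) (+-assoc c b d)))) (sym (+-assoc a c (b + d))))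

  dot-add : ∀ xs ys ρ → dot (addL xs ys) ρ ≡ dot xs ρ + dot ys ρ
  dot-add [] ys ρ = refl
  dot-add (x ∷ xs) [] ρ = sym (+-identityʳ _)
  dot-add (x ∷ xs) (y ∷ ys) [] = refl
  dot-add (x ∷ xs) (y ∷ ys) (z ∷ ρ) = trans (cong₂ _+_ (*-distribʳ-+ z x y) (dot-add xs ys ρ))
    (+-interchange (x * z) (y * z) (dot xs ρ) (dot ys ρ))

  dot-scale : ∀ k xs ρ → dot (scaleL k xs) ρ ≡ k * dot xs ρ
  dot-scale k [] ρ = sym (*-zeroʳ k)
  dot-scale k (x ∷ xs) [] = sym (*-zeroʳ k)
  dot-scale k (x ∷ xs) (z ∷ ρ) = trans (cong₂ _+_ (*-assoc k x z) (dot-scale k xs ρ))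
    (sym (*-distribˡ-+ k (x * z) (dot xs ρ)))

  dot-unit : ∀ {n} (i : Fin n) (ρ : Vec ℕ n) → dot (unit i) (Vec.toList ρ) ≡ lookup ρ i
  dot-unit zero (x ∷ ρ) = trans (+-identityʳ _) (+-identityʳ x)
  dot-unit (suc i) (x ∷ ρ) = dot-unit i ρ

  norm-correct : ∀ {n} (e : Exp n) ρ → dot (norm e) (1 ∷ Vec.toList ρ) ≡ ⟦ e ⟧ ρ
  norm-correct (K c) ρ = trans (+-identityʳ _) (*-identityʳ c)
  norm-correct (V i) ρ = dot-unit i ρ
  norm-correct (a ⊞ b) ρ = trans (dot-add (norm a) (norm b) _) (cong₂ _+_ (norm-correct a ρ) (norm-correct b ρ))
  norm-correct (k ⊠ a) ρ = trans (dot-scale k (norm a) _) (cong (k *_) (norm-correct a ρ))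

  ∧-T : ∀ {a b} → T (a ∧ b) → T a × T b
  ∧-T {true} {true} _ = tt , tt

  dominated-sound : ∀ xs ys ρ → T (dominated xs ys) → dot xs ρ ≤ dot ys ρ
  dominated-sound [] ys ρ _ = z≤n
  dominated-sound (x ∷ xs) ys [] _ = z≤n
  dominated-sound (x ∷ xs) [] (z ∷ ρ) h with ∧-T {x ≡ᵇ 0} h
  ... | (p , q) = +-mono-≤ (≤-reflexive (cong (_* z) (≡ᵇ⇒≡ x 0 p))) (dominated-sound xs [] ρ q)
  dominated-sound (x ∷ xs) (y ∷ ys) (z ∷ ρ) h with ∧-T {x ≤ᵇ y} h
  ... | (p , q) = +-mono-≤ (*-monoˡ-≤ z (≤ᵇ⇒≤ x y p)) (dominated-sound xs ys ρ q)

  Holds : List ℕ → List Ineq → Set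
  Holds ρ [] = ⊤
  Holds ρ ((l , r) ∷ hs) = (dot l ρ ≤ dot r ρ) × Holds ρ hs

  combine-sound : ∀ cs hs ρ → Holds ρ hs → dot (proj₁ (combine cs hs)) ρ ≤ dot (proj₂ (combine cs hs)) ρ
  combine-sound [] hs ρ h = z≤n
  combine-sound (c ∷ cs) [] ρ h = z≤n
  combine-sound (c ∷ cs) ((l , r) ∷ hs) ρ (p , q) =
    subst₂ _≤_ (sym (trans (dot-add (scaleL c l) _ ρ) (cong (_+ _) (dot-scale c l ρ))))
               (sym (trans (dot-add (scaleL c r) _ ρ) (cong (_+ _) (dot-scale c r ρ))))
               (+-mono-≤ (*-monoʳ-≤ c p) (combine-sound cs hs ρ q))

  verify-sound : ∀ cs hs ρ → T (verify cs hs) → Holds (1 ∷ ρ) hs → ⊥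
  verify-sound cs hs ρ v h = <-irrefl refl (≤-trans
    (≤-trans (≤-reflexive (sym (dot-add (1 ∷ []) (proj₂ (combine cs hs)) (1 ∷ ρ))))
             (dominated-sound (addL (1 ∷ []) (proj₂ (combine cs hs))) (proj₁ (combine cs hs)) (1 ∷ ρ) v))
    (combine-sound cs hs (1 ∷ ρ) h))

  -- Decimal digits, least significant first.
  digits : ℕ → ℕ → List ℕ
  digits zero c = []
  digits (suc fuel) zero = []
  digits (suc fuel) c = c % 10 ∷ digits fuel (c / 10)

  -- The fuel 30 exceeds the number of digits of every certificate below.
  refutable : ℕ → List Ineq → Bool
  refutable c hs = verify (digits 30 c) hs

  check : ∀ {n} → List Ineq → Prob n → Bool
  check hs ([ c ]⊢ a ≼ b) = refutable c ((norm (K 1 ⊞ b) , norm a) ∷ hs)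
  check hs ([ c ]⊢ a ≐ b) = false
  check hs ([ c ∣ d ]⊢ a ≼ b) = false
  check hs ([ c ∣ d ]⊢ a ≐ b) = refutable c ((norm (K 1 ⊞ b) , norm a) ∷ hs) ∧ refutable d ((norm (K 1 ⊞ a) , norm b) ∷ hs)
  check hs ([ c ]⊢absurd) = refutable c hs
  check hs (p & q) = check hs p ∧ check hs q
  check hs (a ≼ b ⇒ p) = check ((norm a , norm b) ∷ hs) p
  -- An equation enters as two inequalities and takes two digits of a certificate: the less
  -- significant one for `a ≤ b`, the next for `b ≤ a`.
  check hs (a ≐ b ⇒ p) = check ((norm a , norm b) ∷ (norm b , norm a) ∷ hs) p

  module _ {n : ℕ} (ρ : Vec ℕ n) where
    private
      env : List ℕ
      env = 1 ∷ Vec.toList ρ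

    norm-≤ : ∀ a b → ⟦ a ⟧ ρ ≤ ⟦ b ⟧ ρ → dot (norm a) env ≤ dot (norm b) env
    norm-≤ a b = subst₂ _≤_ (sym (norm-correct a ρ)) (sym (norm-correct b ρ))

    goal-≤ : ∀ k hs a b → T (refutable k ((norm (K 1 ⊞ b) , norm a) ∷ hs)) → Holds env hs → ⟦ a ⟧ ρ ≤ ⟦ b ⟧ ρ
    goal-≤ k hs a b c h with ⟦ a ⟧ ρ ≤? ⟦ b ⟧ ρ
    ... | yes a≤b = a≤b
    ... | no a≰b = ⊥-elim (verify-sound (digits 30 k) _ (Vec.toList ρ) c (norm-≤ (K 1 ⊞ b) a (≰⇒> a≰b) , h))

    check-sound : ∀ hs p → T (check hs p) → Holds env hs → ⟦ p ⟧ᴾ ρ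
    check-sound hs ([ k ]⊢ a ≼ b) c h = goal-≤ k hs a b c h
    check-sound hs ([ k ∣ l ]⊢ a ≐ b) c h with ∧-T {refutable k ((norm (K 1 ⊞ b) , norm a) ∷ hs)} c
    ... | (c₁ , c₂) = ≤-antisym (goal-≤ k hs a b c₁ h) (goal-≤ l hs b a c₂ h)
    check-sound hs ([ k ]⊢absurd) c h = verify-sound (digits 30 k) hs (Vec.toList ρ) c h
    check-sound hs (p & q) c h with ∧-T {check hs p} c
    ... | (c₁ , c₂) = check-sound hs p c₁ h , check-sound hs q c₂ h
    check-sound hs (a ≼ b ⇒ p) c h q = check-sound _ p c (norm-≤ a b q , h)
    check-sound hs (a ≐ b ⇒ p) c h q =
      check-sound _ p c (norm-≤ a b (≤-reflexive q) , norm-≤ b a (≤-reflexive (sym q)) , h)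

  instantiate : ∀ n → N-ary n (Exp n) (Prob n) → Prob n
  instantiate n f = f $ⁿ Vec.map V (Vec.allFin n)

  lia : ∀ n (f : N-ary n (Exp n) (Prob n)) {_ : T (check [] (instantiate n f))} →
        ∀ⁿ n (curryⁿ {n = n} (⟦ instantiate n f ⟧ᴾ))
  lia n f {c} = curry-sound n {⟦ instantiate n f ⟧ᴾ} (λ ρ → check-sound ρ [] (instantiate n f) c tt)
    where
    curry-sound : ∀ m {B : Vec ℕ m → Set} → (∀ ρ → B ρ) → ∀ⁿ m (curryⁿ {n = m} B)
    curry-sound zero b = b []
    curry-sound (suc m) {B} b = λ x → curry-sound m {λ ρ → B (x ∷ ρ)} (λ ρ → b (x ∷ ρ))

-- Moving a vertical strip across one horizontal strip, down to a dam.

module Step where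

  open Linear

  -- Row lengths and partial sums

  Fn : Set
  Fn = ℕ → ℕ

  prefix : Fn → ℕ → ℕ
  prefix f zero = 0
  prefix f (suc n) = prefix f n + f n

  Decreasing : Fn → Set
  Decreasing f = ∀ k → f (suc k) ≤ f k

  VStrip : Fn → Fn → Set
  VStrip l u = ∀ k → l k ≤ u k × u k ≤ suc (l k)

  HStrip : Fn → Fn → Set
  HStrip l u = ∀ k → l k ≤ u k × u (suc k) ≤ l k

  VanishesFrom : ℕ → Fn → Set
  VanishesFrom n f = ∀ k → n ≤ k → f k ≡ 0

  -- Rows `y` and `suc y` of the vertical strip `u / l` both have a box, and the two boxes lie in
  -- the same column. This is the trace of an entry absorbed between these rows.
  Linked : Fn → Fn → ℕ → Set
  Linked l u y = l (suc y) ≡ l y × u y ≡ suc (l y) × u (suc y) ≡ suc (l y)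

  bit : ∀ n → n ≤ 1 → n ≡ 0 ⊎ n ≡ 1
  bit zero _ = inj₁ refl
  bit (suc zero) _ = inj₂ refl
  bit (suc (suc n)) (s≤s ())

  -- Moving the vertical strip u/l across the horizontal strip u′/u: the entries of row k of
  -- u′/u stay in that row, except that c k of them leave upwards to row k - 1 and c (k + 1) of
  -- them arrive from below.  Rows above R are left alone, and what would cross from row R to
  -- row R - 1 (q boxes) is absorbed into the vertical strip u′/l′.
  record Step (R q : ℕ) (l u l′ u′ : Fn) : Set where
    field
      c      : ℕ → ℕ
      c≤1    : ∀ k → c k ≤ 1
      bound  : ℕ
      c-end  : ∀ k → bound ≤ k → c k ≡ 0
      c-dam  : c R ≡ q
      no-dam : R ≡ 0 → q ≡ 0
      below  : ∀ k → k < R → l′ k ≡ l k × u′ k ≡ u k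
      flow   : ∀ k → R ≤ k → l′ k + u k + c k ≡ l k + u′ k + c (suc k)
      tight  : ∀ k → R ≤ suc k → c (suc k) ≡ 1 → l′ (suc k) ≡ l k × u′ (suc k) ≡ suc (l k) × u k ≡ suc (l k)

    q≤1 : q ≤ 1
    q≤1 = subst (_≤ 1) c-dam (c≤1 R)

    prefix-below : ∀ n → n ≤ R → prefix l′ n ≡ prefix l n × prefix u′ n ≡ prefix u n
    prefix-below zero _ = refl , refl
    prefix-below (suc n) n<R with prefix-below n (<⇒≤ n<R) | below n n<R
    ... | (p , p′) | (e , e′) = cong₂ _+_ p e , cong₂ _+_ p′ e′

    -- Summing `flow` over the rows from the dam on telescopes: of all carries only the inflow `c n`
    -- from below and the outflow `q` through the dam remain.
    prefix-flow : ∀ n → R ≤ n → prefix l′ n + prefix u n + q ≡ prefix l n + prefix u′ n + c n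
    prefix-flow n R≤n with m≤n⇒m<n∨m≡n R≤n
    ... | inj₂ refl = lia 6 (λ a b a′ b′ q c → a′ ≐ a ⇒ b′ ≐ b ⇒ c ≐ q ⇒ [ 110101 ∣ 1001011 ]⊢ a′ ⊞ b ⊞ q ≐ a ⊞ b′ ⊞ c)
                        (prefix l n) (prefix u n) (prefix l′ n) (prefix u′ n) q (c n)
                        (proj₁ (prefix-below n ≤-refl)) (proj₂ (prefix-below n ≤-refl)) c-dam
    prefix-flow (suc n) R≤n | inj₁ (s≤s R≤n′) =
      lia 11 (λ a b a′ b′ q c x y x′ y′ d → a′ ⊞ b ⊞ q ≐ a ⊞ b′ ⊞ c ⇒ x′ ⊞ y ⊞ c ≐ x ⊞ y′ ⊞ d
               ⇒ [ 1011 ∣ 10101 ]⊢ (a′ ⊞ x′) ⊞ (b ⊞ y) ⊞ q ≐ (a ⊞ x) ⊞ (b′ ⊞ y′) ⊞ d)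
        (prefix l n) (prefix u n) (prefix l′ n) (prefix u′ n) q (c n) (l n) (u n) (l′ n) (u′ n) (c (suc n))
        (prefix-flow n R≤n′) (flow n R≤n′)

  open Step public

  module Carry (R N : ℕ) (l u u′ : Fn) where

    -- Computed from the bottom upwards, the first argument being the number of rows still below. A
    -- box leaves row `suc k` exactly when keeping it would make this row of the new inner shape
    -- longer than row `k` of `l`, so that `l′ / l` would not be a horizontal strip.
    carry : ℕ → ℕ → ℕ
    carry zero k = 0
    carry (suc d) zero = 0
    carry (suc d) (suc k) with l (suc k) + u′ (suc k) + carry d (suc (suc k)) ≤? l k + u (suc k)
    ... | yes _ = 0
    ... | no _ = 1

    c₀ : ℕ → ℕ
    c₀ k = carry (N ∸ k) k

    l′ : Fn
    l′ k with k <? R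
    ... | yes _ = l k
    ... | no _ = l k + u′ k + c₀ (suc k) ∸ (u k + c₀ k)

    q : ℕ
    q = c₀ R

  module Forward (R N : ℕ) (l u u′ : Fn) (l-dec : Decreasing l) (vs : VStrip l u) (hs : HStrip u u′)
                 (above : ∀ k → k < R → u′ k ≡ u k) (vanish : VanishesFrom N u′) where

    open Carry R N l u u′

    carry≤1 : ∀ d k → carry d k ≤ 1
    carry≤1 zero k = z≤n
    carry≤1 (suc d) zero = z≤n
    carry≤1 (suc d) (suc k) with l (suc k) + u′ (suc k) + carry d (suc (suc k)) ≤? l k + u (suc k)
    ... | yes _ = z≤n
    ... | no _ = ≤-refl

    -- The strict inequality that triggers a carry is squeezed: `u k ≤ suc (l k)`,
    -- `u′ (suc k) ≤ u k` and `l (suc k) ≤ u (suc k)` leave it a margin of exactly one. When a box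
    -- also arrives from below, the previous instance supplies `u (suc k) ≡ suc (l (suc k))`, which
    -- makes up for it.
    carry-tight : ∀ d k → carry (suc d) (suc k) ≡ 1 →
      u k ≡ suc (l k) × u′ (suc k) ≡ suc (l k) × l (suc k) + u′ (suc k) + carry d (suc (suc k)) ≡ suc (l k + u (suc k))
    carry-tight d k e with l (suc k) + u′ (suc k) + carry d (suc (suc k)) ≤? l k + u (suc k)
    carry-tight d k () | yes _
    carry-tight d k e | no h with bit (carry d (suc (suc k))) (carry≤1 d (suc (suc k)))
    ... | inj₁ z =
      lia 6 (λ a b a⁺ b⁺ b′⁺ c → a ⊞ b⁺ ≺ a⁺ ⊞ b′⁺ ⊞ c ⇒ c ≐ K 0 ⇒ b ≼ K 1 ⊞ a ⇒ b′⁺ ≼ b ⇒ a⁺ ≼ b⁺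
               ⇒ [ 1001 ∣ 1010111 ]⊢ b ≐ K 1 ⊞ a & [ 1101 ∣ 1010011 ]⊢ b′⁺ ≐ K 1 ⊞ a & [ 11111 ∣ 1000001 ]⊢ a⁺ ⊞ b′⁺ ⊞ c ≐ K 1 ⊞ (a ⊞ b⁺))
        (l k) (u k) (l (suc k)) (u (suc k)) (u′ (suc k)) (carry d (suc (suc k)))
        (≰⇒> h) z (proj₂ (vs k)) (proj₂ (hs k)) (proj₁ (vs (suc k)))
    carry-tight (suc d) k e | no h | inj₂ z =
      lia 6 (λ a b a⁺ b⁺ b′⁺ c → a ⊞ b⁺ ≺ a⁺ ⊞ b′⁺ ⊞ c ⇒ c ≐ K 1 ⇒ b ≼ K 1 ⊞ a ⇒ b′⁺ ≼ b ⇒ b⁺ ≐ K 1 ⊞ a⁺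
               ⇒ [ 10001 ∣ 10101101 ]⊢ b ≐ K 1 ⊞ a & [ 11001 ∣ 10100101 ]⊢ b′⁺ ≐ K 1 ⊞ a & [ 111101 ∣ 10000001 ]⊢ a⁺ ⊞ b′⁺ ⊞ c ≐ K 1 ⊞ (a ⊞ b⁺))
        (l k) (u k) (l (suc k)) (u (suc k)) (u′ (suc k)) (carry (suc d) (suc (suc k)))
        (≰⇒> h) z (proj₂ (vs k)) (proj₂ (hs k)) (proj₁ (carry-tight d (suc k) z))

    carry-loose : ∀ d k → carry (suc d) (suc k) ≡ 0 → l (suc k) + u′ (suc k) + carry d (suc (suc k)) ≤ l k + u (suc k)
    carry-loose d k e with l (suc k) + u′ (suc k) + carry d (suc (suc k)) ≤? l k + u (suc k)
    carry-loose d k e | yes h = h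
    carry-loose d k () | no _

    vanish-u : VanishesFrom N u
    vanish-u k N≤k = n≤0⇒n≡0 (subst (u k ≤_) (vanish k N≤k) (proj₁ (hs k)))

    vanish-l : VanishesFrom N l
    vanish-l k N≤k = n≤0⇒n≡0 (subst (l k ≤_) (vanish-u k N≤k) (proj₁ (vs k)))

    c₀-end : ∀ k → N ≤ k → c₀ k ≡ 0
    c₀-end k N≤k = cong (λ d → carry d k) (m≤n⇒m∸n≡0 N≤k)

    unfold : ∀ k → k < N → c₀ k ≡ carry (suc (N ∸ suc k)) k
    unfold k k<N = cong (λ d → carry d k) (+-∸-assoc 1 k<N)

    c₀-tight : ∀ k → c₀ (suc k) ≡ 1 →
      u k ≡ suc (l k) × u′ (suc k) ≡ suc (l k) × l (suc k) + u′ (suc k) + c₀ (suc (suc k)) ≡ suc (l k + u (suc k))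
    c₀-tight k e with suc k <? N
    ... | yes k<N = carry-tight (N ∸ suc (suc k)) k (trans (sym (unfold (suc k) k<N)) e)
    ... | no k≮N with trans (sym e) (c₀-end (suc k) (≮⇒≥ k≮N))
    ... | ()

    c₀-loose : ∀ k → c₀ (suc k) ≡ 0 → l (suc k) + u′ (suc k) + c₀ (suc (suc k)) ≤ l k + u (suc k)
    c₀-loose k e with suc k <? N
    ... | yes k<N = carry-loose (N ∸ suc (suc k)) k (trans (sym (unfold (suc k) k<N)) e)
    ... | no k≮N = subst (_≤ l k + u (suc k))
      (sym (cong₂ _+_ (cong₂ _+_ (vanish-l (suc k) (≮⇒≥ k≮N)) (vanish (suc k) (≮⇒≥ k≮N)))
                      (c₀-end (suc (suc k)) (m≤n⇒m≤1+n (≮⇒≥ k≮N))))) z≤n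

    c₀-zero : c₀ 0 ≡ 0
    c₀-zero = carry-zero N
      where
      carry-zero : ∀ d → carry d 0 ≡ 0
      carry-zero zero = refl
      carry-zero (suc d) = refl

    c₀≤1 : ∀ k → c₀ k ≤ 1
    c₀≤1 k = carry≤1 (N ∸ k) k

    -- the amount leaving row k exceeds neither the entries of the row nor what arrives
    outflow : ∀ k → l k ≤ l k + u′ k + c₀ (suc k) ∸ (u k + c₀ k) × u k + c₀ k ≤ u′ k + c₀ (suc k)
    outflow k = m+n≤o⇒m≤o∸n (l k) (lia 5 (λ a b b′ c c′ → b ⊞ c ≼ b′ ⊞ c′ ⇒ [ 11 ]⊢ a ⊞ (b ⊞ c) ≼ a ⊞ b′ ⊞ c′) (l k) (u k) (u′ k) (c₀ k) (c₀ (suc k)) (enough k)) , enough k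
      where
      enough : ∀ k → u k + c₀ k ≤ u′ k + c₀ (suc k)
      enough k with bit (c₀ k) (c₀≤1 k)
      ... | inj₁ z = lia 4 (λ b b′ c c′ → c ≐ K 0 ⇒ b ≼ b′ ⇒ [ 111 ]⊢ b ⊞ c ≼ b′ ⊞ c′) (u k) (u′ k) (c₀ k) (c₀ (suc k)) z (proj₁ (hs k))
      enough zero | inj₂ z with trans (sym z) c₀-zero
      ... | ()
      enough (suc k) | inj₂ z =
        lia 7 (λ a b a⁺ b⁺ b′⁺ c c′ → c ≐ K 1 ⇒ a⁺ ⊞ b′⁺ ⊞ c′ ≐ K 1 ⊞ (a ⊞ b⁺) ⇒ a⁺ ≼ a ⇒ [ 11011 ]⊢ b⁺ ⊞ c ≼ b′⁺ ⊞ c′)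
          (l k) (u k) (l (suc k)) (u (suc k)) (u′ (suc k)) (c₀ (suc k)) (c₀ (suc (suc k)))
          z (proj₂ (proj₂ (c₀-tight k z))) (l-dec k)

    l′-above : ∀ k → k < R → l′ k ≡ l k
    l′-above k k<R with k <? R
    ... | yes _ = refl
    ... | no k≮R = ⊥-elim (k≮R k<R)

    l′-flow : ∀ k → R ≤ k → l′ k + u k + c₀ k ≡ l k + u′ k + c₀ (suc k)
    l′-flow k R≤k with k <? R
    ... | yes k<R = ⊥-elim (<⇒≱ k<R R≤k)
    ... | no _ = trans (+-assoc _ (u k) (c₀ k)) (m∸n+n≡m
      (lia 5 (λ a b b′ c c′ → b ⊞ c ≼ b′ ⊞ c′ ⇒ [ 11 ]⊢ b ⊞ c ≼ a ⊞ b′ ⊞ c′) (l k) (u k) (u′ k) (c₀ k) (c₀ (suc k)) (proj₂ (outflow k))))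

    step : Step R q l u l′ u′
    step = record
      { c = c₀ ; c≤1 = c₀≤1 ; bound = N ; c-end = c₀-end ; c-dam = refl
      ; no-dam = λ { refl → c₀-zero }
      ; below = λ k k<R → l′-above k k<R , above k k<R
      ; flow = l′-flow
      ; tight = λ k R≤k e → let (p , p′ , p″) = c₀-tight k e in
          lia 7 (λ a a′⁺ b⁺ a⁺ b′⁺ c c′ → a′⁺ ⊞ b⁺ ⊞ c ≐ a⁺ ⊞ b′⁺ ⊞ c′ ⇒ c ≐ K 1 ⇒ a⁺ ⊞ b′⁺ ⊞ c′ ≐ K 1 ⊞ (a ⊞ b⁺) ⇒ [ 110011 ∣ 1001101 ]⊢ a′⁺ ≐ a)
            (l k) (l′ (suc k)) (u (suc k)) (l (suc k)) (u′ (suc k)) (c₀ (suc k)) (c₀ (suc (suc k))) (l′-flow (suc k) R≤k) e p″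
        , p′ , p }

    l≤l′ : ∀ k → l k ≤ l′ k
    l≤l′ k with k <? R
    ... | yes _ = ≤-refl
    ... | no _ = proj₁ (outflow k)

    hs′ : HStrip l l′
    hs′ k = l≤l′ k , upper k
      where
      upper : ∀ k → l′ (suc k) ≤ l k
      upper k with <-≤-connex (suc k) R
      ... | inj₁ k<R = subst (_≤ l k) (sym (l′-above (suc k) k<R)) (l-dec k)
      ... | inj₂ R≤k with bit (c₀ (suc k)) (c₀≤1 (suc k))
      ... | inj₂ e = ≤-reflexive (proj₁ (tight step k R≤k e))
      ... | inj₁ e = lia 7 (λ a a′⁺ b⁺ a⁺ b′⁺ c c′ → a′⁺ ⊞ b⁺ ⊞ c ≐ a⁺ ⊞ b′⁺ ⊞ c′ ⇒ a⁺ ⊞ b′⁺ ⊞ c′ ≼ a ⊞ b⁺ ⇒ [ 111 ]⊢ a′⁺ ≼ a)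
            (l k) (l′ (suc k)) (u (suc k)) (l (suc k)) (u′ (suc k)) (c₀ (suc k)) (c₀ (suc (suc k))) (l′-flow (suc k) R≤k) (c₀-loose k e)

    -- The four combinations of inflow and outflow of a row are checked separately. A balanced row
    -- without traffic keeps its strip; an inflow makes the row of `u / l` occupied by tightness; an
    -- outflow without inflow is settled by tightness at the row above.
    vs′ : VStrip l′ u′
    vs′ k with <-≤-connex k R
    ... | inj₁ k<R rewrite l′-above k k<R | above k k<R = vs k
    ... | inj₂ R≤k = interior k R≤k
      where
      interior : ∀ k → R ≤ k → l′ k ≤ u′ k × u′ k ≤ suc (l′ k)
      interior k R≤k with l′ k | l′-flow k R≤k
      ... | x | fl with bit (c₀ k) (c₀≤1 k) | bit (c₀ (suc k)) (c₀≤1 (suc k))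
      ... | inj₁ z | inj₁ z⁺ = lia 6 (λ a b x b′ c c⁺ → x ⊞ b ⊞ c ≐ a ⊞ b′ ⊞ c⁺ ⇒ c ≐ K 0 ⇒ c⁺ ≐ K 0 ⇒ a ≼ b ⇒ b ≼ K 1 ⊞ a
             ⇒ [ 10001101 ]⊢ x ≼ b′ & [ 100100011 ]⊢ b′ ≼ K 1 ⊞ x) (l k) (u k) x (u′ k) (c₀ k) (c₀ (suc k)) fl z z⁺ (proj₁ (vs k)) (proj₂ (vs k))
      ... | inj₁ z | inj₂ z⁺ = lia 6 (λ a b x b′ c c⁺ → x ⊞ b ⊞ c ≐ a ⊞ b′ ⊞ c⁺ ⇒ c ≐ K 0 ⇒ c⁺ ≐ K 1 ⇒ b ≐ K 1 ⊞ a
             ⇒ [ 10001101 ]⊢ x ≼ b′ & [ 100110011 ]⊢ b′ ≼ K 1 ⊞ x) (l k) (u k) x (u′ k) (c₀ k) (c₀ (suc k)) fl z z⁺ (proj₁ (c₀-tight k z⁺))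
      interior k R≤k | x | fl | inj₂ z | inj₂ z⁺ = lia 6 (λ a b x b′ c c⁺ → x ⊞ b ⊞ c ≐ a ⊞ b′ ⊞ c⁺ ⇒ c ≐ K 1 ⇒ c⁺ ≐ K 1 ⇒ b ≐ K 1 ⊞ a
             ⇒ [ 11001101 ]⊢ x ≼ b′ & [ 100110011 ]⊢ b′ ≼ K 1 ⊞ x) (l k) (u k) x (u′ k) (c₀ k) (c₀ (suc k)) fl z z⁺ (proj₁ (c₀-tight k z⁺))
      interior zero R≤k | x | fl | inj₂ z | inj₁ z⁺ with trans (sym z) c₀-zero
      ... | ()
      interior (suc k) R≤k | x | fl | inj₂ z | inj₁ z⁺ =
        let (_ , t , t′) = c₀-tight k z in
        lia 7 (λ a b x b′ c c⁺ a⁻ → x ⊞ b ⊞ c ≐ a ⊞ b′ ⊞ c⁺ ⇒ c ≐ K 1 ⇒ c⁺ ≐ K 0 ⇒ b′ ≐ K 1 ⊞ a⁻ ⇒ a ⊞ b′ ⊞ c⁺ ≐ K 1 ⊞ (a⁻ ⊞ b)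
             ⇒ [ 1100010011 ]⊢ x ≼ b′ & [ 10010001101 ]⊢ b′ ≼ K 1 ⊞ x) (l (suc k)) (u (suc k)) x (u′ (suc k)) (c₀ (suc k)) (c₀ (suc (suc k))) (l k) fl z z⁺ t t′

  module Uncarry (R q : ℕ) (l l′ u′ : Fn) where

    -- The inverse runs from the dam downwards and begins with the absorbed amount `q`. A box is
    -- declared to have crossed from row `suc d + R` exactly when otherwise row `d + R` of `u` would
    -- be shorter than the next row of `u′`, so that `u′ / u` would not be a horizontal strip.
    carry : ℕ → ℕ
    carry zero = q
    carry (suc d) with u′ (suc d + R) + carry d + l′ (d + R) ≤? l (d + R) + u′ (d + R)
    ... | yes _ = 0
    ... | no _ = 1

    c₀ : ℕ → ℕ
    c₀ k = carry (k ∸ R)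

    u : Fn
    u k with k <? R
    ... | yes _ = u′ k
    ... | no _ = l k + u′ k + c₀ (suc k) ∸ (l′ k + c₀ k)

  module Backward (R q N : ℕ) (l l′ u′ : Fn) (u′-dec : Decreasing u′) (hs′ : HStrip l l′) (vs′ : VStrip l′ u′)
                  (above : ∀ k → k < R → l′ k ≡ l k) (vanish : VanishesFrom N u′) (q≤1 : q ≤ 1)
                  (no-dam : R ≡ 0 → q ≡ 0) (linked : q ≡ 1 → ∀ y → R ≡ suc y → Linked l′ u′ y) where

    open Uncarry R q l l′ u′

    carry≤1 : ∀ d → carry d ≤ 1
    carry≤1 zero = q≤1
    carry≤1 (suc d) with u′ (suc d + R) + carry d + l′ (d + R) ≤? l (d + R) + u′ (d + R)
    ... | yes _ = z≤n
    ... | no _ = ≤-refl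

    carry-loose : ∀ d → carry (suc d) ≡ 0 → u′ (suc d + R) + carry d + l′ (d + R) ≤ l (d + R) + u′ (d + R)
    carry-loose d e with u′ (suc d + R) + carry d + l′ (d + R) ≤? l (d + R) + u′ (d + R)
    carry-loose d e | yes h = h
    carry-loose d () | no _

    -- A row that has given off a box carries a box of `u′ / l′`. At the dam this is the linkedness
    -- hypothesis; further down it comes from tightness, which in turn uses the present fact for the
    -- row above.
    carry-full : ∀ d → carry d ≡ 1 → u′ (d + R) ≡ suc (l′ (d + R))

    carry-tight : ∀ d → carry (suc d) ≡ 1 →
      l′ (suc d + R) ≡ l (d + R) × u′ (suc d + R) ≡ suc (l (d + R)) × u′ (suc d + R) + carry d + l′ (d + R) ≡ suc (l (d + R) + u′ (d + R))
    carry-tight d e with u′ (suc d + R) + carry d + l′ (d + R) ≤? l (d + R) + u′ (d + R)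
    carry-tight d () | yes _
    carry-tight d e | no h with bit (carry d) (carry≤1 d)
    ... | inj₁ z = lia 6 (λ a a′ b′ a′⁺ b′⁺ c → a ⊞ b′ ≺ b′⁺ ⊞ c ⊞ a′ ⇒ c ≐ K 0 ⇒ a′ ≼ b′ ⇒ b′⁺ ≼ K 1 ⊞ a′⁺ ⇒ a′⁺ ≼ a ⇒ b′⁺ ≼ b′
           ⇒ [ 101 ∣ 10111001 ]⊢ a′⁺ ≐ a & [ 1101 ∣ 10110001 ]⊢ b′⁺ ≐ K 1 ⊞ a & [ 111101 ∣ 10000001 ]⊢ b′⁺ ⊞ c ⊞ a′ ≐ K 1 ⊞ (a ⊞ b′))
         (l (d + R)) (l′ (d + R)) (u′ (d + R)) (l′ (suc d + R)) (u′ (suc d + R)) (carry d)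
         (≰⇒> h) z (proj₁ (vs′ (d + R))) (proj₂ (vs′ (suc d + R))) (proj₂ (hs′ (d + R))) (u′-dec (d + R))
    ... | inj₂ z = lia 6 (λ a a′ b′ a′⁺ b′⁺ c → a ⊞ b′ ≺ b′⁺ ⊞ c ⊞ a′ ⇒ c ≐ K 1 ⇒ b′ ≐ K 1 ⊞ a′ ⇒ b′⁺ ≼ K 1 ⊞ a′⁺ ⇒ a′⁺ ≼ a
           ⇒ [ 11 ∣ 10110101 ]⊢ a′⁺ ≐ a & [ 111 ∣ 10110001 ]⊢ b′⁺ ≐ K 1 ⊞ a & [ 110111 ∣ 10000001 ]⊢ b′⁺ ⊞ c ⊞ a′ ≐ K 1 ⊞ (a ⊞ b′))
         (l (d + R)) (l′ (d + R)) (u′ (d + R)) (l′ (suc d + R)) (u′ (suc d + R)) (carry d)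
         (≰⇒> h) z (carry-full d z) (proj₂ (vs′ (suc d + R))) (proj₂ (hs′ (d + R)))

    carry-full zero z = dam R refl
      where
      dam : ∀ r → R ≡ r → u′ R ≡ suc (l′ R)
      dam zero e with trans (sym z) (no-dam e)
      ... | ()
      dam (suc y) refl = let (p , _ , p′) = linked z y refl in trans p′ (cong suc (sym p))
    carry-full (suc d) z = let (p , p′ , _) = carry-tight d z in trans p′ (cong suc (sym p))

    c₀≤1 : ∀ k → c₀ k ≤ 1
    c₀≤1 k = carry≤1 (k ∸ R)

    reindex : ∀ (P : ℕ → ℕ → Set) → (∀ d → P d (d + R)) → ∀ k → R ≤ k → P (k ∸ R) k
    reindex P h k R≤k = subst (P (k ∸ R)) (m∸n+n≡m R≤k) (h (k ∸ R))

    next : ∀ k → R ≤ k → c₀ (suc k) ≡ carry (suc (k ∸ R))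
    next k R≤k = cong carry (+-∸-assoc 1 R≤k)

    c₀-full : ∀ k → R ≤ k → c₀ k ≡ 1 → u′ k ≡ suc (l′ k)
    c₀-full = reindex (λ d k → carry d ≡ 1 → u′ k ≡ suc (l′ k)) carry-full

    c₀-tight : ∀ k → R ≤ k → c₀ (suc k) ≡ 1 →
      l′ (suc k) ≡ l k × u′ (suc k) ≡ suc (l k) × u′ (suc k) + c₀ k + l′ k ≡ suc (l k + u′ k)
    c₀-tight k R≤k e = reindex (λ d k → carry (suc d) ≡ 1 → l′ (suc k) ≡ l k × u′ (suc k) ≡ suc (l k) × u′ (suc k) + carry d + l′ k ≡ suc (l k + u′ k))
      carry-tight k R≤k (trans (sym (next k R≤k)) e)

    c₀-loose : ∀ k → R ≤ k → c₀ (suc k) ≡ 0 → u′ (suc k) + c₀ k + l′ k ≤ l k + u′ k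
    c₀-loose k R≤k e = reindex (λ d k → carry (suc d) ≡ 0 → u′ (suc k) + carry d + l′ k ≤ l k + u′ k)
      carry-loose k R≤k (trans (sym (next k R≤k)) e)

    c₀-end : ∀ k → N + suc R ≤ k → c₀ k ≡ 0
    c₀-end k h with bit (c₀ k) (c₀≤1 k)
    ... | inj₁ z = z
    ... | inj₂ z with trans (sym (vanish k (m+n≤o⇒m≤o N h))) (c₀-full k (<⇒≤ (m+n≤o⇒n≤o N h)) z)
    ... | ()

    -- of the boxes of u′/l′ and those arriving from below, those leaving row k are available
    supply : ∀ k → R ≤ k → l′ k + c₀ k ≤ u′ k + c₀ (suc k)
    supply k R≤k with bit (c₀ k) (c₀≤1 k)
    ... | inj₁ z = lia 4 (λ b b′ c c′ → c ≐ K 0 ⇒ b ≼ b′ ⇒ [ 111 ]⊢ b ⊞ c ≼ b′ ⊞ c′) (l′ k) (u′ k) (c₀ k) (c₀ (suc k)) z (proj₁ (vs′ k))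
    ... | inj₂ z = lia 4 (λ b b′ c c′ → c ≐ K 1 ⇒ b′ ≐ K 1 ⊞ b ⇒ [ 1101 ]⊢ b ⊞ c ≼ b′ ⊞ c′) (l′ k) (u′ k) (c₀ k) (c₀ (suc k)) z (c₀-full k R≤k z)

    u-above : ∀ k → k < R → u k ≡ u′ k
    u-above k k<R with k <? R
    ... | yes _ = refl
    ... | no k≮R = ⊥-elim (k≮R k<R)

    u-flow : ∀ k → R ≤ k → l′ k + u k + c₀ k ≡ l k + u′ k + c₀ (suc k)
    u-flow k R≤k with k <? R
    ... | yes k<R = ⊥-elim (<⇒≱ k<R R≤k)
    ... | no _ = trans (lia 3 (λ x y z →  [ 1 ∣ 1 ]⊢ y ⊞ x ⊞ z ≐ x ⊞ (y ⊞ z)) (l k + u′ k + c₀ (suc k) ∸ (l′ k + c₀ k)) (l′ k) (c₀ k))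
      (m∸n+n≡m (lia 5 (λ a b b′ c c′ → b ⊞ c ≼ b′ ⊞ c′ ⇒ [ 11 ]⊢ b ⊞ c ≼ a ⊞ b′ ⊞ c′) (l k) (l′ k) (u′ k) (c₀ k) (c₀ (suc k)) (supply k R≤k)))

    step : Step R q l u l′ u′
    step = record
      { c = c₀ ; c≤1 = c₀≤1 ; bound = N + suc R ; c-end = c₀-end ; c-dam = cong carry (n∸n≡0 R) ; no-dam = no-dam
      ; below = λ k k<R → above k k<R , sym (u-above k k<R)
      ; flow = u-flow
      ; tight = tight₀ }
      where
      tight₀ : ∀ k → R ≤ suc k → c₀ (suc k) ≡ 1 → l′ (suc k) ≡ l k × u′ (suc k) ≡ suc (l k) × u k ≡ suc (l k)
      tight₀ k R≤k e with m≤n⇒m<n∨m≡n R≤k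
      ... | inj₁ (s≤s R≤k′) = let (p , p′ , p″) = c₀-tight k R≤k′ e in p , p′ ,
        lia 7 (λ a′ b c a b′ c⁺ b′⁺ → a′ ⊞ b ⊞ c ≐ a ⊞ b′ ⊞ c⁺ ⇒ c⁺ ≐ K 1 ⇒ b′⁺ ≐ K 1 ⊞ a ⇒ b′⁺ ⊞ c ⊞ a′ ≐ K 1 ⊞ (a ⊞ b′) ⇒ [ 10101101 ∣ 101010011 ]⊢ b ≐ K 1 ⊞ a)
          (l′ k) (u k) (c₀ k) (l k) (u′ k) (c₀ (suc k)) (u′ (suc k)) (u-flow k R≤k′) e p′ p″
      -- The crossing at the dam itself: row `k` lies above the dam and is untouched, so tightness
      -- is the linkedness of rows `k` and `suc k`.
      ... | inj₂ refl =
        let (p , p′ , p″) = linked (trans (sym (cong carry (n∸n≡0 (suc k)))) e) k refl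
            a = above k ≤-refl
        in trans p a , trans p″ (cong suc a) , trans (u-above k ≤-refl) (trans p′ (cong suc a))

    vs : VStrip l u
    vs k with <-≤-connex k R
    ... | inj₁ k<R rewrite u-above k k<R | sym (above k k<R) = vs′ k
    ... | inj₂ R≤k = interior k R≤k
      where
      interior : ∀ k → R ≤ k → l k ≤ u k × u k ≤ suc (l k)
      interior k R≤k with u k | u-flow k R≤k
      ... | x | fl with bit (c₀ k) (c₀≤1 k) | bit (c₀ (suc k)) (c₀≤1 (suc k))
      ... | inj₁ z | inj₁ z⁺ = lia 6 (λ a a′ x b′ c c⁺ → a′ ⊞ x ⊞ c ≐ a ⊞ b′ ⊞ c⁺ ⇒ c ≐ K 0 ⇒ c⁺ ≐ K 0 ⇒ a′ ≼ b′ ⇒ b′ ≼ K 1 ⊞ a′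
             ⇒ [ 100100101 ]⊢ a ≼ x & [ 10001011 ]⊢ x ≼ K 1 ⊞ a) (l k) (l′ k) x (u′ k) (c₀ k) (c₀ (suc k)) fl z z⁺ (proj₁ (vs′ k)) (proj₂ (vs′ k))
      ... | inj₁ z | inj₂ z⁺ = let (_ , p′ , p″) = c₀-tight k R≤k z⁺ in
           lia 7 (λ a a′ x b′ c c⁺ b′⁺ → a′ ⊞ x ⊞ c ≐ a ⊞ b′ ⊞ c⁺ ⇒ c⁺ ≐ K 1 ⇒ b′⁺ ≐ K 1 ⊞ a ⇒ b′⁺ ⊞ c ⊞ a′ ≐ K 1 ⊞ (a ⊞ b′)
             ⇒ [ 101010011 ]⊢ a ≼ x & [ 10101101 ]⊢ x ≼ K 1 ⊞ a) (l k) (l′ k) x (u′ k) (c₀ k) (c₀ (suc k)) (u′ (suc k)) fl z⁺ p′ p″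
      ... | inj₂ z | inj₁ z⁺ = lia 6 (λ a a′ x b′ c c⁺ → a′ ⊞ x ⊞ c ≐ a ⊞ b′ ⊞ c⁺ ⇒ c ≐ K 1 ⇒ c⁺ ≐ K 0 ⇒ b′ ≐ K 1 ⊞ a′
             ⇒ [ 100100101 ]⊢ a ≼ x & [ 11001011 ]⊢ x ≼ K 1 ⊞ a) (l k) (l′ k) x (u′ k) (c₀ k) (c₀ (suc k)) fl z z⁺ (c₀-full k R≤k z)
      ... | inj₂ z | inj₂ z⁺ = lia 6 (λ a a′ x b′ c c⁺ → a′ ⊞ x ⊞ c ≐ a ⊞ b′ ⊞ c⁺ ⇒ c ≐ K 1 ⇒ c⁺ ≐ K 1 ⇒ b′ ≐ K 1 ⊞ a′
             ⇒ [ 100110101 ]⊢ a ≼ x & [ 11001011 ]⊢ x ≼ K 1 ⊞ a) (l k) (l′ k) x (u′ k) (c₀ k) (c₀ (suc k)) fl z z⁺ (c₀-full k R≤k z)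

    hs : HStrip u u′
    hs k with <-≤-connex k R
    ... | inj₁ k<R rewrite u-above k k<R = ≤-refl , u′-dec k
    ... | inj₂ R≤k = interior k R≤k
      where
      interior : ∀ k → R ≤ k → u k ≤ u′ k × u′ (suc k) ≤ u k
      interior k R≤k with u k | u-flow k R≤k
      ... | x | fl with bit (c₀ (suc k)) (c₀≤1 (suc k))
      ... | inj₁ z = lia 7 (λ a a′ x b′ c c⁺ b′⁺ → a′ ⊞ x ⊞ c ≐ a ⊞ b′ ⊞ c⁺ ⇒ c⁺ ≐ K 0 ⇒ a ≼ a′ ⇒ b′⁺ ⊞ c ⊞ a′ ≼ a ⊞ b′
             ⇒ [ 101101 ]⊢ x ≼ b′ & [ 1000011 ]⊢ b′⁺ ≼ x) (l k) (l′ k) x (u′ k) (c₀ k) (c₀ (suc k)) (u′ (suc k)) fl z (proj₁ (hs′ k)) (c₀-loose k R≤k z)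
      ... | inj₂ z = let (_ , p′ , p″) = c₀-tight k R≤k z in
           lia 7 (λ a a′ x b′ c c⁺ b′⁺ → a′ ⊞ x ⊞ c ≐ a ⊞ b′ ⊞ c⁺ ⇒ c⁺ ≐ K 1 ⇒ b′⁺ ≐ K 1 ⊞ a ⇒ b′⁺ ⊞ c ⊞ a′ ≐ K 1 ⊞ (a ⊞ b′) ⇒ b′⁺ ≼ b′
             ⇒ [ 101001011 ]⊢ x ≼ b′ & [ 1010000101 ]⊢ b′⁺ ≼ x) (l k) (l′ k) x (u′ k) (c₀ k) (c₀ (suc k)) (u′ (suc k)) fl z p′ p″ (u′-dec k)

-- Determinacy of a step, and column strictness under two consecutive steps.

module Compat where

  open Linear
  open Step

  zero≢one : ∀ {n} → n ≡ 0 → n ≡ 1 → ⊥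
  zero≢one refl ()

  -- The carries agree from the bottom upwards. If with equal inflow only one step sends a box out
  -- of row `suc k`, its inner row already has the length `l k` by tightness, and the inner row of
  -- the other is longer by one, too long for a horizontal strip over `l`.
  Step-functional : ∀ {R q₁ q₂ l u l₁ l₂ u′} → HStrip l l₁ → HStrip l l₂ →
    Step R q₁ l u l₁ u′ → Step R q₂ l u l₂ u′ → (∀ k → l₁ k ≡ l₂ k) × q₁ ≡ q₂
  Step-functional {R} {q₁} {q₂} {l} {u} {l₁} {l₂} {u′} h₁ h₂ s₁ s₂ = same , trans (sym (c-dam s₁)) (trans (same-c R ≤-refl) (c-dam s₂))
    where
    B = bound s₁ + bound s₂

    exclude : ∀ {l₁ l₂ q₁ q₂} → HStrip l l₂ → (s₁ : Step R q₁ l u l₁ u′) (s₂ : Step R q₂ l u l₂ u′) →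
              ∀ k → R ≤ k → c s₁ (suc k) ≡ c s₂ (suc k) → c s₁ k ≡ 1 → c s₂ k ≡ 0 → ⊥
    exclude h₂ s₁ s₂ zero R≤k e e₁ e₂ =
      zero≢one (trans (c-dam s₁) (no-dam s₁ (n≤0⇒n≡0 R≤k))) (trans (cong (c s₁) (n≤0⇒n≡0 R≤k)) e₁)
    exclude {l₁} {l₂} h₂ s₁ s₂ (suc k) R≤k e e₁ e₂ =
      lia 10 (λ a b x y c₁ c₂ d₁ d₂ p t → x ⊞ b ⊞ c₁ ≐ a ⊞ t ⊞ d₁ ⇒ y ⊞ b ⊞ c₂ ≐ a ⊞ t ⊞ d₂ ⇒ d₁ ≐ d₂ ⇒ c₁ ≐ K 1 ⇒ c₂ ≐ K 0 ⇒ x ≐ p ⇒ y ≼ p ⇒ [ 110011001101 ]⊢absurd)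
        (l (suc k)) (u (suc k)) (l₁ (suc k)) (l₂ (suc k)) (c s₁ (suc k)) (c s₂ (suc k)) (c s₁ (suc (suc k))) (c s₂ (suc (suc k))) (l k) (u′ (suc k))
        (flow s₁ (suc k) R≤k) (flow s₂ (suc k) R≤k) e e₁ e₂ (proj₁ (tight s₁ k R≤k e₁)) (proj₂ (h₂ k))

    same-from : ∀ d k → B ≤ d + k → R ≤ k → c s₁ k ≡ c s₂ k
    same-from zero k B≤k R≤k = trans (c-end s₁ k (m+n≤o⇒m≤o (bound s₁) B≤k)) (sym (c-end s₂ k (m+n≤o⇒n≤o (bound s₁) B≤k)))
    same-from (suc d) k B≤ R≤k with same-from d (suc k) (subst (B ≤_) (sym (+-suc d k)) B≤) (m≤n⇒m≤1+n R≤k)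
                                 | bit (c s₁ k) (c≤1 s₁ k) | bit (c s₂ k) (c≤1 s₂ k)
    ... | e | inj₁ e₁ | inj₁ e₂ = trans e₁ (sym e₂)
    ... | e | inj₂ e₁ | inj₂ e₂ = trans e₁ (sym e₂)
    ... | e | inj₂ e₁ | inj₁ e₂ = ⊥-elim (exclude h₂ s₁ s₂ k R≤k e e₁ e₂)
    ... | e | inj₁ e₁ | inj₂ e₂ = ⊥-elim (exclude h₁ s₂ s₁ k R≤k (sym e) e₂ e₁)

    same-c : ∀ k → R ≤ k → c s₁ k ≡ c s₂ k
    same-c k = same-from B k (m≤m+n B k)

    same : ∀ k → l₁ k ≡ l₂ k
    same k with <-≤-connex k R
    ... | inj₁ k<R = trans (proj₁ (below s₁ k k<R)) (sym (proj₁ (below s₂ k k<R)))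
    ... | inj₂ R≤k = lia 9 (λ a b x y c₁ c₂ d₁ d₂ t → x ⊞ b ⊞ c₁ ≐ a ⊞ t ⊞ d₁ ⇒ y ⊞ b ⊞ c₂ ≐ a ⊞ t ⊞ d₂ ⇒ d₁ ≐ d₂ ⇒ c₁ ≐ c₂ ⇒ [ 11001101 ∣ 100110011 ]⊢ x ≐ y)
        (l k) (u k) (l₁ k) (l₂ k) (c s₁ k) (c s₂ k) (c s₁ (suc k)) (c s₂ (suc k)) (u′ k)
        (flow s₁ k R≤k) (flow s₂ k R≤k) (same-c (suc k) (m≤n⇒m≤1+n R≤k)) (same-c k R≤k)

  -- Dually, the carries agree from the dam downwards, where the outflow `q` is prescribed. A
  -- crossing in only one of the two steps would leave the other with a row of `u` too short for
  -- `u′` to extend it by a horizontal strip.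
  Step-injective : ∀ {R q l u₁ u₂ l′ u′} → HStrip u₁ u′ → HStrip u₂ u′ →
    Step R q l u₁ l′ u′ → Step R q l u₂ l′ u′ → ∀ k → u₁ k ≡ u₂ k
  Step-injective {R} {q} {l} {u₁} {u₂} {l′} {u′} h₁ h₂ s₁ s₂ = same
    where
    exclude : ∀ {u₁ u₂} → HStrip u₂ u′ → (s₁ : Step R q l u₁ l′ u′) (s₂ : Step R q l u₂ l′ u′) →
              ∀ k → R ≤ k → c s₁ k ≡ c s₂ k → c s₁ (suc k) ≡ 1 → c s₂ (suc k) ≡ 0 → ⊥
    exclude {u₁} {u₂} h₂ s₁ s₂ k R≤k e e₁ e₂ = let (_ , p , p′) = tight s₁ k (m≤n⇒m≤1+n R≤k) e₁ in
      lia 10 (λ a a′ x y c₁ c₂ d₁ d₂ b′ t → a′ ⊞ x ⊞ c₁ ≐ a ⊞ b′ ⊞ d₁ ⇒ a′ ⊞ y ⊞ c₂ ≐ a ⊞ b′ ⊞ d₂ ⇒ c₁ ≐ c₂ ⇒ d₁ ≐ K 1 ⇒ d₂ ≐ K 0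
                ⇒ t ≐ K 1 ⊞ a ⇒ x ≐ K 1 ⊞ a ⇒ t ≼ y ⇒ [ 100101100110011 ]⊢absurd)
        (l k) (l′ k) (u₁ k) (u₂ k) (c s₁ k) (c s₂ k) (c s₁ (suc k)) (c s₂ (suc k)) (u′ k) (u′ (suc k))
        (flow s₁ k R≤k) (flow s₂ k R≤k) e e₁ e₂ p p′ (proj₂ (h₂ k))

    same-c : ∀ d → c s₁ (d + R) ≡ c s₂ (d + R)
    same-c zero = trans (c-dam s₁) (sym (c-dam s₂))
    same-c (suc d) with same-c d | bit (c s₁ (suc d + R)) (c≤1 s₁ _) | bit (c s₂ (suc d + R)) (c≤1 s₂ _)
    ... | e | inj₁ e₁ | inj₁ e₂ = trans e₁ (sym e₂)
    ... | e | inj₂ e₁ | inj₂ e₂ = trans e₁ (sym e₂)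
    ... | e | inj₂ e₁ | inj₁ e₂ = ⊥-elim (exclude h₂ s₁ s₂ (d + R) (m≤n+m R d) e e₁ e₂)
    ... | e | inj₁ e₁ | inj₂ e₂ = ⊥-elim (exclude h₁ s₂ s₁ (d + R) (m≤n+m R d) (sym e) e₂ e₁)

    same-c′ : ∀ k → R ≤ k → c s₁ k ≡ c s₂ k
    same-c′ k R≤k = subst (λ k → c s₁ k ≡ c s₂ k) (m∸n+n≡m R≤k) (same-c (k ∸ R))

    same : ∀ k → u₁ k ≡ u₂ k
    same k with <-≤-connex k R
    ... | inj₁ k<R = trans (sym (proj₂ (below s₁ k k<R))) (proj₂ (below s₂ k k<R))
    ... | inj₂ R≤k = lia 9 (λ a a′ x y c₁ c₂ d₁ d₂ b′ → a′ ⊞ x ⊞ c₁ ≐ a ⊞ b′ ⊞ d₁ ⇒ a′ ⊞ y ⊞ c₂ ≐ a ⊞ b′ ⊞ d₂ ⇒ c₁ ≐ c₂ ⇒ d₁ ≐ d₂ ⇒ [ 11010011 ∣ 100101101 ]⊢ x ≐ y)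
        (l k) (l′ k) (u₁ k) (u₂ k) (c s₁ k) (c s₂ k) (c s₁ (suc k)) (c s₂ (suc k)) (u′ k)
        (flow s₁ k R≤k) (flow s₂ k R≤k) (same-c′ k R≤k) (same-c′ (suc k) (m≤n⇒m≤1+n R≤k))

  -- If f i is the content after rows 0, …, i - 1 of a filling, and g, g⁺ are the inner row
  -- lengths of two consecutive rows, then g + prefix f₁ k - prefix f₀ k boxes of the first one
  -- are inner or have entry < k; so this is column strictness.
  Compatible : ℕ → ℕ → Fn → Fn → Fn → ℕ → Set
  Compatible g g⁺ f₀ f₁ f₂ k = g⁺ + prefix f₂ (suc k) + prefix f₀ k ≤ g + prefix f₁ k + prefix f₁ (suc k)

  prefix-mono : ∀ {f g} → (∀ k → f k ≤ g k) → ∀ n → prefix f n ≤ prefix g n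
  prefix-mono h zero = z≤n
  prefix-mono h (suc n) = +-mono-≤ (prefix-mono h n) (h n)

  -- With rows counted from 0 and r = ρ + 1, the row rule for the leftmost box of row `i`, which is
  -- preceded by `g` boxes of the inner shape, says ρ + i ≤ g + k for its row `k` in the tableau.
  -- The truncated difference is the first row allowed.
  dam : ℕ → ℕ → ℕ → ℕ
  dam ρ i g = (ρ + i) ∸ g

  module TwoSteps {ρ i g g⁺ q q⁺ : ℕ} {l₀ u₀ l₁ u₁ l₂ u₂ : Fn}
    (s : Step (dam ρ i g) q l₀ u₀ l₁ u₁) (s⁺ : Step (dam ρ (suc i) g⁺) q⁺ l₁ u₁ l₂ u₂)
    (g⁺≤g : g⁺ ≤ g)
    (v₀ : VStrip l₀ u₀) (v₁ : VStrip l₁ u₁) (v₂ : VStrip l₂ u₂)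
    (hl₀ : HStrip l₀ l₁) (hl₁ : HStrip l₁ l₂) (hu₀ : HStrip u₀ u₁) (hu₁ : HStrip u₁ u₂) where

    R R⁺ : ℕ
    R = dam ρ i g
    R⁺ = dam ρ (suc i) g⁺

    pull : ∀ k → R⁺ ≤ suc k → R ≤ k
    pull k h = m≤n+o⇒m∸n≤o (ρ + i) g (lia 5 (λ ρ i g g⁺ k → ρ ⊞ (K 1 ⊞ i) ≼ g⁺ ⊞ (K 1 ⊞ k) ⇒ g⁺ ≼ g ⇒ [ 111 ]⊢ ρ ⊞ i ≼ g ⊞ k) ρ i g g⁺ k
      (m∸n≤o⇒m≤n+o (ρ + suc i) g⁺ h) g⁺≤g)
      where
      m∸n≤o⇒m≤n+o : ∀ m n {o} → m ∸ n ≤ o → m ≤ n + o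
      m∸n≤o⇒m≤n+o m n h = ≤-trans (m≤n+m∸n m n) (+-monoʳ-≤ n h)

    -- a box entering row k from below the second strip forces one out of it for the first
    no-descent : ∀ d k → bound s⁺ ≤ d + suc k → (∀ j → Compatible g g⁺ u₀ u₁ u₂ j) → R⁺ ≤ suc k → c s⁺ (suc k) ≡ 1 →
      g⁺ + prefix u₂ (suc k) + prefix u₀ k ≡ g + prefix u₁ k + prefix u₁ (suc k) → c s k ≡ 0 → ⊥
    no-descent zero k B _ h e _ _ = zero≢one (c-end s⁺ (suc k) B) e
    no-descent (suc d) k B com h e eq z =
      let (t₁ , t₂ , t₃) = tight s⁺ k h e
          R≤k = pull k h
          (eq⁺ , uu) = lia 10 (λ g g⁺ P₂ P₀ P₁ x₂ x₀ x₁ x₁⁺ m → g⁺ ⊞ P₂ ⊞ P₀ ≐ g ⊞ P₁ ⊞ (P₁ ⊞ x₁)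
                ⇒ g⁺ ⊞ (P₂ ⊞ x₂) ⊞ (P₀ ⊞ x₀) ≼ g ⊞ (P₁ ⊞ x₁) ⊞ (P₁ ⊞ x₁ ⊞ x₁⁺) ⇒ x₂ ≐ K 1 ⊞ m ⇒ x₁ ≐ K 1 ⊞ m ⇒ x₁⁺ ≼ x₀
                ⇒ [ 1000001 ∣ 100100111 ]⊢ g⁺ ⊞ (P₂ ⊞ x₂) ⊞ (P₀ ⊞ x₀) ≐ g ⊞ (P₁ ⊞ x₁) ⊞ (P₁ ⊞ x₁ ⊞ x₁⁺) & [ 11 ∣ 101100101 ]⊢ x₁⁺ ≐ x₀)
              g g⁺ (prefix u₂ (suc k)) (prefix u₀ k) (prefix u₁ k) (u₂ (suc k)) (u₀ k) (u₁ k) (u₁ (suc k)) (l₁ k)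
              eq (com (suc k)) t₂ t₃ (proj₂ (hu₀ k))
          (z⁺ , f₀) = lia 6 (λ a′ b c a b′ c⁺ → a′ ⊞ b ⊞ c ≐ a ⊞ b′ ⊞ c⁺ ⇒ c ≐ K 0 ⇒ b′ ≐ K 1 ⊞ a′ ⇒ b ≼ K 1 ⊞ a ⇒ [ 10011011 ∣ 1 ]⊢ c⁺ ≐ K 0 & [ 11 ∣ 10011001 ]⊢ b ≐ K 1 ⊞ a)
              (l₁ k) (u₀ k) (c s k) (l₀ k) (u₁ k) (c s (suc k)) (flow s k R≤k) z t₃ (proj₂ (v₀ k))
          l⁺ = lia 8 (λ a′⁺ b⁺ c⁺ a⁺ b′⁺ c⁺⁺ a b → a′⁺ ⊞ b⁺ ⊞ c⁺ ≐ a⁺ ⊞ b′⁺ ⊞ c⁺⁺ ⇒ c⁺ ≐ K 0 ⇒ b′⁺ ≐ b ⇒ b ≐ K 1 ⊞ a ⇒ a′⁺ ≼ a ⇒ b⁺ ≼ K 1 ⊞ a⁺ ⇒ [ 101 ∣ 10011010011 ]⊢ a′⁺ ≐ a)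
              (l₁ (suc k)) (u₀ (suc k)) (c s (suc k)) (l₀ (suc k)) (u₁ (suc k)) (c s (suc (suc k))) (l₀ k) (u₀ k)
              (flow s (suc k) (m≤n⇒m≤1+n R≤k)) z⁺ uu f₀ (proj₂ (hl₀ k)) (proj₂ (v₀ (suc k)))
          e⁺ = lia 9 (λ x y c a b c⁺ m n b₀ → x ⊞ y ⊞ c ≐ a ⊞ b ⊞ c⁺ ⇒ x ≐ m ⇒ c ≐ K 1 ⇒ b ≐ K 1 ⊞ m ⇒ a ≐ n ⇒ y ≐ b₀ ⇒ b₀ ≐ K 1 ⊞ n ⇒ [ 100101101001011 ∣ 11010010110101 ]⊢ c⁺ ≐ K 1)
              (l₂ (suc k)) (u₁ (suc k)) (c s⁺ (suc k)) (l₁ (suc k)) (u₂ (suc k)) (c s⁺ (suc (suc k))) (l₁ k) (l₀ k) (u₀ k)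
              (flow s⁺ (suc k) h) t₁ e t₂ l⁺ uu f₀
      in no-descent d (suc k) (subst (bound s⁺ ≤_) (sym (+-suc d (suc k))) B) com (m≤n⇒m≤1+n h) e⁺ eq⁺ z⁺

    -- Truncation cannot interfere: if `g` exceeded ρ + i, the dam of the next row would be row 0,
    -- where nothing is absorbed.
    dam-suc : q⁺ ≡ 1 → g⁺ ≡ g → R⁺ ≡ suc R
    dam-suc e refl = trans (cong (_∸ g) (+-suc ρ i)) (+-∸-assoc 1 g≤)
      where
      g≤ : g ≤ ρ + i
      g≤ with g ≤? ρ + i
      ... | yes h = h
      ... | no h = ⊥-elim (zero≢one (no-dam s⁺ (m≤n⇒m∸n≡0 (≤-trans (≤-reflexive (+-suc ρ i)) (≰⇒> h)))) e)

    -- By `prefix-flow`, passing from the outer to the inner shapes adds `c s⁺ (suc k)` to the left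
    -- side and `c s k` to the right side. So strictness is at risk only when it holds with equality
    -- and a box leaves row `suc k` in the second step but none leaves row `k` in the first, which
    -- `no-descent` excludes. Above the second dam only the lengths of the inner rows have to be
    -- compared.
    forward : (∀ j → Compatible g g⁺ u₀ u₁ u₂ j) → ∀ k → Compatible (g + q) (g⁺ + q⁺) l₀ l₁ l₂ k
    forward com k with <-≤-connex (suc k) R⁺
    ... | inj₂ h = interior (bit (c s⁺ (suc k)) (c≤1 s⁺ (suc k))) (bit (c s k) (c≤1 s k))
      where
      use : c s⁺ (suc k) + (g⁺ + prefix u₂ (suc k) + prefix u₀ k) ≤ c s k + (g + prefix u₁ k + prefix u₁ (suc k)) →
            Compatible (g + q) (g⁺ + q⁺) l₀ l₁ l₂ k
      use = lia 14 (λ g g⁺ q q⁺ c c⁺ L₀ L₁ L₁⁺ L₂⁺ U₀ U₁ U₁⁺ U₂⁺ → L₁ ⊞ U₀ ⊞ q ≐ L₀ ⊞ U₁ ⊞ c ⇒ L₂⁺ ⊞ U₁⁺ ⊞ q⁺ ≐ L₁⁺ ⊞ U₂⁺ ⊞ c⁺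
               ⇒ c⁺ ⊞ (g⁺ ⊞ U₂⁺ ⊞ U₀) ≼ c ⊞ (g ⊞ U₁ ⊞ U₁⁺) ⇒ [ 100111 ]⊢ g⁺ ⊞ q⁺ ⊞ L₂⁺ ⊞ L₀ ≼ g ⊞ q ⊞ L₁ ⊞ L₁⁺)
            g g⁺ q q⁺ (c s k) (c s⁺ (suc k)) (prefix l₀ k) (prefix l₁ k) (prefix l₁ (suc k)) (prefix l₂ (suc k))
            (prefix u₀ k) (prefix u₁ k) (prefix u₁ (suc k)) (prefix u₂ (suc k)) (prefix-flow s k (pull k h)) (prefix-flow s⁺ (suc k) h)
      interior : c s⁺ (suc k) ≡ 0 ⊎ c s⁺ (suc k) ≡ 1 → c s k ≡ 0 ⊎ c s k ≡ 1 → Compatible (g + q) (g⁺ + q⁺) l₀ l₁ l₂ k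
      interior (inj₁ e) _ = use (subst (λ x → x + _ ≤ _) (sym e) (≤-trans (com k) (m≤n+m _ (c s k))))
      interior (inj₂ e) (inj₂ z) = use (subst (λ x → x + _ ≤ _) (sym e) (subst (λ x → _ ≤ x + _) (sym z) (s≤s (com k))))
      interior (inj₂ e) (inj₁ z) with m≤n⇒m<n∨m≡n (com k)
      ... | inj₁ lt = use (subst (λ x → x + _ ≤ _) (sym e) (≤-trans lt (m≤n+m _ (c s k))))
      ... | inj₂ eq = ⊥-elim (no-descent (bound s⁺) k (m≤m+n _ _) com h e eq z)
    ... | inj₁ h = lia 6 (λ G G⁺ L₀ L₁ L₁⁺ L₂⁺ → G⁺ ≼ G ⇒ L₂⁺ ≐ L₁⁺ ⇒ L₀ ≼ L₁ ⇒ [ 10111 ]⊢ G⁺ ⊞ L₂⁺ ⊞ L₀ ≼ G ⊞ L₁ ⊞ L₁⁺)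
        (g + q) (g⁺ + q⁺) (prefix l₀ k) (prefix l₁ k) (prefix l₁ (suc k)) (prefix l₂ (suc k))
        (edge (bit q⁺ (q≤1 s⁺))) (proj₁ (prefix-below s⁺ (suc k) (<⇒≤ h))) (prefix-mono (λ k → proj₁ (hl₀ k)) k)
      where
      edge : q⁺ ≡ 0 ⊎ q⁺ ≡ 1 → g⁺ + q⁺ ≤ g + q
      edge (inj₁ e) = subst (λ x → g⁺ + x ≤ g + q) (sym e) (≤-trans (≤-reflexive (+-identityʳ g⁺)) (≤-trans g⁺≤g (m≤m+n g q)))
      -- The lower inner row grows. If both inner rows had the same length, the dams are in adjacent
      -- rows and `Compatible` is an equality there, so that the upper row must absorb a box as
      -- well.
      edge (inj₂ e) with m≤n⇒m<n∨m≡n g⁺≤g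
      ... | inj₁ lt = subst (λ x → g⁺ + x ≤ g + q) (sym e) (≤-trans (≤-reflexive (+-comm g⁺ 1)) (≤-trans lt (m≤m+n g q)))
      ... | inj₂ eg = subst (λ x → g⁺ + x ≤ g + q) (sym e) (subst (λ x → g⁺ + 1 ≤ g + x) (sym q≡1) (≤-reflexive (cong (_+ 1) eg)))
        where
        R⁺≡ : R⁺ ≡ suc R
        R⁺≡ = dam-suc e eg
        com-R : g⁺ + prefix u₂ (suc R) + prefix u₀ R ≡ g + prefix u₁ R + prefix u₁ (suc R)
        com-R = lia 9 (λ g⁺ g L₂ U₂ L₁⁺ U₁⁺ L₁ U₁ U₀ → g⁺ ≐ g ⇒ U₂ ≐ U₁⁺ ⇒ U₁ ≐ U₀ ⇒ [ 101101 ∣ 1010011 ]⊢ g⁺ ⊞ U₂ ⊞ U₀ ≐ g ⊞ U₁ ⊞ U₁⁺)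
          g⁺ g (prefix l₂ (suc R)) (prefix u₂ (suc R)) (prefix l₁ (suc R)) (prefix u₁ (suc R)) (prefix l₁ R) (prefix u₁ R) (prefix u₀ R)
          eg (proj₂ (prefix-below s⁺ (suc R) (≤-reflexive (sym R⁺≡)))) (proj₂ (prefix-below s R ≤-refl))
        q≡1 : q ≡ 1
        q≡1 with bit (c s R) (c≤1 s R)
        ... | inj₂ z = trans (sym (c-dam s)) z
        ... | inj₁ z = ⊥-elim (no-descent (bound s⁺) R (m≤m+n _ _) com (≤-reflexive R⁺≡) (trans (cong (c s⁺) (sym R⁺≡)) (trans (c-dam s⁺) e)) com-R z)

    -- the same descent, read upwards
    no-ascent : ∀ k → R ≤ k → R⁺ ≤ suc k → (∀ j → Compatible (g + q) (g⁺ + q⁺) l₀ l₁ l₂ j) → c s k ≡ 1 → c s⁺ (suc k) ≡ 0 →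
      (g⁺ + q⁺) + prefix l₂ (suc k) + prefix l₀ k ≡ (g + q) + prefix l₁ k + prefix l₁ (suc k) → ⊥
    no-ascent zero R≤k _ _ z _ _ = zero≢one (trans (c-dam s) (no-dam s (n≤0⇒n≡0 R≤k))) (trans (cong (c s) (n≤0⇒n≡0 R≤k)) z)
    no-ascent (suc j) R≤k R⁺≤k com z z⁺ eq with m≤n⇒m<n∨m≡n R⁺≤k
    ... | inj₂ R⁺≡ = lia 14 (λ g g⁺ q q⁺ c c⁺ L₀ L₁ L₁⁺ L₂⁺ U₀ U₁ U₁⁺ U₂⁺ → L₁ ⊞ U₀ ⊞ q ≐ L₀ ⊞ U₁ ⊞ c ⇒ c ≐ K 1 ⇒ q⁺ ≐ K 0 ⇒ L₂⁺ ≐ L₁⁺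
               ⇒ g⁺ ⊞ q⁺ ⊞ L₂⁺ ⊞ L₀ ≐ g ⊞ q ⊞ L₁ ⊞ L₁⁺ ⇒ g⁺ ≼ g ⇒ U₀ ≼ U₁ ⇒ [ 101001011011 ]⊢absurd)
            g g⁺ q q⁺ (c s k) (c s⁺ (suc k)) (prefix l₀ k) (prefix l₁ k) (prefix l₁ (suc k)) (prefix l₂ (suc k))
            (prefix u₀ k) (prefix u₁ k) (prefix u₁ (suc k)) (prefix u₂ (suc k))
            (prefix-flow s k R≤k) z (trans (sym (c-dam s⁺)) (trans (cong (c s⁺) R⁺≡) z⁺)) (proj₁ (prefix-below s⁺ (suc k) (≤-reflexive (sym R⁺≡))))
            eq g⁺≤g (prefix-mono (λ k → proj₁ (hu₀ k)) k)
      where k = suc j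
    ... | inj₁ (s≤s R⁺≤j) with pull j R⁺≤j
    ... | R≤j =
      let k = suc j
          (t₁ , t₂ , t₃) = tight s j R≤k z
          (eq⁻ , ll) = lia 9 (λ G G⁺ P₂ P₀ P₁ x₂ x₀ x₁ x₁⁺ → G⁺ ⊞ (P₂ ⊞ x₂) ⊞ (P₀ ⊞ x₀) ≐ G ⊞ (P₁ ⊞ x₁) ⊞ (P₁ ⊞ x₁ ⊞ x₁⁺)
                ⇒ G⁺ ⊞ P₂ ⊞ P₀ ≼ G ⊞ P₁ ⊞ (P₁ ⊞ x₁) ⇒ x₁⁺ ≐ x₀ ⇒ x₂ ≼ x₁
                ⇒ [ 10001 ∣ 1001011 ]⊢ G⁺ ⊞ P₂ ⊞ P₀ ≐ G ⊞ P₁ ⊞ (P₁ ⊞ x₁) & [ 11 ∣ 1011001 ]⊢ x₂ ≐ x₁)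
              (g + q) (g⁺ + q⁺) (prefix l₂ k) (prefix l₀ j) (prefix l₁ j) (l₂ k) (l₀ j) (l₁ j) (l₁ k)
              eq (com j) t₁ (proj₂ (hl₁ j))
          (zk , uk) = lia 8 (λ x₂ y₁ ck x₁ y₂ ck⁺ m n → x₂ ⊞ y₁ ⊞ ck ≐ x₁ ⊞ y₂ ⊞ ck⁺ ⇒ ck⁺ ≐ K 0 ⇒ x₂ ≐ m ⇒ x₁ ≐ n ⇒ y₁ ≐ K 1 ⊞ n ⇒ y₂ ≼ K 1 ⊞ x₂
                ⇒ [ 10100011011 ∣ 1 ]⊢ ck ≐ K 0 & [ 1000011 ∣ 10110011001 ]⊢ y₂ ≐ K 1 ⊞ m)
              (l₂ k) (u₁ k) (c s⁺ k) (l₁ k) (u₂ k) (c s⁺ (suc k)) (l₁ j) (l₀ j)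
              (flow s⁺ k R⁺≤j) z⁺ ll t₁ t₂ (proj₂ (v₂ k))
          zj = lia 7 (λ x₁ y₀ cj x₀ y₁ ck y₂ → x₁ ⊞ y₀ ⊞ cj ≐ x₀ ⊞ y₁ ⊞ ck ⇒ ck ≐ K 1 ⇒ y₀ ≐ K 1 ⊞ x₀ ⇒ y₂ ≐ K 1 ⊞ x₁ ⇒ y₂ ≼ y₁ ⇒ [ 1010011011 ]⊢ K 1 ≼ cj)
              (l₁ j) (u₀ j) (c s j) (l₀ j) (u₁ j) (c s k) (u₂ k) (flow s j R≤j) z t₃ uk (proj₂ (hu₁ j))
      in no-ascent j R≤j R⁺≤j com (≤-antisym (c≤1 s j) zj) zk eq⁻

    -- Here the risk is a box leaving row `k` in the first step while none leaves row `suc k` in the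
    -- second, again in the case of equality; `no-ascent` traces this upwards until a dam stops it.
    backward : (∀ j → Compatible (g + q) (g⁺ + q⁺) l₀ l₁ l₂ j) → ∀ k → Compatible g g⁺ u₀ u₁ u₂ k
    backward com k with <-≤-connex (suc k) R⁺
    ... | inj₁ h = lia 6 (λ G G⁺ L₀ L₁ L₁⁺ L₂⁺ → G⁺ ≼ G ⇒ L₂⁺ ≐ L₁⁺ ⇒ L₀ ≼ L₁ ⇒ [ 10111 ]⊢ G⁺ ⊞ L₂⁺ ⊞ L₀ ≼ G ⊞ L₁ ⊞ L₁⁺)
        g g⁺ (prefix u₀ k) (prefix u₁ k) (prefix u₁ (suc k)) (prefix u₂ (suc k))
        g⁺≤g (proj₂ (prefix-below s⁺ (suc k) (<⇒≤ h))) (prefix-mono (λ k → proj₁ (hu₀ k)) k)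
    ... | inj₂ h = interior (bit (c s⁺ (suc k)) (c≤1 s⁺ (suc k))) (bit (c s k) (c≤1 s k))
      where
      use : c s k + ((g⁺ + q⁺) + prefix l₂ (suc k) + prefix l₀ k) ≤ c s⁺ (suc k) + ((g + q) + prefix l₁ k + prefix l₁ (suc k)) →
            Compatible g g⁺ u₀ u₁ u₂ k
      use = lia 14 (λ g g⁺ q q⁺ c c⁺ L₀ L₁ L₁⁺ L₂⁺ U₀ U₁ U₁⁺ U₂⁺ → L₁ ⊞ U₀ ⊞ q ≐ L₀ ⊞ U₁ ⊞ c ⇒ L₂⁺ ⊞ U₁⁺ ⊞ q⁺ ≐ L₁⁺ ⊞ U₂⁺ ⊞ c⁺
               ⇒ c ⊞ (g⁺ ⊞ q⁺ ⊞ L₂⁺ ⊞ L₀) ≼ c⁺ ⊞ (g ⊞ q ⊞ L₁ ⊞ L₁⁺) ⇒ [ 11011 ]⊢ g⁺ ⊞ U₂⁺ ⊞ U₀ ≼ g ⊞ U₁ ⊞ U₁⁺)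
            g g⁺ q q⁺ (c s k) (c s⁺ (suc k)) (prefix l₀ k) (prefix l₁ k) (prefix l₁ (suc k)) (prefix l₂ (suc k))
            (prefix u₀ k) (prefix u₁ k) (prefix u₁ (suc k)) (prefix u₂ (suc k)) (prefix-flow s k (pull k h)) (prefix-flow s⁺ (suc k) h)
      interior : c s⁺ (suc k) ≡ 0 ⊎ c s⁺ (suc k) ≡ 1 → c s k ≡ 0 ⊎ c s k ≡ 1 → Compatible g g⁺ u₀ u₁ u₂ k
      interior _ (inj₁ z) = use (subst (λ x → x + _ ≤ _) (sym z) (≤-trans (com k) (m≤n+m _ (c s⁺ (suc k)))))
      interior (inj₂ e) (inj₂ z) = use (subst (λ x → x + _ ≤ _) (sym z) (subst (λ x → _ ≤ x + _) (sym e) (s≤s (com k))))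
      interior (inj₁ e) (inj₂ z) with m≤n⇒m<n∨m≡n (com k)
      ... | inj₁ lt = use (subst (λ x → x + _ ≤ _) (sym z) (≤-trans lt (m≤n+m _ (c s⁺ (suc k)))))
      ... | inj₂ eq = ⊥-elim (no-ascent k (pull k h) h com z e eq)

-- Fillings as chains of horizontal strips, and infusion through a whole chain.

module Chain where

  open Linear
  open Step
  open Compat

  infix 4 _≗_
  _≗_ : Fn → Fn → Set
  f ≗ g = ∀ k → f k ≡ g k

  -- A filling of the skew shape with row lengths a, g, encoded by the row lengths Λ i of the
  -- shape obtained from b by adding a box in row v for every entry v of rows 0, …, i - 1.
  record Filling (ρ m : ℕ) (a g b e : Fn) (Λ : ℕ → Fn) : Set where
    field
      start : Λ 0 ≗ b
      end   : ∀ i → m ≤ i → Λ i ≗ e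
      strip : ∀ i → HStrip (Λ i) (Λ (suc i))
      total : ∀ i → ∃[ N ] (∀ n → N ≤ n → g i + prefix (Λ (suc i)) n ≡ a i + prefix (Λ i) n)
      flag  : ∀ i k → k < dam ρ i (g i) → Λ (suc i) k ≡ Λ i k
      strict : ∀ i k → Compatible (g i) (g (suc i)) (Λ i) (Λ (suc i)) (Λ (suc (suc i))) k

  open Filling public

  -- `g` is the inner shape of the filling encoded by `Λ`, and `q i` entries of its row `i` are
  -- absorbed; hence `K` encodes a filling with inner shape `g + q`.
  record Infusion (ρ : ℕ) (g q : Fn) (K Λ : ℕ → Fn) : Set where
    field
      stepᵢ : ∀ i → Step (dam ρ i (g i)) (q i) (K i) (Λ i) (K (suc i)) (Λ (suc i))
      vertᵢ : ∀ i → VStrip (K i) (Λ i)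

  open Infusion public

  ≤-end : ∀ {ρ m a g b e Λ} → Filling ρ m a g b e Λ → ∀ i k → Λ i k ≤ e k
  ≤-end {m = m} {e = e} {Λ} F i k = ≤-trans (grow m i) (≤-reflexive (end F (m + i) (m≤m+n m i) k))
    where
    grow : ∀ d i → Λ i k ≤ Λ (d + i) k
    grow zero i = ≤-refl
    grow (suc d) i = ≤-trans (grow d i) (proj₁ (strip F (d + i) k))

  HStrip-decˡ : ∀ {l u} → HStrip l u → Decreasing l
  HStrip-decˡ h k = ≤-trans (proj₁ (h (suc k))) (proj₂ (h k))

  HStrip-decʳ : ∀ {l u} → HStrip l u → Decreasing u
  HStrip-decʳ h k = ≤-trans (proj₂ (h k)) (proj₁ (h k))

  -- When there are no entries to move, a box leaving a row must be made up for by one arriving from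
  -- the row below, and so on beyond the bound of the carries.
  Step-idle : ∀ {R q l u l′ u′} → Step R q l u l′ u′ → (∀ k → l k ≤ l′ k) → u′ ≗ u → q ≡ 0 × l′ ≗ l
  Step-idle {R} {q} {l} {u} {l′} {u′} s l≤l′ e = trans (sym (c-dam s)) (none R ≤-refl) , same
    where
    spread : ∀ d k → bound s ≤ d + k → R ≤ k → c s k ≡ 1 → ⊥
    spread zero k B _ z = zero≢one (c-end s k B) z
    spread (suc d) k B R≤k z = spread d (suc k) (subst (bound s ≤_) (sym (+-suc d k)) B) (m≤n⇒m≤1+n R≤k)
      (≤-antisym (c≤1 s (suc k)) (lia 6 (λ a b a′ b′ c c⁺ → a′ ⊞ b ⊞ c ≐ a ⊞ b′ ⊞ c⁺ ⇒ b′ ≐ b ⇒ a ≼ a′ ⇒ c ≐ K 1 ⇒ [ 1011101 ]⊢ K 1 ≼ c⁺)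
        (l k) (u k) (l′ k) (u′ k) (c s k) (c s (suc k)) (flow s k R≤k) (e k) (l≤l′ k) z))

    none : ∀ k → R ≤ k → c s k ≡ 0
    none k R≤k with bit (c s k) (c≤1 s k)
    ... | inj₁ z = z
    ... | inj₂ z = ⊥-elim (spread (bound s) k (m≤m+n _ k) R≤k z)

    same : l′ ≗ l
    same k with <-≤-connex k R
    ... | inj₁ k<R = proj₁ (below s k k<R)
    ... | inj₂ R≤k = lia 6 (λ a b a′ b′ c c⁺ → a′ ⊞ b ⊞ c ≐ a ⊞ b′ ⊞ c⁺ ⇒ b′ ≐ b ⇒ c ≐ K 0 ⇒ c⁺ ≐ K 0 ⇒ [ 10100011 ∣ 101001001 ]⊢ a′ ≐ a)
        (l k) (u k) (l′ k) (u′ k) (c s k) (c s (suc k)) (flow s k R≤k) (e k) (none k R≤k) (none (suc k) (m≤n⇒m≤1+n R≤k))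

  Step-cong : ∀ {R q l u l′ u′ m v m′ v′} → l ≗ m → u ≗ v → l′ ≗ m′ → u′ ≗ v′ → Step R q l u l′ u′ → Step R q m v m′ v′
  Step-cong {R} el eu el′ eu′ s = record
    { c = c s ; c≤1 = c≤1 s ; bound = bound s ; c-end = c-end s ; c-dam = c-dam s ; no-dam = no-dam s
    ; below = λ k h → trans (sym (el′ k)) (trans (proj₁ (below s k h)) (el k)) , trans (sym (eu′ k)) (trans (proj₂ (below s k h)) (eu k))
    ; flow = λ k h → trans (cong (_+ c s k) (sym (cong₂ _+_ (el′ k) (eu k)))) (trans (flow s k h) (cong (_+ c s (suc k)) (cong₂ _+_ (el k) (eu′ k))))
    ; tight = λ k h z → let (p , p′ , p″) = tight s k h z in
        trans (sym (el′ (suc k))) (trans p (el k)) , trans (sym (eu′ (suc k))) (trans p′ (cong suc (el k))) , trans (sym (eu k)) (trans p″ (cong suc (el k))) }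

  HStrip-cong : ∀ {l u m v} → l ≗ m → u ≗ v → HStrip l u → HStrip m v
  HStrip-cong el eu h k = subst₂′ (proj₁ (h k)) (el k) (eu k) , subst₂′ (proj₂ (h k)) (eu (suc k)) (el k)
    where
    subst₂′ : ∀ {a b c d} → a ≤ b → a ≡ c → b ≡ d → c ≤ d
    subst₂′ h refl refl = h

  total-step : ∀ {R q l u l′ u′ a g} → Step R q l u l′ u′ →
    ∃[ N ] (∀ n → N ≤ n → g + prefix u′ n ≡ a + prefix u n) → ∃[ N ] (∀ n → N ≤ n → (g + q) + prefix l′ n ≡ a + prefix l n)
  total-step {R} {q} {l} {u} {l′} {u′} {a} {g} s (N , h) = R + (bound s + N) , λ n le →
    lia 8 (λ q a g L U L′ U′ z → L′ ⊞ U ⊞ q ≐ L ⊞ U′ ⊞ z ⇒ z ≐ K 0 ⇒ g ⊞ U′ ≐ a ⊞ U ⇒ [ 101011 ∣ 1000101 ]⊢ g ⊞ q ⊞ L′ ≐ a ⊞ L)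
      q a g (prefix l n) (prefix u n) (prefix l′ n) (prefix u′ n) (c s n) (prefix-flow s n (m+n≤o⇒m≤o R le))
      (c-end s n (m+n≤o⇒m≤o (bound s) (m+n≤o⇒n≤o R le))) (h n (m+n≤o⇒n≤o (bound s) (m+n≤o⇒n≤o R le)))

  total-unstep : ∀ {R q l u l′ u′ a g} → Step R q l u l′ u′ →
    ∃[ N ] (∀ n → N ≤ n → (g + q) + prefix l′ n ≡ a + prefix l n) → ∃[ N ] (∀ n → N ≤ n → g + prefix u′ n ≡ a + prefix u n)
  total-unstep {R} {q} {l} {u} {l′} {u′} {a} {g} s (N , h) = R + (bound s + N) , λ n le →
    lia 8 (λ q a g L U L′ U′ z → L′ ⊞ U ⊞ q ≐ L ⊞ U′ ⊞ z ⇒ z ≐ K 0 ⇒ g ⊞ q ⊞ L′ ≐ a ⊞ L ⇒ [ 1000011 ∣ 101101 ]⊢ g ⊞ U′ ≐ a ⊞ U)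
      q a g (prefix l n) (prefix u n) (prefix l′ n) (prefix u′ n) (c s n) (prefix-flow s n (m+n≤o⇒m≤o R le))
      (c-end s n (m+n≤o⇒m≤o (bound s) (m+n≤o⇒n≤o R le))) (h n (m+n≤o⇒n≤o (bound s) (m+n≤o⇒n≤o R le)))

  -- The row index grows while the inner rows do not, so positive dams move strictly down. Therefore
  -- the linked rows left at one dam are out of reach of all later steps.
  dam-mono : ∀ ρ {i j g h y} → i < j → h ≤ g → dam ρ i g ≡ suc y → suc y < dam ρ j h
  dam-mono ρ {i} {j} {g} {h} {y} i<j h≤g e = m+n≤o⇒m≤o∸n (suc (suc y)) (lia 6 (λ ρ i j g h y → ρ ⊞ i ≐ K 1 ⊞ y ⊞ g ⇒ i ≺ j ⇒ h ≼ g ⇒ [ 10111 ]⊢ K 2 ⊞ y ⊞ h ≼ ρ ⊞ j)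
    ρ i j g h y (trans (sym (m∸n+n≡m {n = g} (<⇒≤ (m∸n≢0⇒n<m {ρ + i} {g} λ z → 1+n≢0 (trans (sym e) z))))) (cong (_+ g) e)) i<j h≤g)

  dec-≤ : ∀ {f} → Decreasing f → ∀ {i j} → i ≤ j → f j ≤ f i
  dec-≤ {f} d {i} {j} i≤j = subst (λ x → f x ≤ f i) (m∸n+n≡m i≤j) (go (j ∸ i))
    where
    go : ∀ n → f (n + i) ≤ f i
    go zero = ≤-refl
    go (suc n) = ≤-trans (d (n + i)) (go n)

  LinkedAt : ℕ → Fn → Fn → Fn → Fn → Set
  LinkedAt ρ g q d e = ∀ i → q i ≡ 1 → ∃[ y ] (dam ρ i (g i) ≡ suc y × Linked d e y)

  module Push (ρ m N : ℕ) (a g λ₀ e b : Fn) (Λ : ℕ → Fn) (F : Filling ρ m a g λ₀ e Λ)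
              (vanish : VanishesFrom N e) (b-dec : Decreasing b) (b-vs : VStrip b λ₀) (g-dec : Decreasing g)
              (g-end : ∀ i → m ≤ i → g i ≡ 0) where

    K′ : ℕ → Fn
    K′ zero = b
    K′ (suc i) = Carry.l′ (dam ρ i (g i)) N (K′ i) (Λ i) (Λ (suc i))

    q : Fn
    q i = Carry.q (dam ρ i (g i)) N (K′ i) (Λ i) (Λ (suc i))

    private
      Good : ℕ → Set
      Good i = Decreasing (K′ i) × VStrip (K′ i) (Λ i)

      vanishᵢ : ∀ i → VanishesFrom N (Λ i)
      vanishᵢ i k N≤k = n≤0⇒n≡0 (≤-trans (≤-end F i k) (≤-reflexive (vanish k N≤k)))

      module Fw (i : ℕ) (G : Good i) =
        Forward (dam ρ i (g i)) N (K′ i) (Λ i) (Λ (suc i)) (proj₁ G) (proj₂ G) (strip F i) (flag F i) (vanishᵢ (suc i))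

      good : ∀ i → Good i
      good zero = b-dec , λ k → subst (λ x → b k ≤ x × x ≤ suc (b k)) (sym (start F k)) (b-vs k)
      good (suc i) = HStrip-decʳ (Fw.hs′ i (good i)) , Fw.vs′ i (good i)

      hsK : ∀ i → HStrip (K′ i) (K′ (suc i))
      hsK i = Fw.hs′ i (good i)

    infusion : Infusion ρ g q K′ Λ
    infusion = record { stepᵢ = λ i → Fw.step i (good i) ; vertᵢ = λ i → proj₂ (good i) }

    idle : ∀ i → m ≤ i → q i ≡ 0 × K′ (suc i) ≗ K′ i
    idle i m≤i = Step-idle (stepᵢ infusion i) (λ k → proj₁ (hsK i k))
      (λ k → trans (end F (suc i) (m≤n⇒m≤1+n m≤i) k) (sym (end F i m≤i k)))

    stable : ∀ d → K′ (d + m) ≗ K′ m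
    stable zero k = refl
    stable (suc d) k = trans (proj₂ (idle (d + m) (m≤n+m m d)) k) (stable d k)

    filling : Filling ρ m a (λ i → g i + q i) b (K′ m) K′
    filling = record
      { start = λ _ → refl
      ; end = λ i m≤i k → subst (λ j → K′ j k ≡ K′ m k) (m∸n+n≡m m≤i) (stable (i ∸ m) k)
      ; strip = hsK
      ; total = λ i → total-step {g = g i} (stepᵢ infusion i) (total F i)
      -- The dam for the longer inner row `g i + q i` lies weakly higher, so the rows above it are
      -- among those that the step leaves alone.
      ; flag = λ i k h → proj₁ (below (stepᵢ infusion i) k (<-≤-trans h (∸-monoʳ-≤ (ρ + i) (m≤m+n (g i) (q i)))))
      ; strict = λ i → TwoSteps.forward {ρ} {i} (stepᵢ infusion i) (stepᵢ infusion (suc i)) (g-dec i)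
          (proj₂ (good i)) (proj₂ (good (suc i))) (proj₂ (good (suc (suc i)))) (hsK i) (hsK (suc i)) (strip F i) (strip F (suc i)) (strict F i)
      }

    private
      keep : ∀ {i y} → dam ρ i (g i) ≡ suc y → ∀ d → Linked (K′ (suc i)) (Λ (suc i)) y → Linked (K′ (d + suc i)) (Λ (d + suc i)) y
      keep e zero h = h
      keep {i} {y} e (suc d) h with keep e d h | below (stepᵢ infusion (d + suc i))
      ... | (p , p′ , p″) | same =
        let r : suc y < dam ρ (d + suc i) (g (d + suc i))
            r = dam-mono ρ (m≤n+m (suc i) d) (dec-≤ g-dec (≤-trans (n≤1+n i) (m≤n+m (suc i) d))) e
            (a , a′) = same y (<-trans (n<1+n y) r)
            (b , b′) = same (suc y) r
        in trans b (trans p (sym a)) , trans a′ (trans p′ (cong suc (sym a))) , trans b′ (trans p″ (cong suc (sym a)))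

      -- Tightness at the dam, together with the fact that the row just above it does not change, is
      -- linkedness immediately after the absorption.
      born : ∀ i y → dam ρ i (g i) ≡ suc y → q i ≡ 1 → Linked (K′ (suc i)) (Λ (suc i)) y
      born i y e z =
        let s = stepᵢ infusion i
            (a , a′) = below s y (≤-reflexive (sym e))
            (t , t′ , t″) = tight s y (≤-reflexive e) (trans (cong (c s) (sym e)) (trans (c-dam s) z))
            b = trans t (sym a)
        in b , trans a′ (trans t″ (cong suc (sym a))) , trans t′ (cong suc (sym a))

    vert-end : VStrip (K′ m) e
    vert-end k = subst (λ x → K′ m k ≤ x × x ≤ suc (K′ m k)) (end F m ≤-refl k) (vertᵢ infusion m k)

    linked-end : LinkedAt ρ g q (K′ m) e
    linked-end i z with <-≤-connex i m
    ... | inj₂ m≤i = ⊥-elim (zero≢one (proj₁ (idle i m≤i)) z)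
    ... | inj₁ i<m = at-dam (dam ρ i (g i)) refl
      where
      at-dam : ∀ r → dam ρ i (g i) ≡ r → ∃[ y ] (dam ρ i (g i) ≡ suc y × Linked (K′ m) e y)
      at-dam zero e′ = ⊥-elim (zero≢one (no-dam (stepᵢ infusion i) e′) z)
      at-dam (suc y) e′ = y , e′ ,
        let (p , p′ , p″) = subst (λ j → Linked (K′ j) (Λ j) y) (m∸n+n≡m i<m) (keep e′ (m ∸ suc i) (born i y e′ z))
        in p , trans (sym (end F m ≤-refl y)) p′ , trans (sym (end F m ≤-refl (suc y))) p″

  module Pull (ρ m N : ℕ) (a g q b d e : Fn) (κ : ℕ → Fn) (F : Filling ρ m a (λ i → g i + q i) b d κ)
              (vanish : VanishesFrom N e) (e-dec : Decreasing e) (d-vs : VStrip d e) (g-dec : Decreasing g)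
              (q-bit : ∀ i → q i ≤ 1) (q-end : ∀ i → m ≤ i → q i ≡ 0) (a-end : ∀ i → m ≤ i → a i ≡ 0)
              (linked : LinkedAt ρ g q d e) where

    R : ℕ → ℕ
    R i = dam ρ i (g i)

    descend : ℕ → ℕ → Fn
    descend zero i = e
    descend (suc n) i = Uncarry.u (R i) (q i) (κ i) (κ (suc i)) (descend n (suc i))

    Λ : ℕ → Fn
    Λ i = descend (m ∸ i) i

    private
      no-dam′ : ∀ i → R i ≡ 0 → q i ≡ 0
      no-dam′ i r with bit (q i) (q-bit i)
      ... | inj₁ z = z
      ... | inj₂ z with linked i z
      ... | (y , e′ , _) = ⊥-elim (1+n≢0 (trans (sym e′) r))

      -- The field `links` passes the linked rows of the earlier rows `j` on to the reversed steps
      -- that will use them; the steps undone before that have lower dams and do not disturb these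
      -- rows.
      record Good (i : ℕ) (u : Fn) : Set where
        field
          vstrip   : VStrip (κ i) u
          u-dec    : Decreasing u
          vanishes : VanishesFrom N u
          links    : ∀ j → j < i → q j ≡ 1 → ∀ y → R j ≡ suc y → Linked (κ i) u y
      open Good

      module Bw (i : ℕ) (u′ : Fn) (G : Good (suc i) u′) where

        -- at the dam the link leaves no room for an entry, although it would not violate the flag
        flagκ : ∀ k → k < R i → κ (suc i) k ≡ κ i k
        flagκ k k<R with bit (q i) (q-bit i)
        ... | inj₁ z = flag F i k (<-≤-trans k<R (≤-reflexive (cong (dam ρ i) (sym (trans (cong (g i +_) z) (+-identityʳ _))))))
        ... | inj₂ z with linked i z
        ... | (y , e′ , _) with m≤n⇒m<n∨m≡n (≤-pred (subst (k <_) e′ k<R))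
        ... | inj₁ k<y = flag F i k (subst (k <_) (sym (trans (cong (λ x → dam ρ i (g i + x)) z) (trans (cong (dam ρ i) (+-comm (g i) 1)) (trans (∸-suc (ρ + i) (g i)) (cong ℕ.pred e′))))) k<y)
          where
          ∸-suc : ∀ a b → a ∸ suc b ≡ ℕ.pred (a ∸ b)
          ∸-suc a b = sym (pred[m∸n]≡m∸[1+n] a b)
        ... | inj₂ refl = ≤-antisym (≤-trans (≤-reflexive (sym (proj₁ (links G i ≤-refl z y e′)))) (proj₂ (strip F i y))) (proj₁ (strip F i y))

        open Backward (R i) (q i) N (κ i) (κ (suc i)) u′ (u-dec G) (strip F i) (vstrip G) flagκ (vanishes G) (q-bit i)
                      (no-dam′ i) (λ z y r → links G i ≤-refl z y r) public

        good : Good i (Uncarry.u (R i) (q i) (κ i) (κ (suc i)) u′)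
        good = record
          { vstrip = vs
          ; u-dec = HStrip-decˡ hs
          ; vanishes = λ k h → n≤0⇒n≡0 (≤-trans (proj₁ (hs k)) (≤-reflexive (vanishes G k h)))
          ; links = λ j j<i z y r →
              let lt = dam-mono ρ {j} {i} {g j} {g i} j<i (dec-≤ g-dec (<⇒≤ j<i)) r
                  (p , p′ , p″) = links G j (m≤n⇒m≤1+n j<i) z y r
                  (a , a′) = below step y (<-trans (n<1+n y) lt)
                  (b , b′) = below step (suc y) lt
              in trans (sym b) (trans p a) , trans (sym a′) (trans p′ (cong suc a)) , trans (sym b′) (trans p″ (cong suc a))
          }

      good-end : ∀ i → m ≤ i → Good i e
      good-end i m≤i = record
        { vstrip = λ k → subst (λ x → x ≤ e k × e k ≤ suc x) (sym (end F i m≤i k)) (d-vs k)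
        ; u-dec = e-dec
        ; vanishes = vanish
        ; links = λ j _ z y r → transport y (suc-injective (trans (sym r) (proj₁ (proj₂ (linked j z))))) (proj₂ (proj₂ (linked j z)))
        }
        where
        transport : ∀ y {y′} → y ≡ y′ → Linked d e y′ → Linked (κ i) e y
        transport y refl (p , p′ , p″) = trans (end F i m≤i (suc y)) (trans p (sym (end F i m≤i y)))
          , trans p′ (cong suc (sym (end F i m≤i y))) , trans p″ (cong suc (sym (end F i m≤i y)))

      good-descend : ∀ n i → n + i ≡ m → Good i (descend n i)
      good-descend zero i refl = good-end m ≤-refl
      good-descend (suc n) i eq = Bw.good i _ (good-descend n (suc i) (trans (+-suc n i) eq))

      Λ-end : ∀ i → m ≤ i → Λ i ≡ e
      Λ-end i m≤i = cong (λ n → descend n i) (m≤n⇒m∸n≡0 m≤i)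

      good : ∀ i → Good i (Λ i)
      good i with <-≤-connex i m
      ... | inj₁ i<m = good-descend (m ∸ i) i (m∸n+n≡m (<⇒≤ i<m))
      ... | inj₂ m≤i = subst (Good i) (sym (Λ-end i m≤i)) (good-end i m≤i)

      Λ-suc : ∀ i → i < m → Λ i ≡ Uncarry.u (R i) (q i) (κ i) (κ (suc i)) (Λ (suc i))
      Λ-suc i i<m = cong (λ n → descend n i) (+-∸-assoc 1 i<m)

      idle-step : ∀ i → m ≤ i → Step (R i) (q i) (κ i) e (κ (suc i)) e
      idle-step i m≤i = record
        { c = λ _ → 0 ; c≤1 = λ _ → z≤n ; bound = 0 ; c-end = λ _ _ → refl ; c-dam = sym (q-end i m≤i) ; no-dam = λ _ → q-end i m≤i
        ; below = λ k _ → same k , refl ; flow = λ k _ → cong (λ x → x + e k + 0) (same k) ; tight = λ _ _ () }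
        where
        same : κ (suc i) ≗ κ i
        same k = trans (end F (suc i) (m≤n⇒m≤1+n m≤i) k) (sym (end F i m≤i k))

      stepsᵢ : ∀ i → Step (R i) (q i) (κ i) (Λ i) (κ (suc i)) (Λ (suc i)) × HStrip (Λ i) (Λ (suc i))
      stepsᵢ i with <-≤-connex i m
      ... | inj₁ i<m = subst (λ u → Step (R i) (q i) (κ i) u (κ (suc i)) (Λ (suc i)) × HStrip u (Λ (suc i))) (sym (Λ-suc i i<m))
        (Bw.step i _ (good (suc i)) , Bw.hs i _ (good (suc i)))
      ... | inj₂ m≤i rewrite Λ-end i m≤i | Λ-end (suc i) (m≤n⇒m≤1+n m≤i) =
        idle-step i m≤i , λ k → ≤-refl , e-dec k

    infusion : Infusion ρ g q κ Λ
    infusion = record { stepᵢ = λ i → proj₁ (stepsᵢ i) ; vertᵢ = λ i → vstrip (good i) }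

    filling : Filling ρ m a g (Λ 0) e Λ
    filling = record
      { start = λ _ → refl
      ; end = λ i m≤i k → cong (λ f → f k) (Λ-end i m≤i)
      ; strip = λ i → proj₂ (stepsᵢ i)
      ; total = λ i → total-unstep {g = g i} (stepᵢ infusion i) (total F i)
      ; flag = λ i k h → proj₂ (below (stepᵢ infusion i) k h)
      ; strict = λ i → TwoSteps.backward {ρ} {i} (stepᵢ infusion i) (stepᵢ infusion (suc i)) (g-dec i)
          (vertᵢ infusion i) (vertᵢ infusion (suc i)) (vertᵢ infusion (suc (suc i)))
          (strip F i) (strip F (suc i)) (proj₂ (stepsᵢ i)) (proj₂ (stepsᵢ (suc i))) (strict F i)
      }

    start-dec : Decreasing (Λ 0)
    start-dec = u-dec (good 0)

    vert-start : VStrip b (Λ 0)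
    vert-start k = subst (λ x → x ≤ Λ 0 k × Λ 0 k ≤ suc x) (start F k) (vertᵢ infusion 0 k)

  Infusion-functional : ∀ {ρ m a g b₁ b₂ d₁ d₂ q₁ q₂ κ₁ κ₂ Λ₁ Λ₂} →
    Filling ρ m a (λ i → g i + q₁ i) b₁ d₁ κ₁ → Filling ρ m a (λ i → g i + q₂ i) b₂ d₂ κ₂ → b₁ ≗ b₂ → (∀ i → Λ₁ i ≗ Λ₂ i) →
    Infusion ρ g q₁ κ₁ Λ₁ → Infusion ρ g q₂ κ₂ Λ₂ → (∀ i → κ₁ i ≗ κ₂ i) × q₁ ≗ q₂
  Infusion-functional {b₁ = b₁} {b₂} {q₁ = q₁} {q₂} {κ₁} {κ₂} {Λ₁} {Λ₂} F₁ F₂ eb eΛ I₁ I₂ = same , λ i → proj₂ (next i (same i))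
    where
    next : ∀ i → κ₁ i ≗ κ₂ i → κ₁ (suc i) ≗ κ₂ (suc i) × q₁ i ≡ q₂ i
    next i h = Step-functional (strip F₁ i) (HStrip-cong (λ k → sym (h k)) (λ _ → refl) (strip F₂ i)) (stepᵢ I₁ i)
      (Step-cong (λ k → sym (h k)) (λ k → sym (eΛ i k)) (λ _ → refl) (λ k → sym (eΛ (suc i) k)) (stepᵢ I₂ i))
    same : ∀ i → κ₁ i ≗ κ₂ i
    same zero k = trans (start F₁ k) (trans (eb k) (sym (start F₂ k)))
    same (suc i) = proj₁ (next i (same i))

  Infusion-injective : ∀ {ρ m a g b₁ b₂ e q₁ q₂ κ₁ κ₂ Λ₁ Λ₂} →
    Filling ρ m a g b₁ e Λ₁ → Filling ρ m a g b₂ e Λ₂ → (∀ i → κ₁ i ≗ κ₂ i) → q₁ ≗ q₂ →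
    Infusion ρ g q₁ κ₁ Λ₁ → Infusion ρ g q₂ κ₂ Λ₂ → ∀ i → Λ₁ i ≗ Λ₂ i
  Infusion-injective {m = m} {q₁ = q₁} {q₂} {κ₁} {κ₂} {Λ₁} {Λ₂} F₁ F₂ eκ eq I₁ I₂ i = back m i (m≤m+n m i)
    where
    back : ∀ n i → m ≤ n + i → Λ₁ i ≗ Λ₂ i
    back zero i h k = trans (end F₁ i h k) (sym (end F₂ i h k))
    back (suc n) i h = Step-injective (strip F₁ i) (HStrip-cong (λ _ → refl) (λ k → sym (ih k)) (strip F₂ i)) (stepᵢ I₁ i)
      (subst (λ r → Step _ r _ _ _ _) (sym (eq i))
        (Step-cong (λ k → sym (eκ i k)) (λ _ → refl) (λ k → sym (eκ (suc i) k)) (λ k → sym (ih k)) (stepᵢ I₂ i)))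
      where
      ih : Λ₁ (suc i) ≗ Λ₂ (suc i)
      ih = back n (suc i) (subst (m ≤_) (sym (+-suc n i)) h)

  Filling-cong : ∀ {ρ m a g g′ b b′ e e′ Λ} → g ≗ g′ → b ≗ b′ → e ≗ e′ → Filling ρ m a g b e Λ → Filling ρ m a g′ b′ e′ Λ
  Filling-cong {ρ} {g = g} {g′} {Λ = Λ} eg eb ee F = record
    { start = λ k → trans (start F k) (eb k)
    ; end = λ i h k → trans (end F i h k) (ee k)
    ; strip = strip F
    ; total = λ i → let (N , h) = total F i in N , λ n le → trans (cong (_+ prefix (Λ (suc i)) n) (sym (eg i))) (h n le)
    ; flag = λ i k h → flag F i k (subst (λ x → k < dam ρ i x) (sym (eg i)) h)
    ; strict = λ i k → subst₂ (λ x y → Compatible x y (Λ i) (Λ (suc i)) (Λ (suc (suc i))) k) (eg i) (eg (suc i)) (strict F i k) }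

  Infusion-cong : ∀ {ρ g q q′ κ κ′ Λ Λ′} → q ≗ q′ → (∀ i → κ i ≗ κ′ i) → (∀ i → Λ i ≗ Λ′ i) → Infusion ρ g q κ Λ → Infusion ρ g q′ κ′ Λ′
  Infusion-cong {ρ} {g} eq eκ eΛ I = record
    { stepᵢ = λ i → subst (λ x → Step (dam ρ i (g i)) x _ _ _ _) (eq i) (Step-cong (eκ i) (eΛ i) (eκ (suc i)) (eΛ (suc i)) (stepᵢ I i))
    ; vertᵢ = λ i k → subst₂ (λ x y → x ≤ y × y ≤ suc x) (eκ i k) (eΛ i k) (vertᵢ I i k) }

  Linked-cong : ∀ {l u l′ u′ y} → l ≗ l′ → u ≗ u′ → Linked l u y → Linked l′ u′ y
  Linked-cong {y = y} el eu (a , b , c) = trans (sym (el (suc y))) (trans a (el y)) , trans (sym (eu y)) (trans b (cong suc (el y))) , trans (sym (eu (suc y))) (trans c (cong suc (el y)))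

-- Finite sums, duplicate-free enumerations, and sums matched by a bijection.

module Enum where

  -- Finite sums

  ∑ : {A : Set} → List A → (A → ℤ) → ℤ
  ∑ [] f = ℤ.+ 0
  ∑ (x ∷ xs) f = f x ℤ.+ ∑ xs f

  module _ {A : Set} where

    ∑-cong : (xs : List A) {f g : A → ℤ} → (∀ x → x ∈ xs → f x ≡ g x) → ∑ xs f ≡ ∑ xs g
    ∑-cong [] h = refl
    ∑-cong (x ∷ xs) h = cong₂ ℤ._+_ (h x (here refl)) (∑-cong xs (λ y p → h y (there p)))

    ∑-++ : (xs ys : List A) (f : A → ℤ) → ∑ (xs ++ ys) f ≡ ∑ xs f ℤ.+ ∑ ys f
    ∑-++ [] ys f = sym (ℤₚ.+-identityˡ _)
    ∑-++ (x ∷ xs) ys f = trans (cong (λ s → f x ℤ.+ s) (∑-++ xs ys f)) (sym (ℤₚ.+-assoc (f x) (∑ xs f) (∑ ys f)))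

    ∑-↭ : {xs ys : List A} (f : A → ℤ) → xs ↭ ys → ∑ xs f ≡ ∑ ys f
    ∑-↭ f ↭.refl = refl
    ∑-↭ f (↭.prep x p) = cong (λ s → f x ℤ.+ s) (∑-↭ f p)
    ∑-↭ f (↭.swap x y p) = trans (cong (λ s → f x ℤ.+ (f y ℤ.+ s)) (∑-↭ f p))
      (trans (sym (ℤₚ.+-assoc (f x) (f y) _)) (trans (cong (ℤ._+ _) (ℤₚ.+-comm (f x) (f y))) (ℤₚ.+-assoc (f y) (f x) _)))
    ∑-↭ f (↭.trans p q) = trans (∑-↭ f p) (∑-↭ f q)

    ∑-+ : (xs : List A) (f g : A → ℤ) → ∑ xs (λ x → f x ℤ.+ g x) ≡ ∑ xs f ℤ.+ ∑ xs g
    ∑-+ [] f g = refl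
    ∑-+ (x ∷ xs) f g = trans (cong (λ s → f x ℤ.+ g x ℤ.+ s) (∑-+ xs f g)) (interchange (f x) (g x) (∑ xs f) (∑ xs g))
      where
      open import Algebra.Properties.CommutativeSemigroup ℤₚ.+-commutativeSemigroup using (interchange)

    ∑-*ˡ : (c : ℤ) (xs : List A) (f : A → ℤ) → ∑ xs (λ x → c ℤ.* f x) ≡ c ℤ.* ∑ xs f
    ∑-*ˡ c [] f = sym (ℤₚ.*-zeroʳ c)
    ∑-*ˡ c (x ∷ xs) f = trans (cong (λ s → c ℤ.* f x ℤ.+ s) (∑-*ˡ c xs f)) (sym (ℤₚ.*-distribˡ-+ c (f x) (∑ xs f)))

    ∑-*ʳ : (c : ℤ) (xs : List A) (f : A → ℤ) → ∑ xs (λ x → f x ℤ.* c) ≡ ∑ xs f ℤ.* c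
    ∑-*ʳ c xs f = trans (∑-cong xs (λ x _ → ℤₚ.*-comm (f x) c)) (trans (∑-*ˡ c xs f) (ℤₚ.*-comm c (∑ xs f)))

    ∑-const-1 : (xs : List A) → ∑ xs (λ _ → ℤ.+ 1) ≡ ℤ.+ length xs
    ∑-const-1 [] = refl
    ∑-const-1 (x ∷ xs) = trans (cong (λ s → ℤ.+ 1 ℤ.+ s) (∑-const-1 xs)) refl

    ∑-zero : (xs : List A) → ∑ xs (λ _ → ℤ.+ 0) ≡ ℤ.+ 0
    ∑-zero [] = refl
    ∑-zero (x ∷ xs) = trans (ℤₚ.+-identityˡ _) (∑-zero xs)

  module _ {A B : Set} where

    ∑-map : (h : A → B) (xs : List A) (f : B → ℤ) → ∑ (map h xs) f ≡ ∑ xs (f ∘ h)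
    ∑-map h [] f = refl
    ∑-map h (x ∷ xs) f = cong (λ s → f (h x) ℤ.+ s) (∑-map h xs f)

    ∑-concatMap : (h : A → List B) (xs : List A) (f : B → ℤ) → ∑ (concatMap h xs) f ≡ ∑ xs (λ x → ∑ (h x) f)
    ∑-concatMap h [] f = refl
    ∑-concatMap h (x ∷ xs) f = trans (∑-++ (h x) (concatMap h xs) f) (cong (λ s → ∑ (h x) f ℤ.+ s) (∑-concatMap h xs f))

  module _ {A B : Set} where

    pairs : List A → (A → List B) → List (A × B)
    pairs xs ys = concatMap (λ x → map (x ,_) (ys x)) xs

    ∑-pairs : (xs : List A) (ys : A → List B) (f : A × B → ℤ) → ∑ (pairs xs ys) f ≡ ∑ xs (λ x → ∑ (ys x) (λ y → f (x , y)))
    ∑-pairs xs ys f = trans (∑-concatMap _ xs f) (∑-cong xs (λ x _ → ∑-map (x ,_) (ys x) f))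

    ∑-swap : (xs : List A) (ys : List B) (f : A → B → ℤ) → ∑ xs (λ x → ∑ ys (f x)) ≡ ∑ ys (λ y → ∑ xs (λ x → f x y))
    ∑-swap [] ys f = sym (∑-zero ys)
    ∑-swap (x ∷ xs) ys f = trans (cong (λ s → ∑ ys (f x) ℤ.+ s) (∑-swap xs ys f)) (sym (∑-+ ys (f x) (λ y → ∑ xs (λ x → f x y))))

  -- Enumerations of finite sets

  record Enumerates {A : Set} (xs : List A) (P : A → Set) : Set where
    constructor enumerates
    field
      unique   : Unique xs
      sound    : ∀ {x} → x ∈ xs → P x
      complete : ∀ {x} → P x → x ∈ xs

  open Enumerates public

  module _ {A : Set} where

    enum-resp : {xs : List A} {P Q : A → Set} → (∀ {x} → P x → Q x) → (∀ {x} → Q x → P x) → Enumerates xs P → Enumerates xs Q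
    enum-resp f g e = enumerates (unique e) (λ p → f (sound e p)) (λ q → complete e (g q))

    ∈-filterB⁻ : (p : A → Bool) (xs : List A) {x : A} → x ∈ filterB p xs → x ∈ xs × T (p x)
    ∈-filterB⁻ p (y ∷ xs) x∈ with p y in e
    ∈-filterB⁻ p (y ∷ xs) (here refl) | true = here refl , subst T (sym e) tt
    ∈-filterB⁻ p (y ∷ xs) (there x∈) | true = let (a , b) = ∈-filterB⁻ p xs x∈ in there a , b
    ∈-filterB⁻ p (y ∷ xs) x∈ | false = let (a , b) = ∈-filterB⁻ p xs x∈ in there a , b

    ∈-filterB⁺ : (p : A → Bool) (xs : List A) {x : A} → x ∈ xs → T (p x) → x ∈ filterB p xs
    ∈-filterB⁺ p (y ∷ xs) x∈ h with p y in e
    ∈-filterB⁺ p (y ∷ xs) (here refl) h | true = here refl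
    ∈-filterB⁺ p (y ∷ xs) (there x∈) h | true = there (∈-filterB⁺ p xs x∈ h)
    ∈-filterB⁺ p (y ∷ xs) (here refl) h | false = ⊥-elim (subst T e h)
    ∈-filterB⁺ p (y ∷ xs) (there x∈) h | false = ∈-filterB⁺ p xs x∈ h

    unique-filterB : (p : A → Bool) {xs : List A} → Unique xs → Unique (filterB p xs)
    unique-filterB p [] = []
    unique-filterB p {x ∷ xs} (h ∷ u) with p x
    ... | true = All.tabulate (λ y∈ → All.lookup h (proj₁ (∈-filterB⁻ p xs y∈))) ∷ unique-filterB p u
    ... | false = unique-filterB p u

    enum-filterB : {xs : List A} {P : A → Set} (p : A → Bool) → Enumerates xs P → Enumerates (filterB p xs) (λ x → P x × T (p x))
    enum-filterB {xs} p e = enumerates (unique-filterB p (unique e))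
      (λ x∈ → let (a , b) = ∈-filterB⁻ p xs x∈ in sound e a , b) (λ (a , b) → ∈-filterB⁺ p xs (complete e a) b)

    enum-[_] : (x : A) → Enumerates (x ∷ []) (_≡ x)
    enum-[ x ] = enumerates ([] ∷ []) (λ { (here e) → e }) here

  module _ {A B : Set} where

    ∈-concatMap⁻′ : (f : A → List B) (xs : List A) {y : B} → y ∈ concatMap f xs → ∃[ x ] (x ∈ xs × y ∈ f x)
    ∈-concatMap⁻′ f (x ∷ xs) y∈ with ∈-++⁻ (f x) y∈
    ... | inj₁ h = x , here refl , h
    ... | inj₂ h = let (z , a , b) = ∈-concatMap⁻′ f xs h in z , there a , b

    ∈-concatMap⁺′ : (f : A → List B) (xs : List A) {x : A} {y : B} → x ∈ xs → y ∈ f x → y ∈ concatMap f xs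
    ∈-concatMap⁺′ f (x ∷ xs) (here refl) y∈ = ∈-++⁺ˡ y∈
    ∈-concatMap⁺′ f (x ∷ xs) (there x∈) y∈ = ∈-++⁺ʳ (f x) (∈-concatMap⁺′ f xs x∈ y∈)

  module _ {A B : Set} where

    enum-map : {xs : List A} {P : A → Set} (f : A → B) → (∀ {x y} → f x ≡ f y → x ≡ y) → Enumerates xs P →
               Enumerates (map f xs) (λ y → ∃[ x ] (P x × y ≡ f x))
    enum-map {xs} f inj e = enumerates (Uniq.map⁺ inj (unique e))
      (λ y∈ → let (x , x∈ , eq) = ∈-map⁻ f y∈ in x , sound e x∈ , eq) (λ { (x , p , refl) → ∈-map⁺ f (complete e p) })

  module _ {A B : Set} where

    enum-concatMap : {xs : List A} {P : A → Set} {Q : A → B → Set} (f : A → List B) →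
      (∀ {x x′ y} → P x → P x′ → Q x y → Q x′ y → x ≡ x′) → Enumerates xs P → (∀ {x} → P x → Enumerates (f x) (Q x)) →
      Enumerates (concatMap f xs) (λ y → ∃[ x ] (P x × Q x y))
    enum-concatMap {xs} {P} {Q} f disjoint e es = enumerates
      (uniq xs (unique e) (λ _ → sound e))
      (λ y∈ → let (x , x∈ , h) = ∈-concatMap⁻′ f xs y∈ in x , sound e x∈ , sound (es (sound e x∈)) h)
      (λ { (x , p , h) → ∈-concatMap⁺′ f xs (complete e p) (complete (es p) h) })
      where
      uniq : ∀ xs → Unique xs → (∀ x → x ∈ xs → P x) → Unique (concatMap f xs)
      uniq [] u h = []
      uniq (x ∷ xs) (n ∷ u) h = Uniq.++⁺ (unique (es (h _ (here refl)))) (uniq xs u (λ z → h z ∘ there))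
        (λ { (a , b) → let (x′ , x′∈ , c) = ∈-concatMap⁻′ f xs b in
          All.lookup n x′∈ (disjoint (h _ (here refl)) (h _ (there x′∈)) (sound (es (h _ (here refl))) a) (sound (es (h _ (there x′∈))) c)) })

  module _ {A B : Set} where

    enum-pairs : {xs : List A} {P : A → Set} {Q : A → B → Set} {ys : A → List B} →
      Enumerates xs P → (∀ {x} → P x → Enumerates (ys x) (Q x)) → Enumerates (pairs xs ys) (λ z → P (proj₁ z) × Q (proj₁ z) (proj₂ z))
    enum-pairs {Q = Q} {ys} e es = enum-resp
      (λ { (x , p , y , q , refl) → p , q }) (λ { (p , q) → _ , p , _ , q , refl })
      (enum-concatMap (λ x → map (x ,_) (ys x)) (λ { _ _ (_ , _ , refl) (_ , _ , refl) → refl }) e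
        (λ {x} p → enum-map (x ,_) (cong proj₂) (es p)))

  enum-upTo : ∀ n → Enumerates (upTo n) (_< n)
  enum-upTo n = enumerates (Uniq.upTo⁺ n) ∈-upTo⁻ ∈-upTo⁺

  enum-fromTo : ∀ a b → Enumerates (fromTo a b) (λ k → a ≤ k × k ≤ b)
  enum-fromTo a b = enum-resp
    (λ { (k , lt , refl) → m≤m+n a k , rest a b k lt })
    (λ { {k} (p , q) → k ℕ.∸ a , m≤n⇒m∸o<1 p q , sym (m+[n∸m]≡n p) })
    (enum-map (λ k → a ℕ.+ k) (λ {x} {y} → +-cancelˡ-≡ a x y) (enum-upTo (suc b ℕ.∸ a)))
    where
    rest : ∀ a b k → k < suc b ℕ.∸ a → a ℕ.+ k ≤ b
    rest zero b k lt = ≤-pred lt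
    rest (suc a) zero k lt = ⊥-elim (n≮0 (subst (k <_) (0∸n≡0 a) lt))
    rest (suc a) (suc b) k lt = s≤s (rest a b k lt)
    m≤n⇒m∸o<1 : ∀ {a b k} → a ≤ k → k ≤ b → k ℕ.∸ a < suc b ℕ.∸ a
    m≤n⇒m∸o<1 {a} p q = ∸-monoˡ-< (s≤s q) p

  -- The bijection is a relation, total and single-valued in both directions, in place of two
  -- inverse maps. Partners are constructed together with proofs, and comparing them only through
  -- `R` avoids composing the two constructions.
  ∑-match : {A B : Set} {xs : List A} {ys : List B} {P : A → Set} {Q : B → Set} {f : A → ℤ} {g : B → ℤ} (R : A → B → Set) →
    Enumerates xs P → Enumerates ys Q →
    (∀ {x} → P x → ∃[ y ] (Q y × R x y)) → (∀ {y} → Q y → ∃[ x ] (P x × R x y)) →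
    (∀ {x y y′} → P x → Q y → Q y′ → R x y → R x y′ → y ≡ y′) →
    (∀ {x x′ y} → P x → P x′ → Q y → R x y → R x′ y → x ≡ x′) →
    (∀ {x y} → P x → Q y → R x y → f x ≡ g y) → ∑ xs f ≡ ∑ ys g
  ∑-match {A} {B} {xs} {ys} {P} {Q} {f} {g} R ex ey to from fun inj val =
    trans (image-∑ xs (λ _ → sound ex)) (∑-↭ g (∼bag⇒↭ (unique∧set⇒bag (image-unique xs (λ _ → sound ex) (unique ex)) (unique ey)
      (λ {z} → mk⇔ (λ z∈ → let (x , x∈ , q , r) = image-sound xs (λ _ → sound ex) z∈ in complete ey q)
                   (λ z∈ → let (x , p , r) = from (sound ey z∈) in image-complete xs (λ _ → sound ex) (complete ex p) (sound ey z∈) r)))))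
    where
    image : ∀ xs → (∀ x → x ∈ xs → P x) → List B
    image [] h = []
    image (x ∷ xs) h = proj₁ (to (h _ (here refl))) ∷ image xs (λ z → h z ∘ there)

    image-∑ : ∀ xs h → ∑ xs f ≡ ∑ (image xs h) g
    image-∑ [] h = refl
    image-∑ (x ∷ xs) h = cong₂ ℤ._+_ (let (y , q , r) = to (h _ (here refl)) in val (h _ (here refl)) q r) (image-∑ xs (λ z → h z ∘ there))

    image-sound : ∀ xs (h : ∀ x → x ∈ xs → P x) {y} → y ∈ image xs h → ∃[ x ] (x ∈ xs × Q y × R x y)
    image-sound (x ∷ xs) h (here refl) = x , here refl , proj₂ (to (h _ (here refl)))
    image-sound (x ∷ xs) h (there y∈) = let (x′ , x∈ , r) = image-sound xs (λ z → h z ∘ there) y∈ in x′ , there x∈ , r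

    image-complete : ∀ xs (h : ∀ x → x ∈ xs → P x) {x y} → x ∈ xs → Q y → R x y → y ∈ image xs h
    image-complete (x ∷ xs) h (here refl) q r =
      let (y′ , q′ , r′) = to (h _ (here refl)) in here (fun (h _ (here refl)) q q′ r r′)
    image-complete (x ∷ xs) h (there x∈) q r = there (image-complete xs (λ z → h z ∘ there) x∈ q r)

    image-unique : ∀ xs (h : ∀ x → x ∈ xs → P x) → Unique xs → Unique (image xs h)
    image-unique [] h u = []
    image-unique (x ∷ xs) h (n ∷ u) =
      All.tabulate (λ { y∈ refl → let (x′ , x∈ , q , r) = image-sound xs (λ z → h z ∘ there) y∈
                                      (_ , _ , r′) = to (h _ (here refl))
                                  in All.lookup n x∈ (inj (h _ (here refl)) (h _ (there x∈)) q r′ r) })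
      ∷ image-unique xs (λ z → h z ∘ there) u

-- Partitions, skew shapes and their boxes.

module Shape where

  open Linear using (∧-T; lia; _⊞_; _≼_; _≺_; _≐_; _⇒_; [_]⊢_; [_∣_]⊢_)
  open Step using (Fn; prefix; Decreasing; VanishesFrom)
  open Chain using (_≗_)
  open Enum

  ∧-T⁺ : ∀ {a b} → T a → T b → T (a ∧ b)
  ∧-T⁺ {true} _ q = q

  -- Parts of a partition, padded with zeros

  pt : Part → Fn
  pt [] k = 0
  pt (x ∷ xs) zero = x
  pt (x ∷ xs) (suc k) = pt xs k

  IsP : Part → Set
  IsP α = T (isPartition α)

  infix 4 _⊑_
  _⊑_ : Part → Part → Set
  β ⊑ α = ∀ k → pt β k ≤ pt α k

  prefix-suc : ∀ f n → prefix f (suc n) ≡ f 0 + prefix (f ∘ suc) n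
  prefix-suc f zero = +-comm 0 (f 0)
  prefix-suc f (suc n) = trans (cong (_+ f (suc n)) (prefix-suc f n)) (+-assoc (f 0) _ _)

  prefix-cong : ∀ {f g} → f ≗ g → ∀ n → prefix f n ≡ prefix g n
  prefix-cong h zero = refl
  prefix-cong h (suc n) = cong₂ _+_ (prefix-cong h n) (h n)

  prefix-pt : ∀ α n → length α ≤ n → prefix (pt α) n ≡ size α
  prefix-pt [] zero _ = refl
  prefix-pt [] (suc n) _ = trans (+-identityʳ _) (prefix-pt [] n z≤n)
  prefix-pt (x ∷ α) (suc n) (s≤s h) = trans (prefix-suc (pt (x ∷ α)) n) (cong (x +_) (prefix-pt α n h))

  pt-vanish : ∀ α → VanishesFrom (length α) (pt α)
  pt-vanish [] k h = refl
  pt-vanish (x ∷ α) (suc k) (s≤s h) = pt-vanish α k h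

  IsP-tail : ∀ x α → IsP (x ∷ α) → IsP α
  IsP-tail x [] h = tt
  IsP-tail x (y ∷ α) h = proj₂ (∧-T {1 ≤ᵇ x} (proj₂ (∧-T {y ≤ᵇ x} h)))

  IsP-head : ∀ x α → IsP (x ∷ α) → 1 ≤ x × pt α 0 ≤ x
  IsP-head x [] h = ≤ᵇ⇒≤ 1 x h , z≤n
  IsP-head x (y ∷ α) h = let (p , q) = ∧-T {y ≤ᵇ x} h in ≤ᵇ⇒≤ 1 x (proj₁ (∧-T {1 ≤ᵇ x} q)) , ≤ᵇ⇒≤ y x p

  IsP-∷ : ∀ {x} α → 1 ≤ x → pt α 0 ≤ x → IsP α → IsP (x ∷ α)
  IsP-∷ [] p q h = ≤⇒≤ᵇ p
  IsP-∷ {x} (y ∷ α) p q h = ∧-T⁺ {y ≤ᵇ x} (≤⇒≤ᵇ q) (∧-T⁺ {1 ≤ᵇ x} (≤⇒≤ᵇ p) h)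

  pt-dec : ∀ α → IsP α → Decreasing (pt α)
  pt-dec [] h k = z≤n
  pt-dec (x ∷ α) h zero = proj₂ (IsP-head x α h)
  pt-dec (x ∷ α) h (suc k) = pt-dec α (IsP-tail x α h) k

  pt-injective : ∀ α β → IsP α → IsP β → pt α ≗ pt β → α ≡ β
  pt-injective [] [] _ _ _ = refl
  pt-injective [] (y ∷ β) _ q h = ⊥-elim (<-irrefl (h 0) (proj₁ (IsP-head y β q)))
  pt-injective (x ∷ α) [] p _ h = ⊥-elim (<-irrefl (sym (h 0)) (proj₁ (IsP-head x α p)))
  pt-injective (x ∷ α) (y ∷ β) p q h = cong₂ _∷_ (h 0) (pt-injective α β (IsP-tail x α p) (IsP-tail y β q) (h ∘ suc))

  fromFn : ℕ → Fn → Part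
  fromFn zero f = []
  fromFn (suc n) f with f 0
  ... | zero = []
  ... | suc x = suc x ∷ fromFn n (f ∘ suc)

  pt-fromFn : ∀ n f → Decreasing f → VanishesFrom n f → pt (fromFn n f) ≗ f
  pt-fromFn zero f d v k = sym (v k z≤n)
  pt-fromFn (suc n) f d v k with f 0 in e
  pt-fromFn (suc n) f d v k | zero = sym (n≤0⇒n≡0 (subst (f k ≤_) e (first-max k)))
    where
    first-max : ∀ k → f k ≤ f 0
    first-max zero = ≤-refl
    first-max (suc k) = ≤-trans (d k) (first-max k)
  pt-fromFn (suc n) f d v zero | suc x = sym e
  pt-fromFn (suc n) f d v (suc k) | suc x = pt-fromFn n (f ∘ suc) (d ∘ suc) (λ k h → v (suc k) (s≤s h)) k

  fromFn-IsP : ∀ n f → Decreasing f → VanishesFrom n f → IsP (fromFn n f)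
  fromFn-IsP zero f d v = tt
  fromFn-IsP (suc n) f d v with f 0 in e
  ... | zero = tt
  ... | suc x = IsP-∷ (fromFn n (f ∘ suc)) (s≤s z≤n)
    (subst (_≤ suc x) (sym (pt-fromFn n (f ∘ suc) (d ∘ suc) (λ k h → v (suc k) (s≤s h)) 0)) (subst (f 1 ≤_) e (d 0)))
    (fromFn-IsP n (f ∘ suc) (d ∘ suc) (λ k h → v (suc k) (s≤s h)))

  ⊆ᵇ⇒⊑ : ∀ β α → T (β ⊆ᵇ α) → β ⊑ α
  ⊆ᵇ⇒⊑ [] α h k = z≤n
  ⊆ᵇ⇒⊑ (x ∷ β) [] h zero = ≤-reflexive (≡ᵇ⇒≡ x 0 (proj₁ (∧-T {x ≡ᵇ 0} h)))
  ⊆ᵇ⇒⊑ (x ∷ β) [] h (suc k) = ⊆ᵇ⇒⊑ β [] (proj₂ (∧-T {x ≡ᵇ 0} h)) k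
  ⊆ᵇ⇒⊑ (x ∷ β) (y ∷ α) h zero = ≤ᵇ⇒≤ x y (proj₁ (∧-T {x ≤ᵇ y} h))
  ⊆ᵇ⇒⊑ (x ∷ β) (y ∷ α) h (suc k) = ⊆ᵇ⇒⊑ β α (proj₂ (∧-T {x ≤ᵇ y} h)) k

  ⊑⇒⊆ᵇ : ∀ β α → β ⊑ α → T (β ⊆ᵇ α)
  ⊑⇒⊆ᵇ [] α h = tt
  ⊑⇒⊆ᵇ (x ∷ β) [] h = ∧-T⁺ {x ≡ᵇ 0} (≡⇒≡ᵇ x 0 (n≤0⇒n≡0 (h 0))) (⊑⇒⊆ᵇ β [] (h ∘ suc))
  ⊑⇒⊆ᵇ (x ∷ β) (y ∷ α) h = ∧-T⁺ {x ≤ᵇ y} (≤⇒≤ᵇ (h 0)) (⊑⇒⊆ᵇ β α (h ∘ suc))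

  size-mono : ∀ β α → β ⊑ α → size β ≤ size α
  size-mono [] α h = z≤n
  size-mono (x ∷ β) [] h = +-mono-≤ (h 0) (size-mono β [] (h ∘ suc))
  size-mono (x ∷ β) (y ∷ α) h = +-mono-≤ (h 0) (size-mono β α (h ∘ suc))

  ⊑-size-≡ : ∀ β α → β ⊑ α → size β ≡ size α → pt β ≗ pt α
  ⊑-size-≡ [] [] h e k = refl
  ⊑-size-≡ [] (y ∷ α) h e zero = sym (m+n≡0⇒m≡0 y (sym e))
  ⊑-size-≡ [] (y ∷ α) h e (suc k) = ⊑-size-≡ [] α (λ _ → z≤n) (sym (m+n≡0⇒n≡0 y (sym e))) k
  ⊑-size-≡ (x ∷ β) [] h e zero = n≤0⇒n≡0 (h 0)
  ⊑-size-≡ (x ∷ β) [] h e (suc k) = n≤0⇒n≡0 (h (suc k))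
  ⊑-size-≡ (x ∷ β) (y ∷ α) h e k = split (≤-antisym (h 0) y≤x) k
    where
    y≤x : y ≤ x
    y≤x = lia 4 (λ x y s t → x ⊞ s ≐ y ⊞ t ⇒ s ≼ t ⇒ [ 1011 ]⊢ y ≼ x) x y (size β) (size α) e (size-mono β α (h ∘ suc))
    split : x ≡ y → pt (x ∷ β) ≗ pt (y ∷ α)
    split refl zero = refl
    split refl (suc k) = ⊑-size-≡ β α (h ∘ suc) (+-cancelˡ-≡ x _ _ e) k

  enum-ptsF : ∀ f n m → n ≤ f → Enumerates (ptsF f n m) (λ α → IsP α × size α ≡ n × pt α 0 ≤ m)
  enum-ptsF f zero m _ = enum-resp (λ { refl → tt , refl , z≤n }) (λ (p , e , _) → empty _ p e) enum-[ [] ]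
    where
    empty : ∀ α → IsP α → size α ≡ 0 → α ≡ []
    empty [] p e = refl
    empty (x ∷ α) p e = ⊥-elim (<-irrefl (sym (m+n≡0⇒m≡0 x e)) (proj₁ (IsP-head x α p)))
  enum-ptsF (suc f) (suc n) m (s≤s n≤f) = enum-resp to from
    (enum-concatMap (λ k → map (k ∷_) (ptsF f (suc n ∸ k) k)) (λ { _ _ (_ , _ , refl) (_ , _ , refl) → refl })
      (enum-fromTo 1 (m ⊓ suc n)) (λ {k} (1≤k , _) → enum-map (k ∷_) (λ { refl → refl }) (enum-ptsF f (suc n ∸ k) k (bound k 1≤k))))
    where
    bound : ∀ k → 1 ≤ k → suc n ∸ k ≤ f
    bound (suc k) _ = ≤-trans (m∸n≤m n k) n≤f
    to : ∀ {α} → ∃[ k ] ((1 ≤ k × k ≤ m ⊓ suc n) × ∃[ α′ ] ((IsP α′ × size α′ ≡ suc n ∸ k × pt α′ 0 ≤ k) × α ≡ k ∷ α′)) →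
         IsP α × size α ≡ suc n × pt α 0 ≤ m
    to (k , (1≤k , k≤) , α′ , (p , e , h) , refl) =
      IsP-∷ α′ 1≤k h p , trans (cong (k +_) e) (m+[n∸m]≡n (≤-trans k≤ (m⊓n≤n m (suc n)))) , ≤-trans k≤ (m⊓n≤m m (suc n))
    from : ∀ {α} → IsP α × size α ≡ suc n × pt α 0 ≤ m →
         ∃[ k ] ((1 ≤ k × k ≤ m ⊓ suc n) × ∃[ α′ ] ((IsP α′ × size α′ ≡ suc n ∸ k × pt α′ 0 ≤ k) × α ≡ k ∷ α′))
    from {x ∷ α} (p , e , h) = x , (proj₁ (IsP-head x α p) , ⊓-glb h (subst (x ≤_) e (m≤m+n x _))) ,
      α , (IsP-tail x α p , trans (sym (m+n∸m≡n x (size α))) (cong (_∸ x) e) , proj₂ (IsP-head x α p)) , refl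

  enum-partitionsOf : ∀ n → Enumerates (partitionsOf n) (λ α → IsP α × size α ≡ n)
  enum-partitionsOf n = enum-resp (λ (p , e , _) → p , e) (λ { {α} (p , e) → p , e , subst (pt α 0 ≤_) e (head≤ α) }) (enum-ptsF n n n ≤-refl)
    where
    head≤ : ∀ α → pt α 0 ≤ size α
    head≤ [] = z≤n
    head≤ (x ∷ α) = m≤m+n x _

  enum-subPartitions : ∀ α → Enumerates (subPartitions α) (λ β → IsP β × β ⊑ α)
  enum-subPartitions α = enum-resp
    (λ { {β} ((n , lt , p , e) , h) → p , ⊆ᵇ⇒⊑ β α h })
    (λ { {β} (p , h) → (size β , s≤s (size-mono β α h) , p , refl) , ⊑⇒⊆ᵇ β α h })
    (enum-filterB (_⊆ᵇ α) (enum-concatMap partitionsOf (λ { _ _ (_ , e) (_ , e′) → trans (sym e) e′ }) (enum-upTo (suc (size α))) (λ {n} _ → enum-partitionsOf n)))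

  -- Boxes of a skew shape

  InSkew : Part → Part → ℕ → ℕ → Set
  InSkew α β k j = pt β k < j × j ≤ pt α k

  -- reading order of rl: top to bottom, and right to left in a row
  infix 4 _≺ᵇ_ _≺ᵣ_
  _≺ᵣ_ : Box → Box → Set
  b ≺ᵣ c = row b < row c ⊎ (row b ≡ row c × col c < col b)

  _≺ᵇ_ : Box → Box → Set
  b ≺ᵇ c = row b < row c ⊎ (row b ≡ row c × col b < col c)

  rowBoxes : ℕ → ℕ → ℕ → List Box
  rowBoxes i b a = map (λ j → (i , j)) (fromTo (suc b) a)

  ∈-rowBoxes⁻ : ∀ {i b a x} → x ∈ rowBoxes i b a → row x ≡ i × b < col x × col x ≤ a
  ∈-rowBoxes⁻ {i} {b} {a} x∈ with ∈-map⁻ (λ j → (i , j)) x∈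
  ... | (j , j∈ , refl) = let (p , q) = sound (enum-fromTo (suc b) a) j∈ in refl , p , q

  ∈-rowBoxes⁺ : ∀ {i b a j} → b < j → j ≤ a → (i , j) ∈ rowBoxes i b a
  ∈-rowBoxes⁺ {i} {b} {a} p q = ∈-map⁺ (λ j → (i , j)) (complete (enum-fromTo (suc b) a) (p , q))

  InRows : ℕ → Part → Part → Box → Set
  InRows i as bs x = ∃[ k ] (row x ≡ i + k × InSkew as bs k (col x))

  -- `boxes` and `rl` differ only in the order within a row: `g` is the identity for the former and
  -- `reverse` for the latter.
  module RowWise (f : ℕ → List ℕ → List ℕ → List Box) (g : List Box → List Box)
    (f-[] : ∀ i bs → f i [] bs ≡ []) (f-∷[] : ∀ i a as → f i (a ∷ as) [] ≡ g (rowBoxes i 0 a) ++ f (suc i) as [])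
    (f-∷∷ : ∀ i a as b bs → f i (a ∷ as) (b ∷ bs) ≡ g (rowBoxes i b a) ++ f (suc i) as bs)
    (g-⁻ : ∀ {x xs} → x ∈ g xs → x ∈ xs) (g-⁺ : ∀ {x xs} → x ∈ xs → x ∈ g xs) (g-length : ∀ xs → length (g xs) ≡ length xs) where

    f-∷ : ∀ i a as bs → f i (a ∷ as) bs ≡ g (rowBoxes i (pt bs 0) a) ++ f (suc i) as (drop 1 bs)
    f-∷ i a as [] = f-∷[] i a as
    f-∷ i a as (b ∷ bs) = f-∷∷ i a as b bs

    pt-drop : ∀ bs k → pt (drop 1 bs) k ≡ pt bs (suc k)
    pt-drop [] k = refl
    pt-drop (b ∷ bs) k = refl

    ∈⁻ : ∀ i as bs {x} → x ∈ f i as bs → InRows i as bs x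
    ∈⁻ i [] bs x∈ with subst (_ ∈_) (f-[] i bs) x∈
    ... | ()
    ∈⁻ i (a ∷ as) bs x∈ with ∈-++⁻ (g (rowBoxes i (pt bs 0) a)) (subst (_ ∈_) (f-∷ i a as bs) x∈)
    ... | inj₁ h = let (e , p , q) = ∈-rowBoxes⁻ (g-⁻ h) in 0 , trans e (sym (+-identityʳ i)) , p , q
    ... | inj₂ h = let (k , e , p , q) = ∈⁻ (suc i) as (drop 1 bs) h in suc k , trans e (sym (+-suc i k)) , subst (_< _) (pt-drop bs k) p , q

    ∈⁺ : ∀ i as bs {k j} → InSkew as bs k j → (i + k , j) ∈ f i as bs
    ∈⁺ i [] bs (p , q) = ⊥-elim (<⇒≱ (≤-<-trans z≤n p) q)
    ∈⁺ i (a ∷ as) bs {zero} (p , q) = subst (_ ∈_) (sym (f-∷ i a as bs))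
      (∈-++⁺ˡ (g-⁺ (subst (λ r → (r , _) ∈ rowBoxes i (pt bs 0) a) (sym (+-identityʳ i)) (∈-rowBoxes⁺ p q))))
    ∈⁺ i (a ∷ as) bs {suc k} {j} (p , q) = subst (_ ∈_) (sym (f-∷ i a as bs)) (∈-++⁺ʳ (g (rowBoxes i (pt bs 0) a))
      (subst (λ r → (r , j) ∈ f (suc i) as (drop 1 bs)) (sym (+-suc i k)) (∈⁺ (suc i) as (drop 1 bs) {k} (subst (_< j) (sym (pt-drop bs k)) p , q))))

    length-≡ : ∀ i as bs → (∀ k → pt bs k ≤ pt as k) → length (f i as bs) + prefix (pt bs) (length as) ≡ size as
    length-≡ i [] bs h = trans (+-identityʳ _) (cong length (f-[] i bs))
    length-≡ i (a ∷ as) bs h =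
      lia 7 (λ L L₁ L₂ b P a S → L ≐ L₁ ⊞ L₂ ⇒ L₁ ⊞ b ≐ a ⇒ L₂ ⊞ P ≐ S ⇒ [ 101011 ∣ 1010101 ]⊢ L ⊞ (b ⊞ P) ≐ a ⊞ S)
        (length (f i (a ∷ as) bs)) (length (g (rowBoxes i (pt bs 0) a))) (length (f (suc i) as (drop 1 bs))) (pt bs 0)
        (prefix (pt (drop 1 bs)) (length as)) a (size as)
        (trans (cong length (f-∷ i a as bs)) (length-++ (g (rowBoxes i (pt bs 0) a))))
        (trans (cong (_+ pt bs 0) (trans (g-length _) (trans (length-map _ (fromTo (suc (pt bs 0)) a)) (trans (length-map _ (upTo (suc a ∸ suc (pt bs 0)))) (length-upTo (a ∸ pt bs 0)))))) (m∸n+n≡m (h 0)))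
        (length-≡ (suc i) as (drop 1 bs) (λ k → subst (_≤ pt as k) (sym (pt-drop bs k)) (h (suc k))))
      |> subst (λ z → length (f i (a ∷ as) bs) + z ≡ a + size as) (sym (trans (prefix-suc (pt bs) (length as)) (cong (pt bs 0 +_) (prefix-cong (λ k → sym (pt-drop bs k)) (length as)))))
      where
      infixl 0 _|>_
      _|>_ : {A B : Set} → A → (A → B) → B
      x |> f = f x

    sorted : (_≺_ : Box → Box → Set) → (∀ i b a → AllPairs _≺_ (g (rowBoxes i b a))) → (∀ {x y} → row x < row y → x ≺ y) →
             ∀ i as bs → AllPairs _≺_ (f i as bs)
    sorted _≺_ within across i [] bs = subst (AllPairs _≺_) (sym (f-[] i bs)) []
    sorted _≺_ within across i (a ∷ as) bs = subst (AllPairs _≺_) (sym (f-∷ i a as bs))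
      (AP.++⁺ (within i (pt bs 0) a) (sorted _≺_ within across (suc i) as (drop 1 bs))
        (All.tabulate (λ {x} x∈ → All.tabulate (λ {y} y∈ → across (
          let (k , e , _) = ∈⁻ (suc i) as (drop 1 bs) y∈
          in ≤-trans (s≤s (≤-reflexive (proj₁ (∈-rowBoxes⁻ (g-⁻ x∈))))) (subst (suc i ≤_) (sym e) (m≤m+n (suc i) k)))))))

  fromTo-sorted : ∀ a b → AllPairs _<_ (fromTo a b)
  fromTo-sorted a b = AP.map⁺ (AP.applyUpTo⁺₁ (λ k → k) (suc b ∸ a) (λ p _ → +-monoʳ-< a p))

  rowBoxes-sorted : ∀ i b a → AllPairs _≺ᵇ_ (rowBoxes i b a)
  rowBoxes-sorted i b a = AP.map⁺ (AllPairs.map (λ p → inj₂ (refl , p)) (fromTo-sorted (suc b) a))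

  AllPairs-reverse : ∀ {A : Set} {R : A → A → Set} (xs : List A) → AllPairs R xs → AllPairs (λ x y → R y x) (reverse xs)
  AllPairs-reverse [] [] = []
  AllPairs-reverse {R = R} (x ∷ xs) (h ∷ p) = subst (AllPairs (λ x y → R y x)) (sym (unfold-reverse x xs))
    (AP.++⁺ (AllPairs-reverse xs p) ([] ∷ []) (All.tabulate (λ y∈ → All.lookup h (reverse⁻ y∈) ∷ [])))

  private
    module B = RowWise boxesAux (λ xs → xs) (λ _ _ → refl) (λ _ _ _ → refl) (λ _ _ _ _ _ → refl) (λ x → x) (λ x → x) (λ _ → refl)
    module L = RowWise rlAux reverse (λ _ _ → refl) (λ _ _ _ → refl) (λ _ _ _ _ _ → refl) reverse⁻ reverse⁺ length-reverse

  ∈-boxes⁻ : ∀ {α β x} → x ∈ boxes α β → ∃[ k ] (row x ≡ suc k × InSkew α β k (col x))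
  ∈-boxes⁻ {α} {β} = B.∈⁻ 1 α β

  ∈-boxes⁺ : ∀ {α β k j} → InSkew α β k j → (suc k , j) ∈ boxes α β
  ∈-boxes⁺ {α} {β} = B.∈⁺ 1 α β

  ∈-rl⁻ : ∀ {α β x} → x ∈ rl α β → ∃[ k ] (row x ≡ suc k × InSkew α β k (col x))
  ∈-rl⁻ {α} {β} = L.∈⁻ 1 α β

  ∈-rl⁺ : ∀ {α β k j} → InSkew α β k j → (suc k , j) ∈ rl α β
  ∈-rl⁺ {α} {β} = L.∈⁺ 1 α β

  ≺ᵇ-irrefl : ∀ {x y} → x ≺ᵇ y → x ≢ y
  ≺ᵇ-irrefl (inj₁ p) refl = <-irrefl refl p
  ≺ᵇ-irrefl (inj₂ (_ , p)) refl = <-irrefl refl p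

  ≺ᵣ-irrefl : ∀ {x y} → x ≺ᵣ y → x ≢ y
  ≺ᵣ-irrefl (inj₁ p) refl = <-irrefl refl p
  ≺ᵣ-irrefl (inj₂ (_ , p)) refl = <-irrefl refl p

  boxes-sorted : ∀ α β → AllPairs _≺ᵇ_ (boxes α β)
  boxes-sorted α β = B.sorted _≺ᵇ_ rowBoxes-sorted inj₁ 1 α β

  rl-sorted : ∀ α β → AllPairs _≺ᵣ_ (rl α β)
  rl-sorted α β = L.sorted _≺ᵣ_ (λ i b a → AllPairs.map (λ { (inj₁ p) → ⊥-elim (<-irrefl refl p) ; (inj₂ (e , p)) → inj₂ (sym e , p) })
    (within i b a)) inj₁ 1 α β
    where
    within : ∀ i b a → AllPairs (λ x y → i < i ⊎ (row y ≡ row x × col y < col x)) (reverse (rowBoxes i b a))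
    within i b a = AllPairs-reverse (rowBoxes i b a) (AP.map⁺ (AllPairs.map (λ p → inj₂ (refl , p)) (fromTo-sorted (suc b) a)))

  boxes-unique : ∀ α β → Unique (boxes α β)
  boxes-unique α β = AllPairs.map ≺ᵇ-irrefl (boxes-sorted α β)

  rl-unique : ∀ α β → Unique (rl α β)
  rl-unique α β = AllPairs.map ≺ᵣ-irrefl (rl-sorted α β)

  IsP-⊑-length : ∀ α β → IsP β → β ⊑ α → length β ≤ length α
  IsP-⊑-length α [] p h = z≤n
  IsP-⊑-length [] (x ∷ β) p h = ⊥-elim (<⇒≱ (proj₁ (IsP-head x β p)) (h 0))
  IsP-⊑-length (y ∷ α) (x ∷ β) p h = s≤s (IsP-⊑-length α β (IsP-tail x β p) (h ∘ suc))

  length-boxes : ∀ α β → IsP β → β ⊑ α → length (boxes α β) + size β ≡ size α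
  length-boxes α β p h = trans (cong (length (boxes α β) +_) (sym (prefix-pt β (length α) (IsP-⊑-length α β p h)))) (B.length-≡ 1 α β h)

  length-rl : ∀ α β → IsP β → β ⊑ α → length (rl α β) + size β ≡ size α
  length-rl α β p h = trans (cong (length (rl α β) +_) (sym (prefix-pt β (length α) (IsP-⊑-length α β p h)))) (L.length-≡ 1 α β h)

-- Pictures between skew shapes and the chains of shapes that they define.

module Picture where

  open Linear using (∧-T; lia; K; _⊞_; _≼_; _≺_; _≐_; _⇒_; [_]⊢_; [_∣_]⊢_)
  open Step using (Fn; prefix; HStrip)
  open Compat using (Compatible; dam)
  open Chain using (_≗_; Filling; start; end; strip; total; flag; strict)
  open Enum
  open Shape

  pigeonhole : ∀ {A : Set} (xs ys : List A) → Unique xs → (∀ {x} → x ∈ xs → x ∈ ys) → length xs ≤ length ys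
  pigeonhole [] ys u h = z≤n
  pigeonhole (x ∷ xs) ys (n ∷ u) h with ∈-∃++ (h (here refl))
  ... | (l , r , refl) = subst (suc (length xs) ≤_) (sym (trans (length-++ l) (trans (+-suc (length l) (length r)) (cong suc (sym (length-++ l))))))
    (s≤s (pigeonhole xs (l ++ r) u other))
    where
    other : ∀ {y} → y ∈ xs → y ∈ l ++ r
    other y∈ with ∈-++⁻ l (h (there y∈))
    ... | inj₁ p = ∈-++⁺ˡ p
    ... | inj₂ (here refl) = ⊥-elim (All.lookup n y∈ refl)
    ... | inj₂ (there p) = ∈-++⁺ʳ l p

  length-fromTo : ∀ a b → length (fromTo a b) ≡ suc b ∸ a
  length-fromTo a b = trans (length-map (a +_) (upTo (suc b ∸ a))) (length-upTo (suc b ∸ a))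

  -- Pigeonhole against intervals starting at `suc b`, once in each direction. This is what turns
  -- the number of boxes found in a row into the length of that row.
  initial-segment : ∀ (D : List ℕ) b → Unique D → (∀ {l} → l ∈ D → b < l) → (∀ {l} → l ∈ D → ∀ {l′} → b < l′ → l′ < l → l′ ∈ D) →
    (∀ {l} → l ∈ D → l ≤ b + length D) × (∀ {l} → b < l → l ≤ b + length D → l ∈ D)
  initial-segment D b u lo down = upper , full
    where
    upper : ∀ {l} → l ∈ D → l ≤ b + length D
    upper {l} l∈ = m∸n≤o⇒m≤n+o′ (subst (_≤ length D) (length-fromTo (suc b) l) (pigeonhole (fromTo (suc b) l) D (unique (enum-fromTo (suc b) l)) inside))
      where
      m∸n≤o⇒m≤n+o′ : l ∸ b ≤ length D → l ≤ b + length D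
      m∸n≤o⇒m≤n+o′ h = ≤-trans (m≤n+m∸n l b) (+-monoʳ-≤ b h)
      inside : ∀ {x} → x ∈ fromTo (suc b) l → x ∈ D
      inside x∈ with sound (enum-fromTo (suc b) l) x∈
      ... | (p , q) with m≤n⇒m<n∨m≡n q
      ... | inj₁ lt = down l∈ p lt
      ... | inj₂ refl = l∈
    full : ∀ {l} → b < l → l ≤ b + length D → l ∈ D
    full {zero} () h
    full {suc l} p h with suc l ∈? D
    ... | yes l∈ = l∈
    ... | no l∉ = ⊥-elim (<⇒≱ (s≤s (subst (λ n → b + length D ≤ b + n) (length-fromTo (suc b) l)
          (+-monoʳ-≤ b (pigeonhole D (fromTo (suc b) l) u (λ x∈ → complete (enum-fromTo (suc b) l) (lo x∈ , small x∈))))))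
          (subst (_≤ b + length D) (cong suc (sym (m+[n∸m]≡n (≤-pred p)))) h))
      where
      small : ∀ {x} → x ∈ D → x ≤ l
      small {x} x∈ with <-≤-connex x (suc l)
      ... | inj₁ lt = ≤-pred lt
      ... | inj₂ ge with m≤n⇒m<n∨m≡n ge
      ... | inj₁ gt = ⊥-elim (l∉ (down x∈ p gt))
      ... | inj₂ refl = ⊥-elim (l∉ x∈)

  cnt : {A : Set} → (A → Bool) → List A → ℕ
  cnt p zs = length (filterB p zs)

  ind : Bool → ℕ
  ind true = 1
  ind false = 0

  cnt-∷ : ∀ {A : Set} (p : A → Bool) z zs → cnt p (z ∷ zs) ≡ ind (p z) + cnt p zs
  cnt-∷ p z zs with p z
  ... | true = refl
  ... | false = refl

  unique-map-on : ∀ {A B : Set} (f : A → B) (xs : List A) → Unique xs → (∀ {x y} → x ∈ xs → y ∈ xs → f x ≡ f y → x ≡ y) → Unique (map f xs)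
  unique-map-on f [] u h = []
  unique-map-on f (x ∷ xs) (n ∷ u) h =
    All.tabulate (λ y∈ e → let (z , z∈ , e′) = ∈-map⁻ f y∈ in All.lookup n z∈ (h (here refl) (there z∈) (trans e e′)))
    ∷ unique-map-on f xs u (λ p q → h (there p) (there q))

  module _ {A : Set} (p : A → Bool) (h : A → ℕ) (b : ℕ) (zs : List A) (u : Unique zs)
           (inj : ∀ {x y} → x ∈ zs → y ∈ zs → T (p x) → T (p y) → h x ≡ h y → x ≡ y)
           (lo : ∀ {x} → x ∈ zs → T (p x) → b < h x)
           (down : ∀ {x} → x ∈ zs → T (p x) → ∀ {l} → b < l → l < h x → ∃[ y ] (y ∈ zs × T (p y) × h y ≡ l)) where

    private
      D = map h (filterB p zs)
      from : ∀ {l} → l ∈ D → ∃[ x ] (x ∈ zs × T (p x) × l ≡ h x)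
      from l∈ = let (x , x∈ , e) = ∈-map⁻ h l∈ ; (a , c) = ∈-filterB⁻ p zs x∈ in x , a , c , e
      to : ∀ {x} → x ∈ zs → T (p x) → h x ∈ D
      to x∈ t = ∈-map⁺ h (∈-filterB⁺ p zs x∈ t)
      seg = initial-segment D b
        (unique-map-on h (filterB p zs) (unique-filterB p u) (λ x∈ y∈ e → let (a , c) = ∈-filterB⁻ p zs x∈ ; (a′ , c′) = ∈-filterB⁻ p zs y∈ in inj a a′ c c′ e))
        (λ l∈ → let (x , x∈ , t , e) = from l∈ in subst (b <_) (sym e) (lo x∈ t))
        (λ l∈ lt lt′ → let (x , x∈ , t , e) = from l∈ ; (y , y∈ , t′ , e′) = down x∈ t lt (subst (_ <_) e lt′) in subst (_∈ D) e′ (to y∈ t′))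
      len = length-map h (filterB p zs)

    cnt-upper : ∀ {x} → x ∈ zs → T (p x) → h x ≤ b + cnt p zs
    cnt-upper x∈ t = subst (λ n → _ ≤ b + n) len (proj₁ seg (to x∈ t))

    cnt-full : ∀ {l} → b < l → l ≤ b + cnt p zs → ∃[ x ] (x ∈ zs × T (p x) × l ≡ h x)
    cnt-full lt le = from (proj₂ seg lt (subst (λ n → _ ≤ b + n) (sym len) le))

  -- Pictures: A i j k l says that box j of row i of α/β goes to box l of row k of γ/δ.

  Before : ℕ → ℕ → ℕ → ℕ → Set
  Before i j i′ j′ = i < i′ ⊎ (i ≡ i′ × j′ < j)

  Before-trans : ∀ {i j i′ j′ i″ j″} → Before i j i′ j′ → Before i′ j′ i″ j″ → Before i j i″ j″
  Before-trans (inj₁ p) (inj₁ q) = inj₁ (<-trans p q)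
  Before-trans (inj₁ p) (inj₂ (refl , _)) = inj₁ p
  Before-trans (inj₂ (refl , _)) (inj₁ q) = inj₁ q
  Before-trans (inj₂ (refl , p)) (inj₂ (refl , q)) = inj₂ (refl , <-trans q p)

  Before-≤ : ∀ {i j i′ j′} → Before i j i′ j′ → i ≤ i′
  Before-≤ (inj₁ p) = <⇒≤ p
  Before-≤ (inj₂ (refl , _)) = ≤-refl

  -- A tableau in `RW` is a picture in Zelevinsky's sense. `right` and `down` say that its labels,
  -- ordered as the boxes of `rl α β`, increase along the rows and columns of γ/δ; `rowwise` and
  -- `colwise` are the two conditions that define `RW`.
  record Picture (α β γ δ : Part) (A : ℕ → ℕ → ℕ → ℕ → Set) : Set where
    field
      source : ∀ {i j k l} → A i j k l → InSkew α β i j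
      target : ∀ {i j k l} → A i j k l → InSkew γ δ k l
      image  : ∀ {i j} → InSkew α β i j → ∃[ k ] ∃[ l ] A i j k l
      origin : ∀ {k l} → InSkew γ δ k l → ∃[ i ] ∃[ j ] A i j k l
      functional : ∀ {i j k l k′ l′} → A i j k l → A i j k′ l′ → k ≡ k′ × l ≡ l′
      injective  : ∀ {i j i′ j′ k l} → A i j k l → A i′ j′ k l → i ≡ i′ × j ≡ j′
      right : ∀ {i j i′ j′ k l} → A i j k l → A i′ j′ k (suc l) → Before i j i′ j′
      down  : ∀ {i j i′ j′ k l} → A i j k l → A i′ j′ (suc k) l → Before i j i′ j′
      rowwise : ∀ {i j j′ k l k′ l′} → A i j k l → A i j′ k′ l′ → j′ < j → l < l′ × k′ ≤ k
      colwise : ∀ {i j k l k′ l′} → A i j k l → A (suc i) j k′ l′ → k < k′ × l′ ≤ l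

  module Rows {α β γ δ A} (P : Picture α β γ δ A) where
    open Picture P

    right⁺ : ∀ {i j i′ j′ k l} d → A i j k l → A i′ j′ k (suc d + l) → Before i j i′ j′
    right⁺ zero a a′ = right a a′
    right⁺ {k = k} {l} (suc d) a a′ with origin {k} {suc d + l} (<-≤-trans (proj₁ (target a)) (m≤n+m l (suc d)) , ≤-trans (n≤1+n _) (proj₂ (target a′)))
    ... | (_ , _ , b) = Before-trans (right⁺ d a b) (right b a′)

    right-< : ∀ {i j i′ j′ k l l′} → l < l′ → A i j k l → A i′ j′ k l′ → Before i j i′ j′
    right-< {l = l} {l′} lt a a′ = right⁺ (l′ ∸ suc l) a (subst (λ x → A _ _ _ x) (sym (trans (sym (+-suc (l′ ∸ suc l) l)) (m∸n+n≡m lt))) a′)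

  At : List (Box × Box) → ℕ → ℕ → ℕ → ℕ → Set
  At Z i j k l = ((suc i , j) , (suc k , l)) ∈ Z

  dam-blocks : ∀ ρ i b k → ρ + i ≤ b + k → k < dam ρ i b → ⊥
  dam-blocks ρ i b k le lt = <⇒≱ lt (m≤n+o⇒m∸n≤o (ρ + i) b le)

  module Counting {α β γ δ : Part} (Z : List (Box × Box)) (uZ : Unique Z)
                  (suc-form : ∀ {z} → z ∈ Z → ∃[ i ] ∃[ j ] ∃[ k ] ∃[ l ] z ≡ ((suc i , j) , (suc k , l)))
                  (pα : IsP α) (pβ : IsP β) (pγ : IsP γ) (pδ : IsP δ) (β⊑α : β ⊑ α) (δ⊑γ : δ ⊑ γ)
                  (P : Picture α β γ δ (At Z)) where
    open Picture P
    open Rows P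

    early : ℕ → ℕ → Box × Box → Bool
    early i k (b , x) = (row b ≤ᵇ i) ∧ (row x ≡ᵇ suc k)

    small : ℕ → ℕ → Box × Box → Bool
    small i k (b , x) = (row b ≡ᵇ suc i) ∧ (row x ≤ᵇ k)

    Λ : ℕ → Fn
    Λ i k = pt δ k + cnt (early i k) Z

    -- Let the entry of a box be the row of its image. By `rowwise` the entries of row `i` increase
    -- weakly from left to right, so the columns up to `M i k` are those of the inner shape and
    -- those with entries below `k`.
    M : ℕ → ℕ → ℕ
    M i k = pt β i + cnt (small i k) Z

    T-early : ∀ i k i₀ k₀ → T ((suc i₀ ≤ᵇ i) ∧ (k₀ ≡ᵇ k)) → i₀ < i × k₀ ≡ k
    T-early i k i₀ k₀ t = let (p , q) = ∧-T {suc i₀ ≤ᵇ i} t in ≤ᵇ⇒≤ (suc i₀) i p , ≡ᵇ⇒≡ k₀ k q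

    early-T : ∀ i k i₀ k₀ → i₀ < i → k₀ ≡ k → T ((suc i₀ ≤ᵇ i) ∧ (k₀ ≡ᵇ k))
    early-T i k i₀ k₀ p q = ∧-T⁺ {suc i₀ ≤ᵇ i} (≤⇒≤ᵇ p) (≡⇒≡ᵇ k₀ k q)

    T-small : ∀ i k i₀ k₀ → T ((i₀ ≡ᵇ i) ∧ (suc k₀ ≤ᵇ k)) → i₀ ≡ i × k₀ < k
    T-small i k i₀ k₀ t = let (p , q) = ∧-T {i₀ ≡ᵇ i} t in ≡ᵇ⇒≡ i₀ i p , ≤ᵇ⇒≤ (suc k₀) k q

    small-T : ∀ i k i₀ k₀ → i₀ ≡ i → k₀ < k → T ((i₀ ≡ᵇ i) ∧ (suc k₀ ≤ᵇ k))
    small-T i k i₀ k₀ p q = ∧-T⁺ {i₀ ≡ᵇ i} (≡⇒≡ᵇ i₀ i p) (≤⇒≤ᵇ q)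

    private
      module E (i k : ℕ) where
        inj : ∀ {x y} → x ∈ Z → y ∈ Z → T (early i k x) → T (early i k y) → col (proj₂ x) ≡ col (proj₂ y) → x ≡ y
        inj x∈ y∈ t t′ e with suc-form x∈ | suc-form y∈
        ... | (i₁ , _ , k₁ , _ , refl) | (i₂ , _ , k₂ , _ , refl) with T-early i k i₁ k₁ t | T-early i k i₂ k₂ t′ | e
        ... | (_ , refl) | (_ , refl) | refl with injective x∈ y∈
        ... | (refl , refl) = refl
        lo : ∀ {x} → x ∈ Z → T (early i k x) → pt δ k < col (proj₂ x)
        lo x∈ t with suc-form x∈
        ... | (i₁ , _ , k₁ , _ , refl) with T-early i k i₁ k₁ t
        ... | (_ , refl) = proj₁ (target x∈)
        dn : ∀ {x} → x ∈ Z → T (early i k x) → ∀ {l} → pt δ k < l → l < col (proj₂ x) → ∃[ y ] (y ∈ Z × T (early i k y) × col (proj₂ y) ≡ l)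
        dn x∈ t {l} p q with suc-form x∈
        ... | (i₁ , _ , k₁ , _ , refl) with T-early i k i₁ k₁ t
        ... | (i₁<i , refl) with origin {k} {l} (p , ≤-trans (<⇒≤ q) (proj₂ (target x∈)))
        ... | (i₂ , j₂ , a) = _ , a , early-T i k i₂ k (≤-<-trans (Before-≤ (right-< q a x∈)) i₁<i) refl , refl

      module S (i k : ℕ) where
        inj : ∀ {x y} → x ∈ Z → y ∈ Z → T (small i k x) → T (small i k y) → col (proj₁ x) ≡ col (proj₁ y) → x ≡ y
        inj x∈ y∈ t t′ e with suc-form x∈ | suc-form y∈
        ... | (i₁ , _ , k₁ , _ , refl) | (i₂ , _ , k₂ , _ , refl) with T-small i k i₁ k₁ t | T-small i k i₂ k₂ t′ | e
        ... | (refl , _) | (refl , _) | refl with functional x∈ y∈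
        ... | (refl , refl) = refl
        lo : ∀ {x} → x ∈ Z → T (small i k x) → pt β i < col (proj₁ x)
        lo x∈ t with suc-form x∈
        ... | (i₁ , _ , k₁ , _ , refl) with T-small i k i₁ k₁ t
        ... | (refl , _) = proj₁ (source x∈)
        dn : ∀ {x} → x ∈ Z → T (small i k x) → ∀ {j} → pt β i < j → j < col (proj₁ x) → ∃[ y ] (y ∈ Z × T (small i k y) × col (proj₁ y) ≡ j)
        dn x∈ t {j} p q with suc-form x∈
        ... | (i₁ , _ , k₁ , _ , refl) with T-small i k i₁ k₁ t
        ... | (refl , k₁<k) with image {i} {j} (p , ≤-trans (<⇒≤ q) (proj₂ (source x∈)))
        ... | (k₂ , l₂ , a) = _ , a , small-T i k i k₂ refl (≤-<-trans (proj₂ (rowwise x∈ a q)) k₁<k) , refl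

    -- Λ i is the shape of δ together with the images of the first i rows
    Λ-⁺ : ∀ {i i₀ j k l} → At Z i₀ j k l → i₀ < i → l ≤ Λ i k
    Λ-⁺ {i} {k = k} a p = cnt-upper (early i k) (col ∘ proj₂) (pt δ k) Z uZ (E.inj i k) (E.lo i k) (E.dn i k) a (early-T i k _ k p refl)

    Λ-⁻ : ∀ i {k l} → pt δ k < l → l ≤ Λ i k → ∃[ i₀ ] ∃[ j ] (At Z i₀ j k l × i₀ < i)
    Λ-⁻ i {k} p q with cnt-full (early i k) (col ∘ proj₂) (pt δ k) Z uZ (E.inj i k) (E.lo i k) (E.dn i k) p q
    ... | (_ , x∈ , t , e) with suc-form x∈
    ... | (i₁ , j , k₁ , _ , refl) with T-early i k i₁ k₁ t | e
    ... | (lt , refl) | refl = i₁ , j , x∈ , lt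

    M-⁺ : ∀ {i j k k₀ l} → At Z i j k₀ l → k₀ < k → j ≤ M i k
    M-⁺ {i} {k = k} a p = cnt-upper (small i k) (col ∘ proj₁) (pt β i) Z uZ (S.inj i k) (S.lo i k) (S.dn i k) a (small-T i k i _ refl p)

    M-⁻ : ∀ {i j} k → pt β i < j → j ≤ M i k → ∃[ k₀ ] ∃[ l ] (At Z i j k₀ l × k₀ < k)
    M-⁻ {i} k p q with cnt-full (small i k) (col ∘ proj₁) (pt β i) Z uZ (S.inj i k) (S.lo i k) (S.dn i k) p q
    ... | (_ , x∈ , t , e) with suc-form x∈
    ... | (i₁ , _ , k₁ , l , refl) with T-small i k i₁ k₁ t | e
    ... | (refl , lt) | refl = k₁ , l , x∈ , lt

    -- counting the entries < n of row i in two ways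
    prefix-Λ : ∀ i n → pt β i + prefix (Λ (suc i)) n ≡ M i n + prefix (Λ i) n
    prefix-Λ i n = lia 6 (λ b d x y m t → x ≐ d ⊞ t ⊞ m ⇒ y ≐ d ⊞ t ⇒ [ 1101 ∣ 10011 ]⊢ b ⊞ x ≐ b ⊞ m ⊞ y)
      (pt β i) (prefix (pt δ) n) (prefix (Λ (suc i)) n) (prefix (Λ i) n) (cnt (small i n) Z) (prefix (λ k → cnt (early i k) Z) n)
      (trans (prefix-+ (pt δ) _ n) (trans (cong (prefix (pt δ) n +_) (double Z suc-form)) (sym (+-assoc (prefix (pt δ) n) _ _)))) (prefix-+ (pt δ) _ n)
      where
      prefix-+ : ∀ f g n → prefix (λ k → f k + g k) n ≡ prefix f n + prefix g n
      prefix-+ f g zero = refl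
      prefix-+ f g (suc n) = lia 5 (λ p q r a b → p ≐ q ⊞ r ⇒ [ 11 ∣ 101 ]⊢ p ⊞ (a ⊞ b) ≐ q ⊞ a ⊞ (r ⊞ b)) (prefix (λ k → f k + g k) n) (prefix f n) (prefix g n) (f n) (g n) (prefix-+ f g n)
      prefix-0 : ∀ n → prefix (λ _ → 0) n ≡ 0
      prefix-0 zero = refl
      prefix-0 (suc n) = trans (+-identityʳ _) (prefix-0 n)
      ind-step : ∀ i i₀ c → ind ((suc i₀ ≤ᵇ suc i) ∧ c) ≡ ind ((suc i₀ ≤ᵇ i) ∧ c) + ind ((i₀ ≡ᵇ i) ∧ c)
      ind-step zero zero c = refl
      ind-step zero (suc i₀) c = refl
      ind-step (suc i) zero true = refl
      ind-step (suc i) zero false = refl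
      ind-step (suc i) (suc i₀) c = ind-step i i₀ c
      last : ∀ k n → ind (suc k ≤ᵇ n) + ind (k ≡ᵇ n) ≡ ind (suc k ≤ᵇ suc n)
      last zero zero = refl
      last zero (suc n) = refl
      last (suc k) zero = refl
      last (suc k) (suc n) = last k n
      one : ∀ c k n → prefix (λ k′ → ind (c ∧ (k ≡ᵇ k′))) n ≡ ind (c ∧ (suc k ≤ᵇ n))
      one false k zero = refl
      one false k (suc n) = trans (+-identityʳ _) (trans (one false k n) refl)
      one true k zero = refl
      one true k (suc n) = trans (cong (_+ ind (k ≡ᵇ n)) (one true k n)) (last k n)
      double : ∀ Z → (∀ {z} → z ∈ Z → ∃[ i ] ∃[ j ] ∃[ k ] ∃[ l ] z ≡ ((suc i , j) , (suc k , l))) →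
               prefix (λ k → cnt (early (suc i) k) Z) n ≡ prefix (λ k → cnt (early i k) Z) n + cnt (small i n) Z
      double [] h = trans (prefix-0 n) (sym (trans (+-identityʳ _) (prefix-0 n)))
      double (z ∷ Z) h with h (here refl)
      ... | (i₀ , j , k₀ , l , refl) = lia 9 (λ a b c x y z′ u v w → a ≐ x ⊞ u ⇒ b ≐ y ⊞ v ⇒ c ≐ z′ ⊞ w ⇒ u ≐ v ⊞ w ⇒ x ≐ y ⊞ z′ ⇒ [ 1101001011 ∣ 10010110101 ]⊢ a ≐ b ⊞ c)
        (prefix (λ k → cnt (early (suc i) k) (z₀ ∷ Z)) n) (prefix (λ k → cnt (early i k) (z₀ ∷ Z)) n) (cnt (small i n) (z₀ ∷ Z))
        (prefix (λ k → ind (early (suc i) k z₀)) n) (prefix (λ k → ind (early i k z₀)) n) (ind (small i n z₀))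
        (prefix (λ k → cnt (early (suc i) k) Z) n) (prefix (λ k → cnt (early i k) Z) n) (cnt (small i n) Z)
        (trans (prefix-cong (λ k → cnt-∷ (early (suc i) k) z₀ Z) n) (prefix-+ _ _ n))
        (trans (prefix-cong (λ k → cnt-∷ (early i k) z₀ Z) n) (prefix-+ _ _ n)) (cnt-∷ (small i n) z₀ Z) (double Z (h ∘ there))
        (trans (one (suc i₀ ≤ᵇ suc i) k₀ n) (trans (ind-step i i₀ (suc k₀ ≤ᵇ n)) (cong (_+ ind ((i₀ ≡ᵇ i) ∧ (suc k₀ ≤ᵇ n))) (sym (one (suc i₀ ≤ᵇ i) k₀ n)))))
        where z₀ = ((suc i₀ , j) , (suc k₀ , l))

    Λ-lo : ∀ i k → pt δ k ≤ Λ i k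
    Λ-lo i k = m≤m+n _ _

    Λ-hi : ∀ i k → Λ i k ≤ pt γ k
    Λ-hi i k with <-≤-connex (pt δ k) (Λ i k)
    ... | inj₂ h = ≤-trans h (δ⊑γ k)
    ... | inj₁ h with Λ-⁻ i h ≤-refl
    ... | (_ , _ , a , _) = proj₂ (target a)

    Λ-mono : ∀ i k → Λ i k ≤ Λ (suc i) k
    Λ-mono i k with <-≤-connex (pt δ k) (Λ i k)
    ... | inj₂ h = ≤-trans h (Λ-lo (suc i) k)
    ... | inj₁ h with Λ-⁻ i h ≤-refl
    ... | (_ , _ , a , p) = Λ-⁺ a (m≤n⇒m≤1+n p)

    M-hi : ∀ i k → M i k ≤ pt α i
    M-hi i k with <-≤-connex (pt β i) (M i k)
    ... | inj₂ h = ≤-trans h (β⊑α i)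
    ... | inj₁ h with M-⁻ k h ≤-refl
    ... | (_ , _ , a , _) = proj₂ (source a)

    inside : ∀ α k {j} → 0 < j → j ≤ pt α k → k < length α
    inside α k p q with <-≤-connex k (length α)
    ... | inj₁ h = h
    ... | inj₂ h = ⊥-elim (<⇒≱ p (subst (_ ≤_) (pt-vanish α k h) q))

    M-end : ∀ i n → length γ ≤ n → M i n ≡ pt α i
    M-end i n h = ≤-antisym (M-hi i n) lower
      where
      lower : pt α i ≤ M i n
      lower with <-≤-connex (pt β i) (pt α i)
      ... | inj₂ le = ≤-trans le (m≤m+n _ _)
      ... | inj₁ lt with image {i} {pt α i} (lt , ≤-refl)
      ... | (k , l , a) = M-⁺ a (<-≤-trans (inside γ k (≤-<-trans z≤n (proj₁ (target a))) (proj₂ (target a))) h)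

    -- The box above a box of row `suc k` is read earlier. It cannot stem from the same row of α/β,
    -- because reading a row from right to left never leads to a larger entry; so it was present one
    -- step before.
    Λ-strip : ∀ i → HStrip (Λ i) (Λ (suc i))
    Λ-strip i k = Λ-mono i k , upper
      where
      upper : Λ (suc i) (suc k) ≤ Λ i k
      upper with <-≤-connex (pt δ k) (Λ (suc i) (suc k))
      ... | inj₂ h = ≤-trans h (Λ-lo i k)
      ... | inj₁ h with Λ-⁻ (suc i) {suc k} (≤-<-trans (pt-dec δ pδ k) h) ≤-refl
      ... | (i₁ , j₁ , a , lt) with origin {k} {Λ (suc i) (suc k)} (h , ≤-trans (Λ-hi (suc i) (suc k)) (pt-dec γ pγ k))
      ... | (i₀ , j₀ , b) with down b a
      ... | inj₁ p = Λ-⁺ b (<-≤-trans p (≤-pred lt))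
      ... | inj₂ (refl , p) = ⊥-elim (1+n≰n (proj₂ (rowwise b a p)))

    -- In terms of `M` this is `M (suc i) (suc k) ≤ M i k`: the box above an entry at most `k` has
    -- an entry below `k`, by `colwise`.
    compatible : ∀ i k → Compatible (pt β i) (pt β (suc i)) (Λ i) (Λ (suc i)) (Λ (suc (suc i))) k
    compatible i k = lia 8 (λ b b⁺ p₀ p₁ p₁⁺ p₂ m m⁺ → b ⊞ p₁ ≐ m ⊞ p₀ ⇒ b⁺ ⊞ p₂ ≐ m⁺ ⊞ p₁⁺ ⇒ m⁺ ≼ m ⇒ [ 100111 ]⊢ b⁺ ⊞ p₂ ⊞ p₀ ≼ b ⊞ p₁ ⊞ p₁⁺)
      (pt β i) (pt β (suc i)) (prefix (Λ i) k) (prefix (Λ (suc i)) k) (prefix (Λ (suc i)) (suc k)) (prefix (Λ (suc (suc i))) (suc k)) (M i k) (M (suc i) (suc k))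
      (prefix-Λ i k) (prefix-Λ (suc i) (suc k)) lower
      where
      lower : M (suc i) (suc k) ≤ M i k
      lower with <-≤-connex (pt β i) (M (suc i) (suc k))
      ... | inj₂ h = ≤-trans h (m≤m+n _ _)
      ... | inj₁ h with M-⁻ {suc i} (suc k) (≤-<-trans (pt-dec β pβ i) h) ≤-refl
      ... | (k₁ , l₁ , a , lt) with image {i} {M (suc i) (suc k)} (h , ≤-trans (M-hi (suc i) (suc k)) (pt-dec α pα i))
      ... | (k₀ , l₀ , b) = M-⁺ b (<-≤-trans (proj₁ (colwise b a)) (≤-pred lt))

    Λ-first : ∀ k → Λ 0 k ≤ pt δ k
    Λ-first k with <-≤-connex (pt δ k) (Λ 0 k)
    ... | inj₂ h = h
    ... | inj₁ h with Λ-⁻ 0 h ≤-refl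
    ... | (_ , _ , _ , ())

    Λ-last : ∀ i → length α ≤ i → ∀ k → pt γ k ≤ Λ i k
    Λ-last i h k with <-≤-connex (pt δ k) (pt γ k)
    ... | inj₂ le = ≤-trans le (Λ-lo i k)
    ... | inj₁ lt with origin {k} {pt γ k} (lt , ≤-refl)
    ... | (i₀ , j , a) = Λ-⁺ a (<-≤-trans (inside α i₀ (≤-<-trans z≤n (proj₁ (source a))) (proj₂ (source a))) h)

    Λ-new : ∀ i k → Λ i k < Λ (suc i) k → ∃[ j ] ∃[ l ] At Z i j k l
    Λ-new i k lt with Λ-⁻ (suc i) (≤-<-trans (Λ-lo i k) lt) ≤-refl
    ... | (i₀ , j , a , i₀<) with m≤n⇒m<n∨m≡n (≤-pred i₀<)
    ... | inj₁ i₀<i = ⊥-elim (<⇒≱ lt (Λ-⁺ a i₀<i))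
    ... | inj₂ refl = j , _ , a

    FlagRule : ℕ → Set
    FlagRule ρ = ∀ {i j k l} → At Z i j k l → ρ + suc i ≤ k + j

    -- the leftmost entry of a row is the smallest one and has the strictest flag
    leftmost-flag : ∀ ρ → FlagRule ρ → ∀ {i j k l} → At Z i j k l → ρ + i ≤ pt β i + k
    leftmost-flag ρ rule {i} {j} {k} a with m≤n⇒m<n∨m≡n (proj₁ (source a))
    ... | inj₂ e = lia 5 (λ ρ i k b j → ρ ⊞ (K 1 ⊞ i) ≼ k ⊞ j ⇒ K 1 ⊞ b ≐ j ⇒ [ 1101 ]⊢ ρ ⊞ i ≼ b ⊞ k) ρ i k (pt β i) j (rule a) e
    ... | inj₁ lt with image {i} {suc (pt β i)} (≤-refl , ≤-trans (<⇒≤ lt) (proj₂ (source a)))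
    ... | (k₀ , _ , b) = lia 5 (λ ρ i k b k₀ → ρ ⊞ (K 1 ⊞ i) ≼ k₀ ⊞ (K 1 ⊞ b) ⇒ k₀ ≼ k ⇒ [ 111 ]⊢ ρ ⊞ i ≼ b ⊞ k) ρ i k (pt β i) k₀ (rule b) (proj₂ (rowwise a b lt))

    Λ-idle : ∀ i k → (∀ j l → At Z i j k l → ⊥) → Λ (suc i) k ≡ Λ i k
    Λ-idle i k h = ≤-antisym (≮⇒≥ (λ lt → let (j , l , a) = Λ-new i k lt in h j l a)) (Λ-mono i k)

    Λ-flag : ∀ ρ → FlagRule ρ → ∀ i k → k < dam ρ i (pt β i) → Λ (suc i) k ≡ Λ i k
    Λ-flag ρ rule i k h = Λ-idle i k (λ j l a → dam-blocks ρ i (pt β i) k (leftmost-flag ρ rule a) h)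

    filling : ∀ ρ → FlagRule ρ → Filling ρ (length α) (pt α) (pt β) (pt δ) (pt γ) Λ
    filling ρ rule = record
      { start = λ k → ≤-antisym (Λ-first k) (Λ-lo 0 k)
      ; end = λ i h k → ≤-antisym (Λ-hi i k) (Λ-last i h k)
      ; strip = Λ-strip
      ; total = λ i → length γ , λ n h → trans (prefix-Λ i n) (cong (_+ prefix (Λ i) n) (M-end i n h))
      ; flag = Λ-flag ρ rule
      ; strict = compatible }

    M-between : ∀ {i j k l} → At Z i j k l → M i k < j × j ≤ M i (suc k)
    M-between {i} {j} {k} a = lower , M-⁺ a ≤-refl
      where
      lower : M i k < j
      lower with <-≤-connex (M i k) j
      ... | inj₁ h = h
      ... | inj₂ h with M-⁻ k (proj₁ (source a)) h
      ... | (k₀ , _ , b , lt) = ⊥-elim (<-irrefl (sym (proj₁ (functional a b))) lt)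

    Λ-between : ∀ {i j k l} → At Z i j k l → Λ i k < l × l ≤ Λ (suc i) k
    Λ-between {i} {j} {k} {l} a = lower , Λ-⁺ a ≤-refl
      where
      lower : Λ i k < l
      lower with <-≤-connex (Λ i k) l
      ... | inj₁ h = h
      ... | inj₂ h with Λ-⁻ i (proj₁ (target a)) h
      ... | (i₀ , _ , b , lt) = ⊥-elim (<-irrefl (sym (proj₁ (injective a b))) lt)

    M-letter : ∀ {i j} k → M i k < j → j ≤ M i (suc k) → ∃[ l ] At Z i j k l
    M-letter {i} {j} k p q with M-⁻ (suc k) (≤-<-trans (m≤m+n (pt β i) _) p) q
    ... | (k₀ , l , a , lt) with m≤n⇒m<n∨m≡n (≤-pred lt)
    ... | inj₁ k₀<k = ⊥-elim (<⇒≱ p (M-⁺ a k₀<k))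
    ... | inj₂ refl = l , a

    -- Induction from the left end of the block of entries `k` in row `i`: one column to the left
    -- means at least one column to the right in the image. The opposite estimate starts from the
    -- right end, and the two meet because by `M-Λ` the block is as long as the set of new boxes in
    -- row `k`.
    placement-≤ : ∀ d {i j k l} → At Z i j k l → j ≡ d + suc (M i k) → l + j ≤ suc (Λ (suc i) k) + M i k
    placement-≤ zero {i} {j} {k} {l} a e = lia 4 (λ l x m j → l ≼ x ⇒ j ≐ K 1 ⊞ m ⇒ [ 1011 ]⊢ l ⊞ j ≼ K 1 ⊞ x ⊞ m) l (Λ (suc i) k) (M i k) j (proj₂ (Λ-between a)) e
    placement-≤ (suc d) {i} {zero} a ()
    placement-≤ (suc d) {i} {suc j} {k} {l} a e =
      let e′ = suc-injective e
          (l′ , b) = M-letter {i} {j} k (subst (M i k <_) (sym e′) (m≤n+m (suc (M i k)) d)) (≤-trans (n≤1+n _) (proj₂ (M-between a)))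
      in lia 5 (λ l l′ j x m → l ≺ l′ ⇒ l′ ⊞ j ≼ K 1 ⊞ x ⊞ m ⇒ [ 111 ]⊢ l ⊞ (K 1 ⊞ j) ≼ K 1 ⊞ x ⊞ m)
        l l′ j (Λ (suc i) k) (M i k) (proj₁ (rowwise a b (n<1+n j))) (placement-≤ d b e′)

    placement-≥ : ∀ d {i j k l} → At Z i j k l → d + j ≡ M i (suc k) → suc (Λ i k + M i (suc k)) ≤ l + j
    placement-≥ zero {i} {j} {k} {l} a e = lia 4 (λ x l j m → x ≺ l ⇒ j ≐ m ⇒ [ 1101 ]⊢ K 1 ⊞ (x ⊞ m) ≼ l ⊞ j) (Λ i k) l j (M i (suc k)) (proj₁ (Λ-between a)) e
    placement-≥ (suc d) {i} {j} {k} {l} a e =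
      let (l′ , b) = M-letter {i} {suc j} k (m≤n⇒m≤1+n (proj₁ (M-between a))) (subst (suc j ≤_) e (s≤s (m≤n+m j d)))
      in lia 5 (λ x m l l′ j → l′ ≺ l ⇒ K 1 ⊞ (x ⊞ m) ≼ l′ ⊞ (K 1 ⊞ j) ⇒ [ 111 ]⊢ K 1 ⊞ (x ⊞ m) ≼ l ⊞ j)
        (Λ i k) (M i (suc k)) l l′ j (proj₁ (rowwise b a (n<1+n j))) (placement-≥ d b (trans (+-suc d j) e))

    M-Λ : ∀ i k → M i k + Λ (suc i) k ≡ Λ i k + M i (suc k)
    M-Λ i k = lia 7 (λ b p₀ p₁ x x⁺ m m⁺ → b ⊞ p₁ ≐ m ⊞ p₀ ⇒ b ⊞ (p₁ ⊞ x⁺) ≐ m⁺ ⊞ (p₀ ⊞ x) ⇒ [ 10011 ∣ 1101 ]⊢ m ⊞ x⁺ ≐ x ⊞ m⁺)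
      (pt β i) (prefix (Λ i) k) (prefix (Λ (suc i)) k) (Λ i k) (Λ (suc i) k) (M i k) (M i (suc k)) (prefix-Λ i k) (prefix-Λ i (suc k))

    -- the entries k of row i fill the new boxes of row k from left to right as one reads row i
    -- from right to left
    placement : ∀ {i j k l} → At Z i j k l → l + j ≡ suc (Λ i k + M i (suc k))
    placement {i} {j} {k} {l} a = ≤-antisym
      (≤-trans (placement-≤ (j ∸ suc (M i k)) a (sym (m∸n+n≡m (proj₁ (M-between a))))) (≤-reflexive (cong suc (trans (+-comm (Λ (suc i) k) (M i k)) (M-Λ i k)))))
      (placement-≥ (M i (suc k) ∸ j) a (m∸n+n≡m (proj₂ (M-between a))))

    Λ-unique : ∀ (f : ℕ → Fn) → (∀ i k → pt δ k ≤ f i k) → (∀ i k → f i k ≤ pt γ k) →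
      (∀ {i₀ j k l} → At Z i₀ j k l → ∀ i → i₀ < i → l ≤ f i k) → (∀ {i₀ j k l} → At Z i₀ j k l → ∀ i → l ≤ f i k → i₀ < i) → ∀ i → Λ i ≗ f i
    Λ-unique f lo hi to from i k = ≤-antisym
      (≮⇒≥ (λ lt → let (i₀ , j , a , i₀<i) = Λ-⁻ i (≤-<-trans (lo i k) lt) ≤-refl in <⇒≱ lt (to a i i₀<i)))
      (≮⇒≥ (λ lt → let (i₀ , j , a) = origin (≤-<-trans (Λ-lo i k) lt , hi i k) in <⇒≱ lt (Λ-⁺ a (from a i ≤-refl))))

-- Tableaux in `RW` and their pictures.

module Tableau where

  open Linear using (∧-T)
  open Enum
  open Shape
  open Picture

  T-allB : ∀ {A : Set} (p : A → Bool) xs → T (allB p xs) → ∀ {x} → x ∈ xs → T (p x)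
  T-allB p (x ∷ xs) h (here refl) = proj₁ (∧-T {p x} h)
  T-allB p (x ∷ xs) h (there x∈) = T-allB p xs (proj₂ (∧-T {p x} h)) x∈

  allB-T : ∀ {A : Set} (p : A → Bool) xs → (∀ {x} → x ∈ xs → T (p x)) → T (allB p xs)
  allB-T p [] h = tt
  allB-T p (x ∷ xs) h = ∧-T⁺ {p x} (h (here refl)) (allB-T p xs (h ∘ there))

  T-anyB : ∀ {A : Set} (p : A → Bool) xs → T (anyB p xs) → ∃[ x ] (x ∈ xs × T (p x))
  T-anyB p (x ∷ xs) h with p x in e
  ... | true = x , here refl , subst T (sym e) tt
  ... | false = let (y , y∈ , t) = T-anyB p xs h in y , there y∈ , t

  anyB-T : ∀ {A : Set} (p : A → Bool) xs {x} → x ∈ xs → T (p x) → T (anyB p xs)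
  anyB-T p (x ∷ xs) (here refl) h with p x
  ... | true = tt
  anyB-T p (y ∷ xs) (there x∈) h with p y
  ... | true = tt
  ... | false = anyB-T p xs x∈ h

  T-⇒ᵇ : ∀ {a b} → T (a ⇒ᵇ b) → T a → T b
  T-⇒ᵇ {true} h _ = h

  ⇒ᵇ-T : ∀ {a b} → (T a → T b) → T (a ⇒ᵇ b)
  ⇒ᵇ-T {true} h = h tt
  ⇒ᵇ-T {false} h = tt

  eqBox⇒≡ : ∀ x y → T (eqBox x y) → x ≡ y
  eqBox⇒≡ (a , b) (c , d) h = let (p , q) = ∧-T {a ≡ᵇ c} h in cong₂ _,_ (≡ᵇ⇒≡ a c p) (≡ᵇ⇒≡ b d q)

  eqBox-refl : ∀ x → T (eqBox x x)
  eqBox-refl (a , b) = ∧-T⁺ {a ≡ᵇ a} (≡⇒≡ᵇ a a refl) (≡⇒≡ᵇ b b refl)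

  eqTab⇒≡ : ∀ s t → T (eqTab s t) → s ≡ t
  eqTab⇒≡ [] [] h = refl
  eqTab⇒≡ (x ∷ s) (y ∷ t) h = let (p , q) = ∧-T {eqBox x y} h in cong₂ _∷_ (eqBox⇒≡ x y p) (eqTab⇒≡ s t q)

  eqTab-refl : ∀ t → T (eqTab t t)
  eqTab-refl [] = tt
  eqTab-refl (x ∷ t) = ∧-T⁺ {eqBox x x} (eqBox-refl x) (eqTab-refl t)

  inShape⇒∈ : ∀ {bs b} → T (inShape bs b) → b ∈ bs
  inShape⇒∈ {bs} {b} h = let (x , x∈ , e) = T-anyB (eqBox b) bs h in subst (_∈ bs) (sym (eqBox⇒≡ b x e)) x∈

  ∈⇒inShape : ∀ {bs b} → b ∈ bs → T (inShape bs b)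
  ∈⇒inShape {bs} {b} h = anyB-T (eqBox b) bs h (eqBox-refl b)

  insertions⇒↭ : ∀ {A : Set} (x : A) ys {zs} → zs ∈ insertions x ys → zs ↭ x ∷ ys
  insertions⇒↭ x [] (here refl) = ↭-refl
  insertions⇒↭ x (y ∷ ys) (here refl) = ↭-refl
  insertions⇒↭ x (y ∷ ys) (there z∈) with ∈-map⁻ (y ∷_) z∈
  ... | (ws , w∈ , refl) = ↭-trans (prep y (insertions⇒↭ x ys w∈)) (swap y x ↭-refl)

  perms⇒↭ : ∀ {A : Set} (xs : List A) {zs} → zs ∈ perms xs → zs ↭ xs
  perms⇒↭ [] (here refl) = ↭-refl
  perms⇒↭ (x ∷ xs) z∈ with ∈-concatMap⁻′ (insertions x) (perms xs) z∈
  ... | (ys , y∈ , h) = ↭-trans (insertions⇒↭ x ys h) (prep x (perms⇒↭ xs y∈))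

  ∈-insertions : ∀ {A : Set} (x : A) l r → l ++ x ∷ r ∈ insertions x (l ++ r)
  ∈-insertions x [] [] = here refl
  ∈-insertions x [] (y ∷ r) = here refl
  ∈-insertions x (y ∷ l) r = there (∈-map⁺ (y ∷_) (∈-insertions x l r))

  ↭⇒perms : ∀ {A : Set} (xs : List A) {zs} → zs ↭ xs → zs ∈ perms xs
  ↭⇒perms [] {[]} p = here refl
  ↭⇒perms [] {z ∷ zs} p with ↭-length p
  ... | ()
  ↭⇒perms (x ∷ xs) p with ∈-∃++ (∈-resp-↭ (↭-sym p) (here refl))
  ... | (l , r , refl) = ∈-concatMap⁺′ (insertions x) (perms xs) (↭⇒perms xs (drop-∷ (↭-trans (↭-sym (shift x l r)) p))) (∈-insertions x l r)

  insertions-unique : ∀ {A : Set} (x : A) ys → x ∉ ys → Unique (insertions x ys)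
  insertions-unique x [] n = [] ∷ []
  insertions-unique x (y ∷ ys) n =
    All.tabulate (λ { z∈ e → let (ws , w∈ , e′) = ∈-map⁻ (y ∷_) z∈ in n (here (∷-injectiveˡ (trans e e′))) })
    ∷ Uniq.map⁺ (λ { refl → refl }) (insertions-unique x ys (n ∘ there))

  insertions-injective : ∀ {A : Set} (x : A) ys ys′ {zs} → x ∉ ys → x ∉ ys′ → zs ∈ insertions x ys → zs ∈ insertions x ys′ → ys ≡ ys′
  insertions-injective x [] [] n n′ p q = refl
  insertions-injective x [] (y ∷ ys′) n n′ (here refl) (there q) with ∈-map⁻ (y ∷_) q
  ... | (_ , _ , refl) = ⊥-elim (n′ (here refl))
  insertions-injective x (y ∷ ys) [] n n′ (there p) (here refl) with ∈-map⁻ (y ∷_) p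
  ... | (_ , _ , refl) = ⊥-elim (n (here refl))
  insertions-injective x (y ∷ ys) (y′ ∷ ys′) n n′ (here refl) (here refl) = refl
  insertions-injective x (y ∷ ys) (y′ ∷ ys′) n n′ (here refl) (there q) with ∈-map⁻ (y′ ∷_) q
  ... | (_ , _ , refl) = ⊥-elim (n′ (here refl))
  insertions-injective x (y ∷ ys) (y′ ∷ ys′) n n′ (there p) (here refl) with ∈-map⁻ (y ∷_) p
  ... | (_ , _ , refl) = ⊥-elim (n (here refl))
  insertions-injective x (y ∷ ys) (y′ ∷ ys′) n n′ (there p) (there q) with ∈-map⁻ (y ∷_) p | ∈-map⁻ (y′ ∷_) q
  ... | (_ , a , refl) | (_ , b , refl) = cong (y ∷_) (insertions-injective x ys ys′ (n ∘ there) (n′ ∘ there) a b)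

  enum-perms : ∀ {A : Set} (xs : List A) → Unique xs → Enumerates (perms xs) (_↭ xs)
  enum-perms [] u = enum-resp (λ { refl → ↭-refl }) (λ p → empty p) enum-[ [] ]
    where
    empty : ∀ {A : Set} {zs : List A} → zs ↭ [] → zs ≡ []
    empty {zs = []} p = refl
    empty {zs = z ∷ zs} p with ↭-length p
    ... | ()
  enum-perms (x ∷ xs) (n ∷ u) = enumerates
    (unique (enum-concatMap {Q = λ ys zs → zs ∈ insertions x ys} (insertions x)
      (λ {ys} {ys′} p p′ → insertions-injective x ys ys′ (notin p) (notin p′)) (enum-perms xs u)
      (λ {ys} p → enumerates (insertions-unique x ys (notin p)) (λ z → z) (λ z → z))))
    (perms⇒↭ (x ∷ xs)) (↭⇒perms (x ∷ xs))
    where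
    notin : ∀ {ys} → ys ↭ xs → x ∉ ys
    notin p x∈ = All.lookup n (∈-resp-↭ p x∈) refl

  Unique-resp : ∀ {A : Set} {xs ys : List A} → xs ↭ ys → Unique xs → Unique ys
  Unique-resp {A} p = PermS.Unique-resp-↭ (≡.setoid A) (↭⇒↭ₛ p)

  Unique-↭ : ∀ {A : Set} {xs ys : List A} → Unique xs → Unique ys → (∀ {x} → x ∈ xs → x ∈ ys) → (∀ {x} → x ∈ ys → x ∈ xs) → xs ↭ ys
  Unique-↭ u v f g = ∼bag⇒↭ (unique∧set⇒bag u v (mk⇔ f g))

  -- Corresponding entries of two lists

  module _ {A B : Set} where

    zip-∈ˡ : ∀ {xs : List A} {ys : List B} {x y} → (x , y) ∈ zip xs ys → x ∈ xs
    zip-∈ˡ {_ ∷ _} {_ ∷ _} (here refl) = here refl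
    zip-∈ˡ {_ ∷ _} {_ ∷ _} (there p) = there (zip-∈ˡ p)

    zip-∈ʳ : ∀ {xs : List A} {ys : List B} {x y} → (x , y) ∈ zip xs ys → y ∈ ys
    zip-∈ʳ {_ ∷ _} {_ ∷ _} (here refl) = here refl
    zip-∈ʳ {_ ∷ _} {_ ∷ _} (there p) = there (zip-∈ʳ p)

    zip-image : ∀ {xs : List A} {ys : List B} {x} → length xs ≡ length ys → x ∈ xs → ∃[ y ] ((x , y) ∈ zip xs ys)
    zip-image {_ ∷ _} {y ∷ _} e (here refl) = y , here refl
    zip-image {_ ∷ _} {_ ∷ _} e (there p) = let (y , q) = zip-image (suc-injective e) p in y , there q

    zip-origin : ∀ {xs : List A} {ys : List B} {y} → length xs ≡ length ys → y ∈ ys → ∃[ x ] ((x , y) ∈ zip xs ys)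
    zip-origin {x ∷ _} {_ ∷ _} e (here refl) = x , here refl
    zip-origin {_ ∷ _} {_ ∷ _} e (there p) = let (x , q) = zip-origin (suc-injective e) p in x , there q

    zip-functional : ∀ {xs : List A} {ys : List B} {x y y′} → Unique xs → (x , y) ∈ zip xs ys → (x , y′) ∈ zip xs ys → y ≡ y′
    zip-functional {_ ∷ _} {_ ∷ _} (n ∷ u) (here refl) (here refl) = refl
    zip-functional {_ ∷ _} {_ ∷ _} (n ∷ u) (here refl) (there q) = ⊥-elim (All.lookup n (zip-∈ˡ q) refl)
    zip-functional {_ ∷ _} {_ ∷ _} (n ∷ u) (there p) (here refl) = ⊥-elim (All.lookup n (zip-∈ˡ p) refl)
    zip-functional {_ ∷ _} {_ ∷ _} (n ∷ u) (there p) (there q) = zip-functional u p q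

    zip-injective : ∀ {xs : List A} {ys : List B} {x x′ y} → Unique ys → (x , y) ∈ zip xs ys → (x′ , y) ∈ zip xs ys → x ≡ x′
    zip-injective {_ ∷ _} {_ ∷ _} (n ∷ u) (here refl) (here refl) = refl
    zip-injective {_ ∷ _} {_ ∷ _} (n ∷ u) (here refl) (there q) = ⊥-elim (All.lookup n (zip-∈ʳ q) refl)
    zip-injective {_ ∷ _} {_ ∷ _} (n ∷ u) (there p) (here refl) = ⊥-elim (All.lookup n (zip-∈ʳ p) refl)
    zip-injective {_ ∷ _} {_ ∷ _} (n ∷ u) (there p) (there q) = zip-injective u p q

    zip-unique : ∀ {xs : List A} {ys : List B} → Unique xs → Unique (zip xs ys)
    zip-unique {[]} u = []
    zip-unique {_ ∷ _} {[]} u = []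
    zip-unique {_ ∷ _} {_ ∷ _} (n ∷ u) = All.tabulate (λ { p refl → All.lookup n (zip-∈ˡ p) refl }) ∷ zip-unique u

    zip-ext : ∀ {xs : List A} {ys ys′ : List B} → length xs ≡ length ys → length xs ≡ length ys′ → Unique xs →
              (∀ {x y y′} → (x , y) ∈ zip xs ys → (x , y′) ∈ zip xs ys′ → y ≡ y′) → ys ≡ ys′
    zip-ext {[]} {[]} {[]} _ _ _ h = refl
    zip-ext {x ∷ xs} {y ∷ ys} {y′ ∷ ys′} e e′ (n ∷ u) h = cong₂ _∷_ (h (here refl) (here refl))
      (zip-ext (suc-injective e) (suc-injective e′) u (λ p q → h (there p) (there q)))

  choose : ∀ {A B : Set} {R : A → B → Set} (xs : List A) → (∀ {x} → x ∈ xs → ∃[ y ] R x y) →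
           ∃[ ys ] (length xs ≡ length ys × (∀ {x y} → (x , y) ∈ zip xs ys → R x y))
  choose [] h = [] , refl , λ ()
  choose (x ∷ xs) h =
    let (y , r) = h (here refl)
        (ys , e , rs) = choose xs (h ∘ there)
    in y ∷ ys , cong suc e , λ { (here refl) → r ; (there p) → rs p }

  index : ∀ {b : Box} {t} → b ∈ t → ∃[ n ] (indexOf b t ≡ just n)
  index {b} {c ∷ t} b∈ with eqBox b c in e
  ... | true = 0 , refl
  index {b} {c ∷ t} (here refl) | false = ⊥-elim (subst T e (eqBox-refl b))
  index {b} {c ∷ t} (there b∈) | false = let (n , h) = index b∈ in suc n , cong (Maybe.map suc) h

  -- In a tableau t recorded along a sorted list of boxes, labels compare as the boxes do.
  module Labels {_⊏_ : Box → Box → Set} (⊏-asym : ∀ {b c} → b ⊏ c → c ⊏ b → ⊥) where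

    labelLess-just : ∀ t x y {m n} → indexOf x t ≡ just m → indexOf y t ≡ just n → labelLess t x y ≡ (m <ᵇ n)
    labelLess-just t x y e e′ rewrite e | e′ = refl

    indexOf-here : ∀ x t → indexOf x (x ∷ t) ≡ just 0
    indexOf-here x t with eqBox x x in e
    ... | true = refl
    ... | false = ⊥-elim (subst T e (eqBox-refl x))

    indexOf-there : ∀ {x y} t {n} → x ≢ y → indexOf x t ≡ just n → indexOf x (y ∷ t) ≡ just (suc n)
    indexOf-there {x} {y} t ne h with eqBox x y in e
    ... | true = ⊥-elim (ne (eqBox⇒≡ x y (subst T (sym e) tt)))
    ... | false = cong (Maybe.map suc) h

    labels : ∀ {L t b c x y} → AllPairs _⊏_ L → Unique t → (b , x) ∈ zip L t → (c , y) ∈ zip L t →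
             (T (labelLess t x y) → b ⊏ c) × (b ⊏ c → T (labelLess t x y))
    labels {l ∷ L} {z ∷ t} s (n ∷ u) (here refl) (here refl) =
      (λ h → ⊥-elim (subst T (labelLess-just (z ∷ t) z z (indexOf-here z t) (indexOf-here z t)) h)) , (λ h → ⊥-elim (⊏-asym h h))
    labels {l ∷ L} {z ∷ t} {y = y} (s ∷ ss) (n ∷ u) (here refl) (there q) =
      let y∈ = zip-∈ʳ q ; (m , e) = index y∈ in
      (λ _ → All.lookup s (zip-∈ˡ q)) ,
      (λ _ → subst T (sym (labelLess-just (z ∷ t) z y (indexOf-here z t) (indexOf-there t (λ e → All.lookup n y∈ (sym e)) e))) tt)
    labels {l ∷ L} {z ∷ t} {x = x} (s ∷ ss) (n ∷ u) (there p) (here refl) =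
      let x∈ = zip-∈ʳ p ; (m , e) = index x∈ in
      (λ h → ⊥-elim (subst T (labelLess-just (z ∷ t) x z (indexOf-there t (λ e → All.lookup n x∈ (sym e)) e) (indexOf-here z t)) h)) ,
      (λ h → ⊥-elim (⊏-asym h (All.lookup s (zip-∈ˡ p))))
    labels {l ∷ L} {z ∷ t} {x = x} {y} (s ∷ ss) (n ∷ u) (there p) (there q) =
      let x∈ = zip-∈ʳ p ; (m , e) = index x∈ ; y∈ = zip-∈ʳ q ; (m′ , e′) = index y∈
          (f , g) = labels ss u p q
          eq = trans (labelLess-just (z ∷ t) x y (indexOf-there t (λ e → All.lookup n x∈ (sym e)) e) (indexOf-there t (λ e → All.lookup n y∈ (sym e)) e′))
                     (sym (labelLess-just t x y e e′))
      in (λ h → f (subst T eq h)) , (λ h → subst T (sym eq) (g h))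

  ≺ᵣ-asym : ∀ {b c} → b ≺ᵣ c → c ≺ᵣ b → ⊥
  ≺ᵣ-asym (inj₁ p) (inj₁ q) = <-asym p q
  ≺ᵣ-asym (inj₁ p) (inj₂ (e , _)) = <-irrefl (sym e) p
  ≺ᵣ-asym (inj₂ (e , _)) (inj₁ q) = <-irrefl (sym e) q
  ≺ᵣ-asym (inj₂ (_ , p)) (inj₂ (_ , q)) = <-asym p q

  open Labels {_≺ᵣ_} ≺ᵣ-asym using (labels)

  Before⇒≺ : ∀ {i j i′ j′} → Before i j i′ j′ → (suc i , j) ≺ᵣ (suc i′ , j′)
  Before⇒≺ (inj₁ p) = inj₁ (s≤s p)
  Before⇒≺ (inj₂ (e , p)) = inj₂ (cong suc e , p)

  ≺⇒Before : ∀ {i j i′ j′} → (suc i , j) ≺ᵣ (suc i′ , j′) → Before i j i′ j′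
  ≺⇒Before (inj₁ (s≤s p)) = inj₁ p
  ≺⇒Before (inj₂ (e , p)) = inj₂ (suc-injective e , p)

  -- The boolean conditions, with their local definitions made visible

  incOk : Part → Part → Tab → Box → Bool
  incOk γ δ t (i , j) = (inShape (boxes γ δ) (i , suc j) ⇒ᵇ labelLess t (i , j) (i , suc j))
                      ∧ (inShape (boxes γ δ) (suc i , j) ⇒ᵇ labelLess t (i , j) (suc i , j))

  rowOk colOk : (Box × Box) × (Box × Box) → Bool
  rowOk ((b , x) , (c , y)) = (row b ≡ᵇ row c) ⇒ᵇ ((col x <ᵇ col y) ∧ (row y ≤ᵇ row x))
  colOk ((b , x) , (c , y)) = ((suc (row b) ≡ᵇ row c) ∧ (col b ≡ᵇ col c)) ⇒ᵇ ((row x <ᵇ row y) ∧ (col y ≤ᵇ col x))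

  isStd⇒ : ∀ γ δ t → T (isStd γ δ t) → t ↭ boxes γ δ × T (increasing γ δ t)
  isStd⇒ γ δ t h with T-anyB (eqTab t) (SYT γ δ) h
  ... | (t′ , t∈ , e) with eqTab⇒≡ t t′ e
  ... | refl = let (a , b) = ∈-filterB⁻ (increasing γ δ) (perms (boxes γ δ)) t∈ in perms⇒↭ (boxes γ δ) a , b

  ∈-SYT : ∀ γ δ t → t ↭ boxes γ δ → T (increasing γ δ t) → t ∈ SYT γ δ
  ∈-SYT γ δ t p h = ∈-filterB⁺ (increasing γ δ) (perms (boxes γ δ)) (↭⇒perms (boxes γ δ) p) h

  ⇒isStd : ∀ γ δ t → t ↭ boxes γ δ → T (increasing γ δ t) → T (isStd γ δ t)
  ⇒isStd γ δ t p h = anyB-T (eqTab t) (SYT γ δ) (∈-SYT γ δ t p h) (eqTab-refl t)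

  consec-adjacent : ∀ {A B : Set} {_⊏_ : A → A → Set} {L : List A} {t : List B} {b c x y} → (∀ {b c} → b ⊏ c → c ⊏ b → ⊥) → AllPairs _⊏_ L →
    (b , x) ∈ zip L t → (c , y) ∈ zip L t → b ⊏ c → (∀ {d} → d ∈ L → b ⊏ d → d ⊏ c → ⊥) → ((b , x) , (c , y)) ∈ consec (zip L t)
  consec-adjacent {L = _ ∷ _} {_ ∷ _} asym s (here refl) (here refl) lt gap = ⊥-elim (asym lt lt)
  consec-adjacent {L = _ ∷ _ ∷ _} {_ ∷ _ ∷ _} asym s (here refl) (there (here refl)) lt gap = here refl
  consec-adjacent {L = _ ∷ _ ∷ _} {_ ∷ _ ∷ _} asym ((r ∷ _) ∷ (s ∷ _)) (here refl) (there (there q)) lt gap =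
    ⊥-elim (gap (there (here refl)) r (All.lookup s (zip-∈ˡ q)))
  consec-adjacent {L = _ ∷ _} {_ ∷ _} asym (s ∷ _) (there p) (here refl) lt gap = ⊥-elim (asym lt (All.lookup s (zip-∈ˡ p)))
  consec-adjacent {L = _ ∷ _ ∷ _} {_ ∷ _ ∷ _} asym (_ ∷ s) (there p) (there q) lt gap = there (consec-adjacent asym s p q lt (gap ∘ there))

  consec-∈ : ∀ {A B : Set} {_⊏_ : A → A → Set} {L : List A} {t : List B} {z} → AllPairs _⊏_ L → z ∈ consec (zip L t) →
    proj₁ z ∈ zip L t × proj₂ z ∈ zip L t × proj₁ (proj₁ z) ⊏ proj₁ (proj₂ z)
  consec-∈ {L = _ ∷ []} {_ ∷ []} _ ()
  consec-∈ {L = _ ∷ _ ∷ _} {_ ∷ _ ∷ _} ((r ∷ _) ∷ _) (here refl) = here refl , there (here refl) , r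
  consec-∈ {L = _ ∷ _ ∷ _} {_ ∷ _ ∷ _} (_ ∷ s) (there z∈) = let (p , q , r) = consec-∈ s z∈ in there p , there q , r

  ∈-allPairs⁺ : ∀ {A : Set} {xs : List A} {x y} → x ∈ xs → y ∈ xs → (x , y) ∈ allPairs xs
  ∈-allPairs⁺ {xs = xs} {x} p q = ∈-concatMap⁺′ (λ x → map (λ y → (x , y)) xs) xs p (∈-map⁺ (x ,_) q)

  ∈-allPairs⁻ : ∀ {A : Set} {xs : List A} {z} → z ∈ allPairs xs → proj₁ z ∈ xs × proj₂ z ∈ xs
  ∈-allPairs⁻ {xs = xs} z∈ with ∈-concatMap⁻′ (λ x → map (λ y → (x , y)) xs) xs z∈
  ... | (x , p , q) with ∈-map⁻ (x ,_) q
  ... | (y , r , refl) = p , r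

  module Conversion (α β γ δ : Part) (t : Tab) where

    L : List Box
    L = rl α β

    Z : List (Box × Box)
    Z = zip L t

    suc-form : t ↭ boxes γ δ → ∀ {z} → z ∈ Z → ∃[ i ] ∃[ j ] ∃[ k ] ∃[ l ] z ≡ ((suc i , j) , (suc k , l))
    suc-form p {z} z∈ =
      let (i , e , _) = ∈-rl⁻ {α} {β} (zip-∈ˡ z∈) ; (k , e′ , _) = ∈-boxes⁻ {γ} {δ} (∈-resp-↭ p (zip-∈ʳ z∈))
      in i , col (proj₁ z) , k , col (proj₂ z) , cong₂ (λ a b → (a , col (proj₁ z)) , (b , col (proj₂ z))) e e′

    module Sound (h : T (RW γ δ α β t)) where
      private
        h₁ = ∧-T {isStd γ δ t} h
        h₂ = ∧-T {length t ≡ᵇ length L} (proj₂ h₁)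
        h₃ = ∧-T {allB rowOk (consec Z)} (proj₂ h₂)

      perm : t ↭ boxes γ δ
      perm = proj₁ (isStd⇒ γ δ t (proj₁ h₁))

      t-unique : Unique t
      t-unique = Unique-resp (↭-sym perm) (boxes-unique γ δ)

      len : length L ≡ length t
      len = sym (≡ᵇ⇒≡ (length t) (length L) (proj₁ h₂))

      private
        inc : ∀ {x} → x ∈ boxes γ δ → T (incOk γ δ t x)
        inc = T-allB (incOk γ δ t) (boxes γ δ) (proj₂ (isStd⇒ γ δ t (proj₁ h₁)))

        -- The row condition of `RW` concerns consecutive labels, that is, horizontal neighbours: no
        -- box is read between them. Arbitrary boxes of a row are then reached in single steps.
        rowAdjacent : ∀ {i j k l k′ l′} → At Z i (suc j) k l → At Z i j k′ l′ → l < l′ × k′ ≤ k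
        rowAdjacent {i} {j} {k} {l} {k′} {l′} a b =
          let t′ = T-⇒ᵇ {row (suc i , suc j) ≡ᵇ suc i} (T-allB rowOk (consec Z) (proj₁ h₃)
                (consec-adjacent ≺ᵣ-asym (rl-sorted α β) a b (inj₂ (refl , ≤-refl)) gap)) (≡⇒≡ᵇ i i refl)
              (p , q) = ∧-T {l <ᵇ l′} t′
          in <ᵇ⇒< l l′ p , ≤-pred (≤ᵇ⇒≤ (suc k′) (suc k) q)
          where
          gap : ∀ {d} → d ∈ L → (suc i , suc j) ≺ᵣ d → d ≺ᵣ (suc i , j) → ⊥
          gap _ (inj₁ p) (inj₁ q) = <-asym p q
          gap _ (inj₁ p) (inj₂ (e , _)) = <-irrefl (sym e) p
          gap _ (inj₂ (e , _)) (inj₁ q) = <-irrefl (sym e) q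
          gap _ (inj₂ (_ , p)) (inj₂ (_ , q)) = <⇒≱ p q

        member : ∀ {i j} → InSkew α β i j → ∃[ k ] ∃[ l ] At Z i j k l
        member s with zip-image len (∈-rl⁺ {α} {β} s)
        ... | (x , x∈) with suc-form perm x∈
        ... | (_ , _ , _ , _ , refl) = _ , _ , x∈

        src : ∀ {i j k l} → At Z i j k l → InSkew α β i j
        src a with ∈-rl⁻ {α} {β} (zip-∈ˡ a)
        ... | (_ , refl , s) = s

        tgt : ∀ {i j k l} → At Z i j k l → InSkew γ δ k l
        tgt a with ∈-boxes⁻ {γ} {δ} (∈-resp-↭ perm (zip-∈ʳ a))
        ... | (_ , refl , s) = s

        rows : ∀ d {i j k l k′ l′} → At Z i (suc d + j) k l → At Z i j k′ l′ → l < l′ × k′ ≤ k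
        rows zero a b = rowAdjacent a b
        rows (suc d) {j = j} a b with member (≤-trans (proj₁ (src b)) (m≤n+m j (suc d)) , ≤-trans (n≤1+n _) (proj₂ (src a)))
        ... | (_ , _ , m) = let (p , q) = rows d m b ; (p′ , q′) = rowAdjacent a m in <-trans p′ p , ≤-trans q q′

      picture : Picture α β γ δ (At Z)
      picture = record
        { source = src ; target = tgt ; image = member
        ; origin = origin′
        ; functional = λ a b → let e = zip-functional (rl-unique α β) a b in suc-injective (cong proj₁ e) , cong proj₂ e
        ; injective = λ a b → let e = zip-injective t-unique a b in suc-injective (cong proj₁ e) , cong proj₂ e
        ; right = λ {i} {j} {i′} {j′} {k} {l} a b → ≺⇒Before (proj₁ (labels (rl-sorted α β) t-unique a b)
            (T-⇒ᵇ (proj₁ (∧-T {inShape (boxes γ δ) (suc k , suc l) ⇒ᵇ labelLess t (suc k , l) (suc k , suc l)} (inc (∈-boxes⁺ {γ} {δ} (tgt a))))) (∈⇒inShape (∈-boxes⁺ {γ} {δ} (tgt b)))))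
        ; down = λ {i} {j} {i′} {j′} {k} {l} a b → ≺⇒Before (proj₁ (labels (rl-sorted α β) t-unique a b)
            (T-⇒ᵇ (proj₂ (∧-T {inShape (boxes γ δ) (suc k , suc l) ⇒ᵇ labelLess t (suc k , l) (suc k , suc l)} (inc (∈-boxes⁺ {γ} {δ} (tgt a))))) (∈⇒inShape (∈-boxes⁺ {γ} {δ} (tgt b)))))
        ; rowwise = λ {i} {j} {j′} {k} {l} a b lt → rows (j ∸ suc j′)
            (subst (λ j → At Z i j k l) (trans (sym (m∸n+n≡m lt)) (+-suc (j ∸ suc j′) j′)) a) b
        ; colwise = λ {i} {j} {k} {l} {k′} {l′} a b →
            let t′ = T-⇒ᵇ {(suc (suc i) ≡ᵇ suc (suc i)) ∧ (j ≡ᵇ j)} (T-allB colOk (allPairs Z) (proj₂ h₃) (∈-allPairs⁺ a b)) (∧-T⁺ {i ≡ᵇ i} (≡⇒≡ᵇ i i refl) (≡⇒≡ᵇ j j refl))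
                (p , q) = ∧-T {suc k <ᵇ suc k′} t′
            in ≤-pred (<ᵇ⇒< (suc k) (suc k′) p) , ≤ᵇ⇒≤ l′ l q
        }
        where
        origin′ : ∀ {k l} → InSkew γ δ k l → ∃[ i ] ∃[ j ] At Z i j k l
        origin′ s with zip-origin len (∈-resp-↭ (↭-sym perm) (∈-boxes⁺ {γ} {δ} s))
        ... | (b , b∈) with suc-form perm b∈
        ... | (_ , _ , _ , _ , refl) = _ , _ , b∈

    complete-RW : t ↭ boxes γ δ → length L ≡ length t → Picture α β γ δ (At Z) → t ∈ SYT γ δ × T (RW γ δ α β t)
    complete-RW perm len P = ∈-SYT γ δ t perm inc ,
      ∧-T⁺ {isStd γ δ t} (⇒isStd γ δ t perm inc) (∧-T⁺ {length t ≡ᵇ length L} (≡⇒≡ᵇ _ _ (sym len))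
        (∧-T⁺ {allB rowOk (consec Z)} (allB-T rowOk (consec Z) rowAll) (allB-T colOk (allPairs Z) colAll)))
      where
      open Picture.Picture P
      t-unique : Unique t
      t-unique = Unique-resp (↭-sym perm) (boxes-unique γ δ)
      less : ∀ {k l k′ l′} → InSkew γ δ k l → InSkew γ δ k′ l′ → (∀ {i j i′ j′} → At Z i j k l → At Z i′ j′ k′ l′ → Before i j i′ j′) →
             T (labelLess t (suc k , l) (suc k′ , l′))
      less s s′ f = let (_ , _ , a) = origin s ; (_ , _ , b) = origin s′ in proj₂ (labels (rl-sorted α β) t-unique a b) (Before⇒≺ (f a b))
      shape : ∀ {k l} → T (inShape (boxes γ δ) (suc k , l)) → InSkew γ δ k l
      shape {k} {l} h with ∈-boxes⁻ {γ} {δ} (inShape⇒∈ {boxes γ δ} {suc k , l} h)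
      ... | (_ , refl , s) = s
      inc : T (increasing γ δ t)
      inc = allB-T (incOk γ δ t) (boxes γ δ) each
        where
        each : ∀ {x} → x ∈ boxes γ δ → T (incOk γ δ t x)
        each {i , j} x∈ with ∈-boxes⁻ {γ} {δ} x∈
        ... | (k , refl , s) = ∧-T⁺ {inShape (boxes γ δ) (suc k , suc j) ⇒ᵇ labelLess t (suc k , j) (suc k , suc j)}
          (⇒ᵇ-T (λ h → less s (shape h) right)) (⇒ᵇ-T (λ h → less s (shape h) down))
      rowAll : ∀ {z} → z ∈ consec Z → T (rowOk z)
      rowAll {z} z∈ with consec-∈ (rl-sorted α β) z∈
      ... | (a , b , lt) with suc-form perm a | suc-form perm b
      ... | (i , j , k , l , refl) | (i′ , j′ , k′ , l′ , refl) = ⇒ᵇ-T (λ e → check (≡ᵇ⇒≡ i i′ e) lt)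
        where
        check : i ≡ i′ → (suc i , j) ≺ᵣ (suc i′ , j′) → T ((l <ᵇ l′) ∧ (suc k′ ≤ᵇ suc k))
        check refl (inj₁ p) = ⊥-elim (<-irrefl refl p)
        check refl (inj₂ (_ , p)) = let (q , q′) = rowwise a b p in ∧-T⁺ {l <ᵇ l′} (<⇒<ᵇ q) (≤⇒≤ᵇ (s≤s q′))
      colAll : ∀ {z} → z ∈ allPairs Z → T (colOk z)
      colAll {z} z∈ with ∈-allPairs⁻ z∈
      ... | (a , b) with suc-form perm a | suc-form perm b
      ... | (i , j , k , l , refl) | (i′ , j′ , k′ , l′ , refl) = ⇒ᵇ-T (λ e → let (p , q) = ∧-T {suc i ≡ᵇ i′} e in check (≡ᵇ⇒≡ (suc i) i′ p) (≡ᵇ⇒≡ j j′ q))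
        where
        check : suc i ≡ i′ → j ≡ j′ → T ((suc k <ᵇ suc k′) ∧ (l′ ≤ᵇ l))
        check refl refl = let (p , q) = colwise a b in ∧-T⁺ {suc k <ᵇ suc k′} (<⇒<ᵇ (s≤s p)) (≤⇒≤ᵇ q)

-- Arrows encoded by fillings, and the placement that decodes a filling.

module ArrowToFilling where

  open Linear using (lia; K; _⊞_; _≼_; _≺_; _≐_; _⇒_; [_]⊢_; [_∣_]⊢_; _&_)
  open Step using (Fn; prefix)
  open Compat using (dam)
  open Chain using (_≗_; Filling; start; end; strip; total; flag; strict; HStrip-decˡ; dec-≤)
  open Shape
  open Picture
  open Tableau

  -- The row rule

  -- The entries of the row rule filling may be negative and are integers. Since rows are natural
  -- numbers, the comparison moves to ℕ by putting the column on the other side, whether or not the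
  -- difference is negative.
  diff≤ : ∀ m n k → T ((ℤ.+ m ℤ.- ℤ.+ n) ℤ.≤ᵇ ℤ.+ k) → m ≤ k + n
  diff≤ m n k h with <-≤-connex m n
  ... | inj₁ m<n = ≤-trans (<⇒≤ m<n) (m≤n+m n k)
  ... | inj₂ n≤m = m∸n≤o⇒m≤o+n (ℤₚ.drop‿+≤+ (subst (ℤ._≤ ℤ.+ k) (trans (ℤₚ.m-n≡m⊖n m n) (ℤₚ.⊖-≥ n≤m)) (ℤₚ.≤ᵇ⇒≤ h)))
    where
    m∸n≤o⇒m≤o+n : m ∸ n ≤ k → m ≤ k + n
    m∸n≤o⇒m≤o+n h = ≤-trans (≤-reflexive (sym (m∸n+n≡m n≤m))) (+-monoˡ-≤ n h)

  ≤diff : ∀ m n k → m ≤ k + n → T ((ℤ.+ m ℤ.- ℤ.+ n) ℤ.≤ᵇ ℤ.+ k)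
  ≤diff m n k h with <-≤-connex m n
  ... | inj₁ m<n = ℤₚ.≤⇒≤ᵇ (subst (ℤ._≤ ℤ.+ k) (sym (trans (ℤₚ.m-n≡m⊖n m n) (ℤₚ.⊖-< m<n))) (ℤₚ.≤-trans (ℤₚ.neg-mono-≤ (ℤ.+≤+ z≤n)) (ℤ.+≤+ z≤n)))
  ... | inj₂ n≤m = ℤₚ.≤⇒≤ᵇ (subst (ℤ._≤ ℤ.+ k) (sym (trans (ℤₚ.m-n≡m⊖n m n) (ℤₚ.⊖-≥ n≤m))) (ℤ.+≤+ (m≤n+o⇒m∸n≤o m n (subst (m ≤_) (+-comm k n) h))))

  -- Boxes are numbered from 1 and the rows here from 0. With r = ρ + 1, one successor cancels on
  -- each side.
  rule⇒ : ∀ ρ α β t → T (rowRule (suc ρ) α β t) → ∀ {i j k l} → At (zip (rl α β) t) i j k l → ρ + suc i ≤ k + j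
  rule⇒ ρ α β t h {i} {j} {k} a = ≤-pred (diff≤ (suc ρ + suc i) j (suc k) (T-allB _ (zip (rl α β) t) h a))

  ⇒rule : ∀ ρ α β t → (∀ {z} → z ∈ zip (rl α β) t → ∃[ i ] ∃[ j ] ∃[ k ] ∃[ l ] z ≡ ((suc i , j) , (suc k , l))) →
    (∀ {i j k l} → At (zip (rl α β) t) i j k l → ρ + suc i ≤ k + j) → T (rowRule (suc ρ) α β t)
  ⇒rule ρ α β t form h = allB-T _ (zip (rl α β) t) each
    where
    each : ∀ {z} → z ∈ zip (rl α β) t → T (Rr (suc ρ) (proj₁ z) ℤ.≤ᵇ ℤ.+ row (proj₂ z))
    each z∈ with form z∈
    ... | (i , j , k , l , refl) = ≤diff (suc ρ + suc i) j (suc k) (s≤s (h z∈))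

  -- Tableaux in RW are encoded faithfully by their fillings

  module Encoding (α β γ δ : Part) (pα : IsP α) (pβ : IsP β) (pγ : IsP γ) (pδ : IsP δ) (β⊑α : β ⊑ α) (δ⊑γ : δ ⊑ γ) where

    module Of (t : Tab) (h : T (RW γ δ α β t)) where
      open Conversion α β γ δ t
      open Sound h public
      open Counting Z (zip-unique (rl-unique α β)) (suc-form perm) pα pβ pγ pδ β⊑α δ⊑γ picture public

    M-same : ∀ t h t′ h′ → (∀ i → Of.Λ t h i ≗ Of.Λ t′ h′ i) → ∀ i n → Of.M t h i n ≡ Of.M t′ h′ i n
    M-same t h t′ h′ e i n = lia 7 (λ b p p⁺ p′ p⁺′ m m′ → b ⊞ p⁺ ≐ m ⊞ p ⇒ b ⊞ p⁺′ ≐ m′ ⊞ p′ ⇒ p ≐ p′ ⇒ p⁺ ≐ p⁺′ ⇒ [ 100110011 ∣ 11001101 ]⊢ m ≐ m′)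
      (pt β i) (prefix (Of.Λ t h i) n) (prefix (Of.Λ t h (suc i)) n) (prefix (Of.Λ t′ h′ i) n) (prefix (Of.Λ t′ h′ (suc i)) n) (Of.M t h i n) (Of.M t′ h′ i n)
      (Of.prefix-Λ t h i n) (Of.prefix-Λ t′ h′ i n) (prefix-cong (e i) n) (prefix-cong (e (suc i)) n)

    letter≤ : ∀ t h t′ h′ → (∀ i → Of.Λ t h i ≗ Of.Λ t′ h′ i) → ∀ {i j k l k′ l′} →
      At (zip (rl α β) t) i j k l → At (zip (rl α β) t′) i j k′ l′ → k′ ≤ k
    letter≤ t h t′ h′ e {i} {j} {k} {l} {k′} a a′ = ≮⇒≥ (λ k<k′ →
      <⇒≱ (proj₁ (Of.M-between t′ h′ a′)) (subst (j ≤_) (M-same t h t′ h′ e i k′) (Of.M-⁺ t h a k<k′)))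

    module Determined (t : Tab) (h : T (RW γ δ α β t)) (t′ : Tab) (h′ : T (RW γ δ α β t′)) (e : ∀ i → Of.Λ t h i ≗ Of.Λ t′ h′ i) where

      same-col : ∀ {i j k k′ l l′} → k ≡ k′ → At (zip (rl α β) t) i j k l → At (zip (rl α β) t′) i j k′ l′ → l ≡ l′
      same-col {i} {j} {k} {l = l} {l′} refl a a′ = lia 7 (λ l l′ j x x′ m m′ → l ⊞ j ≐ K 1 ⊞ (x ⊞ m) ⇒ l′ ⊞ j ≐ K 1 ⊞ (x′ ⊞ m′) ⇒ x ≐ x′ ⇒ m ≐ m′ ⇒ [ 11001011 ∣ 100110101 ]⊢ l ≐ l′)
        l l′ j (Of.Λ t h i k) (Of.Λ t′ h′ i k) (Of.M t h i (suc k)) (Of.M t′ h′ i (suc k)) (Of.placement t h a) (Of.placement t′ h′ a′) (e i k) (M-same t h t′ h′ e i (suc k))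

      same-row : ∀ {i j k k′ l l′} → At (zip (rl α β) t) i j k l → At (zip (rl α β) t′) i j k′ l′ → k ≡ k′
      same-row a a′ = ≤-antisym (letter≤ t′ h′ t h (λ i k → sym (e i k)) a′ a) (letter≤ t h t′ h′ e a a′)

      same-at : ∀ {b x x′} → (b , x) ∈ zip (rl α β) t → (b , x′) ∈ zip (rl α β) t′ →
        ∃[ i ] ∃[ j ] ∃[ k ] ∃[ l ] (b , x) ≡ ((suc i , j) , (suc k , l)) → ∃[ i ] ∃[ j ] ∃[ k ] ∃[ l ] (b , x′) ≡ ((suc i , j) , (suc k , l)) → x ≡ x′
      same-at p p′ (_ , _ , _ , _ , refl) (_ , _ , _ , _ , refl) = cong₂ (λ k l → suc k , l) (same-row p p′) (same-col (same-row p p′) p p′)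

      same : t ≡ t′
      same = zip-ext (Of.len t h) (Of.len t′ h′) (rl-unique α β)
        (λ p p′ → same-at p p′ (Conversion.suc-form α β γ δ t (Of.perm t h) p) (Conversion.suc-form α β γ δ t′ (Of.perm t′ h′) p′))

  search-interval : ∀ (f : ℕ → ℕ) n j → f 0 < j → j ≤ f n → ∃[ k ] (k < n × f k < j × j ≤ f (suc k))
  search-interval f zero j p q = ⊥-elim (<⇒≱ p q)
  search-interval f (suc n) j p q with <-≤-connex (f n) j
  ... | inj₁ h = n , ≤-refl , h , q
  ... | inj₂ h = let (k , k<n , a , b) = search-interval f n j p h in k , m≤n⇒m≤1+n k<n , a , b

  inc-≤ : ∀ {f : ℕ → ℕ} → (∀ k → f k ≤ f (suc k)) → ∀ {i j} → i ≤ j → f i ≤ f j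
  inc-≤ {f} h {i} {j} i≤j = subst (λ x → f i ≤ f x) (m∸n+n≡m i≤j) (go (j ∸ i))
    where
    go : ∀ n → f i ≤ f (n + i)
    go zero = ≤-refl
    go (suc n) = ≤-trans (go n) (h (n + i))

  module Decoding (ρ : ℕ) (α β γ δ : Part) (pα : IsP α) (pβ : IsP β) (pγ : IsP γ) (pδ : IsP δ) (β⊑α : β ⊑ α) (δ⊑γ : δ ⊑ γ)
                  (Λ : ℕ → Fn) (F : Filling ρ (length α) (pt α) (pt β) (pt δ) (pt γ) Λ) where

    Λ-inc : ∀ k {i i′} → i ≤ i′ → Λ i k ≤ Λ i′ k
    Λ-inc k = inc-≤ {λ i → Λ i k} (λ i → proj₁ (strip F i k))

    Λ-dec : ∀ i {k k′} → k ≤ k′ → Λ i k′ ≤ Λ i k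
    Λ-dec i = dec-≤ (HStrip-decˡ (strip F i))

    Λ≤γ : ∀ i k → Λ i k ≤ pt γ k
    Λ≤γ i k = ≤-trans (Λ-inc k (m≤m+n i (length α))) (≤-reflexive (end F (i + length α) (m≤n+m _ i) k))

    δ≤Λ : ∀ i k → pt δ k ≤ Λ i k
    δ≤Λ i k = ≤-trans (≤-reflexive (sym (start F k))) (Λ-inc k z≤n)

    -- The multiplicity of `k` in row `i` is read off from the chain as the growth of row `k` in
    -- step `i`; the sums agree with the count `M` of a picture by the identity `M-prefix`.
    M : ℕ → ℕ → ℕ
    M i zero = pt β i
    M i (suc k) = M i k + (Λ (suc i) k ∸ Λ i k)

    M-Λ : ∀ i k → M i (suc k) + Λ i k ≡ M i k + Λ (suc i) k
    M-Λ i k = trans (+-assoc (M i k) _ _) (cong (M i k +_) (m∸n+n≡m (proj₁ (strip F i k))))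

    M-inc : ∀ i {k k′} → k ≤ k′ → M i k ≤ M i k′
    M-inc i = inc-≤ {M i} (λ k → m≤m+n (M i k) (Λ (suc i) k ∸ Λ i k))

    M-prefix : ∀ i n → pt β i + prefix (Λ (suc i)) n ≡ M i n + prefix (Λ i) n
    M-prefix i zero = refl
    M-prefix i (suc n) = lia 7 (λ b p q m m⁺ x y → b ⊞ p ≐ m ⊞ q ⇒ m⁺ ⊞ y ≐ m ⊞ x ⇒ [ 1101 ∣ 10011 ]⊢ b ⊞ (p ⊞ x) ≐ m⁺ ⊞ (q ⊞ y))
      (pt β i) (prefix (Λ (suc i)) n) (prefix (Λ i) n) (M i n) (M i (suc n)) (Λ (suc i) n) (Λ i n) (M-prefix i n) (M-Λ i n)

    M-end : ∀ i → ∃[ n ] M i n ≡ pt α i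
    M-end i = let (n , h) = total F i in n , +-cancelʳ-≡ (prefix (Λ i) n) _ _ (trans (sym (M-prefix i n)) (h n ≤-refl))

    M≤α : ∀ i k → M i k ≤ pt α i
    M≤α i k = let (n , h) = total F i in
      ≤-trans (M-inc i {k} {k + n} (m≤m+n k n)) (≤-reflexive (+-cancelʳ-≡ (prefix (Λ i) (k + n)) _ _ (trans (sym (M-prefix i (k + n))) (h (k + n) (m≤n+m n k)))))

    M-col : ∀ i k → M (suc i) (suc k) ≤ M i k
    M-col i k = lia 8 (λ b b⁺ p₀ p₁ p₁⁺ p₂ m m⁺ → b ⊞ p₁ ≐ m ⊞ p₀ ⇒ b⁺ ⊞ p₂ ≐ m⁺ ⊞ p₁⁺ ⇒ b⁺ ⊞ p₂ ⊞ p₀ ≼ b ⊞ p₁ ⊞ p₁⁺ ⇒ [ 11011 ]⊢ m⁺ ≼ m)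
      (pt β i) (pt β (suc i)) (prefix (Λ i) k) (prefix (Λ (suc i)) k) (prefix (Λ (suc i)) (suc k)) (prefix (Λ (suc (suc i))) (suc k)) (M i k) (M (suc i) (suc k))
      (M-prefix i k) (M-prefix (suc i) (suc k)) (strict F i k)

    -- The first two fields say that column `j` of row `i` has entry `k`. The third sends the boxes
    -- with this entry to the new boxes of row `k` in reversed order: the rightmost of them, in
    -- column `M i (suc k)`, goes to the first new column `suc (Λ i k)`.
    record Place (i j k l : ℕ) : Set where
      constructor place
      field
        lower : M i k < j
        upper : j ≤ M i (suc k)
        sum   : l + j ≡ suc (Λ i k + M i (suc k))
    open Place

    between : ∀ {i j k l} → Place i j k l → Λ i k < l × l ≤ Λ (suc i) k
    between {i} {j} {k} {l} (place p q s) =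
      lia 6 (λ l j x y m m⁺ → m ≺ j ⇒ j ≼ m⁺ ⇒ l ⊞ j ≐ K 1 ⊞ (x ⊞ m⁺) ⇒ m⁺ ⊞ x ≐ m ⊞ y ⇒ [ 110001 ]⊢ x ≺ l & [ 1001011 ]⊢ l ≼ y)
        l j (Λ i k) (Λ (suc i) k) (M i k) (M i (suc k)) p q s (M-Λ i k)

    in-source : ∀ {i j k l} → Place i j k l → InSkew α β i j
    in-source {i} {j} {k} (place p q _) = ≤-<-trans (M-inc i {0} {k} z≤n) p , ≤-trans q (M≤α i (suc k))

    in-target : ∀ {i j k l} → Place i j k l → InSkew γ δ k l
    in-target {i} {j} {k} a = ≤-<-trans (δ≤Λ i k) (proj₁ (between a)) , ≤-trans (proj₂ (between a)) (Λ≤γ (suc i) k)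

    exists : ∀ {i j} → InSkew α β i j → ∃[ k ] ∃[ l ] Place i j k l
    exists {i} {j} (p , q) =
      let (n , e) = M-end i
          (k , _ , a , b) = search-interval (M i) n j p (subst (j ≤_) (sym e) q)
      in k , _ , place a b (m∸n+n≡m {suc (Λ i k + M i (suc k))} {j} (≤-trans b (≤-trans (m≤n+m _ (Λ i k)) (n≤1+n _))))

    covers : ∀ {k l} → InSkew γ δ k l → ∃[ i ] ∃[ j ] Place i j k l
    covers {k} {l} (p , q) =
      let (i , _ , a , b) = search-interval (λ i → Λ i k) (length α) l (subst (_< l) (sym (start F k)) p) (subst (l ≤_) (sym (end F (length α) ≤-refl k)) q)
          s = m∸n+n≡m {suc (Λ i k + M i (suc k))} {l} (≤-trans b (lia 4 (λ x y m m⁺ → m⁺ ⊞ x ≐ m ⊞ y ⇒ [ 101 ]⊢ y ≼ K 1 ⊞ (x ⊞ m⁺)) (Λ i k) (Λ (suc i) k) (M i k) (M i (suc k)) (M-Λ i k)))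
          j = suc (Λ i k + M i (suc k)) ∸ l
          (c , d) = lia 6 (λ l j x y m m⁺ → x ≺ l ⇒ l ≼ y ⇒ j ⊞ l ≐ K 1 ⊞ (x ⊞ m⁺) ⇒ m⁺ ⊞ x ≐ m ⊞ y ⇒ [ 110101 ]⊢ m ≺ j & [ 1001001 ]⊢ j ≼ m⁺)
            l j (Λ i k) (Λ (suc i) k) (M i k) (M i (suc k)) a b s (M-Λ i k)
      in i , j , place c d (trans (+-comm l j) s)

    letter-≤ : ∀ {i j j′ k l k′ l′} → Place i j k l → Place i j′ k′ l′ → j′ ≤ j → k′ ≤ k
    letter-≤ {i} a b le = ≮⇒≥ (λ k<k′ → <⇒≱ (lower b) (≤-trans le (≤-trans (upper a) (M-inc i {_} {_} k<k′))))

    Place-functional : ∀ {i j k l k′ l′} → Place i j k l → Place i j k′ l′ → k ≡ k′ × l ≡ l′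
    Place-functional {i} {j} a b with ≤-antisym (letter-≤ b a ≤-refl) (letter-≤ a b ≤-refl)
    ... | refl = refl , +-cancelʳ-≡ j _ _ (trans (sum a) (sym (sum b)))

    early-≤ : ∀ {i j i′ j′ k l l′} → Place i j k l → Place i′ j′ k l′ → l ≤ l′ → i ≤ i′
    early-≤ {k = k} a b le = ≮⇒≥ (λ i′<i → <⇒≱ (proj₁ (between a)) (≤-trans le (≤-trans (proj₂ (between b)) (Λ-inc k i′<i))))

    Place-injective : ∀ {i j i′ j′ k l} → Place i j k l → Place i′ j′ k l → i ≡ i′ × j ≡ j′
    Place-injective {k = k} {l} a b with ≤-antisym (early-≤ a b ≤-refl) (early-≤ b a ≤-refl)
    ... | refl = refl , +-cancelˡ-≡ l _ _ (trans (sum a) (sym (sum b)))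

    Place-right : ∀ {i j i′ j′ k l} → Place i j k l → Place i′ j′ k (suc l) → Before i j i′ j′
    Place-right {i} {j} {i′} {j′} {k} {l} a b with m≤n⇒m<n∨m≡n (early-≤ a b (n≤1+n l))
    ... | inj₁ lt = inj₁ lt
    ... | inj₂ refl = inj₂ (refl , lia 4 (λ l j j′ s → l ⊞ j ≐ s ⇒ K 1 ⊞ l ⊞ j′ ≐ s ⇒ [ 10011 ]⊢ j′ ≺ j) l j j′ _ (sum a) (sum b))

    Place-down : ∀ {i j i′ j′ k l} → Place i j k l → Place i′ j′ (suc k) l → Before i j i′ j′
    Place-down {i} {j} {i′} {j′} {k} {l} a b = inj₁ (≰⇒> (λ i′≤i → <⇒≱ (proj₁ (between a))
      (≤-trans (proj₂ (between b)) (≤-trans (proj₂ (strip F i′ k)) (Λ-inc k i′≤i)))))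

    Place-row : ∀ {i j j′ k l k′ l′} → Place i j k l → Place i j′ k′ l′ → j′ < j → l < l′ × k′ ≤ k
    Place-row {i} {j} {j′} {k} {l} {k′} {l′} a b lt = further (m≤n⇒m<n∨m≡n k′≤k) , k′≤k
      where
      k′≤k : k′ ≤ k
      k′≤k = letter-≤ a b (<⇒≤ lt)
      further : k′ < k ⊎ k′ ≡ k → l < l′
      further (inj₁ k′<k) = ≤-<-trans (proj₂ (between a)) (≤-<-trans (Λ-dec (suc i) k′<k) (≤-<-trans (proj₂ (strip F i k′)) (proj₁ (between b))))
      further (inj₂ refl) = lia 5 (λ l l′ j j′ s → l ⊞ j ≐ s ⇒ l′ ⊞ j′ ≐ s ⇒ j′ ≺ j ⇒ [ 11011 ]⊢ l ≺ l′) l l′ j j′ _ (sum a) (sum b) lt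

    -- Λ i k + M i (k + 1) is weakly decreasing in k, since it is at least Λ (i + 1) (k + 1) + M i (k + 1)
    slope : ∀ i {k k′} → k ≤ k′ → Λ i k′ + M i (suc k′) ≤ Λ i k + M i (suc k)
    slope i = dec-≤ {λ k → Λ i k + M i (suc k)} (λ k → lia 5 (λ x x⁺ y⁺ m⁺ m⁺⁺ → m⁺⁺ ⊞ x⁺ ≐ m⁺ ⊞ y⁺ ⇒ y⁺ ≼ x ⇒ [ 111 ]⊢ x⁺ ⊞ m⁺⁺ ≼ x ⊞ m⁺)
      (Λ i k) (Λ i (suc k)) (Λ (suc i) (suc k)) (M i (suc k)) (M i (suc (suc k))) (M-Λ i (suc k)) (proj₂ (strip F i k)))

    Place-col : ∀ {i j k l k′ l′} → Place i j k l → Place (suc i) j k′ l′ → k < k′ × l′ ≤ l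
    Place-col {i} {j} {k} {l} {k′} {l′} a b = k<k′ , further k′ k<k′ b
      where
      k<k′ : k < k′
      k<k′ = ≰⇒> (λ k′≤k → <⇒≱ (lower a) (≤-trans (upper b) (≤-trans (M-inc (suc i) (s≤s k′≤k)) (M-col i k))))
      further : ∀ k′ → k < k′ → Place (suc i) j k′ l′ → l′ ≤ l
      further (suc k′) (s≤s le) b = lia 9 (λ l l′ j x m y m′ z w → l ⊞ j ≐ K 1 ⊞ (x ⊞ m) ⇒ l′ ⊞ j ≐ K 1 ⊞ (y ⊞ m′) ⇒ y ≼ z ⇒ m′ ≼ w ⇒ z ⊞ w ≼ x ⊞ m ⇒ [ 10011111 ]⊢ l′ ≼ l)
        l l′ j (Λ i k) (M i (suc k)) (Λ (suc i) (suc k′)) (M (suc i) (suc (suc k′))) (Λ i k′) (M i (suc k′))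
        (sum a) (sum b) (proj₂ (strip F i k′)) (M-col i (suc k′)) (slope i le)

    -- The dam is the row rule for the leftmost box of the row. For the boxes to its right the rule
    -- asks for less, because the column grows.
    flagged : ∀ {i j k l} → Place i j k l → ρ + suc i ≤ k + j
    flagged {i} {j} {k} a = lia 5 (λ ρ i k j b → ρ ⊞ i ≼ b ⊞ k ⇒ b ≺ j ⇒ [ 111 ]⊢ ρ ⊞ (K 1 ⊞ i) ≼ k ⊞ j) ρ i k j (pt β i) (undammed (≮⇒≥ blocked)) (proj₁ (in-source a))
      where
      blocked : k < dam ρ i (pt β i) → ⊥
      blocked h = <-irrefl (sym (flag F i k h)) (<-≤-trans (proj₁ (between a)) (proj₂ (between a)))
      undammed : dam ρ i (pt β i) ≤ k → ρ + i ≤ pt β i + k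
      undammed h = ≤-trans (m≤n+m∸n (ρ + i) (pt β i)) (+-monoʳ-≤ (pt β i) h)

-- The tableau belonging to a filling.

module FillingToArrow where

  open Step using (Fn)
  open Chain using (_≗_; Filling)
  open Shape
  open Picture
  open Tableau
  open ArrowToFilling

  zip-unique-ʳ : ∀ {A B : Set} {xs : List A} {ys : List B} → length xs ≡ length ys → Unique xs →
    (∀ {x x′ y} → (x , y) ∈ zip xs ys → (x′ , y) ∈ zip xs ys → x ≡ x′) → Unique ys
  zip-unique-ʳ {xs = []} {[]} e u h = []
  zip-unique-ʳ {xs = x ∷ xs} {y ∷ ys} e (n ∷ u) h =
    All.tabulate (λ { y∈ refl → let (x′ , p) = zip-origin (suc-injective e) y∈ in All.lookup n (zip-∈ˡ p) (h (here refl) (there p)) })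
    ∷ zip-unique-ʳ (suc-injective e) u (λ p q → h (there p) (there q))

  module Decoded (ρ : ℕ) (α β γ δ : Part) (pα : IsP α) (pβ : IsP β) (pγ : IsP γ) (pδ : IsP δ) (β⊑α : β ⊑ α) (δ⊑γ : δ ⊑ γ)
                 (Λ : ℕ → Fn) (F : Filling ρ (length α) (pt α) (pt β) (pt δ) (pt γ) Λ) where

    open Decoding ρ α β γ δ pα pβ pγ pδ β⊑α δ⊑γ Λ F

    data Placed : Box → Box → Set where
      placed : ∀ {i j k l} → Place i j k l → Placed (suc i , j) (suc k , l)

    private
      all-placed : ∀ {b} → b ∈ rl α β → ∃[ x ] Placed b x
      all-placed {b} b∈ with ∈-rl⁻ {α} {β} b∈
      ... | (i , refl , s) = let (k , l , p) = exists s in (suc k , l) , placed p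

      chosen = choose (rl α β) all-placed

    tab : Tab
    tab = proj₁ chosen

    len : length (rl α β) ≡ length tab
    len = proj₁ (proj₂ chosen)

    spec : ∀ {b x} → (b , x) ∈ zip (rl α β) tab → Placed b x
    spec = proj₂ (proj₂ chosen)

    At⇒Place : ∀ {i j k l} → At (zip (rl α β) tab) i j k l → Place i j k l
    At⇒Place a with spec a
    ... | placed p = p

    Place⇒At : ∀ {i j k l} → Place i j k l → At (zip (rl α β) tab) i j k l
    Place⇒At {i} {j} p with zip-image len (∈-rl⁺ {α} {β} (in-source p))
    ... | (x , x∈) with spec x∈
    ... | placed q with Place-functional p q
    ... | (refl , refl) = x∈

    tab-unique : Unique tab
    tab-unique = zip-unique-ʳ len (rl-unique α β) (λ p q → inj (spec p) (spec q))
      where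
      inj : ∀ {b b′ x} → Placed b x → Placed b′ x → b ≡ b′
      inj (placed p) (placed q) = let (e , e′) = Place-injective p q in cong₂ (λ i j → suc i , j) e e′

    tab-perm : tab ↭ boxes γ δ
    tab-perm = Unique-↭ tab-unique (boxes-unique γ δ) to from
      where
      box : ∀ {b x} → Placed b x → x ∈ boxes γ δ
      box (placed p) = ∈-boxes⁺ {γ} {δ} (in-target p)
      to : ∀ {x} → x ∈ tab → x ∈ boxes γ δ
      to x∈ = box (spec (proj₂ (zip-origin len x∈)))
      from : ∀ {x} → x ∈ boxes γ δ → x ∈ tab
      from x∈ with ∈-boxes⁻ {γ} {δ} x∈
      ... | (k , refl , s) = zip-∈ʳ (Place⇒At (proj₂ (proj₂ (covers s))))

    tab-picture : Picture α β γ δ (At (zip (rl α β) tab))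
    tab-picture = record
      { source = in-source ∘ At⇒Place ; target = in-target ∘ At⇒Place
      ; image = λ s → let (k , l , p) = exists s in k , l , Place⇒At p
      ; origin = λ s → let (i , j , p) = covers s in i , j , Place⇒At p
      ; functional = λ a b → Place-functional (At⇒Place a) (At⇒Place b)
      ; injective = λ a b → Place-injective (At⇒Place a) (At⇒Place b)
      ; right = λ a b → Place-right (At⇒Place a) (At⇒Place b)
      ; down = λ a b → Place-down (At⇒Place a) (At⇒Place b)
      ; rowwise = λ a b → Place-row (At⇒Place a) (At⇒Place b)
      ; colwise = λ a b → Place-col (At⇒Place a) (At⇒Place b) }

    tab-RW : T (RW γ δ α β tab)
    tab-RW = proj₂ (Conversion.complete-RW α β γ δ tab tab-perm len tab-picture)

    tab-rule : T (rowRule (suc ρ) α β tab)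
    tab-rule = ⇒rule ρ α β tab (Conversion.suc-form α β γ δ tab tab-perm) (flagged ∘ At⇒Place)

    tab-Λ : ∀ i → Encoding.Of.Λ α β γ δ pα pβ pγ pδ β⊑α δ⊑γ tab tab-RW i ≗ Λ i
    tab-Λ = Encoding.Of.Λ-unique α β γ δ pα pβ pγ pδ β⊑α δ⊑γ tab tab-RW Λ δ≤Λ Λ≤γ
      (λ {i₀} {j} {k} a i i₀<i → ≤-trans (proj₂ (between (At⇒Place a))) (Λ-inc k i₀<i))
      (λ {i₀} {j} {k} a i le → ≰⇒> (λ i≤i₀ → <⇒≱ (proj₁ (between (At⇒Place a))) (≤-trans le (Λ-inc k i≤i₀))))

-- Vertical strips listed by rows, and a single slide of such a strip.

module Strips where

  open Step using (Fn; VStrip)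
  open Shape
  open Tableau

  sorted-ext : ∀ {A : Set} {_⊏_ : A → A → Set} {xs ys : List A} → (∀ {x y} → x ⊏ y → y ⊏ x → ⊥) → AllPairs _⊏_ xs → AllPairs _⊏_ ys →
    (∀ {x} → x ∈ xs → x ∈ ys) → (∀ {x} → x ∈ ys → x ∈ xs) → xs ≡ ys
  sorted-ext {xs = []} {[]} asym _ _ f g = refl
  sorted-ext {xs = []} {y ∷ ys} asym _ _ f g with g (here refl)
  ... | ()
  sorted-ext {xs = x ∷ xs} {[]} asym _ _ f g with f (here refl)
  ... | ()
  sorted-ext {_⊏_ = _⊏_} {x ∷ xs} {y ∷ ys} asym (p ∷ ps) (q ∷ qs) f g = cong₂ _∷_ x≡y
    (sorted-ext asym ps qs (λ z∈ → skip (f (there z∈)) (λ e → irrefl (All.lookup p z∈) (trans x≡y (sym e))))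
                           (λ z∈ → skip (g (there z∈)) (λ e → irrefl (All.lookup q z∈) (trans (sym x≡y) (sym e)))))
    where
    irrefl : ∀ {a b} → a ⊏ b → a ≡ b → ⊥
    irrefl r refl = asym r r
    skip : ∀ {A : Set} {z w : A} {ws} → z ∈ w ∷ ws → z ≢ w → z ∈ ws
    skip (here e) n = ⊥-elim (n e)
    skip (there z∈) n = z∈
    first : x ∈ y ∷ ys → y ∈ x ∷ xs → x ≡ y
    first (here e) _ = e
    first (there _) (here e) = sym e
    first (there a) (there b) = ⊥-elim (asym (All.lookup q a) (All.lookup p b))
    x≡y = first (f (here refl)) (g (here refl))

  -- Vertical strips by rows

  strip? : ℕ → ℕ → Fn → Fn → List ℕ
  strip? zero k m u = []
  strip? (suc n) k m u = if m k <ᵇ u k then k ∷ strip? n (suc k) m u else strip? n (suc k) m u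

  ∈-strip?⁻ : ∀ n k m u {y} → y ∈ strip? n k m u → k ≤ y × m y < u y
  ∈-strip?⁻ (suc n) k m u y∈ with m k <ᵇ u k in e
  ∈-strip?⁻ (suc n) k m u (here refl) | true = ≤-refl , <ᵇ⇒< (m k) (u k) (subst T (sym e) tt)
  ∈-strip?⁻ (suc n) k m u (there y∈) | true = let (p , q) = ∈-strip?⁻ n (suc k) m u y∈ in <⇒≤ p , q
  ∈-strip?⁻ (suc n) k m u y∈ | false = let (p , q) = ∈-strip?⁻ n (suc k) m u y∈ in <⇒≤ p , q

  ∈-strip?⁺ : ∀ n k m u {y} → k ≤ y → y < n + k → m y < u y → y ∈ strip? n k m u
  ∈-strip?⁺ zero k m u p q r = ⊥-elim (<⇒≱ q p)
  ∈-strip?⁺ (suc n) k m u {y} p q r with m k <ᵇ u k in e | m≤n⇒m<n∨m≡n p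
  ... | true | inj₂ refl = here refl
  ... | true | inj₁ lt = there (∈-strip?⁺ n (suc k) m u lt (subst (y <_) (sym (+-suc n k)) q) r)
  ... | false | inj₂ refl = ⊥-elim (subst T e (<⇒<ᵇ r))
  ... | false | inj₁ lt = ∈-strip?⁺ n (suc k) m u lt (subst (y <_) (sym (+-suc n k)) q) r

  strip?-sorted : ∀ n k m u → AllPairs _<_ (strip? n k m u)
  strip?-sorted zero k m u = []
  strip?-sorted (suc n) k m u with m k <ᵇ u k
  ... | true = All.tabulate (λ y∈ → proj₁ (∈-strip?⁻ n (suc k) m u y∈)) ∷ strip?-sorted n (suc k) m u
  ... | false = strip?-sorted n (suc k) m u

  cell : Fn → ℕ → Box
  cell m k = (suc k , suc (m k))

  ≺ᵇ-asym : ∀ {b c} → b ≺ᵇ c → c ≺ᵇ b → ⊥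
  ≺ᵇ-asym (inj₁ p) (inj₁ q) = <-asym p q
  ≺ᵇ-asym (inj₁ p) (inj₂ (e , _)) = <-irrefl (sym e) p
  ≺ᵇ-asym (inj₂ (e , _)) (inj₁ q) = <-irrefl (sym e) q
  ≺ᵇ-asym (inj₂ (_ , p)) (inj₂ (_ , q)) = <-asym p q

  module _ (α β : Part) (vs : VStrip (pt β) (pt α)) (n : ℕ) (n≥ : length α ≤ n) where

    private
      cells = map (cell (pt β)) (strip? n 0 (pt β) (pt α))

      col-of : ∀ k {j} → InSkew α β k j → j ≡ suc (pt β k)
      col-of k (p , q) = ≤-antisym (≤-trans q (proj₂ (vs k))) p

      in-cells : ∀ k {j} → InSkew α β k j → (suc k , j) ∈ cells
      in-cells k s@(p , q) = subst (λ j → (suc k , j) ∈ cells) (sym (col-of k s))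
        (∈-map⁺ (cell (pt β)) (∈-strip?⁺ n 0 (pt β) (pt α) z≤n (subst (k <_) (sym (+-identityʳ n)) (<-≤-trans (short k (≤-<-trans z≤n p) q) n≥)) (<-≤-trans p q)))
        where
        short : ∀ k {j} → 0 < j → j ≤ pt α k → k < length α
        short k p q = ≰⇒> (λ h → <⇒≱ p (subst (_ ≤_) (pt-vanish α k h) q))

      out-cells : ∀ {x} → x ∈ cells → ∃[ k ] (x ≡ cell (pt β) k × InSkew α β k (suc (pt β k)))
      out-cells x∈ = let (k , k∈ , e) = ∈-map⁻ (cell (pt β)) x∈ in k , e , ≤-refl , proj₂ (∈-strip?⁻ n 0 (pt β) (pt α) k∈)

    boxes-strip : boxes α β ≡ cells
    boxes-strip = sorted-ext {_⊏_ = _≺ᵇ_} ≺ᵇ-asym (boxes-sorted α β) (AP.map⁺ (AllPairs.map (inj₁ ∘ s≤s) (strip?-sorted n 0 (pt β) (pt α)))) to from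
      where
      to : ∀ {x} → x ∈ boxes α β → x ∈ cells
      to x∈ with ∈-boxes⁻ {α} {β} x∈
      ... | (k , refl , s) = in-cells k s
      from : ∀ {x} → x ∈ cells → x ∈ boxes α β
      from x∈ with out-cells x∈
      ... | (k , refl , s) = ∈-boxes⁺ {α} {β} s

    -- Each row has at most one box, so reading rows from the right or from the left gives the same
    -- list, which is also that of `boxes-strip`.
    rl-strip : rl α β ≡ cells
    rl-strip = sorted-ext {_⊏_ = _≺ᵣ_} ≺ᵣ-asym (rl-sorted α β) (AP.map⁺ (AllPairs.map (inj₁ ∘ s≤s) (strip?-sorted n 0 (pt β) (pt α)))) to from
      where
      to : ∀ {x} → x ∈ rl α β → x ∈ cells
      to x∈ with ∈-rl⁻ {α} {β} x∈
      ... | (k , refl , s) = in-cells k s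
      from : ∀ {x} → x ∈ cells → x ∈ rl α β
      from x∈ with out-cells x∈
      ... | (k , refl , s) = ∈-rl⁺ {α} {β} s

  -- Sliding a vertical strip into a box

  AboveRow : ℕ → List Box → Set
  AboveRow i = All (λ x → row x < i)

  BelowRow : ℕ → List Box → Set
  BelowRow i = All (λ x → i < row x)

  indexOf-skip : ∀ b pre t → AboveRow (row b) pre → indexOf b (pre ++ t) ≡ Maybe.map (length pre +_) (indexOf b t)
  indexOf-skip b [] t [] = sym (map-id (indexOf b t))
    where
    map-id : (m : Maybe ℕ) → Maybe.map (0 +_) m ≡ m
    map-id (just x) = refl
    map-id nothing = refl
  indexOf-skip b (x ∷ pre) t (p ∷ ps) with eqBox b x in e
  ... | true = ⊥-elim (<-irrefl (cong proj₁ (sym (eqBox⇒≡ b x (subst T (sym e) tt)))) p)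
  ... | false = trans (cong (Maybe.map suc) (indexOf-skip b pre t ps)) (map-map (indexOf b t))
    where
    map-map : (m : Maybe ℕ) → Maybe.map suc (Maybe.map (length pre +_) m) ≡ Maybe.map (suc (length pre) +_) m
    map-map (just x) = refl
    map-map nothing = refl

  indexOf-none : ∀ b t → b ∉ t → indexOf b t ≡ nothing
  indexOf-none b [] n = refl
  indexOf-none b (x ∷ t) n with eqBox b x in e
  ... | true = ⊥-elim (n (here (eqBox⇒≡ b x (subst T (sym e) tt))))
  ... | false = cong (Maybe.map suc) (indexOf-none b t (n ∘ there))

  indexOf-first : ∀ b t → indexOf b (b ∷ t) ≡ just 0
  indexOf-first b t with eqBox b b in e
  ... | true = refl
  ... | false = ⊥-elim (subst T e (eqBox-refl b))

  setAt-skip : ∀ (pre : List Box) {x y t} → setAt (length pre + 0) y (pre ++ x ∷ t) ≡ pre ++ y ∷ t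
  setAt-skip [] = refl
  setAt-skip (z ∷ pre) = cong (z ∷_) (setAt-skip pre)

  below-∉ : ∀ {i j t} → BelowRow i t → (i , j) ∉ t
  below-∉ h x∈ = <-irrefl refl (All.lookup h x∈)

  slide-stop : ∀ f i j t → indexOf (i , suc j) t ≡ nothing → indexOf (suc i , j) t ≡ nothing → slideLoop f (i , j) t ≡ t
  slide-stop zero i j t e e′ = refl
  slide-stop (suc f) i j t e e′ rewrite e | e′ = refl

  slide-down : ∀ f i j t b → indexOf (i , suc j) t ≡ nothing → indexOf (suc i , j) t ≡ just b →
               slideLoop (suc f) (i , j) t ≡ slideLoop f (suc i , j) (setAt b (i , j) t)
  slide-down f i j t b e e′ rewrite e | e′ = refl

  slide-right : ∀ f i j t a → indexOf (i , suc j) t ≡ just a → (∀ b → indexOf (suc i , j) t ≡ just b → a < b) →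
                slideLoop (suc f) (i , j) t ≡ slideLoop f (i , suc j) (setAt a (i , j) t)
  slide-right f i j t a e h with indexOf (i , suc j) t | indexOf (suc i , j) t
  slide-right f i j t a refl h | just .a | nothing = refl
  slide-right f i j t a refl h | just .a | just b with a <ᵇ b in e
  ... | true = refl
  ... | false = ⊥-elim (subst T e (<⇒<ᵇ (h b refl)))

  -- The effect of a slide whose hole never has a right neighbour: the hole runs down its column as
  -- long as the boxes follow without a gap.
  moveUp : Box → List Box → List Box
  moveUp c [] = []
  moveUp c (x ∷ t) = if eqBox x (suc (row c) , col c) then c ∷ moveUp x t else x ∷ t

  RowSorted : List Box → Set
  RowSorted = AllPairs (λ x y → row x < row y)

  -- The boxes of `pre` lie above the hole and those of `t` below it, one per row. So the place to
  -- the right of the hole is always empty, and `pre` grows by every box that has moved up.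
  slideLoop-shift : ∀ f i j pre t → length t < f → AboveRow i pre → BelowRow i t → RowSorted t →
                    slideLoop f (i , j) (pre ++ t) ≡ pre ++ moveUp (i , j) t
  slideLoop-shift f i j pre [] lt ab _ _ = slide-stop f i j (pre ++ [])
    (indexOf-skip (i , suc j) pre [] ab) (indexOf-skip (suc i , j) pre [] (All.map m≤n⇒m≤1+n ab))
  slideLoop-shift (suc f) i j pre (x ∷ t) (s≤s lt) ab (bx ∷ bt) (sx ∷ st) with eqBox x (suc i , j) in e
  ... | true = hit (eqBox⇒≡ x (suc i , j) (subst T (sym e) tt))
    where
    hit : x ≡ (suc i , j) → slideLoop (suc f) (i , j) (pre ++ x ∷ t) ≡ pre ++ (i , j) ∷ moveUp x t
    hit refl = trans (slide-down f i j (pre ++ x ∷ t) (length pre + 0)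
        (trans (indexOf-skip (i , suc j) pre (x ∷ t) ab) (cong (Maybe.map (length pre +_)) (indexOf-none (i , suc j) (x ∷ t) (below-∉ (bx ∷ bt)))))
        (trans (indexOf-skip (suc i , j) pre (x ∷ t) (All.map m≤n⇒m≤1+n ab)) (cong (Maybe.map (length pre +_)) (indexOf-first (suc i , j) t))))
      (trans (cong (slideLoop f (suc i , j)) (trans (setAt-skip pre) (sym (++-assoc pre ((i , j) ∷ []) t))))
      (trans (slideLoop-shift f (suc i) j (pre ++ (i , j) ∷ []) t lt (AllP.++⁺ (All.map m≤n⇒m≤1+n ab) (≤-refl ∷ [])) sx st)
             (++-assoc pre ((i , j) ∷ []) _)))
  ... | false = slide-stop (suc f) i j (pre ++ x ∷ t)
        (trans (indexOf-skip (i , suc j) pre (x ∷ t) ab) (cong (Maybe.map (length pre +_)) (indexOf-none (i , suc j) (x ∷ t) (below-∉ (bx ∷ bt)))))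
        (trans (indexOf-skip (suc i , j) pre (x ∷ t) (All.map m≤n⇒m≤1+n ab)) (cong (Maybe.map (length pre +_)) (indexOf-none (suc i , j) (x ∷ t) miss)))
    where
    miss : (suc i , j) ∉ x ∷ t
    miss (here refl) = subst T e (eqBox-refl (suc i , j))
    miss (there p) = <⇒≱ (All.lookup sx p) bx

  -- Labels increase downwards in a vertical strip, hence the right neighbour wins against a box
  -- below the hole. After this move the hole has neither a right nor a lower neighbour, and the
  -- slide ends.
  slideLoop-left : ∀ f i j pre t → AboveRow i pre → BelowRow i t → (suc i , suc j) ∉ t →
                   slideLoop (suc f) (i , j) (pre ++ (i , suc j) ∷ t) ≡ pre ++ (i , j) ∷ t
  slideLoop-left f i j pre t ab bt n = trans
    (slide-right f i j (pre ++ (i , suc j) ∷ t) (length pre + 0)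
      (trans (indexOf-skip (i , suc j) pre _ ab) (cong (Maybe.map (length pre +_)) (indexOf-first (i , suc j) t))) later)
    (trans (cong (slideLoop f (i , suc j)) (setAt-skip pre))
      (slide-stop f i (suc j) (pre ++ (i , j) ∷ t)
        (trans (indexOf-skip (i , suc (suc j)) pre _ ab) (cong (Maybe.map (length pre +_)) (indexOf-none _ _ stop-right)))
        (trans (indexOf-skip (suc i , suc j) pre _ (All.map m≤n⇒m≤1+n ab)) (cong (Maybe.map (length pre +_)) (indexOf-none _ _ stop-down)))))
    where
    stop-right : (i , suc (suc j)) ∉ (i , j) ∷ t
    stop-right (here ())
    stop-right (there p) = below-∉ bt p
    stop-down : (suc i , suc j) ∉ (i , j) ∷ t
    stop-down (here ())
    stop-down (there p) = n p
    eqBox-ne : eqBox (suc i , j) (i , suc j) ≡ false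
    eqBox-ne with eqBox (suc i , j) (i , suc j) in e
    ... | false = refl
    ... | true = ⊥-elim (1+n≢n (cong proj₁ (eqBox⇒≡ (suc i , j) (i , suc j) (subst T (sym e) tt))))
    later : ∀ b → indexOf (suc i , j) (pre ++ (i , suc j) ∷ t) ≡ just b → length pre + 0 < b
    later b h = go (indexOf (suc i , j) t) refl (trans (sym (indexOf-skip (suc i , j) pre _ (All.map m≤n⇒m≤1+n ab))) h)
      where
      go : ∀ m → indexOf (suc i , j) t ≡ m → Maybe.map (length pre +_) (indexOf (suc i , j) ((i , suc j) ∷ t)) ≡ just b → length pre + 0 < b
      go m e h rewrite eqBox-ne | e with m | h
      ... | just a | refl = +-monoʳ-< (length pre) (s≤s z≤n)

-- Sliding one vertical strip through another.

module Sliding where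

  open Linear using (∧-T)
  open Step using (Fn; Decreasing; VStrip; Linked)
  open Shape
  open Strips

  module SlideStrip (μ l γ : Fn) (μ-dec : Decreasing μ) (γ-dec : Decreasing γ) (v : VStrip μ l) (w : VStrip l γ) where

    -- (y , z): the box of γ/l in row z has been slid to row y
    Mark : Set
    Mark = ℕ × ℕ

    -- The hole is the first box of row `k` outside `μ`. A slid box of the next row occupies the
    -- first place outside `μ` there, so it lies directly below the hole exactly when `μ` has equal
    -- rows; it then leaves a hole of the same kind.
    up : ℕ → List Mark → List Mark
    up k [] = []
    up k ((y , z) ∷ t) = if (y ≡ᵇ suc k) ∧ (μ y ≡ᵇ μ k) then (k , z) ∷ up y t else (y , z) ∷ t

    -- Holes are filled from the bottom upwards, as in `Slide`. If row `k` has a box of `γ / l`,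
    -- this box ends at the first place outside `μ`, after a move to the left if there is a hole. If
    -- it has only a hole, the boxes below may move up.
    marks : ℕ → ℕ → List Mark
    marks zero k = []
    marks (suc n) k with l k <ᵇ γ k | μ k <ᵇ l k
    ... | true | _ = (k , k) ∷ marks n (suc k)
    ... | false | true = up k (marks n (suc k))
    ... | false | false = marks n (suc k)

    -- By `link`, each passage of a box from row `suc z` to row `z` happens between linked rows of
    -- `γ / μ`. This is the fact that ties the reverse row rule to linkedness at the dams.
    record Good (k : ℕ) (m : Mark) : Set where
      field
        low  : k ≤ proj₁ m
        rise : proj₁ m ≤ proj₂ m
        room : suc (μ (proj₁ m)) ≤ γ (proj₁ m)
        link : ∀ z → proj₁ m ≤ z → z < proj₂ m → Linked μ γ z
    open Good public

    weaken : ∀ {k m} → Good (suc k) m → Good k m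
    weaken g = record { low = <⇒≤ (low g) ; rise = rise g ; room = room g ; link = link g }

    Sorted : List Mark → Set
    Sorted = AllPairs (λ m m′ → proj₁ m < proj₁ m′)

    -- no gaps in the part of the inner shape that has been filled
    Full : ℕ → List Mark → Set
    Full k t = ∀ y {z} → k ≤ y → (suc y , z) ∈ t → μ (suc y) ≡ μ y → ∃[ z′ ] ((y , z′) ∈ t)

    record Inv (k : ℕ) (t : List Mark) : Set where
      field
        good   : All (Good k) t
        sorted : Sorted t
        full   : Full k t
    open Inv public

    hit : ∀ {y k} → T ((y ≡ᵇ suc k) ∧ (μ y ≡ᵇ μ k)) → y ≡ suc k × μ (suc k) ≡ μ k
    hit {y} {k} h with ∧-T {y ≡ᵇ suc k} h
    ... | (p , q) with ≡ᵇ⇒≡ y (suc k) p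
    ... | refl = refl , ≡ᵇ⇒≡ (μ (suc k)) (μ k) q

    up-inv : ∀ k t → γ k ≡ suc (μ k) → Inv (suc k) t → Inv k (up k t)
    up-inv k [] e I = record { good = [] ; sorted = [] ; full = λ _ _ () }
    up-inv k ((y , z) ∷ t) e I with (y ≡ᵇ suc k) ∧ (μ y ≡ᵇ μ k) in eq
    ... | false = record { good = All.map weaken (good I) ; sorted = sorted I ; full = full′ }
      where
      full′ : Full k ((y , z) ∷ t)
      full′ x k≤x x∈ same with m≤n⇒m<n∨m≡n k≤x
      ... | inj₁ lt = full I x lt x∈ same
      full′ x k≤x (here refl) same | inj₂ refl = ⊥-elim (subst T eq (∧-T⁺ {k ≡ᵇ k} (≡⇒≡ᵇ k k refl) (≡⇒≡ᵇ (μ (suc k)) (μ k) same)))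
      full′ x k≤x (there x∈) same | inj₂ refl with sorted I
      ... | s ∷ _ = ⊥-elim (<⇒≱ (All.lookup s x∈) (low (All.head (good I))))
    ... | true with hit {y} {k} (subst T (sym eq) tt)
    ... | (refl , same) = record { good = first ∷ All.map weaken (good rest) ; sorted = All.map low (good rest) ∷ sorted rest ; full = full′ }
      where
      g₀ = All.head (good I)
      top : γ (suc k) ≡ suc (μ k)
      top = ≤-antisym (≤-trans (γ-dec k) (≤-reflexive e)) (≤-trans (≤-reflexive (cong suc (sym same))) (room g₀))
      tail-inv : Inv (suc k) ((suc k , z) ∷ t) → Inv (suc (suc k)) t
      tail-inv J with sorted J
      ... | s ∷ ss = record
        { good = All.zipWith (λ (g , lt) → record { low = lt ; rise = rise g ; room = room g ; link = link g }) (All.tail (good J) , s)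
        ; sorted = ss
        ; full = λ x le x∈ eq′ → out x le (full J x (<⇒≤ le) (there x∈) eq′) }
        where
        out : ∀ x → suc (suc k) ≤ x → ∃[ z′ ] ((x , z′) ∈ (suc k , z) ∷ t) → ∃[ z′ ] ((x , z′) ∈ t)
        out x le (_ , here refl) = ⊥-elim (<-irrefl refl le)
        out x le (z′ , there p) = z′ , p
      rest : Inv (suc k) (up (suc k) t)
      rest = up-inv (suc k) t (trans top (cong suc (sym same))) (tail-inv I)
      linked-at : ∀ x → k ≤ x → x < z → Linked μ γ x
      linked-at x le lt with m≤n⇒m<n∨m≡n le
      ... | inj₁ lt′ = link g₀ x lt′ lt
      ... | inj₂ refl = same , e , top
      first : Good k (k , z)
      first = record { low = ≤-refl ; rise = <⇒≤ (rise g₀) ; room = ≤-reflexive (sym e) ; link = linked-at }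
      full′ : Full k ((k , z) ∷ up (suc k) t)
      full′ x k≤x (here refl) _ = ⊥-elim (1+n≰n k≤x)
      full′ x k≤x (there x∈) eq′ with m≤n⇒m<n∨m≡n k≤x
      ... | inj₂ refl = z , here refl
      ... | inj₁ lt = let (z′ , p) = full rest x lt x∈ eq′ in z′ , there p

    marks-inv : ∀ n k → Inv k (marks n k)
    marks-inv zero k = record { good = [] ; sorted = [] ; full = λ _ _ () }
    marks-inv (suc n) k with l k <ᵇ γ k in eW | μ k <ᵇ l k in eV
    ... | true | _ = record
        { good = record { low = ≤-refl ; rise = ≤-refl ; room = ≤-<-trans (proj₁ (v k)) (<ᵇ⇒< (l k) (γ k) (subst T (sym eW) tt)) ; link = λ x p q → ⊥-elim (<⇒≱ q p) }
                 ∷ All.map weaken (good I)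
        ; sorted = All.map low (good I) ∷ sorted I
        ; full = full′ }
      where
      I = marks-inv n (suc k)
      full′ : Full k ((k , k) ∷ marks n (suc k))
      full′ x k≤x (here refl) _ = ⊥-elim (1+n≰n k≤x)
      full′ x k≤x (there x∈) e with m≤n⇒m<n∨m≡n k≤x
      ... | inj₂ refl = k , here refl
      ... | inj₁ lt = let (z′ , p) = full I x lt x∈ e in z′ , there p
    ... | false | true = up-inv k (marks n (suc k)) (≤-antisym (≤-trans (≮⇒≥ (λ lt → subst T eW (<⇒<ᵇ lt))) (proj₂ (v k)))
          (≤-trans (<ᵇ⇒< (μ k) (l k) (subst T (sym eV) tt)) (proj₁ (w k)))) (marks-inv n (suc k))
    ... | false | false = record { good = All.map weaken (good I) ; sorted = sorted I ; full = full′ }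
      where
      I = marks-inv n (suc k)
      full′ : Full k (marks n (suc k))
      full′ x k≤x x∈ e with m≤n⇒m<n∨m≡n k≤x
      ... | inj₁ lt = full I x lt x∈ e
      -- Row `k` of `γ / μ` is empty here, so a box directly below its first free place would stick
      -- out of the partition `γ`.
      ... | inj₂ refl = ⊥-elim (<⇒≱ (room (All.lookup (good I) x∈)) (≤-trans (γ-dec k) (≤-trans (≮⇒≥ (λ lt → subst T eW (<⇒<ᵇ lt)))
                         (≤-trans (≮⇒≥ (λ lt → subst T eV (<⇒<ᵇ lt))) (≤-reflexive (sym e))))))

    up-origin : ∀ k t → map proj₂ (up k t) ≡ map proj₂ t
    up-origin k [] = refl
    up-origin k ((y , z) ∷ t) with (y ≡ᵇ suc k) ∧ (μ y ≡ᵇ μ k)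
    ... | true = cong (z ∷_) (up-origin y t)
    ... | false = refl

    marks-origin : ∀ n k → map proj₂ (marks n k) ≡ strip? n k l γ
    marks-origin zero k = refl
    marks-origin (suc n) k with l k <ᵇ γ k | μ k <ᵇ l k
    ... | true | _ = cong (k ∷_) (marks-origin n (suc k))
    ... | false | true = trans (up-origin k _) (marks-origin n (suc k))
    ... | false | false = marks-origin n (suc k)

    cells : List Mark → List Box
    cells = map (cell μ ∘ proj₁)

    shift-up : ∀ k t → moveUp (cell μ k) (cells t) ≡ cells (up k t)
    shift-up k [] = refl
    shift-up k ((y , z) ∷ t) with (y ≡ᵇ suc k) ∧ (μ y ≡ᵇ μ k)
    ... | true = cong (cell μ k ∷_) (shift-up y t)
    ... | false = refl

    below-cells : ∀ k t → All (Good (suc k)) t → BelowRow (suc k) (cells t)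
    below-cells k t g = AllP.map⁺ (All.map (λ h → s≤s (low h)) g)

    sorted-cells : ∀ t → Sorted t → RowSorted (cells t)
    sorted-cells t s = AP.map⁺ (AllPairs.map s≤s s)

    -- `pre` collects the boxes in the rows already passed. They lie above all holes that are filled
    -- in rows `k` and below, hence are never moved by these slides.
    slide-marks : ∀ n k pre → AboveRow (suc k) pre →
      foldr slideInto (pre ++ map (cell l) (strip? n k l γ)) (map (cell μ) (strip? n k μ l)) ≡ pre ++ cells (marks n k)
    slide-marks zero k pre ab = refl
    slide-marks (suc n) k pre ab with l k <ᵇ γ k in eW | μ k <ᵇ l k in eV
    ... | true | true = trans (cong (slideInto (cell μ k)) step) (trans (cong (λ c → slideInto (cell μ k) (pre ++ (suc k , suc c) ∷ t)) l≡)
            (slideLoop-left _ (suc k) (suc (μ k)) pre t ab (below-cells k _ (good I)) off))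
      where
      I = marks-inv n (suc k)
      t = cells (marks n (suc k))
      l≡ : l k ≡ suc (μ k)
      l≡ = ≤-antisym (proj₂ (v k)) (<ᵇ⇒< (μ k) (l k) (subst T (sym eV) tt))
      step : foldr slideInto (pre ++ cell l k ∷ map (cell l) (strip? n (suc k) l γ)) (map (cell μ) (strip? n (suc k) μ l)) ≡ pre ++ cell l k ∷ t
      step = trans (cong (λ xs → foldr slideInto xs (map (cell μ) (strip? n (suc k) μ l))) (sym (++-assoc pre (cell l k ∷ []) _)))
        (trans (slide-marks n (suc k) (pre ++ cell l k ∷ []) (AllP.++⁺ (All.map m≤n⇒m≤1+n ab) (≤-refl ∷ []))) (++-assoc pre (cell l k ∷ []) t))
      off : (suc (suc k) , suc (suc (μ k))) ∉ t
      off p with ∈-map⁻ (cell μ ∘ proj₁) p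
      ... | ((y , z) , m∈ , e) = <⇒≱ (s≤s (μ-dec k)) (≤-reflexive (trans (suc-injective (cong proj₂ e)) (cong μ (sym (suc-injective (cong proj₁ e))))))
    ... | true | false = trans (cong (λ xs → foldr slideInto xs (map (cell μ) (strip? n (suc k) μ l))) (sym (++-assoc pre (cell l k ∷ []) _)))
        (trans (slide-marks n (suc k) (pre ++ cell l k ∷ []) (AllP.++⁺ (All.map m≤n⇒m≤1+n ab) (≤-refl ∷ [])))
        (trans (++-assoc pre (cell l k ∷ []) _) (cong (λ c → pre ++ (suc k , suc c) ∷ cells (marks n (suc k))) (≤-antisym (≮⇒≥ (λ lt → subst T eV (<⇒<ᵇ lt))) (proj₁ (v k))))))
    ... | false | true = trans (cong (slideInto (cell μ k)) (slide-marks n (suc k) pre (All.map m≤n⇒m≤1+n ab)))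
        (trans (slideLoop-shift _ (suc k) (suc (μ k)) pre (cells (marks n (suc k)))
                 (s≤s (subst (length (cells (marks n (suc k))) ≤_) (sym (length-++ pre)) (m≤n+m _ (length pre)))) ab (below-cells k _ (good I)) (sorted-cells _ (sorted I)))
               (cong (pre ++_) (shift-up k (marks n (suc k)))))
      where
      I = marks-inv n (suc k)
    ... | false | false = slide-marks n (suc k) pre (All.map m≤n⇒m≤1+n ab)

-- Vertical strips whose boxes cross prescribed dams along linked rows.

module LinkedRows where

  open Linear using (lia; K; _⊞_; _≼_; _≺_; _≐_; _⇒_; [_]⊢_)
  open Step using (VStrip; Linked)
  open Compat using (dam)
  open Shape
  open Tableau
  open ArrowToFilling using (diff≤; ≤diff)
  open Strips
  open Sliding

  module _ {A B C D : Set} (f : A → C) (g : B → D) where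

    zip-map⁺ : ∀ {xs ys x y} → (x , y) ∈ zip xs ys → (f x , g y) ∈ zip (map f xs) (map g ys)
    zip-map⁺ {_ ∷ _} {_ ∷ _} (here refl) = here refl
    zip-map⁺ {_ ∷ _} {_ ∷ _} (there p) = there (zip-map⁺ p)

    zip-map⁻ : ∀ {xs ys z} → z ∈ zip (map f xs) (map g ys) → ∃[ x ] ∃[ y ] ((x , y) ∈ zip xs ys × z ≡ (f x , g y))
    zip-map⁻ {_ ∷ _} {_ ∷ _} (here refl) = _ , _ , here refl , refl
    zip-map⁻ {_ ∷ _} {_ ∷ _} (there p) = let (x , y , q , e) = zip-map⁻ p in x , y , there q , e

  zip-monotone : ∀ {A B : Set} {_⊏_ : A → A → Set} {_⊏′_ : B → B → Set} {xs ys x x′ y y′} → (∀ {b b′} → b ⊏′ b′ → b′ ⊏′ b → ⊥) →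
    AllPairs _⊏_ xs → AllPairs _⊏′_ ys → (x , y) ∈ zip xs ys → (x′ , y′) ∈ zip xs ys → y ⊏′ y′ → x ⊏ x′
  zip-monotone {xs = _ ∷ _} {_ ∷ _} asym (p ∷ ps) (q ∷ qs) (here refl) (here refl) lt = ⊥-elim (asym lt lt)
  zip-monotone {xs = _ ∷ _} {_ ∷ _} asym (p ∷ ps) (q ∷ qs) (here refl) (there b) lt = All.lookup p (zip-∈ˡ b)
  zip-monotone {xs = _ ∷ _} {_ ∷ _} asym (p ∷ ps) (q ∷ qs) (there a) (here refl) lt = ⊥-elim (asym lt (All.lookup q (zip-∈ʳ a)))
  zip-monotone {xs = _ ∷ _} {_ ∷ _} asym (p ∷ ps) (q ∷ qs) (there a) (there b) lt = zip-monotone asym ps qs a b lt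

  Linked? : ∀ l u y → Dec (Linked l u y)
  Linked? l u y = (l (suc y) ≟ l y) ×-dec ((u y ≟ suc (l y)) ×-dec (u (suc y) ≟ suc (l y)))

  -- the rows of the new vertical strip are determined by the rows where its boxes have to cross
  module Rows (Lk : ℕ → Set) (d : ℕ → ℕ) where

    -- In the application `d i` is the row just above the dam. The box that starts in row `w` has to
    -- reach it, so it starts lower and all rows on its way are linked.
    Chained : List ℕ → List ℕ → Set
    Chained is ws = ∀ {i w} → (i , w) ∈ zip is ws → d i < w × (∀ x → d i ≤ x → x < w → Lk x)

    -- For the rows `ws` of γ₁/λ this expresses that λ is a partition: linked rows of γ₁ have equal
    -- length, so removing the box of the upper one requires removing that of the lower one.
    Closed : List ℕ → Set
    Closed ws = ∀ {w} → w ∈ ws → Lk w → suc w ∈ ws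

    climb : ∀ {ws} → Closed ws → ∀ n {w} → w ∈ ws → (∀ x → w ≤ x → x < n + w → Lk x) → n + w ∈ ws
    climb cl zero w∈ h = w∈
    climb cl (suc n) {w} w∈ h = cl (climb cl n w∈ (λ x p q → h x p (m≤n⇒m≤1+n q))) (h (n + w) (m≤n+m w n) ≤-refl)

    tail-closed : ∀ {w ws} → AllPairs _<_ (w ∷ ws) → Closed (w ∷ ws) → Closed ws
    tail-closed (s ∷ _) cl w′∈ lk with cl (there w′∈) lk
    ... | here e = ⊥-elim (<⇒≱ (All.lookup s w′∈) (≤-trans (n≤1+n _) (≤-reflexive e)))
    ... | there p = p

    no-less : ∀ {w w′ ws} → AllPairs _<_ (w′ ∷ ws) → Closed (w ∷ ws) → (∀ x → w ≤ x → x < w′ → Lk x) → w < w′ → ⊥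
    no-less {w} {w′} {ws} (s ∷ _) cl h lt with subst (_∈ w ∷ ws) (m∸n+n≡m (<⇒≤ lt)) (climb cl (w′ ∸ w) (here refl) (λ x p q → h x p (subst (x <_) (m∸n+n≡m (<⇒≤ lt)) q)))
    ... | here e = <-irrefl (sym e) lt
    ... | there p = <-irrefl refl (All.lookup s p)

    -- The lists are compared from their last rows upwards. If the next rows satisfied `w < w′`, the
    -- links between them would carry `w` down to `w′` inside the first list by closedness, although
    -- all its remaining rows, shared with the second list, lie below `w′`.
    rows-unique : ∀ is ws ws′ → length is ≡ length ws → length is ≡ length ws′ → AllPairs _<_ ws → AllPairs _<_ ws′ →
      Chained is ws → Chained is ws′ → Closed ws → Closed ws′ → ws ≡ ws′
    rows-unique [] [] [] _ _ _ _ _ _ _ _ = refl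
    rows-unique (i ∷ is) (w ∷ ws) (w′ ∷ ws′) e e′ (s ∷ ss) (s′ ∷ ss′) c c′ cl cl′
      with rows-unique is ws ws′ (suc-injective e) (suc-injective e′) ss ss′ (c ∘ there) (c′ ∘ there) (tail-closed (s ∷ ss) cl) (tail-closed (s′ ∷ ss′) cl′)
    ... | refl = cong (_∷ ws) (≤-antisym
      (≮⇒≥ (no-less (s ∷ ss) cl′ (λ x p q → proj₂ (c (here refl)) x (≤-trans (<⇒≤ (proj₁ (c′ (here refl)))) p) q)))
      (≮⇒≥ (no-less (s′ ∷ ss′) cl (λ x p q → proj₂ (c′ (here refl)) x (≤-trans (<⇒≤ (proj₁ (c (here refl)))) p) q))))

    module Build (Lk? : ∀ x → Dec (Lk x)) (N : ℕ) (none : ∀ x → N ≤ x → Lk x → ⊥) where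

      -- the last row reachable from y along links without running into the rows tl
      extend : ∀ f y tl → All (y <_) tl → N ≤ f + y →
        ∃[ w ] (y ≤ w × (∀ x → y ≤ x → x < w → Lk x) × All (w <_) tl × (Lk w → suc w ∈ tl))
      extend f y tl lo h with Lk? y
      ... | no ¬lk = y , ≤-refl , (λ x p q → ⊥-elim (<⇒≱ q p)) , lo , (λ lk → ⊥-elim (¬lk lk))
      ... | yes lk with suc y ∈? tl
      ... | yes p = y , ≤-refl , (λ x p q → ⊥-elim (<⇒≱ q p)) , lo , (λ _ → p)
      extend zero y tl lo h | yes lk | no ∉ = ⊥-elim (none y h lk)
      extend (suc f) y tl lo h | yes lk | no ∉ =
        let (w , a , b , c , e) = extend f (suc y) tl (All.tabulate (λ z∈ → ≤∧≢⇒< (All.lookup lo z∈) (λ eq → ∉ (subst (_∈ tl) (sym eq) z∈)))) (subst (N ≤_) (sym (+-suc f y)) h)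
        in w , <⇒≤ a , (λ x p q → prepend x (m≤n⇒m<n∨m≡n p) q b) , c , e
        where
        prepend : ∀ {w} x → y < x ⊎ y ≡ x → x < w → (∀ x → suc y ≤ x → x < w → Lk x) → Lk x
        prepend x (inj₁ p) q b = b x p q
        prepend x (inj₂ refl) q b = lk

      -- The lowest dam is treated first. For each dam the search starts in the row `suc (d i)` just
      -- below it and goes down along links until they end or the next row has been taken by a lower
      -- dam; stopping there makes the list closed.
      build : ∀ is → AllPairs (λ i j → d i < d j) is → All (λ i → Lk (d i)) is →
        ∃[ ws ] (length is ≡ length ws × AllPairs _<_ ws × Chained is ws × Closed ws × (∀ x → (∀ {i} → i ∈ is → x ≤ d i) → All (x <_) ws))
      build [] _ _ = [] , refl , [] , (λ ()) , (λ ()) , λ _ _ → []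
      build (i ∷ is) (s ∷ ss) (lk ∷ lks) =
        let (tl , e , st , ch , cl , lo) = build is ss lks
            (w , a , b , c , f) = extend N (suc (d i)) tl (lo (suc (d i)) (λ j∈ → All.lookup s j∈)) (m≤m+n N (suc (d i)))
        in w ∷ tl , cong suc e , c ∷ st
           , (λ { (here refl) → a , (λ x p q → first x (m≤n⇒m<n∨m≡n p) q b) ; (there p) → ch p })
           , (λ { (here refl) k → there (f k) ; (there p) k → there (cl p k) })
           , λ x h → ≤-<-trans (h (here refl)) a ∷ lo x (h ∘ there)
        where
        first : ∀ {w} x → d i < x ⊎ d i ≡ x → x < w → (∀ x → suc (d i) ≤ x → x < w → Lk x) → Lk x
        first x (inj₁ p) q b = b x p q
        first x (inj₂ refl) q b = lk

  -- A term of the formula for (δ₁, δ₂), with `l` for its λ. The case γ₁ = λ, γ₂ = δ₂ of empty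
  -- strips is included and stands for the term τ_{λ,δ₂}.
  record JPair (ρ p : ℕ) (δ₁ δ₂ l γ₁ γ₂ : Part) : Set where
    field
      l-part  : IsP l
      γ₁-part : IsP γ₁
      γ₂-part : IsP γ₂
      l-strip  : VStrip (pt δ₁) (pt l)
      γ₁-strip : VStrip (pt l) (pt γ₁)
      γ₂-strip : VStrip (pt γ₂) (pt δ₂)
      l-size   : size l ≡ size δ₁ + p
      γ-size   : size γ₁ + size γ₂ ≡ size l + size δ₂
      rule     : T (rowRule (suc ρ) δ₂ γ₂ (Tstrip γ₁ l))
      reverse-rule : T (reverseRowRule (suc ρ) δ₂ γ₂ (Slide (Tstrip l δ₁) (Tstrip γ₁ l)))

  -- The same term with λ forgotten. At each row of δ₂/γ₂ the two rows of γ₁/δ₁ adjacent to the dam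
  -- must be linked; `FromJ`, `FromL` and `J-unique` together say that exactly one λ then exists.
  record LPair (ρ p : ℕ) (δ₁ δ₂ γ₁ γ₂ : Part) : Set where
    field
      γ₁-partᴸ : IsP γ₁
      γ₂-partᴸ : IsP γ₂
      γ₁-stripᴸ : VStrip (pt δ₁) (pt γ₁)
      γ₂-stripᴸ : VStrip (pt γ₂) (pt δ₂)
      γ-sizeᴸ   : size γ₁ + size γ₂ ≡ size δ₁ + size δ₂ + p
      linkedᴸ   : ∀ i → pt δ₂ i ≡ suc (pt γ₂ i) → ∃[ y ] (dam ρ i (pt γ₂ i) ≡ suc y × Linked (pt δ₁) (pt γ₁) y)

  open JPair public
  open LPair public

  VStrip-⊑ : ∀ {β α} → VStrip (pt β) (pt α) → β ⊑ α
  VStrip-⊑ v k = proj₁ (v k)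

  module Common (ρ p : ℕ) (δ₁ δ₂ γ₁ γ₂ : Part) (pδ₁ : IsP δ₁) (pδ₂ : IsP δ₂) (pγ₁ : IsP γ₁) (pγ₂ : IsP γ₂) (vb : VStrip (pt γ₂) (pt δ₂)) where

    N : ℕ
    N = length γ₁ + length δ₂

    is : List ℕ
    is = strip? N 0 (pt γ₂) (pt δ₂)

    rl≡ : rl δ₂ γ₂ ≡ map (cell (pt γ₂)) is
    rl≡ = rl-strip δ₂ γ₂ vb N (m≤n+m _ _)

    is-∈ : ∀ {i} → pt δ₂ i ≡ suc (pt γ₂ i) → i ∈ is
    is-∈ {i} e = ∈-strip?⁺ N 0 (pt γ₂) (pt δ₂) z≤n (subst (i <_) (sym (+-identityʳ N)) (≤-trans short (m≤n+m _ _))) (≤-reflexive (sym e))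
      where
      short : i < length δ₂
      short = ≰⇒> (λ h → 1+n≢0 (trans (sym e) (pt-vanish δ₂ i h)))

    ∈-is : ∀ {i} → i ∈ is → pt δ₂ i ≡ suc (pt γ₂ i)
    ∈-is {i} i∈ = ≤-antisym (proj₂ (vb i)) (proj₂ (∈-strip?⁻ N 0 (pt γ₂) (pt δ₂) i∈))

    length-is : length is + size γ₂ ≡ size δ₂
    length-is = trans (cong (_+ size γ₂) (trans (sym (length-map _ is)) (cong length (sym rl≡)))) (length-rl δ₂ γ₂ pγ₂ (VStrip-⊑ {γ₂} {δ₂} vb))

    Lk : ℕ → Set
    Lk = Linked (pt δ₁) (pt γ₁)

    d : ℕ → ℕ
    d i = dam ρ i (pt γ₂ i) ∸ 1

    open Rows Lk d public

    module Inner (l : Part) (pl : IsP l) (vl : VStrip (pt δ₁) (pt l)) (vγ : VStrip (pt l) (pt γ₁)) where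

      ws : List ℕ
      ws = strip? N 0 (pt l) (pt γ₁)

      open SlideStrip (pt δ₁) (pt l) (pt γ₁) (pt-dec δ₁ pδ₁) (pt-dec γ₁ pγ₁) vl vγ public

      ms : List Mark
      ms = marks N 0

      inv : Inv 0 ms
      inv = marks-inv N 0

      boxes≡ : boxes γ₁ l ≡ map (cell (pt l)) ws
      boxes≡ = boxes-strip γ₁ l vγ N (m≤m+n _ _)

      slide≡ : Slide (Tstrip l δ₁) (Tstrip γ₁ l) ≡ cells ms
      slide≡ = trans (cong₂ Slide (boxes-strip l δ₁ vl N (≤-trans (IsP-⊑-length γ₁ l pl (VStrip-⊑ {l} {γ₁} vγ)) (m≤m+n _ _))) boxes≡) (slide-marks N 0 [] [])

      length-ws : length ws + size l ≡ size γ₁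
      length-ws = trans (cong (_+ size l) (trans (sym (length-map _ ws)) (cong length (sym boxes≡)))) (length-boxes γ₁ l pl (VStrip-⊑ {l} {γ₁} vγ))

      length-ms : length ms ≡ length ws
      length-ms = trans (sym (length-map proj₂ ms)) (cong length (marks-origin N 0))

      ws-∈ : ∀ {w} → pt l w < pt γ₁ w → w ∈ ws
      ws-∈ {w} lt = ∈-strip?⁺ N 0 (pt l) (pt γ₁) z≤n (subst (w <_) (sym (+-identityʳ N)) (≤-trans short (m≤m+n _ _))) lt
        where
        short : w < length γ₁
        short = ≰⇒> (λ h → <⇒≱ lt (≤-trans (≤-reflexive (pt-vanish γ₁ w h)) z≤n))

      ∈-ws : ∀ {w} → w ∈ ws → pt l w < pt γ₁ w
      ∈-ws w∈ = proj₂ (∈-strip?⁻ N 0 (pt l) (pt γ₁) w∈)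

      zip-ws : ∀ {i y z} → (i , (y , z)) ∈ zip is ms → (i , z) ∈ zip is ws
      zip-ws {i} {y} {z} p = subst (λ t → (i , z) ∈ zip is t) (marks-origin N 0) (subst (λ t → (i , z) ∈ zip t (map proj₂ ms)) (map-id is) (zip-map⁺ (λ x → x) proj₂ p))
        where
        map-id : ∀ (xs : List ℕ) → map (λ x → x) xs ≡ xs
        map-id [] = refl
        map-id (x ∷ xs) = cong (x ∷_) (map-id xs)

      rule⇒ʷ : T (rowRule (suc ρ) δ₂ γ₂ (Tstrip γ₁ l)) → ∀ {i w} → (i , w) ∈ zip is ws → ρ + i ≤ w + pt γ₂ i
      rule⇒ʷ h {i} {w} p = lia 4 (λ ρ i w g → K 1 ⊞ ρ ⊞ (K 1 ⊞ i) ≼ K 1 ⊞ w ⊞ (K 1 ⊞ g) ⇒ [ 11 ]⊢ ρ ⊞ i ≼ w ⊞ g) ρ i w (pt γ₂ i)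
        (diff≤ (suc ρ + suc i) (suc (pt γ₂ i)) (suc w) (T-allB _ (zip (rl δ₂ γ₂) (boxes γ₁ l)) h
          (subst (λ s → _ ∈ zip s (boxes γ₁ l)) (sym rl≡) (subst (λ s → _ ∈ zip (map (cell (pt γ₂)) is) s) (sym boxes≡) (zip-map⁺ (cell (pt γ₂)) (cell (pt l)) p)))))

      ⇒ruleʷ : (∀ {i w} → (i , w) ∈ zip is ws → ρ + i ≤ w + pt γ₂ i) → T (rowRule (suc ρ) δ₂ γ₂ (Tstrip γ₁ l))
      ⇒ruleʷ h = allB-T _ (zip (rl δ₂ γ₂) (boxes γ₁ l)) each
        where
        each : ∀ {z} → z ∈ zip (rl δ₂ γ₂) (boxes γ₁ l) → T (Rr (suc ρ) (proj₁ z) ℤ.≤ᵇ ℤ.+ row (proj₂ z))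
        each {z} z∈ with zip-map⁻ (cell (pt γ₂)) (cell (pt l)) (subst (λ s → z ∈ zip s (map (cell (pt l)) ws)) rl≡ (subst (λ s → z ∈ zip (rl δ₂ γ₂) s) boxes≡ z∈))
        ... | (i , w , p , refl) = ≤diff (suc ρ + suc i) (suc (pt γ₂ i)) (suc w)
          (lia 4 (λ ρ i w g → ρ ⊞ i ≼ w ⊞ g ⇒ [ 11 ]⊢ K 1 ⊞ ρ ⊞ (K 1 ⊞ i) ≼ K 1 ⊞ w ⊞ (K 1 ⊞ g)) ρ i w (pt γ₂ i) (h p))

      rev⇒ : T (reverseRowRule (suc ρ) δ₂ γ₂ (Slide (Tstrip l δ₁) (Tstrip γ₁ l))) → ∀ {i m} → (i , m) ∈ zip is ms → proj₁ m + pt γ₂ i < ρ + i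
      rev⇒ h {i} {(y , z)} p = ≰⇒> (λ le → not-T (T-allB _ (zip (rl δ₂ γ₂) (Slide (Tstrip l δ₁) (Tstrip γ₁ l))) h
          (subst (λ s → _ ∈ zip s (Slide (Tstrip l δ₁) (Tstrip γ₁ l))) (sym rl≡) (subst (λ s → _ ∈ zip (map (cell (pt γ₂)) is) s) (sym slide≡) (zip-map⁺ (cell (pt γ₂)) (cell (pt δ₁) ∘ proj₁) p))))
          (≤diff (suc ρ + suc i) (suc (pt γ₂ i)) (suc y) (lia 4 (λ ρ i w g → ρ ⊞ i ≼ w ⊞ g ⇒ [ 11 ]⊢ K 1 ⊞ ρ ⊞ (K 1 ⊞ i) ≼ K 1 ⊞ w ⊞ (K 1 ⊞ g)) ρ i y (pt γ₂ i) le)))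
        where
        not-T : ∀ {b} → T (not b) → T b → ⊥
        not-T {false} _ ()

      ⇒rev : (∀ {i m} → (i , m) ∈ zip is ms → proj₁ m + pt γ₂ i < ρ + i) → T (reverseRowRule (suc ρ) δ₂ γ₂ (Slide (Tstrip l δ₁) (Tstrip γ₁ l)))
      ⇒rev h = allB-T _ (zip (rl δ₂ γ₂) (Slide (Tstrip l δ₁) (Tstrip γ₁ l))) each
        where
        T-not : ∀ {b} → (T b → ⊥) → T (not b)
        T-not {true} f = f tt
        T-not {false} f = tt
        each : ∀ {z} → z ∈ zip (rl δ₂ γ₂) (Slide (Tstrip l δ₁) (Tstrip γ₁ l)) → T (not (Rr (suc ρ) (proj₁ z) ℤ.≤ᵇ ℤ.+ row (proj₂ z)))
        each {z} z∈ with zip-map⁻ (cell (pt γ₂)) (cell (pt δ₁) ∘ proj₁) (subst (λ s → z ∈ zip s (cells ms)) rl≡ (subst (λ s → z ∈ zip (rl δ₂ γ₂) s) slide≡ z∈))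
        ... | (i , (y , _) , p , refl) = T-not (λ t → <⇒≱ (h p) (lia 4 (λ ρ i w g → K 1 ⊞ ρ ⊞ (K 1 ⊞ i) ≼ K 1 ⊞ w ⊞ (K 1 ⊞ g) ⇒ [ 11 ]⊢ ρ ⊞ i ≼ w ⊞ g) ρ i y (pt γ₂ i)
          (diff≤ (suc ρ + suc i) (suc (pt γ₂ i)) (suc y) t)))

  -- The reverse rule holds in the final row `y` of a box and the row rule in its original row `z`.
  -- So the first row allowed lies strictly below `y` and weakly above `z`, and its predecessor `d`
  -- is passed by the slide.
  dam-bounds : ∀ ρ i g y z → y + g < ρ + i → ρ + i ≤ z + g → ∃[ d ] (dam ρ i g ≡ suc d × y ≤ d × d < z)
  dam-bounds ρ i g y z lt le = at (dam ρ i g) (sym (m∸n+n≡m (≤-trans (m≤n+m g y) (<⇒≤ lt))))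
    where
    at : ∀ n → ρ + i ≡ n + g → ∃[ d ] (n ≡ suc d × y ≤ d × d < z)
    at zero e = ⊥-elim (<⇒≱ lt (≤-trans (≤-reflexive e) (m≤n+m g y)))
    at (suc d) e = d , refl , lia 5 (λ t g y z d → y ⊞ g ≺ t ⇒ t ≐ K 1 ⊞ d ⊞ g ⇒ [ 1011 ]⊢ y ≼ d) (ρ + i) g y z d lt e ,
                              lia 5 (λ t g y z d → t ≼ z ⊞ g ⇒ t ≐ K 1 ⊞ d ⊞ g ⇒ [ 1101 ]⊢ d ≺ z) (ρ + i) g y z d le e

-- Existence and uniqueness of the intermediate partition.

module VerticalPairs where

  open Linear using (lia; _⊞_; _≐_; _⇒_; [_]⊢_; [_∣_]⊢_)
  open Step using (Fn; Decreasing; VStrip; VanishesFrom)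
  open Compat using (dam)
  open Chain using (_≗_; dam-mono; dec-≤)
  open Shape
  open Tableau
  open Strips
  open Sliding
  open LinkedRows

  VStrip-trans-bound : ∀ {a b c} → a ≤ b → b ≤ suc a → b ≤ c → c ≤ suc b → (b < c → c ≤ suc a) → a ≤ c × c ≤ suc a
  VStrip-trans-bound {a} {b} {c} p q r s h with m≤n⇒m<n∨m≡n r
  ... | inj₁ lt = ≤-trans p r , h lt
  ... | inj₂ refl = p , q

  module FromJ {ρ p : ℕ} {δ₁ δ₂ l γ₁ γ₂ : Part} (pδ₁ : IsP δ₁) (pδ₂ : IsP δ₂) (J : JPair ρ p δ₁ δ₂ l γ₁ γ₂) where
    open Common ρ p δ₁ δ₂ γ₁ γ₂ pδ₁ pδ₂ (γ₁-part J) (γ₂-part J) (γ₂-strip J) public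
    open Inner l (l-part J) (l-strip J) (γ₁-strip J) public

    same-length : length is ≡ length ws
    same-length = lia 6 (λ i w g₁ g₂ l d → i ⊞ g₂ ≐ d ⇒ w ⊞ l ≐ g₁ ⇒ g₁ ⊞ g₂ ≐ l ⊞ d ⇒ [ 110101 ∣ 1001011 ]⊢ i ≐ w)
      (length is) (length ws) (size γ₁) (size γ₂) (size l) (size δ₂) length-is length-ws (γ-size J)

    mark-of : ∀ {i} → i ∈ is → ∃[ m ] ((i , m) ∈ zip is ms)
    mark-of = zip-image {xs = is} {ms} (trans same-length (sym length-ms))

    crossing : ∀ {i y z} → (i , (y , z)) ∈ zip is ms → ∃[ e ] (dam ρ i (pt γ₂ i) ≡ suc e × y ≤ e × e < z)
    crossing {i} {y} {z} q = dam-bounds ρ i (pt γ₂ i) y z (rev⇒ (reverse-rule J) q) (rule⇒ʷ (rule J) (zip-ws q))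

    linked-between : ∀ {i y z} → (i , (y , z)) ∈ zip is ms → ∀ x → y ≤ x → x < z → Lk x
    linked-between q = link (All.lookup (good inv) (zip-∈ʳ q))

    crossed : ∀ {i} → i ∈ is → ∃[ y ] (dam ρ i (pt γ₂ i) ≡ suc y × Lk y)
    crossed i∈ =
      let ((y , z) , q) = mark-of i∈
          (e , r , y≤e , e<z) = crossing q
      in e , r , linked-between q e y≤e e<z

    -- A box of γ₁/λ in row `k` crosses its dam, so in particular it leaves row `k`. The rows
    -- `k - 1` and `k` are therefore linked, and γ₁ exceeds δ₁ by only one in row `k`: the two
    -- vertical strips never stack up in a row.
    new-row : ∀ k → pt l k < pt γ₁ k → pt γ₁ k ≤ suc (pt δ₁ k)
    new-row k lt =
      let (i , q) = zip-origin {xs = is} {ws} same-length (ws-∈ lt)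
          ((y , z) , r) = mark-of (zip-∈ˡ q)
          z≡k = zip-functional (AllPairs.map (λ p e → <-irrefl e p) (strip?-sorted N 0 (pt γ₂) (pt δ₂))) (zip-ws r) q
      in at k r z≡k
      where
      at : ∀ {i y z} k → (i , (y , z)) ∈ zip is ms → z ≡ k → pt γ₁ k ≤ suc (pt δ₁ k)
      at zero r refl with crossing r
      ... | (_ , _ , _ , ())
      at (suc k) r refl with crossing r
      ... | (e , _ , y≤e , s≤s e≤k) with linked-between r k (≤-trans y≤e e≤k) ≤-refl
      ... | (a , _ , c) = ≤-reflexive (trans c (cong suc (sym a)))

    links : LPair ρ p δ₁ δ₂ γ₁ γ₂
    links = record
      { γ₁-partᴸ = γ₁-part J ; γ₂-partᴸ = γ₂-part J
      ; γ₁-stripᴸ = λ k → VStrip-trans-bound (proj₁ (l-strip J k)) (proj₂ (l-strip J k)) (proj₁ (γ₁-strip J k)) (proj₂ (γ₁-strip J k)) (new-row k)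
      ; γ₂-stripᴸ = γ₂-strip J
      ; γ-sizeᴸ = lia 6 (λ g₁ g₂ l d₁ d₂ p → g₁ ⊞ g₂ ≐ l ⊞ d₂ ⇒ l ≐ d₁ ⊞ p ⇒ [ 1011 ∣ 10101 ]⊢ g₁ ⊞ g₂ ≐ d₁ ⊞ d₂ ⊞ p)
          (size γ₁) (size γ₂) (size l) (size δ₁) (size δ₂) p (γ-size J) (l-size J)
      ; linkedᴸ = λ i e → crossed (is-∈ e) }

    chained : Chained is ws
    chained {i} {w} q with mark-of (zip-∈ˡ q)
    ... | ((y , z) , r) with zip-functional (AllPairs.map (λ p e → <-irrefl e p) (strip?-sorted N 0 (pt γ₂) (pt δ₂))) (zip-ws r) q | crossing r
    ... | refl | (e , de , y≤e , e<z) = subst (_< z) (sym d≡) e<z , (λ x p q → linked-between r x (≤-trans y≤e (subst (_≤ x) d≡ p)) q)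
      where
      d≡ : d i ≡ e
      d≡ = cong (_∸ 1) de

    closed : Closed ws
    closed {w} w∈ (a , b , c) = ws-∈ (≤-trans (s≤s (pt-dec l (l-part J) w)) (≤-trans (∈-ws w∈) (≤-reflexive (trans b (sym c)))))

  -- The rows of γ₁/λ are chained to the dams and closed under links for both partitions, and these
  -- properties determine the rows.
  J-unique : ∀ {ρ p δ₁ δ₂ l l′ γ₁ γ₂} → IsP δ₁ → IsP δ₂ → JPair ρ p δ₁ δ₂ l γ₁ γ₂ → JPair ρ p δ₁ δ₂ l′ γ₁ γ₂ → l ≡ l′
  J-unique {ρ} {p} {δ₁} {δ₂} {l} {l′} {γ₁} {γ₂} pδ₁ pδ₂ J J′ = pt-injective l l′ (l-part J) (l-part J′) same
    where
    module A = FromJ pδ₁ pδ₂ J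
    module B = FromJ pδ₁ pδ₂ J′
    ws≡ : A.ws ≡ B.ws
    ws≡ = A.rows-unique A.is A.ws B.ws A.same-length B.same-length (strip?-sorted A.N 0 (pt l) (pt γ₁)) (strip?-sorted A.N 0 (pt l′) (pt γ₁))
      A.chained B.chained A.closed B.closed
    same : pt l ≗ pt l′
    same k with <-≤-connex (pt l k) (pt γ₁ k) | <-≤-connex (pt l′ k) (pt γ₁ k)
    ... | inj₁ p | inj₁ q = suc-injective (trans (≤-antisym p (proj₂ (γ₁-strip J k))) (≤-antisym (proj₂ (γ₁-strip J′ k)) q))
    ... | inj₂ p | inj₂ q = trans (≤-antisym (proj₁ (γ₁-strip J k)) p) (≤-antisym q (proj₁ (γ₁-strip J′ k)))
    ... | inj₁ p | inj₂ q = ⊥-elim (<⇒≱ (B.∈-ws (subst (k ∈_) ws≡ (A.ws-∈ p))) q)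
    ... | inj₂ p | inj₁ q = ⊥-elim (<⇒≱ (A.∈-ws (subst (k ∈_) (sym ws≡) (B.ws-∈ q))) p)

  module FromL {ρ p : ℕ} {δ₁ δ₂ γ₁ γ₂ : Part} (pδ₁ : IsP δ₁) (pδ₂ : IsP δ₂) (L : LPair ρ p δ₁ δ₂ γ₁ γ₂) where
    open Common ρ p δ₁ δ₂ γ₁ γ₂ pδ₁ pδ₂ (γ₁-partᴸ L) (γ₂-partᴸ L) (γ₂-stripᴸ L)

    private
      γ-dec = pt-dec γ₁ (γ₁-partᴸ L)
      g-dec = pt-dec γ₂ (γ₂-partᴸ L)

      dam≡ : ∀ {i} → i ∈ is → dam ρ i (pt γ₂ i) ≡ suc (d i) × Lk (d i)
      dam≡ i∈ = let (y , e , k) = linkedᴸ L _ (∈-is i∈) ; y≡ = cong (_∸ 1) (sym e) in trans e (cong suc y≡) , subst Lk y≡ k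

      d-mono : ∀ {i j} → i ∈ is → j ∈ is → i < j → d i < d j
      d-mono {i} {j} i∈ j∈ lt = ≤-pred (subst (suc (d i) <_) (proj₁ (dam≡ j∈)) (dam-mono ρ {i} {j} {pt γ₂ i} {pt γ₂ j} lt (dec-≤ g-dec (<⇒≤ lt)) (proj₁ (dam≡ i∈))))

      AllPairs-∈ : ∀ {R : ℕ → ℕ → Set} {S : ℕ → ℕ → Set} xs → (∀ {x y} → x ∈ xs → y ∈ xs → R x y → S x y) → AllPairs R xs → AllPairs S xs
      AllPairs-∈ [] h [] = []
      AllPairs-∈ (x ∷ xs) h (p ∷ ps) = All.tabulate (λ y∈ → h (here refl) (there y∈) (All.lookup p y∈)) ∷ AllPairs-∈ xs (λ a b → h (there a) (there b)) ps

      unlinked : ∀ x → N ≤ x → Lk x → ⊥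
      unlinked x h (_ , e , _) = 1+n≢0 (trans (sym e) (pt-vanish γ₁ x (≤-trans (m≤m+n _ _) h)))

      built = Build.build (Linked? (pt δ₁) (pt γ₁)) N unlinked is (AllPairs-∈ is d-mono (strip?-sorted N 0 (pt γ₂) (pt δ₂))) (All.tabulate (proj₂ ∘ dam≡))

    rows : List ℕ
    rows = proj₁ built

    private
      len : length is ≡ length rows
      len = proj₁ (proj₂ built)
      rows-sorted : AllPairs _<_ rows
      rows-sorted = proj₁ (proj₂ (proj₂ built))
      chain : Chained is rows
      chain = proj₁ (proj₂ (proj₂ (proj₂ built)))
      close : Closed rows
      close = proj₁ (proj₂ (proj₂ (proj₂ (proj₂ built))))

      step-at : ∀ {k} → k ∈ rows → pt γ₁ k ≡ suc (pt δ₁ k)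
      step-at {k} k∈ with zip-origin {xs = is} {rows} len k∈
      ... | (i , q) with chain q
      step-at {zero} k∈ | (i , q) | (() , _)
      step-at {suc k} k∈ | (i , q) | (s≤s d≤k , h) with h k d≤k ≤-refl
      ... | (a , _ , c) = trans c (cong suc (sym a))

      f : Fn
      f k with k ∈? rows
      ... | yes _ = pt δ₁ k
      ... | no _ = pt γ₁ k

      f-in : ∀ {k} → k ∈ rows → f k ≡ pt δ₁ k
      f-in {k} k∈ with k ∈? rows
      ... | yes _ = refl
      ... | no ∉ = ⊥-elim (∉ k∈)

      f-out : ∀ {k} → k ∉ rows → f k ≡ pt γ₁ k
      f-out {k} k∉ with k ∈? rows
      ... | yes k∈ = ⊥-elim (k∉ k∈)
      ... | no _ = refl

      f≤γ : ∀ k → f k ≤ pt γ₁ k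
      f≤γ k with k ∈? rows
      ... | yes _ = proj₁ (γ₁-stripᴸ L k)
      ... | no _ = ≤-refl

      -- The critical place is a row that loses its box while the next one does not. Were the two
      -- rows of γ₁ equally long, they would be linked, and closedness of `rows` would remove the
      -- lower box too.
      f-dec : Decreasing f
      f-dec k = go (k ∈? rows)
        where
        not-linked : k ∈ rows → suc k ∉ rows → pt γ₁ (suc k) < pt γ₁ k
        not-linked k∈ s∉ = ≤∧≢⇒< (γ-dec k) (λ e → s∉ (close k∈ (≤-antisym (pt-dec δ₁ pδ₁ k) (≤-pred (≤-trans (≤-reflexive (trans (sym (step-at k∈)) (sym e))) (proj₂ (γ₁-stripᴸ L (suc k))))) , step-at k∈ , trans e (step-at k∈))))
        go : Dec (k ∈ rows) → f (suc k) ≤ f k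
        go (no k∉) = ≤-trans (f≤γ (suc k)) (≤-trans (γ-dec k) (≤-reflexive (sym (f-out k∉))))
        go (yes k∈) = inner (suc k ∈? rows)
          where
          inner : Dec (suc k ∈ rows) → f (suc k) ≤ f k
          inner (yes s∈) = ≤-trans (≤-reflexive (f-in s∈)) (≤-trans (pt-dec δ₁ pδ₁ k) (≤-reflexive (sym (f-in k∈))))
          inner (no s∉) = ≤-trans (≤-reflexive (f-out s∉)) (≤-trans (≤-pred (≤-trans (not-linked k∈ s∉) (≤-reflexive (step-at k∈)))) (≤-reflexive (sym (f-in k∈))))

      f-vanish : VanishesFrom (length γ₁) f
      f-vanish k h = n≤0⇒n≡0 (≤-trans (f≤γ k) (≤-reflexive (pt-vanish γ₁ k h)))

    l : Part
    l = fromFn (length γ₁) f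

    private
      pl : IsP l
      pl = fromFn-IsP (length γ₁) f f-dec f-vanish

      pt-l : pt l ≗ f
      pt-l = pt-fromFn (length γ₁) f f-dec f-vanish

      vl : VStrip (pt δ₁) (pt l)
      vl k = subst (λ x → pt δ₁ k ≤ x × x ≤ suc (pt δ₁ k)) (sym (pt-l k)) (go (k ∈? rows))
        where
        go : Dec (k ∈ rows) → pt δ₁ k ≤ f k × f k ≤ suc (pt δ₁ k)
        go (yes k∈) = ≤-reflexive (sym (f-in k∈)) , ≤-trans (≤-reflexive (f-in k∈)) (n≤1+n _)
        go (no k∉) = subst (λ x → pt δ₁ k ≤ x × x ≤ suc (pt δ₁ k)) (sym (f-out k∉)) (γ₁-stripᴸ L k)

      vγ : VStrip (pt l) (pt γ₁)
      vγ k = subst (λ x → x ≤ pt γ₁ k × pt γ₁ k ≤ suc x) (sym (pt-l k)) (f≤γ k , go (k ∈? rows))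
        where
        go : Dec (k ∈ rows) → pt γ₁ k ≤ suc (f k)
        go (yes k∈) = ≤-reflexive (trans (step-at k∈) (cong suc (sym (f-in k∈))))
        go (no k∉) = ≤-trans (≤-reflexive (sym (f-out k∉))) (n≤1+n _)

      open Inner l pl vl vγ

      ws≡ : ws ≡ rows
      ws≡ = sorted-ext {_⊏_ = _<_} <-asym (strip?-sorted N 0 (pt l) (pt γ₁)) rows-sorted to from
        where
        to : ∀ {k} → k ∈ ws → k ∈ rows
        to {k} k∈ with k ∈? rows
        ... | yes p = p
        ... | no k∉ = ⊥-elim (<-irrefl (trans (pt-l k) (f-out k∉)) (∈-ws k∈))
        from : ∀ {k} → k ∈ rows → k ∈ ws
        from {k} k∈ = ws-∈ (≤-reflexive (trans (cong suc (trans (pt-l k) (f-in k∈))) (sym (step-at k∈))))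

      same-length : length is ≡ length ms
      same-length = trans len (trans (cong length (sym ws≡)) (sym length-ms))

      chain-ms : ∀ {i y z} → (i , (y , z)) ∈ zip is ms → d i < z × (∀ x → d i ≤ x → x < z → Lk x)
      chain-ms {i} {y} {z} q = chain (subst (λ t → (i , z) ∈ zip is t) ws≡ (zip-ws q))

      -- a box that failed to cross would have its predecessor right above it
      crosses : ∀ y {i z} → (i , (y , z)) ∈ zip is ms → y ≤ d i
      crosses zero q = z≤n
      crosses (suc y) {i} {z} q = ≮⇒≥ λ { (s≤s d≤y) →
        let rises = rise (All.lookup (good inv) (zip-∈ʳ q))
            (z′ , m∈) = full inv y {z} z≤n (zip-∈ʳ q) (proj₁ (proj₂ (chain-ms q) y d≤y rises))
            (i′ , q′) = zip-origin {xs = is} {ms} same-length m∈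
            i′<i = zip-monotone {_⊏_ = _<_} {_⊏′_ = λ m m′ → proj₁ m < proj₁ m′} <-asym (strip?-sorted N 0 (pt γ₂) (pt δ₂)) (sorted inv) q′ q (n<1+n y)
        in <⇒≱ (d-mono (zip-∈ˡ q′) (zip-∈ˡ q) i′<i) (≤-trans d≤y (crosses y q′)) }

    pair : JPair ρ p δ₁ δ₂ l γ₁ γ₂
    pair = record
      { l-part = pl ; γ₁-part = γ₁-partᴸ L ; γ₂-part = γ₂-partᴸ L ; l-strip = vl ; γ₁-strip = vγ ; γ₂-strip = γ₂-stripᴸ L
      ; l-size = lia 8 (λ i w g₁ g₂ l d₁ d₂ p → i ⊞ g₂ ≐ d₂ ⇒ w ⊞ l ≐ g₁ ⇒ i ≐ w ⇒ g₁ ⊞ g₂ ≐ d₁ ⊞ d₂ ⊞ p ⇒ [ 100101011 ∣ 11010101 ]⊢ l ≐ d₁ ⊞ p)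
          (length is) (length ws) (size γ₁) (size γ₂) (size l) (size δ₁) (size δ₂) p length-is length-ws (trans same-length length-ms) (γ-sizeᴸ L)
      ; γ-size = lia 6 (λ i w g₁ g₂ l d₂ → i ⊞ g₂ ≐ d₂ ⇒ w ⊞ l ≐ g₁ ⇒ i ≐ w ⇒ [ 110101 ∣ 1001011 ]⊢ g₁ ⊞ g₂ ≐ l ⊞ d₂)
          (length is) (length ws) (size γ₁) (size γ₂) (size l) (size δ₂) length-is length-ws (trans same-length length-ms)
      ; rule = ⇒ruleʷ (λ {i} {w} q → cross-over (zip-∈ˡ q) (proj₁ (chain (subst (λ t → (i , w) ∈ zip is t) ws≡ q))))
      ; reverse-rule = ⇒rev (λ {i} {m} q → before (zip-∈ˡ q) (crosses (proj₁ m) q)) }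
      where
      total : ∀ {i} → i ∈ is → ρ + i ≡ suc (d i) + pt γ₂ i
      total {i} i∈ = trans (sym (m∸n+n≡m {ρ + i} {pt γ₂ i} (<⇒≤ (m∸n≢0⇒n<m (λ z → 1+n≢0 (trans (sym (proj₁ (dam≡ i∈))) z)))))) (cong (_+ pt γ₂ i) (proj₁ (dam≡ i∈)))
      cross-over : ∀ {i w} → i ∈ is → d i < w → ρ + i ≤ w + pt γ₂ i
      cross-over {i} i∈ lt = ≤-trans (≤-reflexive (total i∈)) (+-monoˡ-≤ (pt γ₂ i) lt)
      before : ∀ {i y} → i ∈ is → y ≤ d i → y + pt γ₂ i < ρ + i
      before {i} i∈ le = ≤-trans (s≤s (+-monoˡ-≤ (pt γ₂ i) le)) (≤-reflexive (sym (total i∈)))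

-- The index set on the right-hand side of the product formula.

module VerticalPairSums where

  open Linear using (∧-T; lia; _⊞_; _≐_; _⇒_; [_]⊢_; [_∣_]⊢_)
  open Step using (VStrip)
  open Enum
  open Shape
  open Picture using (Picture; At)
  open Tableau
  open Strips
  open LinkedRows

  distinctRows⇒ : ∀ bs → T (distinctRows bs) → AllPairs (λ b c → row b ≢ row c) bs
  distinctRows⇒ [] h = []
  distinctRows⇒ (b ∷ bs) h = let (p , q) = ∧-T {allB (λ c → not (row b ≡ᵇ row c)) bs} h in
    All.tabulate (λ {c} c∈ e → not-T (T-allB (λ c → not (row b ≡ᵇ row c)) bs p c∈) (≡⇒≡ᵇ (row b) (row c) e)) ∷ distinctRows⇒ bs q
    where
    not-T : ∀ {b} → T (not b) → T b → ⊥
    not-T {false} _ ()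

  ⇒distinctRows : ∀ bs → AllPairs (λ b c → row b ≢ row c) bs → T (distinctRows bs)
  ⇒distinctRows [] h = tt
  ⇒distinctRows (b ∷ bs) (p ∷ ps) = ∧-T⁺ {allB (λ c → not (row b ≡ᵇ row c)) bs}
    (allB-T (λ c → not (row b ≡ᵇ row c)) bs (λ {c} c∈ → T-not (λ t → All.lookup p c∈ (≡ᵇ⇒≡ (row b) (row c) t)))) (⇒distinctRows bs ps)
    where
    T-not : ∀ {b} → (T b → ⊥) → T (not b)
    T-not {true} f = f tt
    T-not {false} f = tt

  AllPairs-∈² : ∀ {A : Set} {R : A → A → Set} {xs : List A} {x y} → (∀ {x y} → R x y → R y x) → AllPairs R xs → x ∈ xs → y ∈ xs → x ≢ y → R x y
  AllPairs-∈² s (p ∷ ps) (here refl) (here refl) n = ⊥-elim (n refl)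
  AllPairs-∈² s (p ∷ ps) (here refl) (there b) n = All.lookup p b
  AllPairs-∈² s (p ∷ ps) (there a) (here refl) n = s (All.lookup p a)
  AllPairs-∈² s (p ∷ ps) (there a) (there b) n = AllPairs-∈² s ps a b n

  isVStrip⇒ : ∀ μ ν q → T (isVStrip μ ν q) → VStrip (pt ν) (pt μ) × length (boxes μ ν) ≡ q
  isVStrip⇒ μ ν q h = (λ k → ⊆ᵇ⇒⊑ ν μ a k , thin k) , ≡ᵇ⇒≡ (length (boxes μ ν)) q (proj₁ bc)
    where
    a = proj₁ (∧-T {ν ⊆ᵇ μ} h)
    bc = ∧-T {length (boxes μ ν) ≡ᵇ q} (proj₂ (∧-T {ν ⊆ᵇ μ} h))
    thin : ∀ k → pt μ k ≤ suc (pt ν k)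
    thin k = ≮⇒≥ (λ lt → AllPairs-∈² (λ n e → n (sym e)) (distinctRows⇒ (boxes μ ν) (proj₂ bc))
      (∈-boxes⁺ {μ} {ν} {k} (≤-refl , ≤-trans (n≤1+n _) lt)) (∈-boxes⁺ {μ} {ν} {k} (n≤1+n _ , lt)) (λ e → 1+n≢n (sym (cong proj₂ e))) refl)

  ⇒isVStrip : ∀ μ ν q → VStrip (pt ν) (pt μ) → length (boxes μ ν) ≡ q → T (isVStrip μ ν q)
  ⇒isVStrip μ ν q v e = ∧-T⁺ {ν ⊆ᵇ μ} (⊑⇒⊆ᵇ ν μ (λ k → proj₁ (v k))) (∧-T⁺ {length (boxes μ ν) ≡ᵇ q} (≡⇒≡ᵇ _ q e)
    (⇒distinctRows (boxes μ ν) (subst (AllPairs (λ b c → row b ≢ row c)) (sym (boxes-strip μ ν v (length μ) ≤-refl))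
      (AP.map⁺ (AllPairs.map (λ p e → <-irrefl (suc-injective e) p) (strip?-sorted (length μ) 0 (pt ν) (pt μ)))))))

  module StripRW (α β γ δ : Part) (pγ : IsP γ) (pδ : IsP δ) (vα : VStrip (pt β) (pt α)) (vγ : VStrip (pt δ) (pt γ))
                 (len : length (rl α β) ≡ length (boxes γ δ)) where

    private
      Z = zip (rl α β) (boxes γ δ)

      A : ℕ → ℕ → ℕ → ℕ → Set
      A = At Z

      rl-rows : RowSorted (rl α β)
      rl-rows = subst RowSorted (sym (rl-strip α β vα (length α) ≤-refl)) (AP.map⁺ (AllPairs.map s≤s (strip?-sorted (length α) 0 (pt β) (pt α))))

      box-rows : RowSorted (boxes γ δ)
      box-rows = subst RowSorted (sym (boxes-strip γ δ vγ (length γ) ≤-refl)) (AP.map⁺ (AllPairs.map s≤s (strip?-sorted (length γ) 0 (pt δ) (pt γ))))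

      src : ∀ {i j k l} → A i j k l → InSkew α β i j
      src a with ∈-rl⁻ {α} {β} (zip-∈ˡ a)
      ... | (_ , refl , s) = s

      tgt : ∀ {i j k l} → A i j k l → InSkew γ δ k l
      tgt a with ∈-boxes⁻ {γ} {δ} (zip-∈ʳ a)
      ... | (_ , refl , s) = s

      img : ∀ {i j} → InSkew α β i j → ∃[ k ] ∃[ l ] A i j k l
      img s with zip-image {ys = boxes γ δ} len (∈-rl⁺ {α} {β} s)
      ... | (x , x∈) with ∈-boxes⁻ {γ} {δ} (zip-∈ʳ x∈)
      ... | (_ , refl , _) = _ , _ , x∈

      org : ∀ {k l} → InSkew γ δ k l → ∃[ i ] ∃[ j ] A i j k l
      org s with zip-origin {xs = rl α β} len (∈-boxes⁺ {γ} {δ} s)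
      ... | (b , b∈) with ∈-rl⁻ {α} {β} (zip-∈ˡ b∈)
      ... | (_ , refl , _) = _ , _ , b∈

      col-γ : ∀ {i j k l} → A i j k l → l ≡ suc (pt δ k)
      col-γ {k = k} a = ≤-antisym (≤-trans (proj₂ (tgt a)) (proj₂ (vγ k))) (proj₁ (tgt a))

      col-α : ∀ {i j k l} → A i j k l → j ≡ suc (pt β i)
      col-α {i} a = ≤-antisym (≤-trans (proj₂ (src a)) (proj₂ (vα i))) (proj₁ (src a))

      mono : ∀ {i j k l i′ j′ k′ l′} → A i j k l → A i′ j′ k′ l′ → k < k′ → i < i′
      mono a b lt = ≤-pred (zip-monotone {_⊏_ = λ x y → row x < row y} {_⊏′_ = λ x y → row x < row y} <-asym rl-rows box-rows a b (s≤s lt))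

      fun : ∀ {i j k l k′ l′} → A i j k l → A i j k′ l′ → k ≡ k′ × l ≡ l′
      fun a b = let e = zip-functional (rl-unique α β) a b in suc-injective (cong proj₁ e) , cong proj₂ e

      inj : ∀ {i j i′ j′ k l} → A i j k l → A i′ j′ k l → i ≡ i′ × j ≡ j′
      inj a b = let e = zip-injective (boxes-unique γ δ) a b in suc-injective (cong proj₁ e) , cong proj₂ e

      mono⁻ : ∀ {i j k l j′ k′ l′} → A i j k l → A (suc i) j′ k′ l′ → k < k′
      mono⁻ {i} {j} {k} {l} {j′} {k′} {l′} a b with <-cmp k k′
      ... | tri< lt _ _ = lt
      ... | tri> _ _ gt = ⊥-elim (1+n≰n (≤-trans (n≤1+n _) (mono b a gt)))
      ... | tri≈ _ refl _ = ⊥-elim (1+n≢n (sym (proj₁ (inj a (subst (λ l → A (suc i) j′ k l) (trans (col-γ b) (sym (col-γ a))) b)))))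

      picture : Picture α β γ δ A
      picture = record
        { source = src ; target = tgt ; image = img ; origin = org ; functional = fun ; injective = inj
        ; right = λ a b → ⊥-elim (1+n≢n (trans (col-γ b) (sym (col-γ a))))
        ; down = λ a b → inj₁ (mono a b ≤-refl)
        ; rowwise = λ a b lt → ⊥-elim (<-irrefl (trans (col-α b) (sym (col-α a))) lt)
        ; colwise = λ {i} {j} {k} {l} {k′} {l′} a b → let lt = mono⁻ a b in lt ,
            ≤-trans (≤-reflexive (col-γ b)) (≤-trans (s≤s (Chain.dec-≤ (pt-dec δ pδ) (<⇒≤ lt))) (≤-reflexive (sym (col-γ a)))) }

    -- Both labellings run downwards with one box per row. Hence no two labels share a row of α/β,
    -- and labels in a common column go to different rows in the right order; a lower box of a
    -- vertical strip never lies further to the right.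
    strip-RW : T (RW γ δ α β (Tstrip γ δ))
    strip-RW = proj₂ (Conversion.complete-RW α β γ δ (boxes γ δ) ↭-refl len picture)

  -- the index set of the right-hand side

  enum-if : ∀ {A : Set} {xs : List A} {P : A → Set} (c : Bool) → (T c → Enumerates xs P) → Enumerates (if c then xs else []) (λ x → T c × P x)
  enum-if true e = enum-resp (λ p → tt , p) proj₂ (e tt)
  enum-if false e = enumerates [] (λ ()) (λ ())

  innerCond : ℕ → Part → Part → Part → Part → ℕ → Part → Bool
  innerCond r β₁ β₂ l γ₂ q γ₁ = isVStrip γ₁ l q ∧ RW γ₁ l β₂ γ₂ (Tstrip γ₁ l) ∧ rowRule r β₂ γ₂ (Tstrip γ₁ l)
                              ∧ reverseRowRule r β₂ γ₂ (Slide (Tstrip l β₁) (Tstrip γ₁ l))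

  innerFor : ℕ → Part → Part → Part → Part → List (Part × Part)
  innerFor r β₁ β₂ l γ₂ = let q = size β₂ ∸ size γ₂ in
    if (1 ≤ᵇ q) ∧ isVStrip β₂ γ₂ q then map (λ γ₁ → (γ₁ , γ₂)) (filterB (innerCond r β₁ β₂ l γ₂ q) (partitionsOf (size l + q))) else []

  -- The separate term τ_{λ,δ₂} is placed in front of the inner sum, as its case q = 0.
  Jlist : ℕ → ℕ → Part → Part → List (Part × (Part × Part))
  Jlist r p δ₁ δ₂ = pairs (lambdas δ₁ p) (λ l → (l , δ₂) ∷ innerPairs r δ₁ δ₂ l)

  module _ (ρ p : ℕ) (δ₁ δ₂ : Part) (pδ₁ : IsP δ₁) (pδ₂ : IsP δ₂) where

    private
      IsLambda : Part → Set
      IsLambda l = (IsP l × size l ≡ size δ₁ + p) × T (isVStrip l δ₁ p)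

      IsInner : Part → Part × Part → Set
      IsInner l γ = ∃[ γ₂ ] ((IsP γ₂ × γ₂ ⊑ δ₂) × (T ((1 ≤ᵇ size δ₂ ∸ size γ₂) ∧ isVStrip δ₂ γ₂ (size δ₂ ∸ size γ₂)) ×
        ∃[ γ₁ ] (((IsP γ₁ × size γ₁ ≡ size l + (size δ₂ ∸ size γ₂)) × T (innerCond (suc ρ) δ₁ δ₂ l γ₂ (size δ₂ ∸ size γ₂) γ₁)) × γ ≡ (γ₁ , γ₂))))

      enum-inner : ∀ l → Enumerates (innerPairs (suc ρ) δ₁ δ₂ l) (IsInner l)
      enum-inner l = enum-concatMap (innerFor (suc ρ) δ₁ δ₂ l) (λ { _ _ (_ , _ , _ , refl) (_ , _ , _ , refl) → refl }) (enum-subPartitions δ₂)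
        (λ {γ₂} _ → enum-if _ (λ _ → enum-map (λ γ₁ → (γ₁ , γ₂)) (cong proj₁) (enum-filterB (innerCond (suc ρ) δ₁ δ₂ l γ₂ (size δ₂ ∸ size γ₂)) (enum-partitionsOf (size l + (size δ₂ ∸ size γ₂))))))

      enum-here : ∀ l → Enumerates ((l , δ₂) ∷ innerPairs (suc ρ) δ₁ δ₂ l) (λ γ → γ ≡ (l , δ₂) ⊎ IsInner l γ)
      enum-here l = enumerates
        (All.tabulate (λ { γ∈ refl → proper (sound (enum-inner l) γ∈) }) ∷ unique (enum-inner l))
        (λ { (here e) → inj₁ e ; (there p) → inj₂ (sound (enum-inner l) p) })
        (λ { (inj₁ e) → here e ; (inj₂ i) → there (complete (enum-inner l) i) })
        where
        proper : IsInner l (l , δ₂) → ⊥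
        proper (_ , _ , t , _ , _ , refl) = 1+n≰n (≤-trans (≤ᵇ⇒≤ 1 _ (proj₁ (∧-T {1 ≤ᵇ size δ₂ ∸ size δ₂} t))) (≤-reflexive (n∸n≡0 (size δ₂))))

      idle : ∀ l → IsLambda l → JPair ρ p δ₁ δ₂ l l δ₂
      idle l ((pl , sl) , v) = record
        { l-part = pl ; γ₁-part = pl ; γ₂-part = pδ₂ ; l-strip = proj₁ (isVStrip⇒ l δ₁ p v)
        ; γ₁-strip = λ k → ≤-refl , n≤1+n _ ; γ₂-strip = λ k → ≤-refl , n≤1+n _ ; l-size = sl ; γ-size = refl
        ; rule = subst (λ L → T (allB (λ bx → Rr (suc ρ) (proj₁ bx) ℤ.≤ᵇ ℤ.+ row (proj₂ bx)) (zip L (boxes l l)))) (sym none) tt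
        ; reverse-rule = subst (λ L → T (allB (λ bx → not (Rr (suc ρ) (proj₁ bx) ℤ.≤ᵇ ℤ.+ row (proj₂ bx))) (zip L (Slide (Tstrip l δ₁) (Tstrip l l))))) (sym none) tt }
        where
        empty : ∀ {A : Set} (xs : List A) → length xs ≡ 0 → xs ≡ []
        empty [] e = refl
        none : rl δ₂ δ₂ ≡ []
        none = empty (rl δ₂ δ₂) (+-cancelʳ-≡ (size δ₂) _ 0 (length-rl δ₂ δ₂ pδ₂ (λ _ → ≤-refl)))

      inner : ∀ l γ₁ γ₂ → IsLambda l → IsInner l (γ₁ , γ₂) → JPair ρ p δ₁ δ₂ l γ₁ γ₂
      inner l γ₁ γ₂ ((pl , sl) , v) (_ , (pγ₂ , sub) , t , _ , ((pγ₁ , s) , cond) , refl) =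
        let (_ , t₂) = ∧-T {1 ≤ᵇ size δ₂ ∸ size γ₂} t
            (c₁ , c) = ∧-T {isVStrip γ₁ l (size δ₂ ∸ size γ₂)} cond
            (c₂ , c′) = ∧-T {RW γ₁ l δ₂ γ₂ (Tstrip γ₁ l)} c
            (c₃ , c₄) = ∧-T {rowRule (suc ρ) δ₂ γ₂ (Tstrip γ₁ l)} c′
        in record
          { l-part = pl ; γ₁-part = pγ₁ ; γ₂-part = pγ₂ ; l-strip = proj₁ (isVStrip⇒ l δ₁ p v)
          ; γ₁-strip = proj₁ (isVStrip⇒ γ₁ l _ c₁) ; γ₂-strip = proj₁ (isVStrip⇒ δ₂ γ₂ _ t₂) ; l-size = sl
          ; γ-size = trans (cong (_+ size γ₂) s) (trans (+-assoc (size l) _ _) (cong (size l +_) (m∸n+n≡m (size-mono γ₂ δ₂ sub))))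
          ; rule = c₃ ; reverse-rule = c₄ }

      lambda : ∀ {l γ₁ γ₂} → JPair ρ p δ₁ δ₂ l γ₁ γ₂ → IsLambda l
      lambda {l} J = (l-part J , l-size J) , ⇒isVStrip l δ₁ p (l-strip J)
        (+-cancelʳ-≡ (size δ₁) _ p (trans (length-boxes l δ₁ pδ₁ (VStrip-⊑ {δ₁} {l} (l-strip J))) (trans (l-size J) (+-comm (size δ₁) p))))

      split : ∀ {l γ₁ γ₂} → JPair ρ p δ₁ δ₂ l γ₁ γ₂ → (γ₁ , γ₂) ≡ (l , δ₂) ⊎ IsInner l (γ₁ , γ₂)
      split {l} {γ₁} {γ₂} J = by (m≤n⇒m<n∨m≡n (size-mono γ₂ δ₂ sub))
        where
        sub : γ₂ ⊑ δ₂
        sub = VStrip-⊑ {γ₂} {δ₂} (γ₂-strip J)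
        subγ : l ⊑ γ₁
        subγ = VStrip-⊑ {l} {γ₁} (γ₁-strip J)
        by : size γ₂ < size δ₂ ⊎ size γ₂ ≡ size δ₂ → (γ₁ , γ₂) ≡ (l , δ₂) ⊎ IsInner l (γ₁ , γ₂)
        by (inj₂ e) = inj₁ (cong₂ _,_
          (sym (pt-injective l γ₁ (l-part J) (γ₁-part J) (⊑-size-≡ l γ₁ subγ (lia 4 (λ g₁ g₂ l d → g₁ ⊞ g₂ ≐ l ⊞ d ⇒ g₂ ≐ d ⇒ [ 10011 ∣ 1101 ]⊢ l ≐ g₁) (size γ₁) (size γ₂) (size l) (size δ₂) (γ-size J) e))))
          (pt-injective γ₂ δ₂ (γ₂-part J) pδ₂ (⊑-size-≡ γ₂ δ₂ sub e)))
        by (inj₁ lt) = inj₂ (γ₂ , (γ₂-part J , sub) ,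
          ∧-T⁺ {1 ≤ᵇ q} (≤⇒≤ᵇ (m<n⇒0<n∸m lt)) (⇒isVStrip δ₂ γ₂ q (γ₂-strip J) (+-cancelʳ-≡ (size γ₂) _ q (trans lδ (sym q+)))) ,
          γ₁ , ((γ₁-part J , γ₁-size) ,
            ∧-T⁺ {isVStrip γ₁ l q} (⇒isVStrip γ₁ l q (γ₁-strip J) lγ)
              (∧-T⁺ {RW γ₁ l δ₂ γ₂ (Tstrip γ₁ l)} (StripRW.strip-RW δ₂ γ₂ γ₁ l (γ₁-part J) (l-part J) (γ₂-strip J) (γ₁-strip J) (trans lrl (sym lγ)))
                (∧-T⁺ {rowRule (suc ρ) δ₂ γ₂ (Tstrip γ₁ l)} (rule J) (reverse-rule J)))) , refl)
          where
          q = size δ₂ ∸ size γ₂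
          q+ : q + size γ₂ ≡ size δ₂
          q+ = m∸n+n≡m (<⇒≤ lt)
          lδ : length (boxes δ₂ γ₂) + size γ₂ ≡ size δ₂
          lδ = length-boxes δ₂ γ₂ (γ₂-part J) sub
          γ₁-size : size γ₁ ≡ size l + q
          γ₁-size = lia 5 (λ g₁ g₂ l d q → g₁ ⊞ g₂ ≐ l ⊞ d ⇒ q ⊞ g₂ ≐ d ⇒ [ 1101 ∣ 10011 ]⊢ g₁ ≐ l ⊞ q) (size γ₁) (size γ₂) (size l) (size δ₂) q (γ-size J) q+
          lγ : length (boxes γ₁ l) ≡ q
          lγ = +-cancelʳ-≡ (size l) _ q (trans (length-boxes γ₁ l (l-part J) subγ) (trans γ₁-size (+-comm (size l) q)))
          lrl : length (rl δ₂ γ₂) ≡ q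
          lrl = +-cancelʳ-≡ (size γ₂) _ q (trans (length-rl δ₂ γ₂ (γ₂-part J) sub) (sym q+))

    enum-Jlist : Enumerates (Jlist (suc ρ) p δ₁ δ₂) (λ z → JPair ρ p δ₁ δ₂ (proj₁ z) (proj₁ (proj₂ z)) (proj₂ (proj₂ z)))
    enum-Jlist = enum-resp
      (λ { {l , _} (il , inj₁ refl) → idle l il ; {l , (γ₁ , γ₂)} (il , inj₂ i) → inner l γ₁ γ₂ il i })
      (λ J → lambda J , split J)
      (enum-pairs (enum-filterB (λ l → isVStrip l δ₁ p) (enum-partitionsOf (size δ₁ + p))) (λ {l} _ → enum-here l))

-- Arrows that obey the row rule.

module Arrows where

  open Linear using (∧-T; lia; _⊞_; _≐_; _⇒_; [_]⊢_; [_∣_]⊢_)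
  open Enum
  open Shape
  open Picture using (Picture; At)
  open Tableau

  eqList⇒≡ : ∀ xs ys → T (eqList xs ys) → xs ≡ ys
  eqList⇒≡ [] [] h = refl
  eqList⇒≡ (x ∷ xs) (y ∷ ys) h = let (p , q) = ∧-T {x ≡ᵇ y} h in cong₂ _∷_ (≡ᵇ⇒≡ x y p) (eqList⇒≡ xs ys q)

  eqList-refl : ∀ xs → T (eqList xs xs)
  eqList-refl [] = tt
  eqList-refl (x ∷ xs) = ∧-T⁺ {x ≡ᵇ x} (≡⇒≡ᵇ x x refl) (eqList-refl xs)

  length-zero : ∀ {A : Set} (xs : List A) → length xs ≡ 0 → xs ≡ []
  length-zero [] e = refl

  boxes-self : ∀ α → IsP α → boxes α α ≡ []
  boxes-self α p = length-zero (boxes α α) (+-cancelʳ-≡ (size α) _ 0 (length-boxes α α p (λ _ → ≤-refl)))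

  rl-self : ∀ α → IsP α → rl α α ≡ []
  rl-self α p = length-zero (rl α α) (+-cancelʳ-≡ (size α) _ 0 (length-rl α α p (λ _ → ≤-refl)))

  record IsArrow (ρ : ℕ) (α₁ α₂ : Part) (a : Arrow) : Set where
    private
      β₁ = proj₁ a
      β₂ = proj₁ (proj₂ a)
      t  = proj₂ (proj₂ a)
    field
      part₁ : IsP β₁
      part₂ : IsP β₂
      sub₁  : α₁ ⊑ β₁
      sub₂  : β₂ ⊑ α₂
      rw    : T (RW β₁ α₁ α₂ β₂ t)
      rr    : T (rowRule (suc ρ) α₂ β₂ t)

  open IsArrow public

  idArrows : ℕ → Part → Part → List Arrow
  idArrows r α₁ α₂ = (α₁ , α₂ , []) ∷ filterB (λ a → rowRule r α₂ (proj₁ (proj₂ a)) (proj₂ (proj₂ a))) (arrowsFrom α₁ α₂)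

  RW-size : ∀ α β γ δ t → IsP β → IsP δ → β ⊑ α → δ ⊑ γ → T (RW γ δ α β t) → size γ + size β ≡ size δ + size α
  RW-size α β γ δ t pβ pδ β⊑α δ⊑γ h = lia 6 (λ lr lb a b g d → lr ⊞ b ≐ a ⇒ lb ⊞ d ≐ g ⇒ lr ≐ lb ⇒ [ 110101 ∣ 1001011 ]⊢ g ⊞ b ≐ d ⊞ a)
    (length (rl α β)) (length (boxes γ δ)) (size α) (size β) (size γ) (size δ) (length-rl α β pβ β⊑α) (length-boxes γ δ pδ δ⊑γ)
    (trans (Conversion.Sound.len α β γ δ t h) (↭-length (Conversion.Sound.perm α β γ δ t h)))

  module _ (ρ : ℕ) (α₁ α₂ : Part) (p₁ : IsP α₁) (p₂ : IsP α₂) where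

    arrow-size : ∀ {a} → IsArrow ρ α₁ α₂ a → size (proj₁ a) + size (proj₁ (proj₂ a)) ≡ size α₁ + size α₂
    arrow-size {β₁ , β₂ , t} A = RW-size α₂ β₂ β₁ α₁ t (part₂ A) p₁ (sub₂ A) (sub₁ A) (rw A)

    trivial : IsArrow ρ α₁ α₂ (α₁ , α₂ , [])
    trivial = record
      { part₁ = p₁ ; part₂ = p₂ ; sub₁ = λ _ → ≤-refl ; sub₂ = λ _ → ≤-refl
      ; rw = proj₂ (Conversion.complete-RW α₂ α₂ α₁ α₁ [] (subst ([] ↭_) (sym (boxes-self α₁ p₁)) ↭-refl) (cong length none) empty)
      ; rr = subst (λ L → T (allB (λ bx → Rr (suc ρ) (proj₁ bx) ℤ.≤ᵇ ℤ.+ row (proj₂ bx)) (zip L []))) (sym none) tt }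
      where
      none : rl α₂ α₂ ≡ []
      none = rl-self α₂ p₂
      void : ∀ {z} → z ∈ zip (rl α₂ α₂) [] → ⊥
      void {z} z∈ with subst (λ L → z ∈ zip L []) none z∈
      ... | ()
      empty : Picture α₂ α₂ α₁ α₁ (At (zip (rl α₂ α₂) []))
      empty = record
        { source = λ a → ⊥-elim (void a) ; target = λ a → ⊥-elim (void a)
        ; image = λ (p , q) → ⊥-elim (<⇒≱ p q) ; origin = λ (p , q) → ⊥-elim (<⇒≱ p q)
        ; functional = λ a _ → ⊥-elim (void a) ; injective = λ a _ → ⊥-elim (void a)
        ; right = λ a _ → ⊥-elim (void a) ; down = λ a _ → ⊥-elim (void a)
        ; rowwise = λ a _ _ → ⊥-elim (void a) ; colwise = λ a _ → ⊥-elim (void a) }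

    only-trivial : ∀ {t} → IsArrow ρ α₁ α₂ (α₁ , α₂ , t) → t ≡ []
    only-trivial {t} A = length-zero t (trans (↭-length (Conversion.Sound.perm α₂ α₂ α₁ α₁ t (rw A))) (cong length (boxes-self α₁ p₁)))

    private
      same? : Part → Part → Bool
      same? β₁ β₂ = eqList β₁ α₁ ∧ eqList β₂ α₂

      enum-unless : ∀ {A : Set} {xs : List A} {P : A → Set} (c : Bool) → Enumerates xs P → Enumerates (if c then [] else xs) (λ x → T (not c) × P x)
      enum-unless false e = enum-resp (λ p → tt , p) proj₂ e
      enum-unless true e = enumerates [] (λ ()) (λ ())

    enum-arrowsFrom : Enumerates (filterB (λ a → rowRule (suc ρ) α₂ (proj₁ (proj₂ a)) (proj₂ (proj₂ a))) (arrowsFrom α₁ α₂))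
                                 (λ a → IsArrow ρ α₁ α₂ a × T (not (same? (proj₁ a) (proj₁ (proj₂ a)))))
    enum-arrowsFrom = enum-resp
      (λ { {β₁ , β₂ , t} ((_ , (q₂ , s₂) , _ , ((q₁ , _) , s₁) , ne , _ , ((_ , _) , h) , refl) , r) →
          record { part₁ = q₁ ; part₂ = q₂ ; sub₁ = ⊆ᵇ⇒⊑ α₁ β₁ s₁ ; sub₂ = s₂ ; rw = h ; rr = r } , ne })
      (λ { {β₁ , β₂ , t} (A , ne) →
          (β₂ , (part₂ A , sub₂ A) , β₁ , ((part₁ A , sizeOf A) , ⊑⇒⊆ᵇ α₁ β₁ (sub₁ A)) , ne , t ,
            (isStd⇒ β₁ α₁ t (proj₁ (∧-T {isStd β₁ α₁ t} (rw A))) , rw A) , refl) , rr A })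
      (enum-filterB _ (enum-concatMap {Q = λ β₂ a → _} _ (λ { _ _ (_ , _ , _ , _ , _ , refl) (_ , _ , _ , _ , _ , refl) → refl }) (enum-subPartitions α₂)
        (λ {β₂} _ → enum-concatMap {Q = λ β₁ a → _} _ (λ { _ _ (_ , _ , _ , refl) (_ , _ , _ , refl) → refl })
          (enum-filterB (α₁ ⊆ᵇ_) (enum-partitionsOf (size α₁ + (size α₂ ∸ size β₂))))
          (λ {β₁} _ → enum-unless (same? β₁ β₂) (enum-map (λ t → (β₁ , β₂ , t)) (λ { refl → refl })
            (enum-filterB (RW β₁ α₁ α₂ β₂) (enum-filterB (increasing β₁ α₁) (enum-perms (boxes β₁ α₁) (boxes-unique β₁ α₁)))))))))
      where
      sizeOf : ∀ {a} → IsArrow ρ α₁ α₂ a → size (proj₁ a) ≡ size α₁ + (size α₂ ∸ size (proj₁ (proj₂ a)))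
      sizeOf {β₁ , β₂ , t} A = lia 5 (λ b₁ b₂ a₁ a₂ d → b₁ ⊞ b₂ ≐ a₁ ⊞ a₂ ⇒ d ⊞ b₂ ≐ a₂ ⇒ [ 1101 ∣ 10011 ]⊢ b₁ ≐ a₁ ⊞ d) (size β₁) (size β₂) (size α₁) (size α₂) (size α₂ ∸ size β₂)
        (arrow-size A) (m∸n+n≡m (size-mono β₂ α₂ (sub₂ A)))

    enum-idArrows : Enumerates (idArrows (suc ρ) α₁ α₂) (IsArrow ρ α₁ α₂)
    enum-idArrows = enumerates
      (All.tabulate (λ { a∈ refl → proper (sound enum-arrowsFrom a∈) }) ∷ unique enum-arrowsFrom)
      (λ { (here refl) → trivial ; (there p) → proj₁ (sound enum-arrowsFrom p) })
      (λ {a} A → find (proj₁ a) (proj₁ (proj₂ a)) (proj₂ (proj₂ a)) A)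
      where
      proper : ∀ {t} → IsArrow ρ α₁ α₂ (α₁ , α₂ , t) × T (not (same? α₁ α₂)) → ⊥
      proper (_ , h) = not-T h (∧-T⁺ {eqList α₁ α₁} (eqList-refl α₁) (eqList-refl α₂))
        where
        not-T : ∀ {b} → T (not b) → T b → ⊥
        not-T {false} _ ()
      find : ∀ β₁ β₂ t → IsArrow ρ α₁ α₂ (β₁ , β₂ , t) → (β₁ , β₂ , t) ∈ idArrows (suc ρ) α₁ α₂
      find β₁ β₂ t A with same? β₁ β₂ in e
      ... | false = there (complete enum-arrowsFrom (A , subst (T ∘ not) (sym e) tt))
      ... | true = identity (∧-T {eqList β₁ α₁} (subst T (sym e) tt)) A
        where
        identity : T (eqList β₁ α₁) × T (eqList β₂ α₂) → IsArrow ρ α₁ α₂ (β₁ , β₂ , t) → (β₁ , β₂ , t) ∈ idArrows (suc ρ) α₁ α₂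
        identity (x , y) A with eqList⇒≡ β₁ α₁ x | eqList⇒≡ β₂ α₂ y
        ... | refl | refl = here (cong (λ t → α₁ , α₂ , t) (only-trivial A))

    -- The sum of the two sizes is the same at both ends of an arrow. If the second partition kept
    -- its size, the first would too, and by containment both would be equal.
    proper-smaller : ∀ {a} → IsArrow ρ α₁ α₂ a × T (not (same? (proj₁ a) (proj₁ (proj₂ a)))) → size (proj₁ (proj₂ a)) < size α₂
    proper-smaller {β₁ , β₂ , t} (A , ne) = ≤∧≢⇒< (size-mono β₂ α₂ (sub₂ A)) (λ e → equal ne
        (⊑-size-≡ β₂ α₂ (sub₂ A) e) (⊑-size-≡ α₁ β₁ (sub₁ A) (lia 4 (λ b₁ b₂ a₁ a₂ → b₁ ⊞ b₂ ≐ a₁ ⊞ a₂ ⇒ b₂ ≐ a₂ ⇒ [ 10011 ∣ 1101 ]⊢ a₁ ≐ b₁) (size β₁) (size β₂) (size α₁) (size α₂) (arrow-size A) e)))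
      where
      not-T : ∀ {b} → T (not b) → T b → ⊥
      not-T {false} _ ()
      equal : T (not (same? β₁ β₂)) → (∀ k → pt β₂ k ≡ pt α₂ k) → (∀ k → pt α₁ k ≡ pt β₁ k) → ⊥
      equal ne e₂ e₁ with pt-injective β₂ α₂ (part₂ A) p₂ e₂ | pt-injective α₁ β₁ p₁ (part₁ A) e₁
      ... | refl | refl = not-T ne (∧-T⁺ {eqList α₁ α₁} (eqList-refl α₁) (eqList-refl α₂))

-- The bijection between strips followed by arrows and arrows followed by terms.

module ArrowsPastStrips where

  open Linear using (lia; K; _⊞_; _≼_; _≐_; _⇒_; [_]⊢_; [_∣_]⊢_)
  open Step using (Fn; prefix; Decreasing; VStrip; VanishesFrom)
  open Compat using (prefix-mono)
  open Chain
  open Enum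
  open Shape
  open Picture using (cnt)
  open ArrowToFilling
  open FillingToArrow
  open LinkedRows
  open VerticalPairs
  open VerticalPairSums
  open Arrows

  abstract

    -- The chain `Λ` of the picture of `t`, free of the proofs on which its properties depend, so
    -- that chains of different arrows can be compared.
    shapeOf : Part → Part → Part → Tab → ℕ → Fn
    shapeOf α β δ t i k = pt δ k + cnt (λ bx → (row (proj₁ bx) ≤ᵇ i) ∧ (row (proj₂ bx) ≡ᵇ suc k)) (zip (rl α β) t)

    arrow-filling : ∀ {ρ α₁ α₂ β₁ β₂ t} → IsP α₁ → IsP α₂ → IsArrow ρ α₁ α₂ (β₁ , β₂ , t) →
      Filling ρ (length α₂) (pt α₂) (pt β₂) (pt α₁) (pt β₁) (shapeOf α₂ β₂ α₁ t)
    arrow-filling {ρ} {α₁} {α₂} {β₁} {β₂} {t} p₁ p₂ A =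
      Encoding.Of.filling α₂ β₂ β₁ α₁ p₂ (part₂ A) (part₁ A) p₁ (sub₂ A) (sub₁ A) t (rw A) ρ (rule⇒ ρ α₂ β₂ t (rr A))

    arrow-determined : ∀ {ρ α₁ α₂ β₁ β₂ t t′} → IsP α₁ → IsP α₂ → IsArrow ρ α₁ α₂ (β₁ , β₂ , t) → IsArrow ρ α₁ α₂ (β₁ , β₂ , t′) →
      (∀ i → shapeOf α₂ β₂ α₁ t i ≗ shapeOf α₂ β₂ α₁ t′ i) → t ≡ t′
    arrow-determined {ρ} {α₁} {α₂} {β₁} {β₂} {t} {t′} p₁ p₂ A A′ e =
      Encoding.Determined.same α₂ β₂ β₁ α₁ p₂ (part₂ A) (part₁ A) p₁ (sub₂ A) (sub₁ A) t (rw A) t′ (rw A′) e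

    filling-arrow : ∀ {ρ α₁ α₂ β₁ β₂ Λ} → IsP α₁ → IsP α₂ → IsP β₁ → IsP β₂ → β₂ ⊑ α₂ → α₁ ⊑ β₁ →
      Filling ρ (length α₂) (pt α₂) (pt β₂) (pt α₁) (pt β₁) Λ → ∃[ t ] (IsArrow ρ α₁ α₂ (β₁ , β₂ , t) × (∀ i → shapeOf α₂ β₂ α₁ t i ≗ Λ i))
    filling-arrow {ρ} {α₁} {α₂} {β₁} {β₂} {Λ} p₁ p₂ q₁ q₂ s₂ s₁ F =
      D.tab , record { part₁ = q₁ ; part₂ = q₂ ; sub₁ = s₁ ; sub₂ = s₂ ; rw = D.tab-RW ; rr = D.tab-rule } , D.tab-Λ
      where
      module D = Decoded ρ α₂ β₂ β₁ α₁ p₂ q₂ q₁ p₁ s₂ s₁ Λ F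

  missing : Part → Part → Fn
  missing α β i = pt α i ∸ pt β i

  inner-≤-outer : ∀ {ρ m a g b e Λ} → Filling ρ m a g b e Λ → ∀ i → g i ≤ a i
  inner-≤-outer {a = a} {g} {Λ = Λ} F i = let (N , h) = total F i in
    lia 4 (λ g a p q → g ⊞ q ≐ a ⊞ p ⇒ p ≼ q ⇒ [ 111 ]⊢ g ≼ a) (g i) (a i) (prefix (Λ i) N) (prefix (Λ (suc i)) N) (h N ≤-refl) (prefix-mono (λ k → proj₁ (strip F i k)) N)

  -- This is column strictness at `k = 0`: below the smallest entry there are only the inner boxes,
  -- and the inner boxes of row `suc i` must lie under those of row `i`.
  inner-dec : ∀ {ρ m a g b e Λ} → Filling ρ m a g b e Λ → Decreasing g
  inner-dec {g = g} {Λ = Λ} F i = lia 5 (λ g g⁺ x y z → g⁺ ⊞ z ⊞ K 0 ≼ g ⊞ K 0 ⊞ y ⇒ y ≼ z ⇒ [ 111 ]⊢ g⁺ ≼ g)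
    (g i) (g (suc i)) 0 (prefix (Λ (suc i)) 1) (prefix (Λ (suc (suc i))) 1) (strict F i 0) (prefix-mono (λ k → proj₁ (strip F (suc i) k)) 1)

  start-≤ : ∀ {ρ m a g b e Λ} → Filling ρ m a g b e Λ → ∀ k → b k ≤ e k
  start-≤ F k = ≤-trans (≤-reflexive (sym (start F k))) (≤-end F 0 k)

  module _ (ρ p : ℕ) (β₁ β₂ : Part) (pβ₁ : IsP β₁) (pβ₂ : IsP β₂) where

    private
      IsLambda : Part → Set
      IsLambda l = (IsP l × size l ≡ size β₁ + p) × T (isVStrip l β₁ p)

      lambda-strip : ∀ {l} → IsLambda l → VStrip (pt β₁) (pt l)
      lambda-strip {l} L = proj₁ (isVStrip⇒ l β₁ p (proj₂ L))

      X : Part × Arrow → Set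
      X (l , a) = IsLambda l × IsArrow ρ l β₂ a

      Y : Arrow × (Part × (Part × Part)) → Set
      Y (b , z) = IsArrow ρ β₁ β₂ b × JPair ρ p (proj₁ b) (proj₁ (proj₂ b)) (proj₁ z) (proj₁ (proj₂ z)) (proj₂ (proj₂ z))

      -- The correspondence: equal targets, and chains related by an infusion that absorbs the boxes
      -- of δ₂/γ₂. The second partition `l′` does not occur, as it is determined by `J-unique`.
      R : Part × Arrow → Arrow × (Part × (Part × Part)) → Set
      R (l , (γ₁ , γ₂ , t)) ((δ₁ , δ₂ , t′) , (l′ , γ)) = (γ₁ , γ₂) ≡ γ ×
        Infusion ρ (pt γ₂) (missing δ₂ γ₂) (shapeOf β₂ δ₂ β₁ t′) (shapeOf β₂ γ₂ l t)

      add-missing : ∀ {γ₂ δ₂} → VStrip (pt γ₂) (pt δ₂) → pt δ₂ ≗ (λ i → pt γ₂ i + missing δ₂ γ₂ i)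
      add-missing v i = sym (m+[n∸m]≡n (proj₁ (v i)))

      arrow-outside : ∀ {l γ₁ γ₂ t} → IsArrow ρ l β₂ (γ₁ , γ₂ , t) → ∀ i → length β₂ ≤ i → pt γ₂ i ≡ 0
      arrow-outside A i h = n≤0⇒n≡0 (≤-trans (sub₂ A i) (≤-reflexive (pt-vanish β₂ i h)))

      module To (l γ₁ γ₂ : Part) (t : Tab) (L : IsLambda l) (A : IsArrow ρ l β₂ (γ₁ , γ₂ , t)) where
        pl : IsP l
        pl = proj₁ (proj₁ L)

        F : Filling ρ (length β₂) (pt β₂) (pt γ₂) (pt l) (pt γ₁) (shapeOf β₂ γ₂ l t)
        F = arrow-filling pl pβ₂ A

        open Push ρ (length β₂) (length γ₁) (pt β₂) (pt γ₂) (pt l) (pt γ₁) (pt β₁) (shapeOf β₂ γ₂ l t) F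
                  (pt-vanish γ₁) (pt-dec β₁ pβ₁) (lambda-strip L) (pt-dec γ₂ (part₂ A)) (arrow-outside A)
          renaming (filling to Φ) using (K′; q; infusion; idle; vert-end; linked-end)

        D₁ : Fn
        D₁ = K′ (length β₂)

        D₁-dec : Decreasing D₁
        D₁-dec = HStrip-decˡ (strip Φ (length β₂))

        D₁-vanish : VanishesFrom (length γ₁) D₁
        D₁-vanish k h = n≤0⇒n≡0 (≤-trans (proj₁ (vert-end k)) (≤-reflexive (pt-vanish γ₁ k h)))

        D₂ : Fn
        D₂ i = pt γ₂ i + q i

        D₂-vanish : VanishesFrom (length β₂) D₂
        D₂-vanish i h = cong₂ _+_ (arrow-outside A i h) (proj₁ (idle i h))

        δ₁ δ₂ : Part
        δ₁ = fromFn (length γ₁) D₁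
        δ₂ = fromFn (length β₂) D₂

        δ₁≗ : pt δ₁ ≗ D₁
        δ₁≗ = pt-fromFn (length γ₁) D₁ D₁-dec D₁-vanish

        δ₂≗ : pt δ₂ ≗ D₂
        δ₂≗ = pt-fromFn (length β₂) D₂ (inner-dec Φ) D₂-vanish

        q≗ : q ≗ missing δ₂ γ₂
        q≗ i = trans (sym (m+n∸m≡n (pt γ₂ i) (q i))) (cong (_∸ pt γ₂ i) (sym (δ₂≗ i)))

        q-bit : ∀ i → q i ≤ 1
        q-bit i = Step.q≤1 (stepᵢ infusion i)

        arrow : ∃[ t′ ] (IsArrow ρ β₁ β₂ (δ₁ , δ₂ , t′) × (∀ i → shapeOf β₂ δ₂ β₁ t′ i ≗ K′ i))
        arrow = filling-arrow pβ₁ pβ₂ (fromFn-IsP (length γ₁) D₁ D₁-dec D₁-vanish) (fromFn-IsP (length β₂) D₂ (inner-dec Φ) D₂-vanish)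
          (λ i → ≤-trans (≤-reflexive (δ₂≗ i)) (inner-≤-outer Φ i)) (λ k → ≤-trans (start-≤ Φ k) (≤-reflexive (sym (δ₁≗ k))))
          (Filling-cong (λ i → sym (δ₂≗ i)) (λ _ → refl) (λ k → sym (δ₁≗ k)) Φ)

        B : IsArrow ρ β₁ β₂ (δ₁ , δ₂ , proj₁ arrow)
        B = proj₁ (proj₂ arrow)

        links : LPair ρ p δ₁ δ₂ γ₁ γ₂
        links = record
          { γ₁-partᴸ = part₁ A ; γ₂-partᴸ = part₂ A
          ; γ₁-stripᴸ = λ k → subst (λ x → x ≤ pt γ₁ k × pt γ₁ k ≤ suc x) (sym (δ₁≗ k)) (vert-end k)
          ; γ₂-stripᴸ = λ i → subst (λ x → pt γ₂ i ≤ x × x ≤ suc (pt γ₂ i)) (sym (δ₂≗ i))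
              (m≤m+n _ _ , ≤-trans (+-monoʳ-≤ (pt γ₂ i) (q-bit i)) (≤-reflexive (+-comm (pt γ₂ i) 1)))
          ; γ-sizeᴸ = lia 8 (λ g₁ g₂ d₁ d₂ l b₁ b₂ p → g₁ ⊞ g₂ ≐ l ⊞ b₂ ⇒ l ≐ b₁ ⊞ p ⇒ d₁ ⊞ d₂ ≐ b₁ ⊞ b₂ ⇒ [ 101101 ∣ 1010011 ]⊢ g₁ ⊞ g₂ ≐ d₁ ⊞ d₂ ⊞ p)
              (size γ₁) (size γ₂) (size δ₁) (size δ₂) (size l) (size β₁) (size β₂) p
              (arrow-size ρ l β₂ pl pβ₂ A) (proj₂ (proj₁ L)) (arrow-size ρ β₁ β₂ pβ₁ pβ₂ B)
          ; linkedᴸ = λ i e → let (y , r , k) = linked-end i (trans (q≗ i) (trans (cong (_∸ pt γ₂ i) e) (m+n∸n≡m 1 (pt γ₂ i))))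
                              in y , r , Linked-cong {u = pt γ₁} {u′ = pt γ₁} {y = y} (λ k → sym (δ₁≗ k)) (λ _ → refl) k }

        pairᴶ : JPair ρ p δ₁ δ₂ (FromL.l (part₁ B) (part₂ B) links) γ₁ γ₂
        pairᴶ = FromL.pair (part₁ B) (part₂ B) links

        related : Infusion ρ (pt γ₂) (missing δ₂ γ₂) (shapeOf β₂ δ₂ β₁ (proj₁ arrow)) (shapeOf β₂ γ₂ l t)
        related = Infusion-cong q≗ (λ i k → sym (proj₂ (proj₂ arrow) i k)) (λ _ _ → refl) infusion

      module From (δ₁ δ₂ l′ γ₁ γ₂ : Part) (t′ : Tab) (B : IsArrow ρ β₁ β₂ (δ₁ , δ₂ , t′)) (J : JPair ρ p δ₁ δ₂ l′ γ₁ γ₂) where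
        L : LPair ρ p δ₁ δ₂ γ₁ γ₂
        L = FromJ.links (part₁ B) (part₂ B) J

        Φ : Filling ρ (length β₂) (pt β₂) (λ i → pt γ₂ i + missing δ₂ γ₂ i) (pt β₁) (pt δ₁) (shapeOf β₂ δ₂ β₁ t′)
        Φ = Filling-cong (add-missing {γ₂} {δ₂} (γ₂-strip J)) (λ _ → refl) (λ _ → refl) (arrow-filling pβ₁ pβ₂ B)

        open Pull ρ (length β₂) (length γ₁) (pt β₂) (pt γ₂) (missing δ₂ γ₂) (pt β₁) (pt δ₁) (pt γ₁) (shapeOf β₂ δ₂ β₁ t′) Φ
                  (pt-vanish γ₁) (pt-dec γ₁ (γ₁-part J)) (γ₁-stripᴸ L) (pt-dec γ₂ (γ₂-part J))
                  (λ i → ≤-trans (∸-monoˡ-≤ (pt γ₂ i) (proj₂ (γ₂-strip J i))) (≤-reflexive (m+n∸n≡m 1 (pt γ₂ i))))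
                  (λ i h → n≤0⇒n≡0 (≤-trans (m∸n≤m (pt δ₂ i) (pt γ₂ i)) (≤-trans (sub₂ B i) (≤-reflexive (pt-vanish β₂ i h)))))
                  (pt-vanish β₂)
                  (λ i e → linkedᴸ L i (trans (add-missing {γ₂} {δ₂} (γ₂-strip J) i) (trans (cong (pt γ₂ i +_) e) (+-comm (pt γ₂ i) 1))))

        Λ₀-vanish : VanishesFrom (length γ₁) (Λ 0)
        Λ₀-vanish k h = n≤0⇒n≡0 (≤-trans (start-≤ filling k) (≤-reflexive (pt-vanish γ₁ k h)))

        l : Part
        l = fromFn (length γ₁) (Λ 0)

        l≗ : pt l ≗ Λ 0
        l≗ = pt-fromFn (length γ₁) (Λ 0) start-dec Λ₀-vanish

        pl : IsP l
        pl = fromFn-IsP (length γ₁) (Λ 0) start-dec Λ₀-vanish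

        vl : VStrip (pt β₁) (pt l)
        vl k = subst (λ x → pt β₁ k ≤ x × x ≤ suc (pt β₁ k)) (sym (l≗ k)) (vert-start k)

        arrow : ∃[ t ] (IsArrow ρ l β₂ (γ₁ , γ₂ , t) × (∀ i → shapeOf β₂ γ₂ l t i ≗ Λ i))
        arrow = filling-arrow pl pβ₂ (γ₁-part J) (γ₂-part J) (inner-≤-outer filling) (λ k → ≤-trans (≤-reflexive (l≗ k)) (start-≤ filling k))
          (Filling-cong (λ _ → refl) (λ k → sym (l≗ k)) (λ _ → refl) filling)

        A : IsArrow ρ l β₂ (γ₁ , γ₂ , proj₁ arrow)
        A = proj₁ (proj₂ arrow)

        l-sizeᵉ : size l ≡ size β₁ + p
        l-sizeᵉ = lia 9 (λ g₁ g₂ d₁ d₂ l b₁ b₂ p l′ → g₁ ⊞ g₂ ≐ l ⊞ b₂ ⇒ d₁ ⊞ d₂ ≐ b₁ ⊞ b₂ ⇒ g₁ ⊞ g₂ ≐ l′ ⊞ d₂ ⇒ l′ ≐ d₁ ⊞ p ⇒ [ 100101011 ∣ 11010101 ]⊢ l ≐ b₁ ⊞ p)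
          (size γ₁) (size γ₂) (size δ₁) (size δ₂) (size l) (size β₁) (size β₂) p (size l′)
          (arrow-size ρ l β₂ pl pβ₂ A) (arrow-size ρ β₁ β₂ pβ₁ pβ₂ B) (γ-size J) (l-size J)

        isLambda : IsLambda l
        isLambda = (pl , l-sizeᵉ) , ⇒isVStrip l β₁ p vl
          (+-cancelʳ-≡ (size β₁) _ p (trans (length-boxes l β₁ pβ₁ (VStrip-⊑ {β₁} {l} vl)) (trans l-sizeᵉ (+-comm (size β₁) p))))

        related : Infusion ρ (pt γ₂) (missing δ₂ γ₂) (shapeOf β₂ δ₂ β₁ t′) (shapeOf β₂ γ₂ l (proj₁ arrow))
        related = Infusion-cong (λ _ → refl) (λ _ _ → refl) (λ i k → sym (proj₂ (proj₂ arrow) i k)) infusion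

      module Functional (l γ₁ γ₂ : Part) (t : Tab) (δ₁ δ₂ l′ : Part) (t′ : Tab) (ε₁ ε₂ l″ : Part) (t″ : Tab)
        (B : IsArrow ρ β₁ β₂ (δ₁ , δ₂ , t′)) (J : JPair ρ p δ₁ δ₂ l′ γ₁ γ₂) (C : IsArrow ρ β₁ β₂ (ε₁ , ε₂ , t″)) (H : JPair ρ p ε₁ ε₂ l″ γ₁ γ₂)
        (I : Infusion ρ (pt γ₂) (missing δ₂ γ₂) (shapeOf β₂ δ₂ β₁ t′) (shapeOf β₂ γ₂ l t))
        (I′ : Infusion ρ (pt γ₂) (missing ε₂ γ₂) (shapeOf β₂ ε₂ β₁ t″) (shapeOf β₂ γ₂ l t)) where

        F₁ = arrow-filling pβ₁ pβ₂ B
        F₂ = arrow-filling pβ₁ pβ₂ C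

        both : (∀ i → shapeOf β₂ δ₂ β₁ t′ i ≗ shapeOf β₂ ε₂ β₁ t″ i) × missing δ₂ γ₂ ≗ missing ε₂ γ₂
        both = Infusion-functional (Filling-cong (add-missing {γ₂} {δ₂} (γ₂-strip J)) (λ _ → refl) (λ _ → refl) F₁)
          (Filling-cong (add-missing {γ₂} {ε₂} (γ₂-strip H)) (λ _ → refl) (λ _ → refl) F₂) (λ _ → refl) (λ _ _ → refl) I I′

        eq₁ : δ₁ ≡ ε₁
        eq₁ = pt-injective δ₁ ε₁ (part₁ B) (part₁ C) (λ k → trans (sym (end F₁ (length β₂) ≤-refl k)) (trans (proj₁ both (length β₂) k) (end F₂ (length β₂) ≤-refl k)))

        eq₂ : δ₂ ≡ ε₂
        eq₂ = pt-injective δ₂ ε₂ (part₂ B) (part₂ C) (λ i → trans (add-missing {γ₂} {δ₂} (γ₂-strip J) i)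
          (trans (cong (pt γ₂ i +_) (proj₂ both i)) (sym (add-missing {γ₂} {ε₂} (γ₂-strip H) i))))

      -- Infusing forwards determines the new chain and the numbers absorbed. The end of the chain
      -- is δ₁, and δ₂ is γ₂ enlarged by these numbers; the chain gives back the tableau, and
      -- `J-unique` gives the intermediate partition.
      functional : ∀ {x y y′} → X x → Y y → Y y′ → R x y → R x y′ → y ≡ y′
      functional {l , (γ₁ , γ₂ , t)} {(δ₁ , δ₂ , t′) , (l′ , _)} {(ε₁ , ε₂ , t″) , (l″ , _)} _ (B , J) (C , H) (refl , I) (refl , I′) =
        finish eq₁ eq₂ B J C H (proj₁ both)
        where
        open Functional l γ₁ γ₂ t δ₁ δ₂ l′ t′ ε₁ ε₂ l″ t″ B J C H I I′
        finish : ∀ {δ₁ δ₂ ε₁ ε₂} → δ₁ ≡ ε₁ → δ₂ ≡ ε₂ → IsArrow ρ β₁ β₂ (δ₁ , δ₂ , t′) → JPair ρ p δ₁ δ₂ l′ γ₁ γ₂ → IsArrow ρ β₁ β₂ (ε₁ , ε₂ , t″) →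
          JPair ρ p ε₁ ε₂ l″ γ₁ γ₂ → (∀ i → shapeOf β₂ δ₂ β₁ t′ i ≗ shapeOf β₂ ε₂ β₁ t″ i) →
          ((δ₁ , δ₂ , t′) , (l′ , (γ₁ , γ₂))) ≡ ((ε₁ , ε₂ , t″) , (l″ , (γ₁ , γ₂)))
        finish {δ₁} {δ₂} refl refl B J C H e = cong₂ (λ t l → (δ₁ , δ₂ , t) , (l , (γ₁ , γ₂))) (arrow-determined pβ₁ pβ₂ B C e) (J-unique (part₁ B) (part₂ B) J H)

      -- Infusing backwards determines the original chain; its start is λ and the chain gives back
      -- the tableau.
      injective : ∀ {x x′ y} → X x → X x′ → Y y → R x y → R x′ y → x ≡ x′
      injective {l , (γ₁ , γ₂ , t)} {l₂ , (_ , _ , t₂)} {(δ₁ , δ₂ , t′) , (l′ , _)} (L , A) (L₂ , A₂) (B , J) (refl , I) (refl , I′) =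
        finish (pt-injective l l₂ (proj₁ (proj₁ L)) (proj₁ (proj₁ L₂)) (λ k → trans (sym (start F₁ k)) (trans (same 0 k) (start F₂ k)))) A A₂ same
        where
        F₁ = arrow-filling (proj₁ (proj₁ L)) pβ₂ A
        F₂ = arrow-filling (proj₁ (proj₁ L₂)) pβ₂ A₂
        same : ∀ i → shapeOf β₂ γ₂ l t i ≗ shapeOf β₂ γ₂ l₂ t₂ i
        same = Infusion-injective F₁ F₂ (λ _ _ → refl) (λ _ → refl) I I′
        finish : ∀ {l₂} → l ≡ l₂ → IsArrow ρ l β₂ (γ₁ , γ₂ , t) → IsArrow ρ l₂ β₂ (γ₁ , γ₂ , t₂) → (∀ i → shapeOf β₂ γ₂ l t i ≗ shapeOf β₂ γ₂ l₂ t₂ i) →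
          (l , (γ₁ , γ₂ , t)) ≡ (l₂ , (γ₁ , γ₂ , t₂))
        finish refl A A₂ e = cong (λ t → l , (γ₁ , γ₂ , t)) (arrow-determined (proj₁ (proj₁ L)) pβ₂ A A₂ e)

    -- Infusion turns a vertical strip followed by an arrow into an arrow followed by a pair
    -- of vertical strips whose infusion violates the row rule.
    arrows-past-strips : (f : Part → Part → ℤ) →
      ∑ (lambdas β₁ p) (λ l → ∑ (idArrows (suc ρ) l β₂) (λ a → f (proj₁ a) (proj₁ (proj₂ a)))) ≡
      ∑ (idArrows (suc ρ) β₁ β₂) (λ a → ∑ (Jlist (suc ρ) p (proj₁ a) (proj₁ (proj₂ a))) (λ z → f (proj₁ (proj₂ z)) (proj₂ (proj₂ z))))
    arrows-past-strips f = trans (sym (∑-pairs (lambdas β₁ p) (λ l → idArrows (suc ρ) l β₂) (λ x → f (proj₁ (proj₂ x)) (proj₁ (proj₂ (proj₂ x))))))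
      (trans (∑-match R enumX enumY
        (λ { {l , (γ₁ , γ₂ , t)} (L , A) → _ , (To.B l γ₁ γ₂ t L A , To.pairᴶ l γ₁ γ₂ t L A) , (refl , To.related l γ₁ γ₂ t L A) })
        (λ { {(δ₁ , δ₂ , t′) , (l′ , (γ₁ , γ₂))} (B , J) → _ , (From.isLambda δ₁ δ₂ l′ γ₁ γ₂ t′ B J , From.A δ₁ δ₂ l′ γ₁ γ₂ t′ B J) , (refl , From.related δ₁ δ₂ l′ γ₁ γ₂ t′ B J) })
        functional injective (λ { _ _ (refl , _) → refl }))
      (∑-pairs (idArrows (suc ρ) β₁ β₂) (λ a → Jlist (suc ρ) p (proj₁ a) (proj₁ (proj₂ a))) (λ y → f (proj₁ (proj₂ (proj₂ y))) (proj₂ (proj₂ (proj₂ y))))))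
      where
      enumX : Enumerates (pairs (lambdas β₁ p) (λ l → idArrows (suc ρ) l β₂)) X
      enumX = enum-pairs (enum-filterB (λ l → isVStrip l β₁ p) (enum-partitionsOf (size β₁ + p))) (λ {l} L → enum-idArrows ρ l β₂ (proj₁ (proj₁ L)) pβ₂)
      enumY : Enumerates (pairs (idArrows (suc ρ) β₁ β₂) (λ a → Jlist (suc ρ) p (proj₁ a) (proj₁ (proj₂ a)))) Y
      enumY = enum-pairs (enum-idArrows ρ β₁ β₂ pβ₁ pβ₂) (λ {a} B → enum-Jlist ρ p (proj₁ a) (proj₁ (proj₂ a)) (part₁ B) (part₂ B))

-- Semistandard fillings in propositional form.

module Semistandard where

  open Linear using (∧-T)
  open Shape
  open Tableau

  allB-false : ∀ {A : Set} (p : A → Bool) xs → allB p xs ≡ false → ∃[ x ] (x ∈ xs × p x ≡ false)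
  allB-false p (x ∷ xs) e with p x in eq
  ... | false = x , here refl , eq
  ... | true = let (y , y∈ , f) = allB-false p xs e in y , there y∈ , f

  InBoxes : Part → ℕ → ℕ → Set
  InBoxes α i j = 0 < j × j ≤ pt α i

  Entry : Part → List ℕ → ℕ → ℕ → ℕ → Set
  Entry α vs i j v = ((suc i , j) , v) ∈ zip (boxes α []) vs

  record Semi (α : Part) (a : List ℕ) (vs : List ℕ) : Set where
    field
      len     : length (boxes α []) ≡ length vs
      range   : ∀ {v} → v ∈ vs → 1 ≤ v × v ≤ length a
      right   : ∀ {i j x y} → Entry α vs i j x → Entry α vs i (suc j) y → x ≤ y
      down    : ∀ {i j x y} → Entry α vs i j x → Entry α vs (suc i) j y → x < y
      content : ∀ k → k < length a → count (suc k) vs ≡ pt a k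

  open Semi public

  index-zip : ∀ {bs : List Box} {vs : List ℕ} {b v} → Unique bs → (b , v) ∈ zip bs vs → ∃[ m ] (indexOf b bs ≡ just m × nth vs m ≡ just v)
  index-zip {b ∷ bs} {v ∷ vs} u (here refl) = 0 , here-index , refl
    where
    here-index : indexOf b (b ∷ bs) ≡ just 0
    here-index with eqBox b b in e
    ... | true = refl
    ... | false = ⊥-elim (subst T e (eqBox-refl b))
  index-zip {c ∷ bs} {w ∷ vs} {b} (n ∷ u) (there p) = let (m , e , e′) = index-zip u p in suc m , there-index m e , e′
    where
    there-index : ∀ m → indexOf b bs ≡ just m → indexOf b (c ∷ bs) ≡ just (suc m)
    there-index m h with eqBox b c in e
    ... | true = ⊥-elim (All.lookup n (zip-∈ˡ p) (sym (eqBox⇒≡ b c (subst T (sym e) tt))))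
    ... | false = cong (Maybe.map suc) h

  module _ (α : Part) (vs : List ℕ) where

    private
      bs = boxes α []

    semi-right : T (semistandard α vs) → ∀ i j x y → Entry α vs i j x → Entry α vs i (suc j) y → x ≤ y
    semi-right h i j x y p q with index-zip (boxes-unique α []) p | index-zip (boxes-unique α []) q
    ... | (m , e₁ , e₂) | (n , e₃ , e₄) with indexOf (suc i , j) bs | indexOf (suc i , suc j) bs | e₁ | e₃ | T-allB _ bs h (zip-∈ˡ p)
    ... | just .m | just .n | refl | refl | t with nth vs m | nth vs n | e₂ | e₄
    ... | just .x | just .y | refl | refl =
      ≤ᵇ⇒≤ x y (T-⇒ᵇ {inShape bs (suc i , suc j)} (proj₁ (∧-T {inShape bs (suc i , suc j) ⇒ᵇ (x ≤ᵇ y)} t)) (∈⇒inShape (zip-∈ˡ q)))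

    semi-down : T (semistandard α vs) → ∀ i j x y → Entry α vs i j x → Entry α vs (suc i) j y → x < y
    semi-down h i j x y p q with index-zip (boxes-unique α []) p | index-zip (boxes-unique α []) q
    ... | (m , e₁ , e₂) | (n , e₃ , e₄) with indexOf (suc i , j) bs | indexOf (suc (suc i) , j) bs | e₁ | e₃ | T-allB _ bs h (zip-∈ˡ p)
    ... | just .m | just .n | refl | refl | t with nth vs m | nth vs n | e₂ | e₄
    ... | just .x | just .y | refl | refl =
      <ᵇ⇒< x y (T-⇒ᵇ {inShape bs (suc (suc i) , j)} (second t) (∈⇒inShape (zip-∈ˡ q)))
      where
      second : ∀ {a b} → T (a ∧ b) → T b
      second {true} h = h

    private
      Seen : Box → Set
      Seen b = ∃[ y ] ∃[ n ] ((b , y) ∈ zip bs vs × inShape bs b ≡ true × indexOf b bs ≡ just n × nth vs n ≡ just y)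

      look : length bs ≡ length vs → ∀ b → inShape bs b ≡ false ⊎ Seen b
      look ln b with inShape bs b in e
      ... | false = inj₁ refl
      ... | true = let (y , q) = zip-image {ys = vs} ln (inShape⇒∈ {bs} {b} (subst T (sym e) tt)) ; (n , e₁ , e₂) = index-zip (boxes-unique α []) q in inj₂ (y , n , q , refl , e₁ , e₂)

      refute : ∀ {b} → T b → b ≡ false → ⊥
      refute t refl = t

      -- A failing box is extracted from the value `false`. Its right and lower neighbours may each
      -- be in the shape or not, and in every one of the four cases the tests for this box evaluate
      -- to true.
      bad : length bs ≡ length vs → (∀ {i j x y} → Entry α vs i j x → Entry α vs i (suc j) y → x ≤ y) →
        (∀ {i j x y} → Entry α vs i j x → Entry α vs (suc i) j y → x < y) → semistandard α vs ≡ false → ⊥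
      bad ln rt dn e with allB-false _ bs e
      ... | ((i₀ , j) , b∈ , f) with ∈-boxes⁻ {α} {[]} b∈
      ... | (i , refl , _) with zip-image {ys = vs} ln b∈
      ... | (x , p) with index-zip (boxes-unique α []) p | look ln (suc i , suc j) | look ln (suc (suc i) , j)
      ... | _ | inj₁ s | inj₁ s′ with inShape bs (suc i , suc j) | s | inShape bs (suc (suc i) , j) | s′ | f
      ... | false | refl | false | refl | ()
      bad ln rt dn e | ((_ , j) , b∈ , f) | (i , refl , _) | (x , p) | (m , e₁ , e₂) | inj₂ (y , n , q , s , e₃ , e₄) | inj₁ s′
        with inShape bs (suc i , suc j) | s | inShape bs (suc (suc i) , j) | s′ | indexOf (suc i , j) bs | e₁ | indexOf (suc i , suc j) bs | e₃ | f
      ... | true | refl | false | refl | just .m | refl | just .n | refl | f′ with nth vs m | e₂ | nth vs n | e₄ | f′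
      ... | just .x | refl | just .y | refl | f″ = refute (∧-T⁺ {x ≤ᵇ y} (≤⇒≤ᵇ (rt p q)) tt) f″
      bad ln rt dn e | ((_ , j) , b∈ , f) | (i , refl , _) | (x , p) | (m , e₁ , e₂) | inj₁ s | inj₂ (z , n , q , s′ , e₃ , e₄)
        with inShape bs (suc i , suc j) | s | inShape bs (suc (suc i) , j) | s′ | indexOf (suc i , j) bs | e₁ | indexOf (suc (suc i) , j) bs | e₃ | f
      ... | false | refl | true | refl | just .m | refl | just .n | refl | f′ with nth vs m | e₂ | nth vs n | e₄ | f′
      ... | just .x | refl | just .z | refl | f″ = refute (<⇒<ᵇ (dn p q)) f″
      bad ln rt dn e | ((_ , j) , b∈ , f) | (i , refl , _) | (x , p) | (m , e₁ , e₂) | inj₂ (y , n , q , s , e₃ , e₄) | inj₂ (z , k , q′ , s′ , e₅ , e₆)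
        with inShape bs (suc i , suc j) | s | inShape bs (suc (suc i) , j) | s′ | indexOf (suc i , j) bs | e₁ | indexOf (suc i , suc j) bs | e₃ | indexOf (suc (suc i) , j) bs | e₅ | f
      ... | true | refl | true | refl | just .m | refl | just .n | refl | just .k | refl | f′ with nth vs m | e₂ | nth vs n | e₄ | nth vs k | e₆ | f′
      ... | just .x | refl | just .y | refl | just .z | refl | f″ = refute (∧-T⁺ {x ≤ᵇ y} (≤⇒≤ᵇ (rt p q)) (<⇒<ᵇ (dn p q′))) f″

    semi-complete : length bs ≡ length vs → (∀ {i j x y} → Entry α vs i j x → Entry α vs i (suc j) y → x ≤ y) →
      (∀ {i j x y} → Entry α vs i j x → Entry α vs (suc i) j y → x < y) → T (semistandard α vs)
    semi-complete ln rt dn = sure refl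
      where
      sure : ∀ {b} → semistandard α vs ≡ b → T b
      sure {true} _ = tt
      sure {false} e = bad ln rt dn e

-- Semistandard tableaux as Gelfand-Tsetlin chains.

module GelfandTsetlin where

  open Linear using (∧-T; lia; _⊞_; _≐_; _⇒_; [_]⊢_; [_∣_]⊢_)
  open Step using (Fn; prefix; HStrip)
  open Chain using (_≗_)
  open Enum
  open Shape
  open Picture using (cnt; ind; cnt-∷; cnt-upper; cnt-full)
  open Tableau
  open ArrowToFilling using (search-interval; inc-≤)
  open Arrows using (eqList⇒≡; eqList-refl)
  open Semistandard

  list-ext : ∀ (xs ys : List ℕ) → length xs ≡ length ys → (∀ k → k < length xs → pt xs k ≡ pt ys k) → xs ≡ ys
  list-ext [] [] e h = refl
  list-ext (x ∷ xs) (y ∷ ys) e h = cong₂ _∷_ (h 0 (s≤s z≤n)) (list-ext xs ys (suc-injective e) (λ k lt → h (suc k) (s≤s lt)))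

  pt-map-applyUpTo : ∀ (f g : ℕ → ℕ) n k → k < n → pt (map f (map suc (applyUpTo g n))) k ≡ f (suc (g k))
  pt-map-applyUpTo f g (suc n) zero lt = refl
  pt-map-applyUpTo f g (suc n) (suc k) (s≤s lt) = pt-map-applyUpTo f (g ∘ suc) n k lt

  length-counts : ∀ (f : ℕ → ℕ) n → length (map f (fromTo 1 n)) ≡ n
  length-counts f n = trans (length-map f (fromTo 1 n)) (trans (length-map suc (upTo n)) (length-upTo n))

  enum-fillings : ∀ n m → Enumerates (fillings n m) (λ vs → length vs ≡ n × (∀ {v} → v ∈ vs → 1 ≤ v × v ≤ m))
  enum-fillings zero m = enum-resp (λ { refl → refl , λ () }) (λ { {[]} _ → refl }) enum-[ [] ]
  enum-fillings (suc n) m = enum-resp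
    (λ { (v , r , vs , (e , h) , refl) → cong suc e , λ { (here refl) → r ; (there p) → h p } })
    (λ { {v ∷ vs} (e , h) → v , h (here refl) , vs , (suc-injective e , (λ {w} p → h {w} (there p))) , refl })
    (enum-concatMap (λ v → map (v ∷_) (fillings n m)) (λ { _ _ (_ , _ , refl) (_ , _ , refl) → refl }) (enum-fromTo 1 m)
      (λ {v} _ → enum-map (v ∷_) (λ { refl → refl }) (enum-fillings n m)))

  tableaux : Part → List ℕ → List (List ℕ)
  tableaux α a = filterB (λ vs → semistandard α vs ∧ hasContent a vs) (fillings (size α) (length a))

  length-straight : ∀ α → length (boxes α []) ≡ size α
  length-straight α = trans (sym (+-identityʳ _)) (length-boxes α [] tt (λ _ → z≤n))

  enum-tableaux : ∀ α a → Enumerates (tableaux α a) (Semi α a)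
  enum-tableaux α a = enum-resp to from (enum-filterB _ (enum-fillings (size α) (length a)))
    where
    counts : List ℕ → List ℕ
    counts vs = map (λ k → count k vs) (fromTo 1 (length a))
    to : ∀ {vs} → (length vs ≡ size α × (∀ {v} → v ∈ vs → 1 ≤ v × v ≤ length a)) × T (semistandard α vs ∧ hasContent a vs) → Semi α a vs
    to {vs} ((e , r) , h) =
      let (s , h′) = ∧-T {semistandard α vs} h
          (_ , c) = ∧-T {allB (λ v → (1 ≤ᵇ v) ∧ (v ≤ᵇ length a)) vs} h′
      in record { len = trans (length-straight α) (sym e) ; range = r
        ; right = λ p q → semi-right α vs s _ _ _ _ p q ; down = λ p q → semi-down α vs s _ _ _ _ p q
        ; content = λ k lt → trans (sym (pt-map-applyUpTo (λ k → count k vs) (λ k → k) (length a) k lt)) (cong (λ l → pt l k) (eqList⇒≡ (counts vs) a c)) }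
    from : ∀ {vs} → Semi α a vs → (length vs ≡ size α × (∀ {v} → v ∈ vs → 1 ≤ v × v ≤ length a)) × T (semistandard α vs ∧ hasContent a vs)
    from {vs} S = (trans (sym (len S)) (length-straight α) , range S) ,
      ∧-T⁺ {semistandard α vs} (semi-complete α vs (len S) (right S) (down S))
        (∧-T⁺ {allB (λ v → (1 ≤ᵇ v) ∧ (v ≤ᵇ length a)) vs} (allB-T _ vs (λ {v} v∈ → ∧-T⁺ {1 ≤ᵇ v} (≤⇒≤ᵇ (proj₁ (range S v∈))) (≤⇒≤ᵇ (proj₂ (range S v∈)))))
          (subst (λ l → T (eqList l a)) (sym (list-ext (counts vs) a (length-counts _ (length a))
            (λ k lt → trans (pt-map-applyUpTo (λ k → count k vs) (λ k → k) (length a) k (subst (k <_) (length-counts _ (length a)) lt)) (content S k (subst (k <_) (length-counts _ (length a)) lt))))) (eqList-refl a)))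

  -- Semistandard tableaux as chains: Θ k i boxes of row i have entry ≤ k.

  record GTChain (α : Part) (a : List ℕ) (Θ : ℕ → Fn) : Set where
    field
      bottom : ∀ i → Θ 0 i ≡ 0
      top    : ∀ k → length a ≤ k → Θ k ≗ pt α
      weave  : ∀ k → HStrip (Θ k) (Θ (suc k))
      weight : ∀ k N → length α ≤ N → prefix (Θ (suc k)) N ≡ prefix (Θ k) N + pt a k

  open GTChain public

  chainOf : Part → List ℕ → ℕ → Fn
  chainOf α vs k i = cnt (λ z → (row (proj₁ z) ≡ᵇ suc i) ∧ (proj₂ z ≤ᵇ k)) (zip (boxes α []) vs)

  module FromSemi (α : Part) (a vs : List ℕ) (pα : IsP α) (S : Semi α a vs) where

    private
      Z : List (Box × ℕ)
      Z = zip (boxes α []) vs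

      Θ : ℕ → Fn
      Θ = chainOf α vs

      uZ : Unique Z
      uZ = zip-unique (boxes-unique α [])

      form : ∀ {b v} → (b , v) ∈ Z → ∃[ i ] (row b ≡ suc i × InBoxes α i (col b))
      form p = ∈-boxes⁻ {α} {[]} (zip-∈ˡ p)

      rows : ∀ i k {b v} → T ((row b ≡ᵇ suc i) ∧ (v ≤ᵇ k)) → row b ≡ suc i × v ≤ k
      rows i k {b} {v} t = let (p , q) = ∧-T {row b ≡ᵇ suc i} t in ≡ᵇ⇒≡ (row b) (suc i) p , ≤ᵇ⇒≤ v k q

      inj : ∀ i k {x y} → x ∈ Z → y ∈ Z → T ((row (proj₁ x) ≡ᵇ suc i) ∧ (proj₂ x ≤ᵇ k)) → T ((row (proj₁ y) ≡ᵇ suc i) ∧ (proj₂ y ≤ᵇ k)) →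
        col (proj₁ x) ≡ col (proj₁ y) → x ≡ y
      inj i k {(r , j) , v} {(r′ , j′) , v′} x∈ y∈ t t′ refl with rows i k {r , j} {v} t | rows i k {r′ , j′} {v′} t′
      ... | (refl , _) | (refl , _) = cong ((suc i , j) ,_) (zip-functional (boxes-unique α []) x∈ y∈)

      lo : ∀ i k {x} → x ∈ Z → T ((row (proj₁ x) ≡ᵇ suc i) ∧ (proj₂ x ≤ᵇ k)) → 0 < col (proj₁ x)
      lo i k x∈ t = let (_ , _ , p , _) = form x∈ in p

    entry : ∀ {i j} → InBoxes α i j → ∃[ v ] Entry α vs i j v
    entry s = zip-image (len S) (∈-boxes⁺ {α} {[]} s)

    inside : ∀ {i j v} → Entry α vs i j v → InBoxes α i j
    inside p with form p
    ... | (_ , refl , s) = s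

    right⁺ : ∀ d {i j x y} → Entry α vs i j x → Entry α vs i (d + j) y → x ≤ y
    right⁺ zero p q = ≤-reflexive (zip-functional (boxes-unique α []) p q)
    right⁺ (suc d) {i} {j} p q = let (v , r) = entry {i} {d + j} (≤-trans (proj₁ (inside p)) (m≤n+m j d) , ≤-trans (n≤1+n _) (proj₂ (inside q))) in ≤-trans (right⁺ d p r) (right S r q)

    private
      dn : ∀ i k {x} → x ∈ Z → T ((row (proj₁ x) ≡ᵇ suc i) ∧ (proj₂ x ≤ᵇ k)) → ∀ {l} → 0 < l → l < col (proj₁ x) →
        ∃[ y ] (y ∈ Z × T ((row (proj₁ y) ≡ᵇ suc i) ∧ (proj₂ y ≤ᵇ k)) × col (proj₁ y) ≡ l)
      dn i k {(r , j) , v} x∈ t {l} 0<l l<j with rows i k {r , j} {v} t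
      ... | (refl , v≤k) with entry {i} {l} (0<l , ≤-trans (<⇒≤ l<j) (proj₂ (inside x∈)))
      ... | (w , q) = _ , q , ∧-T⁺ {suc i ≡ᵇ suc i} (≡⇒≡ᵇ i i refl)
        (≤⇒≤ᵇ (≤-trans (right⁺ (j ∸ l) q (subst (λ j → Entry α vs i j v) (sym (m∸n+n≡m (<⇒≤ l<j))) x∈)) v≤k)) , refl

    Θ-⁺ : ∀ {i j v k} → Entry α vs i j v → v ≤ k → j ≤ Θ k i
    Θ-⁺ {i} {k = k} p h = cnt-upper (λ z → (row (proj₁ z) ≡ᵇ suc i) ∧ (proj₂ z ≤ᵇ k)) (col ∘ proj₁) 0 Z uZ (inj i k) (lo i k) (dn i k) p (∧-T⁺ {suc i ≡ᵇ suc i} (≡⇒≡ᵇ i i refl) (≤⇒≤ᵇ h))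

    Θ-⁻ : ∀ k {i j} → 0 < j → j ≤ Θ k i → ∃[ v ] (Entry α vs i j v × v ≤ k)
    Θ-⁻ k {i} p q with cnt-full (λ z → (row (proj₁ z) ≡ᵇ suc i) ∧ (proj₂ z ≤ᵇ k)) (col ∘ proj₁) 0 Z uZ (inj i k) (lo i k) (dn i k) p q
    ... | (((r , j) , v) , x∈ , t , refl) with rows i k {r , j} {v} t
    ... | (refl , v≤k) = v , x∈ , v≤k

    private
      by-rows : ∀ {x y} → (0 < x → x ≤ y) → x ≤ y
      by-rows {zero} h = z≤n
      by-rows {suc x} h = h (s≤s z≤n)

      prefix-cnt : ∀ (q : Box × ℕ → Bool) N Z → (∀ {z} → z ∈ Z → ∃[ i ] (row (proj₁ z) ≡ suc i × i < N)) →
        prefix (λ i → cnt (λ z → (row (proj₁ z) ≡ᵇ suc i) ∧ q z) Z) N ≡ cnt q Z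
      prefix-cnt q N [] h = zeros N
        where
        zeros : ∀ n → prefix (λ _ → 0) n ≡ 0
        zeros zero = refl
        zeros (suc n) = trans (+-identityʳ _) (zeros n)
      prefix-cnt q N (z ∷ Z) h =
        trans (prefix-cong (λ i → cnt-∷ (λ z → (row (proj₁ z) ≡ᵇ suc i) ∧ q z) z Z) N)
        (trans (prefix-+ (λ i → ind ((row (proj₁ z) ≡ᵇ suc i) ∧ q z)) (λ i → cnt (λ z → (row (proj₁ z) ≡ᵇ suc i) ∧ q z) Z) N)
        (trans (cong₂ _+_ (one (h (here refl))) (prefix-cnt q N Z (h ∘ there))) (sym (cnt-∷ q z Z))))
        where
        prefix-+ : ∀ f g n → prefix (λ k → f k + g k) n ≡ prefix f n + prefix g n
        prefix-+ f g zero = refl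
        prefix-+ f g (suc n) = lia 5 (λ p q r a b → p ≐ q ⊞ r ⇒ [ 11 ∣ 101 ]⊢ p ⊞ (a ⊞ b) ≐ q ⊞ a ⊞ (r ⊞ b)) (prefix (λ k → f k + g k) n) (prefix f n) (prefix g n) (f n) (g n) (prefix-+ f g n)
        none : ∀ i n c → n ≤ i → prefix (λ k → ind ((i ≡ᵇ k) ∧ c)) n ≡ 0
        none i zero c h = refl
        none i (suc n) c h with i ≡ᵇ n in e
        ... | true = ⊥-elim (<-irrefl (sym (≡ᵇ⇒≡ i n (subst T (sym e) tt))) h)
        ... | false = trans (+-identityʳ _) (none i n c (<⇒≤ h))
        single : ∀ i n c → i < n → prefix (λ k → ind ((i ≡ᵇ k) ∧ c)) n ≡ ind c
        single i (suc n) c (s≤s h) with i ≡ᵇ n in e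
        ... | true = cong (_+ ind c) (none i n c (≤-reflexive (sym (≡ᵇ⇒≡ i n (subst T (sym e) tt)))))
        ... | false = trans (+-identityʳ _) (single i n c (≤∧≢⇒< h (λ eq → subst T e (≡⇒≡ᵇ i n eq))))
        one : ∃[ i ] (row (proj₁ z) ≡ suc i × i < N) → prefix (λ i → ind ((row (proj₁ z) ≡ᵇ suc i) ∧ q z)) N ≡ ind (q z)
        one (i , e , lt) rewrite e = single i N (q z) lt

      cnt-≤-suc : ∀ (bs : List Box) (ws : List ℕ) k → length bs ≡ length ws → cnt (λ z → proj₂ z ≤ᵇ suc k) (zip bs ws) ≡ cnt (λ z → proj₂ z ≤ᵇ k) (zip bs ws) + count (suc k) ws
      cnt-≤-suc [] [] k e = refl
      cnt-≤-suc (b ∷ bs) (w ∷ ws) k e = lia 9 (λ x y z a b c u v t → x ≐ a ⊞ u ⇒ y ≐ b ⊞ v ⇒ u ≐ v ⊞ t ⇒ a ≐ b ⊞ c ⇒ z ≐ c ⊞ t ⇒ [ 1100101101 ∣ 10011010011 ]⊢ x ≐ y ⊞ z)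
        (cnt (λ z → proj₂ z ≤ᵇ suc k) (zip (b ∷ bs) (w ∷ ws))) (cnt (λ z → proj₂ z ≤ᵇ k) (zip (b ∷ bs) (w ∷ ws))) (count (suc k) (w ∷ ws))
        (ind (w ≤ᵇ suc k)) (ind (w ≤ᵇ k)) (if suc k ≡ᵇ w then 1 else 0) (cnt (λ z → proj₂ z ≤ᵇ suc k) (zip bs ws)) (cnt (λ z → proj₂ z ≤ᵇ k) (zip bs ws)) (count (suc k) ws)
        (cnt-∷ (λ z → proj₂ z ≤ᵇ suc k) (b , w) (zip bs ws)) (cnt-∷ (λ z → proj₂ z ≤ᵇ k) (b , w) (zip bs ws)) (cnt-≤-suc bs ws k (suc-injective e)) (split w k) refl
        where
        split : ∀ w k → ind (w ≤ᵇ suc k) ≡ ind (w ≤ᵇ k) + (if suc k ≡ᵇ w then 1 else 0)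
        split zero k = refl
        split (suc zero) zero = refl
        split (suc (suc w)) zero = refl
        split (suc zero) (suc k) = refl
        split (suc (suc w)) (suc k) = split (suc w) k

    gt-chain : GTChain α a Θ
    gt-chain = record
      { bottom = λ i → n≤0⇒n≡0 (by-rows (λ p → let (v , e , h) = Θ-⁻ 0 p ≤-refl in ⊥-elim (<⇒≱ (proj₁ (range S (zip-∈ʳ e))) h)))
      ; top = λ k h i → ≤-antisym (by-rows (λ p → let (v , e , _) = Θ-⁻ k p ≤-refl in proj₂ (inside e)))
          (by-rows (λ p → let (v , e) = entry {i} (p , ≤-refl) in Θ-⁺ e (≤-trans (proj₂ (range S (zip-∈ʳ e))) h)))
      ; weave = λ k i → by-rows (λ p → let (v , e , h) = Θ-⁻ k p ≤-refl in Θ-⁺ e (m≤n⇒m≤1+n h)) ,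
          by-rows (λ p → let (v , e , h) = Θ-⁻ (suc k) p ≤-refl
                             (w , e′) = entry {i} (p , ≤-trans (proj₂ (inside e)) (pt-dec α pα i))
                         in Θ-⁺ e′ (≤-pred (≤-trans (down S e′ e) h)))
      ; weight = λ k N h → trans (prefix-cnt (λ z → proj₂ z ≤ᵇ suc k) N Z (bounded N h)) (trans (cnt-≤-suc (boxes α []) vs k (len S))
          (cong₂ _+_ (sym (prefix-cnt (λ z → proj₂ z ≤ᵇ k) N Z (bounded N h))) (contents k))) }
      where
      bounded : ∀ N → length α ≤ N → ∀ {z} → z ∈ Z → ∃[ i ] (row (proj₁ z) ≡ suc i × i < N)
      bounded N h z∈ = let (i , e , p , q) = form z∈ in i , e , <-≤-trans (≰⇒> (λ le → <⇒≱ p (≤-trans q (≤-reflexive (pt-vanish α i le))))) h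
      count-none : ∀ k ws → (∀ {v} → v ∈ ws → v ≢ k) → count k ws ≡ 0
      count-none k [] h = refl
      count-none k (w ∷ ws) h with k ≡ᵇ w in e
      ... | true = ⊥-elim (h (here refl) (sym (≡ᵇ⇒≡ k w (subst T (sym e) tt))))
      ... | false = count-none k ws (h ∘ there)
      contents : ∀ k → count (suc k) vs ≡ pt a k
      contents k with <-≤-connex k (length a)
      ... | inj₁ lt = content S k lt
      ... | inj₂ ge = trans (count-none (suc k) vs (λ v∈ e → <⇒≱ (≤-trans (s≤s ge) (≤-reflexive (sym e))) (proj₂ (range S v∈)))) (sym (pt-vanish a k ge))

  -- The entry of a box is the first `k` for which the shape `Θ k` contains the box.
  Semi-determined : ∀ {α a a′ vs vs′} → IsP α → Semi α a vs → Semi α a′ vs′ → (∀ k → chainOf α vs k ≗ chainOf α vs′ k) → vs ≡ vs′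
  Semi-determined {α} {a} {a′} {vs} {vs′} pα S S′ e = zip-ext (len S) (len S′) (boxes-unique α []) same
    where
    module A = FromSemi α a vs pα S
    module B = FromSemi α a′ vs′ pα S′
    at : ∀ {i j v v′} → Entry α vs i j v → Entry α vs′ i j v′ → v ≡ v′
    at {i} {j} {v} {v′} p q = ≤-antisym
      (let (w , r , h) = A.Θ-⁻ v′ (proj₁ (A.inside p)) (subst (j ≤_) (sym (e v′ i)) (B.Θ-⁺ q ≤-refl)) in subst (_≤ v′) (zip-functional (boxes-unique α []) r p) h)
      (let (w , r , h) = B.Θ-⁻ v (proj₁ (A.inside p)) (subst (j ≤_) (e v i) (A.Θ-⁺ p ≤-refl)) in subst (_≤ v) (zip-functional (boxes-unique α []) r q) h)
    same : ∀ {b v v′} → (b , v) ∈ zip (boxes α []) vs → (b , v′) ∈ zip (boxes α []) vs′ → v ≡ v′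
    same p q with ∈-boxes⁻ {α} {[]} (zip-∈ˡ p)
    ... | (i , refl , _) = at p q

  module FromChain (α : Part) (a : List ℕ) (pα : IsP α) (Θ : ℕ → Fn) (G : GTChain α a Θ) where

    data Filled : Box → ℕ → Set where
      filled : ∀ {i j k} → Θ k i < j → j ≤ Θ (suc k) i → k < length a → Filled (suc i , j) (suc k)

    private
      all-filled : ∀ {b} → b ∈ boxes α [] → ∃[ v ] Filled b v
      all-filled b∈ with ∈-boxes⁻ {α} {[]} b∈
      ... | (i , refl , p , q) = let (k , lt , h , h′) = search-interval (λ k → Θ k i) (length a) _ (subst (_< _) (sym (bottom G i)) p) (subst (_ ≤_) (sym (top G (length a) ≤-refl i)) q)
                                 in suc k , filled h h′ lt

      chosen = choose (boxes α []) all-filled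

    word : List ℕ
    word = proj₁ chosen

    private
      ln : length (boxes α []) ≡ length word
      ln = proj₁ (proj₂ chosen)

      spec : ∀ {b v} → (b , v) ∈ zip (boxes α []) word → Filled b v
      spec = proj₂ (proj₂ chosen)

      Θ-inc : ∀ i {k k′} → k ≤ k′ → Θ k i ≤ Θ k′ i
      Θ-inc i = inc-≤ {λ k → Θ k i} (λ k → proj₁ (weave G k i))

      small⇒ : ∀ {i j v} k → Filled (suc i , j) v → v ≤ k → j ≤ Θ k i
      small⇒ {i} k (filled p q _) h = ≤-trans q (Θ-inc i h)

      ⇒small : ∀ {i j v} k → Filled (suc i , j) v → j ≤ Θ k i → v ≤ k
      ⇒small {i} k (filled p q _) h = ≰⇒> (λ k≤ → <⇒≱ p (≤-trans h (Θ-inc i k≤)))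

      right′ : ∀ {i j x y} → Filled (suc i , j) x → Filled (suc i , suc j) y → x ≤ y
      right′ {y = y} f g = ⇒small y f (≤-trans (n≤1+n _) (small⇒ y g ≤-refl))

      down′ : ∀ {i j x y} → Filled (suc i , j) x → Filled (suc (suc i) , j) y → x < y
      down′ {i} f (filled {k = k} p q _) = s≤s (⇒small k f (≤-trans q (proj₂ (weave G k i))))

      in-range : ∀ {b v} → Filled b v → 1 ≤ v × v ≤ length a
      in-range (filled _ _ lt) = s≤s z≤n , lt

      -- all but the content condition, which follows from the computation of the chain
      module Partial (a′ : List ℕ) (c : ∀ k → k < length a′ → count (suc k) word ≡ pt a′ k) (e : length a ≡ length a′) where
        semi : Semi α a′ word
        semi = record
          { len = ln ; range = λ v∈ → let (b , p) = zip-origin ln v∈ ; (x , y) = in-range (spec p) in x , subst (_ ≤_) e y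
          ; right = λ p q → right′ (spec p) (spec q) ; down = λ p q → down′ (spec p) (spec q) ; content = c }

      actual : List ℕ
      actual = map (λ k → count k word) (fromTo 1 (length a))

      module P = Partial actual (λ k lt → sym (pt-map-applyUpTo (λ k → count k word) (λ k → k) (length a) k (subst (k <_) (length-counts _ (length a)) lt))) (sym (length-counts _ (length a)))
      module F = FromSemi α actual word pα P.semi

    word-chain : ∀ k → chainOf α word k ≗ Θ k
    word-chain k i = ≤-antisym
      (by-rows (λ p → let (v , e , h) = F.Θ-⁻ k p ≤-refl in small⇒ k (spec e) h))
      (by-rows (λ p → let (v , e) = F.entry {i} (p , ≤-trans (Θ-inc i (m≤m+n k (length a))) (≤-reflexive (top G (k + length a) (m≤n+m _ k) i))) in F.Θ-⁺ e (⇒small k (spec e) ≤-refl)))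
      where
      by-rows : ∀ {x y} → (0 < x → x ≤ y) → x ≤ y
      by-rows {zero} h = z≤n
      by-rows {suc x} h = h (s≤s z≤n)

    -- The word is at first a tableau whose content is whatever it happens to be, `actual`. The
    -- chain of that tableau is `Θ`, so the weights of `Θ` identify this content with `a`.
    word-semi : Semi α a word
    word-semi = Partial.semi a (λ k lt → trans (sym (pt-map-applyUpTo (λ k → count k word) (λ k → k) (length a) k lt)) (+-cancelˡ-≡ (prefix (Θ k) (length α)) _ _
      (trans (cong (_+ pt actual k) (sym (prefix-cong (word-chain k) (length α)))) (trans (sym (weight F.gt-chain k (length α) ≤-refl))
        (trans (prefix-cong (word-chain (suc k)) (length α)) (weight G k (length α) ≤-refl)))))) refl

-- Local growth rules of dual insertion.

module DualInsertion where

  open Linear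
  open Step using (Fn; prefix; Decreasing; VStrip; HStrip; VanishesFrom)
  open Chain using (_≗_)

  -- One row of the local rule: x boxes of ε arrive from above, y are passed on below.
  data Row (ν β μ l x y : ℕ) : Set where
    pass : μ ≡ suc β → y ≡ x → l ≡ suc β → suc ν ≡ μ → Row ν β μ l x y
    swap : μ ≤ β → l ≡ β + x → ν + y ≡ μ → Row ν β μ l x y

  -- A local growth rule for the dual RSK correspondence.  On a square with the horizontal strips β/ν and l/μ and
  -- the vertical strips μ/ν and l/β, the entry ε is inserted at the first row; x k is what row k receives.
  record Bump (ε : ℕ) (ν β μ l : Fn) : Set where
    field
      x     : Fn
      x-top : x 0 ≡ ε
      x≤1   : ∀ k → x k ≤ 1
      limit : ℕ
      x-end : ∀ k → limit ≤ k → x k ≡ 0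
      rows  : ∀ k → Row (ν k) (β k) (μ k) (l k) (x k) (x (suc k))

    -- In either kind of row the balance `l + ν + y = β + μ + x` holds, and the amounts passed from
    -- row to row telescope.
    prefix-bump : ∀ n → prefix l n + prefix ν n + x n ≡ prefix β n + prefix μ n + ε
    prefix-bump zero = x-top
    prefix-bump (suc n) = next (rows n)
      where
      next : Row (ν n) (β n) (μ n) (l n) (x n) (x (suc n)) → prefix l (suc n) + prefix ν (suc n) + x (suc n) ≡ prefix β (suc n) + prefix μ (suc n) + ε
      next (pass p q r s) = lia 11 (λ L V X B M E v b m l y → L ⊞ V ⊞ X ≐ B ⊞ M ⊞ E ⇒ m ≐ K 1 ⊞ b ⇒ y ≐ X ⇒ l ≐ K 1 ⊞ b ⇒ K 1 ⊞ v ≐ m ⇒ [ 1000101011 ∣ 10001010101 ]⊢ (L ⊞ l) ⊞ (V ⊞ v) ⊞ y ≐ (B ⊞ b) ⊞ (M ⊞ m) ⊞ E)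
        (prefix l n) (prefix ν n) (x n) (prefix β n) (prefix μ n) ε (ν n) (β n) (μ n) (l n) (x (suc n)) (prefix-bump n) p q r s
      next (swap p q r) = lia 11 (λ L V X B M E v b m l y → L ⊞ V ⊞ X ≐ B ⊞ M ⊞ E ⇒ l ≐ b ⊞ X ⇒ v ⊞ y ≐ m ⇒ [ 101011 ∣ 1010101 ]⊢ (L ⊞ l) ⊞ (V ⊞ v) ⊞ y ≐ (B ⊞ b) ⊞ (M ⊞ m) ⊞ E)
        (prefix l n) (prefix ν n) (x n) (prefix β n) (prefix μ n) ε (ν n) (β n) (μ n) (l n) (x (suc n)) (prefix-bump n) q r

  open Bump public

  Bump-idle : ∀ {β l} → VStrip β l → Bump 0 β β l l
  Bump-idle {β} {l} vs = record { x = λ _ → 0 ; x-top = refl ; x≤1 = λ _ → z≤n ; limit = 0 ; x-end = λ _ _ → refl ; rows = λ k → at (vs k) }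
    where
    at : ∀ {b l} → b ≤ l × l ≤ suc b → Row b b l l 0 0
    at {b} {l} (p , q) with l ≤? b
    ... | yes r = let e = ≤-antisym r p in swap r (trans e (sym (+-identityʳ b))) (trans (+-identityʳ b) (sym e))
    ... | no r = let e = ≤-antisym q (≰⇒> r) in pass e refl e (sym e)

  Bump-cong : ∀ {ε ν β μ l ν′ β′ μ′ l′} → ν ≗ ν′ → β ≗ β′ → μ ≗ μ′ → l ≗ l′ → Bump ε ν β μ l → Bump ε ν′ β′ μ′ l′
  Bump-cong eν eβ eμ el B = record { x = x B ; x-top = x-top B ; x≤1 = x≤1 B ; limit = limit B ; x-end = x-end B
    ; rows = λ k → resp (eν k) (eβ k) (eμ k) (el k) (rows B k) }
    where
    resp : ∀ {v b m l v′ b′ m′ l′ x y} → v ≡ v′ → b ≡ b′ → m ≡ m′ → l ≡ l′ → Row v b m l x y → Row v′ b′ m′ l′ x y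
    resp refl refl refl refl R = R

  private
    clash : ∀ {m b} → m ≡ suc b → m ≤ b → ⊥
    clash refl h = 1+n≰n h

  -- rows are read from the bottom upwards
  Bump-functional : ∀ {ε₁ ε₂ ν₁ ν₂ β μ l} → Bump ε₁ ν₁ β μ l → Bump ε₂ ν₂ β μ l → ε₁ ≡ ε₂ × ν₁ ≗ ν₂
  Bump-functional {ε₁} {ε₂} {ν₁} {ν₂} {β} {μ} {l} B₁ B₂ = trans (sym (x-top B₁)) (trans (same 0) (x-top B₂)) , λ k → low (rows B₁ k) (rows B₂ k) (same (suc k))
    where
    N = limit B₁ + limit B₂
    up : ∀ {v₁ v₂ b m l x₁ x₂ y₁ y₂} → Row v₁ b m l x₁ y₁ → Row v₂ b m l x₂ y₂ → y₁ ≡ y₂ → x₁ ≡ x₂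
    up (pass _ p _ _) (pass _ q _ _) e = trans (sym p) (trans e q)
    up (pass p _ _ _) (swap q _ _) e = ⊥-elim (clash p q)
    up (swap q _ _) (pass p _ _ _) e = ⊥-elim (clash p q)
    up (swap _ p _) (swap _ q _) e = +-cancelˡ-≡ _ _ _ (trans (sym p) q)
    low : ∀ {v₁ v₂ b m l x₁ x₂ y₁ y₂} → Row v₁ b m l x₁ y₁ → Row v₂ b m l x₂ y₂ → y₁ ≡ y₂ → v₁ ≡ v₂
    low (pass _ _ _ p) (pass _ _ _ q) e = suc-injective (trans p (sym q))
    low (pass p _ _ _) (swap q _ _) e = ⊥-elim (clash p q)
    low (swap q _ _) (pass p _ _ _) e = ⊥-elim (clash p q)
    low (swap _ _ p) (swap _ _ q) refl = +-cancelʳ-≡ _ _ _ (trans p (sym q))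
    from : ∀ d k → N ≤ d + k → x B₁ k ≡ x B₂ k
    from zero k h = trans (x-end B₁ k (m+n≤o⇒m≤o (limit B₁) h)) (sym (x-end B₂ k (m+n≤o⇒n≤o (limit B₁) h)))
    from (suc d) k h = up (rows B₁ k) (rows B₂ k) (from d (suc k) (subst (N ≤_) (sym (+-suc d k)) h))
    same : x B₁ ≗ x B₂
    same k = from N k (m≤m+n N k)

  -- Here the rows are read from the top, beginning with the inserted amount `ε`.
  Bump-injective : ∀ {ε ν β μ l₁ l₂} → Bump ε ν β μ l₁ → Bump ε ν β μ l₂ → l₁ ≗ l₂
  Bump-injective B₁ B₂ k = at (rows B₁ k) (rows B₂ k) (same k)
    where
    at : ∀ {v b m l₁ l₂ x₁ x₂ y₁ y₂} → Row v b m l₁ x₁ y₁ → Row v b m l₂ x₂ y₂ → x₁ ≡ x₂ → l₁ ≡ l₂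
    at (pass _ _ p _) (pass _ _ q _) e = trans p (sym q)
    at (pass p _ _ _) (swap q _ _) e = ⊥-elim (clash p q)
    at (swap q _ _) (pass p _ _ _) e = ⊥-elim (clash p q)
    at (swap _ p _) (swap _ q _) refl = trans p (sym q)
    down : ∀ {v b m l₁ l₂ x₁ x₂ y₁ y₂} → Row v b m l₁ x₁ y₁ → Row v b m l₂ x₂ y₂ → x₁ ≡ x₂ → y₁ ≡ y₂
    down (pass _ p _ _) (pass _ q _ _) e = trans p (trans e (sym q))
    down (pass p _ _ _) (swap q _ _) e = ⊥-elim (clash p q)
    down (swap q _ _) (pass p _ _ _) e = ⊥-elim (clash p q)
    down (swap _ _ p) (swap _ _ q) e = +-cancelˡ-≡ _ _ _ (trans p (sym q))
    same : x B₁ ≗ x B₂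
    same zero = trans (x-top B₁) (sym (x-top B₂))
    same (suc k) = down (rows B₁ k) (rows B₂ k) (same k)

  if-dec : ∀ {P : Set} → Dec P → ℕ → ℕ → ℕ
  if-dec (yes _) a b = a
  if-dec (no _) a b = b

  module Extraction (N : ℕ) (β μ l : Fn) where

    -- The reversed rule, from the bottom upwards. In a `swap` row the box received is the one that
    -- `l` has beyond `β`; a `pass` row hands on what it receives, so its amount is that of the row
    -- below.
    receive : ℕ → ℕ → ℕ
    receive zero k = l k ∸ β k
    receive (suc d) k = if-dec (μ k ≤? β k) (l k ∸ β k) (receive d (suc k))

    xs : Fn
    xs k = receive (N ∸ k) k

    inner : Fn
    inner k = if-dec (μ k ≤? β k) (μ k ∸ xs (suc k)) (β k)

  module Extract (N : ℕ) (β μ l : Fn) (β-dec : Decreasing β) (vs : VStrip β l) (hs : HStrip μ l) (l-end : VanishesFrom N l) where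

    open Extraction N β μ l

    private
      μ-end : ∀ k → N ≤ k → μ k ≤ β k
      μ-end k h = ≤-trans (proj₁ (hs k)) (≤-trans (≤-reflexive (l-end k h)) z≤n)

      if-yes : ∀ {P : Set} (D : Dec P) {a b} → P → if-dec D a b ≡ a
      if-yes (yes _) _ = refl
      if-yes (no n) p = ⊥-elim (n p)

      if-no : ∀ {P : Set} (D : Dec P) {a b} → ¬ P → if-dec D a b ≡ b
      if-no (yes p) n = ⊥-elim (n p)
      if-no (no _) _ = refl

      xs-yes : ∀ k → μ k ≤ β k → xs k ≡ l k ∸ β k
      xs-yes k h with N ∸ k
      ... | zero = refl
      ... | suc d = if-yes (μ k ≤? β k) h

      xs-no : ∀ k → ¬ (μ k ≤ β k) → xs k ≡ xs (suc k)
      xs-no k h with <-≤-connex k N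
      ... | inj₂ N≤k = ⊥-elim (h (μ-end k N≤k))
      ... | inj₁ k<N = trans (cong (λ d → receive d k) (sym (suc-pred′ k<N))) (if-no (μ k ≤? β k) h)
        where
        suc-pred′ : k < N → suc (N ∸ suc k) ≡ N ∸ k
        suc-pred′ h = sym (+-∸-assoc 1 h)

      receive-bit : ∀ d k → receive d k ≤ 1
      receive-bit zero k = m≤n+o⇒m∸n≤o (l k) (β k) (≤-trans (proj₂ (vs k)) (≤-reflexive (+-comm 1 (β k))))
      receive-bit (suc d) k with μ k ≤? β k
      ... | yes _ = receive-bit zero k
      ... | no _ = receive-bit d (suc k)

      room : ∀ k → β k + xs k ≤ l k
      room k with μ k ≤? β k
      ... | yes h = ≤-reflexive (trans (cong (β k +_) (xs-yes k h)) (m+[n∸m]≡n (proj₁ (vs k))))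
      ... | no h = ≤-trans (+-monoʳ-≤ (β k) (receive-bit (N ∸ k) k)) (≤-trans (≤-reflexive (+-comm (β k) 1)) (≤-trans (≰⇒> h) (proj₁ (hs k))))

      fits : ∀ k → β (suc k) + xs (suc k) ≤ μ k
      fits k = ≤-trans (room (suc k)) (proj₂ (hs k))

      at : ∀ k → Row (inner k) (β k) (μ k) (l k) (xs k) (xs (suc k)) × inner k ≤ μ k × inner k ≤ β k × β (suc k) ≤ inner k × μ k ≤ suc (inner k)
      at k with μ k ≤? β k | xs-yes k | xs-no k
      ... | yes h | e | _ = swap h (trans (sym (m+[n∸m]≡n (proj₁ (vs k)))) (cong (β k +_) (sym (e h)))) (m∸n+n≡m (m+n≤o⇒n≤o (β (suc k)) (fits k))) ,
          m∸n≤m (μ k) (xs (suc k)) , ≤-trans (m∸n≤m (μ k) (xs (suc k))) h , m+n≤o⇒m≤o∸n (β (suc k)) (fits k) ,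
          ≤-trans (≤-reflexive (sym (m∸n+n≡m (m+n≤o⇒n≤o (β (suc k)) (fits k))))) (≤-trans (+-monoʳ-≤ _ (receive-bit (N ∸ suc k) (suc k))) (≤-reflexive (+-comm _ 1)))
      ... | no h | _ | e = pass eμ (sym (e h)) (≤-antisym (proj₂ (vs k)) (≤-trans (≰⇒> h) (proj₁ (hs k)))) (sym eμ) ,
          <⇒≤ (≰⇒> h) , ≤-refl , β-dec k , ≤-reflexive eμ
        where
        eμ : μ k ≡ suc (β k)
        eμ = ≤-antisym (≤-trans (proj₁ (hs k)) (proj₂ (vs k))) (≰⇒> h)

    bump : Bump (xs 0) inner β μ l
    bump = record { x = xs ; x-top = refl ; x≤1 = λ k → receive-bit (N ∸ k) k ; limit = N
      ; x-end = λ k h → trans (xs-yes k (μ-end k h)) (trans (cong (_∸ β k) (l-end k h)) (0∸n≡0 (β k))) ; rows = λ k → proj₁ (at k) }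

    hstrip : HStrip inner β
    hstrip k = let (_ , _ , p , q , _) = at k in p , q

    vstrip : VStrip inner μ
    vstrip k = let (_ , p , _ , _ , q) = at k in p , q

  module Insertion (ε : ℕ) (ν β μ : Fn) where

    -- Where `μ` does not exceed `β`, the box that `μ` has beyond `ν` is bumped into the next row;
    -- otherwise this box stays and the incoming amount travels on.
    xs : Fn
    xs zero = ε
    xs (suc k) = if-dec (μ k ≤? β k) (μ k ∸ ν k) (xs k)

    outer : Fn
    outer k = if-dec (μ k ≤? β k) (β k + xs k) (suc (β k))

  module Insert (ε N : ℕ) (ν β μ : Fn) (ε≤1 : ε ≤ 1) (μ-dec : Decreasing μ) (vs : VStrip ν μ) (hs : HStrip ν β) (μ-end : VanishesFrom N μ) where

    open Insertion ε ν β μ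

    private
      xs-bit : ∀ k → xs k ≤ 1
      xs-bit zero = ε≤1
      xs-bit (suc k) with μ k ≤? β k
      ... | yes _ = m≤n+o⇒m∸n≤o (μ k) (ν k) (≤-trans (proj₂ (vs k)) (≤-reflexive (+-comm 1 (ν k))))
      ... | no _ = xs-bit k

      room : ∀ k → ν k + xs (suc k) ≤ μ k
      room k with μ k ≤? β k
      ... | yes _ = ≤-reflexive (m+[n∸m]≡n (proj₁ (vs k)))
      ... | no h = ≤-trans (+-mono-≤ (proj₁ (hs k)) (xs-bit k)) (≤-trans (≤-reflexive (+-comm (β k) 1)) (≰⇒> h))

      fits : ∀ k → β (suc k) + xs (suc k) ≤ μ k
      fits k = ≤-trans (+-monoˡ-≤ (xs (suc k)) (proj₂ (hs k))) (room k)

      at : ∀ k → Row (ν k) (β k) (μ k) (outer k) (xs k) (xs (suc k)) × β k ≤ outer k × outer k ≤ suc (β k) × μ k ≤ outer k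
      at k with μ k ≤? β k
      ... | yes h = swap h refl (m+[n∸m]≡n (proj₁ (vs k))) , m≤m+n _ _ , ≤-trans (+-monoʳ-≤ (β k) (xs-bit k)) (≤-reflexive (+-comm (β k) 1)) , ≤-trans h (m≤m+n _ _)
      ... | no h = pass eμ refl refl (trans (cong suc (≤-antisym (proj₁ (hs k)) (≤-pred (≤-trans (≰⇒> h) (proj₂ (vs k)))))) (sym eμ)) ,
          n≤1+n _ , ≤-refl , ≤-reflexive eμ
        where
        eμ : μ k ≡ suc (β k)
        eμ = ≤-antisym (≤-trans (proj₂ (vs k)) (s≤s (proj₁ (hs k)))) (≰⇒> h)

      outer-below : ∀ k → outer (suc k) ≤ μ k
      outer-below k with μ (suc k) ≤? β (suc k)
      ... | yes _ = fits k
      ... | no h = ≤-trans (≰⇒> h) (μ-dec k)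

    vstrip : VStrip β outer
    vstrip k = let (_ , p , q , _) = at k in p , q

    hstrip : HStrip μ outer
    hstrip k = let (_ , _ , _ , p) = at k in p , outer-below k

    private
      xs-end : ∀ k → suc N ≤ k → xs k ≡ 0
      xs-end (suc k) (s≤s h) = n≤0⇒n≡0 (≤-trans (m+n≤o⇒n≤o (ν k) (room k)) (≤-reflexive (μ-end k h)))

    outer-end : VanishesFrom (suc N) outer
    outer-end (suc k) (s≤s h) = n≤0⇒n≡0 (≤-trans (outer-below k) (≤-reflexive (μ-end k h)))

    bump : Bump ε ν β μ outer
    bump = record { x = xs ; x-top = refl ; x≤1 = xs-bit ; limit = suc N ; x-end = xs-end ; rows = λ k → proj₁ (at k) }

-- Tableaux of column shape as 0-1 contents, and splittings of a content.

module Column where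

  open Step using (Fn; prefix; Decreasing; VanishesFrom; bit)
  open Chain using (_≗_; HStrip-decˡ)
  open Enum
  open Shape
  open Semistandard
  open GelfandTsetlin

  prefix-stop : ∀ {f m} → VanishesFrom m f → ∀ {n} → m ≤ n → prefix f n ≡ prefix f m
  prefix-stop {f} {m} v {n} h = subst (λ n → prefix f n ≡ prefix f m) (m∸n+n≡m h) (go (n ∸ m))
    where
    go : ∀ d → prefix f (d + m) ≡ prefix f m
    go zero = refl
    go (suc d) = trans (cong (prefix f (d + m) +_) (v (d + m) (m≤n+m m d))) (trans (+-identityʳ _) (go d))

  -- The row lengths of a single column of height `n`.
  below? : ℕ → Fn
  below? n k with k <? n
  ... | yes _ = 1
  ... | no _ = 0

  below?-yes : ∀ {n k} → k < n → below? n k ≡ 1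
  below?-yes {n} {k} h with k <? n
  ... | yes _ = refl
  ... | no q = ⊥-elim (q h)

  below?-no : ∀ {n k} → n ≤ k → below? n k ≡ 0
  below?-no {n} {k} h with k <? n
  ... | yes q = ⊥-elim (<⇒≱ q h)
  ... | no _ = refl

  below?≤1 : ∀ n k → below? n k ≤ 1
  below?≤1 n k with k <? n
  ... | yes _ = s≤s z≤n
  ... | no _ = z≤n

  below?-mono : ∀ {m n k l} → (k < m → l < n) → below? m k ≤ below? n l
  below?-mono {m} {n} {k} {l} h with k <? m
  ... | yes p = ≤-reflexive (sym (below?-yes (h p)))
  ... | no _ = z≤n

  prefix-below? : ∀ n N → n ≤ N → prefix (below? n) N ≡ n
  prefix-below? n N h = trans (prefix-stop (λ k → below?-no {n} {k}) h) (go n ≤-refl)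
    where
    go : ∀ m → m ≤ n → prefix (below? n) m ≡ m
    go zero _ = refl
    go (suc m) h = trans (cong₂ _+_ (go m (<⇒≤ h)) (below?-yes h)) (+-comm m 1)

  -- A weakly decreasing 0-1 sequence is an initial run of ones, whose length is its sum.
  below?-unique : ∀ {f} N → Decreasing f → (∀ k → f k ≤ 1) → VanishesFrom N f → f ≗ below? (prefix f N)
  below?-unique {f} N d f≤1 v k with bit (f k) (f≤1 k)
  ... | inj₂ e = trans e (sym (below?-yes (≤-trans (full (suc k) (λ j lt → ≤-trans (≤-reflexive (sym e)) (fall (≤-pred lt)))) (total (suc k)))))
    where
    fall : ∀ {i j} → i ≤ j → f j ≤ f i
    fall {i} h = subst (λ j → f j ≤ f i) (m∸n+n≡m h) (go _)
      where
      go : ∀ n → f (n + i) ≤ f i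
      go zero = ≤-refl
      go (suc n) = ≤-trans (d (n + i)) (go n)
    full : ∀ m → (∀ j → j < m → 1 ≤ f j) → m ≤ prefix f m
    full zero h = z≤n
    full (suc m) h = ≤-trans (≤-reflexive (+-comm 1 m)) (+-mono-≤ (full m (λ j lt → h j (m≤n⇒m≤1+n lt))) (h m ≤-refl))
    total : ∀ m → prefix f m ≤ prefix f N
    total m with ≤-total m N
    ... | inj₂ h = ≤-reflexive (prefix-stop v h)
    ... | inj₁ h = subst (λ n → prefix f m ≤ prefix f n) (m∸n+n≡m h) (go (N ∸ m))
      where
      go : ∀ j → prefix f m ≤ prefix f (j + m)
      go zero = ≤-refl
      go (suc j) = ≤-trans (go j) (m≤m+n _ _)
  ... | inj₁ e = trans e (sym (below?-no (short N)))
    where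
    zeros : ∀ j → f (j + k) ≡ 0
    zeros zero = e
    zeros (suc j) = n≤0⇒n≡0 (≤-trans (d (j + k)) (≤-reflexive (zeros j)))
    bound : ∀ m → prefix f m ≤ m
    bound zero = z≤n
    bound (suc m) = ≤-trans (+-mono-≤ (bound m) (f≤1 m)) (≤-reflexive (+-comm m 1))
    short : ∀ m → prefix f m ≤ k
    short m with ≤-total m k
    ... | inj₁ h = ≤-trans (bound m) h
    ... | inj₂ h = ≤-trans (≤-reflexive (prefix-stop {f} {k} (λ j le → subst (λ j → f j ≡ 0) (m∸n+n≡m le) (zeros (j ∸ k))) h)) (bound k)

  column-pt : ∀ p → pt (column p) ≗ below? p
  column-pt zero k = sym (below?-no {k = k} z≤n)
  column-pt (suc p) zero = refl
  column-pt (suc p) (suc k) with k <? p | column-pt p k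
  ... | yes h | e = trans e (sym (below?-yes (s≤s h)))
  ... | no h | e = trans e (sym (below?-no (s≤s (≮⇒≥ h))))

  column-IsP : ∀ p → IsP (column p)
  column-IsP zero = tt
  column-IsP (suc p) = IsP-∷ (column p) (s≤s z≤n) (≤-trans (≤-reflexive (column-pt p 0)) (below?≤1 p 0)) (column-IsP p)

  length-column : ∀ p → length (column p) ≡ p
  length-column zero = refl
  length-column (suc p) = cong suc (length-column p)

  size-column : ∀ p → size (column p) ≡ p
  size-column zero = refl
  size-column (suc p) = cong suc (size-column p)

  chain-inc : ∀ {α a Θ} → GTChain α a Θ → ∀ k i → Θ k i ≤ pt α i
  chain-inc {a = a} {Θ} G k i = ≤-trans (go (length a)) (≤-reflexive (top G (length a + k) (m≤m+n _ k) i))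
    where
    go : ∀ d → Θ k i ≤ Θ (d + k) i
    go zero = ≤-refl
    go (suc d) = ≤-trans (go d) (proj₁ (weave G (d + k) i))

  chain-vanish : ∀ {α a Θ} → GTChain α a Θ → ∀ k → VanishesFrom (length α) (Θ k)
  chain-vanish {α} G k i h = n≤0⇒n≡0 (≤-trans (chain-inc G k i) (≤-reflexive (pt-vanish α i h)))

  chain-dec : ∀ {α a Θ} → GTChain α a Θ → ∀ k → Decreasing (Θ k)
  chain-dec G k = HStrip-decˡ (weave G k)

  chain-prefix : ∀ {α a Θ} → GTChain α a Θ → ∀ k → prefix (Θ k) (length α) ≡ prefix (pt a) k
  chain-prefix {α} {a} {Θ} G zero = zeros (length α)
    where
    zeros : ∀ n → prefix (Θ 0) n ≡ 0
    zeros zero = refl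
    zeros (suc n) = cong₂ _+_ (zeros n) (bottom G n)
  chain-prefix {α} {a} G (suc k) = trans (weight G k (length α) ≤-refl) (cong (_+ pt a k) (chain-prefix G k))

  Binary : ℕ → List ℕ → Set
  Binary p a = (∀ k → pt a k ≤ 1) × size a ≡ p

  module _ (p : ℕ) (a : List ℕ) where

    private
      col≤1 : ∀ {Θ} → GTChain (column p) a Θ → ∀ k i → Θ k i ≤ 1
      col≤1 G k i = ≤-trans (chain-inc G k i) (≤-trans (≤-reflexive (column-pt p i)) (below?≤1 p i))

    column-chain : ∀ {Θ} → GTChain (column p) a Θ → ∀ k → Θ k ≗ below? (prefix (pt a) k)
    column-chain {Θ} G k i = trans (below?-unique (length (column p)) (chain-dec G k) (col≤1 G k) (chain-vanish G k) i) (cong (λ n → below? n i) (chain-prefix G k))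

    -- Two consecutive columns of the chain form a horizontal strip, and shifting the larger one up
    -- by a row shows that it is at most one box higher. So each letter occurs at most once.
    column-binary : ∀ {Θ} → GTChain (column p) a Θ → Binary p a
    column-binary {Θ} G = (λ k → +-cancelˡ-≤ (prefix (Θ k) N) (pt a k) 1 (≤-trans (≤-reflexive (sym (weight G k N ≤-refl))) (grow k N))) ,
      trans (sym (prefix-pt a (length a) ≤-refl)) (trans (sym (chain-prefix G (length a)))
        (trans (prefix-cong (top G (length a) ≤-refl) N) (trans (prefix-pt (column p) N ≤-refl) (size-column p))))
      where
      N = length (column p)
      grow : ∀ k n → prefix (Θ (suc k)) n ≤ prefix (Θ k) n + 1
      grow k n = ≤-trans (m≤m+n _ _) (≤-trans (≤-reflexive (prefix-suc (Θ (suc k)) n)) (≤-trans (+-mono-≤ (col≤1 G (suc k) 0) (shifted n)) (≤-reflexive (+-comm 1 _))))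
        where
        shifted : ∀ n → prefix (Θ (suc k) ∘ suc) n ≤ prefix (Θ k) n
        shifted zero = z≤n
        shifted (suc n) = +-mono-≤ (shifted n) (proj₂ (weave G k n))

    binary-chain : Binary p a → GTChain (column p) a (λ k → below? (prefix (pt a) k))
    binary-chain (a≤1 , e) = record
      { bottom = λ i → below?-no {k = i} z≤n
      ; top = λ k h i → trans (cong (λ n → below? n i) (trans (prefix-pt a k h) e)) (sym (column-pt p i))
      ; weave = λ k i → below?-mono {k = i} {l = i} (λ lt → ≤-trans lt (m≤m+n _ _)) ,
          below?-mono {k = suc i} {l = i} (λ lt → ≤-pred (≤-trans lt (≤-trans (+-monoʳ-≤ _ (a≤1 k)) (≤-reflexive (+-comm _ 1)))))
      ; weight = λ k N h → trans (prefix-below? (prefix (pt a) (suc k)) N (small (suc k) N h)) (cong (_+ pt a k) (sym (prefix-below? (prefix (pt a) k) N (small k N h)))) }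
      where
      mono : ∀ k → prefix (pt a) k ≤ prefix (pt a) (k + length a)
      mono k = subst (λ n → prefix (pt a) k ≤ prefix (pt a) n) (+-comm (length a) k) (go (length a))
        where
        go : ∀ d → prefix (pt a) k ≤ prefix (pt a) (d + k)
        go zero = ≤-refl
        go (suc d) = ≤-trans (go d) (m≤m+n _ _)
      small : ∀ k N → length (column p) ≤ N → prefix (pt a) k ≤ N
      small k N h = ≤-trans (mono k) (≤-trans (≤-reflexive (trans (prefix-pt a (k + length a) (m≤n+m _ k)) e)) (≤-trans (≤-reflexive (sym (length-column p))) h))

    column-Semi⇒ : ∀ {vs} → Semi (column p) a vs → Binary p a
    column-Semi⇒ {vs} S = column-binary (FromSemi.gt-chain (column p) a vs (column-IsP p) S)

    column-Semi⇐ : Binary p a → ∃[ vs ] Semi (column p) a vs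
    column-Semi⇐ b = _ , FromChain.word-semi (column p) a (column-IsP p) _ (binary-chain b)

    column-Semi-unique : ∀ {vs vs′} → Semi (column p) a vs → Semi (column p) a vs′ → vs ≡ vs′
    column-Semi-unique {vs} {vs′} S S′ = Semi-determined (column-IsP p) S S′
      (λ k i → trans (column-chain (FromSemi.gt-chain (column p) a vs (column-IsP p) S) k i) (sym (column-chain (FromSemi.gt-chain (column p) a vs′ (column-IsP p) S′) k i)))

  Splits : List ℕ → List ℕ × List ℕ → Set
  Splits a (u , v) = length u ≡ length a × length v ≡ length a × (∀ k → pt u k + pt v k ≡ pt a k)

  enum-splits : ∀ a → Enumerates (splits a) (Splits a)
  enum-splits [] = enum-resp (λ { refl → refl , refl , λ _ → refl }) (λ { {[] , []} _ → refl }) enum-[ [] , [] ]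
  enum-splits (n ∷ a) = enum-resp
    (λ { (k , lt , (u , v) , (e , e′ , h) , refl) → cong suc e , cong suc e′ , λ { zero → m+[n∸m]≡n (≤-pred lt) ; (suc i) → h i } })
    (λ { {k ∷ u , l ∷ v} (e , e′ , h) → k , s≤s (≤-trans (m≤m+n k l) (≤-reflexive (h 0))) , (u , v) , (suc-injective e , suc-injective e′ , h ∘ suc) ,
           cong (λ z → k ∷ u , z ∷ v) (trans (sym (m+n∸m≡n k l)) (cong (_∸ k) (h 0))) })
    (enum-concatMap (λ k → map (λ uv → (k ∷ proj₁ uv , (n ∸ k) ∷ proj₂ uv)) (splits a)) (λ { _ _ (_ , _ , refl) (_ , _ , refl) → refl }) (enum-upTo (suc n))
      (λ {k} _ → enum-map (λ uv → (k ∷ proj₁ uv , (n ∸ k) ∷ proj₂ uv)) (λ { refl → refl }) (enum-splits a)))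

-- The Pieri rule for a column, on the level of Kostka numbers.

module Pieri where

  open Linear using (lia; K; _⊞_; _≼_; _≐_; _⇒_; [_]⊢_; [_∣_]⊢_)
  open Step using (Fn; prefix; Decreasing; VStrip; HStrip; VanishesFrom)
  open Compat using (prefix-mono)
  open Chain using (_≗_; HStrip-decˡ; HStrip-decʳ)
  open DualInsertion
  open Enum
  open Shape
  open ArrowToFilling using (inc-≤)
  open VerticalPairSums using (isVStrip⇒; ⇒isVStrip)
  open Semistandard
  open GelfandTsetlin
  open Column

  pt-applyUpTo : ∀ f n → VanishesFrom n f → pt (applyUpTo f n) ≗ f
  pt-applyUpTo f zero h k = sym (h k z≤n)
  pt-applyUpTo f (suc n) h zero = refl
  pt-applyUpTo f (suc n) h (suc k) = pt-applyUpTo (f ∘ suc) n (λ k le → h (suc k) (s≤s le)) k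

  VStrip-cong : ∀ {l u m v} → l ≗ m → u ≗ v → VStrip l u → VStrip m v
  VStrip-cong {l} {u} {m} {v} el eu h k = subst (_≤ v k) (el k) (subst (l k ≤_) (eu k) (proj₁ (h k))) , subst (v k ≤_) (cong suc (el k)) (subst (_≤ suc (l k)) (eu k) (proj₂ (h k)))

  size-splits : ∀ a {u v} → Splits a (u , v) → size u + size v ≡ size a
  size-splits a {u} {v} (e , e′ , h) = trans (cong₂ _+_ (sym (prefix-pt u (length a) (≤-reflexive e))) (sym (prefix-pt v (length a) (≤-reflexive e′)))) (trans (go (length a)) (prefix-pt a (length a) ≤-refl))
    where
    go : ∀ n → prefix (pt u) n + prefix (pt v) n ≡ prefix (pt a) n
    go zero = refl
    go (suc n) = lia 6 (λ U V A x y z → U ⊞ V ≐ A ⇒ x ⊞ y ≐ z ⇒ [ 1011 ∣ 10101 ]⊢ (U ⊞ x) ⊞ (V ⊞ y) ≐ A ⊞ z) (prefix (pt u) n) (prefix (pt v) n) (prefix (pt a) n) (pt u n) (pt v n) (pt a n) (go n) (h n)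

  chain-size : ∀ {α a Θ} → GTChain α a Θ → size α ≡ size a
  chain-size {α} {a} {Θ} G = trans (sym (prefix-pt α (length α) ≤-refl)) (trans (sym (prefix-cong (top G (length a) ≤-refl) (length α)))
    (trans (chain-prefix G (length a)) (prefix-pt a (length a) ≤-refl)))

  -- Side by side, the chains `Θ′` of a tableau of shape β and `Θ` of one of shape λ form a strip of
  -- growth squares. The amount inserted in square `k` is the multiplicity of the letter `suc k` in
  -- the column tableau.
  Bumps : List ℕ → (Θ′ Θ : ℕ → Fn) → Set
  Bumps a′ Θ′ Θ = ∀ k → Bump (pt a′ k) (Θ′ k) (Θ′ (suc k)) (Θ k) (Θ (suc k))

  Bumps-cong : ∀ {a′ Θ′ Θ Ξ′ Ξ} → (∀ k → Θ′ k ≗ Ξ′ k) → (∀ k → Θ k ≗ Ξ k) → Bumps a′ Θ′ Θ → Bumps a′ Ξ′ Ξ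
  Bumps-cong e′ e B k = Bump-cong (e′ k) (e′ (suc k)) (e k) (e (suc k)) (B k)

  -- the chain of λ determines that of β, from the largest entries to the smallest
  module Remove (l β : Part) (a : List ℕ) (Θ : ℕ → Fn) (G : GTChain l a Θ) (pβ : IsP β) (strip : VStrip (pt β) (pt l)) where

    private
      n = length a

      descend : ℕ → ℕ → Fn
      descend zero i = pt β
      descend (suc d) i = Extraction.inner (length l) (descend d (suc i)) (Θ i) (Θ (suc i))

    Θ′ : ℕ → Fn
    Θ′ i = descend (n ∸ i) i

    private
      Good : ℕ → Fn → Set
      Good i u = Decreasing u × VStrip u (Θ i)

      module E (i : ℕ) (u : Fn) (g : Good (suc i) u) =
        Extract (length l) u (Θ i) (Θ (suc i)) (proj₁ g) (proj₂ g) (weave G i) (chain-vanish G (suc i))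

      good-end : ∀ i → n ≤ i → Good i (pt β)
      good-end i h = pt-dec β pβ , VStrip-cong (λ _ → refl) (λ k → sym (top G i h k)) strip

      good-descend : ∀ d i → d + i ≡ n → Good i (descend d i)
      good-descend zero i refl = good-end n ≤-refl
      good-descend (suc d) i e = let g = good-descend d (suc i) (trans (+-suc d i) e) in HStrip-decˡ (E.hstrip i _ g) , E.vstrip i _ g

      Θ′-end : ∀ i → n ≤ i → Θ′ i ≡ pt β
      Θ′-end i h = cong (λ d → descend d i) (m≤n⇒m∸n≡0 h)

      good : ∀ i → Good i (Θ′ i)
      good i with <-≤-connex i n
      ... | inj₁ i<n = good-descend (n ∸ i) i (m∸n+n≡m (<⇒≤ i<n))
      ... | inj₂ n≤i = subst (Good i) (sym (Θ′-end i n≤i)) (good-end i n≤i)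

      Moved : ℕ → Set
      Moved i = ∃[ e ] (e ≤ 1 × (n ≤ i → e ≡ 0) × Bump e (Θ′ i) (Θ′ (suc i)) (Θ i) (Θ (suc i)) × HStrip (Θ′ i) (Θ′ (suc i)))

      moved : ∀ i → Moved i
      moved i with <-≤-connex i n
      ... | inj₁ i<n = e , subst (_≤ 1) (x-top b) (x≤1 b 0) , (λ h → ⊥-elim (<⇒≱ i<n h)) ,
          subst (λ u → Bump e u (Θ′ (suc i)) (Θ i) (Θ (suc i)) × HStrip u (Θ′ (suc i))) (cong (λ d → descend d i) (sym (+-∸-assoc 1 i<n))) (b , E.hstrip i _ (good (suc i)))
        where
        e = Extraction.xs (length l) (Θ′ (suc i)) (Θ i) (Θ (suc i)) 0
        b = E.bump i _ (good (suc i))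
      ... | inj₂ n≤i rewrite Θ′-end i n≤i | Θ′-end (suc i) (m≤n⇒m≤1+n n≤i) = 0 , z≤n , (λ _ → refl) ,
          Bump-cong (λ _ → refl) (λ _ → refl) (λ k → sym (top G i n≤i k)) (λ k → sym (top G (suc i) (m≤n⇒m≤1+n n≤i) k)) (Bump-idle strip) ,
          (λ k → ≤-refl , pt-dec β pβ k)

      ε : ℕ → ℕ
      ε i = proj₁ (moved i)

      inner-strip : ∀ i → HStrip (Θ′ i) (Θ′ (suc i))
      inner-strip i = proj₂ (proj₂ (proj₂ (proj₂ (moved i))))

      bounded : ∀ i k → Θ′ i k ≤ pt β k
      bounded i k = ≤-trans (inc-≤ {λ i → Θ′ i k} (λ i → proj₁ (inner-strip i k)) (m≤m+n i n)) (≤-reflexive (cong (λ f → f k) (Θ′-end (i + n) (m≤n+m n i))))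

      vanish′ : ∀ i → VanishesFrom (length β) (Θ′ i)
      vanish′ i k h = n≤0⇒n≡0 (≤-trans (bounded i k) (≤-reflexive (pt-vanish β k h)))

      -- At the height `M`, beyond all shapes involved and past the limit of the bump, the
      -- telescoped rule has no boundary term. So the letter loses exactly `ε i` of its occurrences
      -- in passing from λ to β.
      balance : ∀ i N → length β ≤ N → prefix (Θ′ (suc i)) N + ε i ≡ prefix (Θ′ i) N + pt a i
      balance i N h = lia 10 (λ P′ P Q′ Q X E A xM sN sN′ → Q ⊞ P′ ⊞ xM ≐ Q′ ⊞ P ⊞ E ⇒ xM ≐ K 0 ⇒ Q ≐ P ⊞ A ⇒ sN′ ≐ Q′ ⇒ sN ≐ P′ ⇒ [ 10010101101 ∣ 1001010011 ]⊢ sN′ ⊞ E ≐ sN ⊞ A)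
        (prefix (Θ′ i) M) (prefix (Θ i) M) (prefix (Θ′ (suc i)) M) (prefix (Θ (suc i)) M) 0 (ε i) (pt a i) (x b M) (prefix (Θ′ i) N) (prefix (Θ′ (suc i)) N)
        (prefix-bump b M) (x-end b M (m≤n+m (limit b) _)) (weight G i M (≤-trans (m≤m+n _ _) (m≤m+n _ (limit b)))) (stop (suc i)) (stop i)
        where
        b = proj₁ (proj₂ (proj₂ (proj₂ (moved i))))
        M = length l + N + limit b
        stop : ∀ i → prefix (Θ′ i) N ≡ prefix (Θ′ i) M
        stop i = trans (prefix-stop (vanish′ i) h) (sym (prefix-stop (vanish′ i) (≤-trans h (≤-trans (m≤n+m N (length l)) (m≤m+n _ (limit b))))))

      ε≤a : ∀ i → ε i ≤ pt a i
      ε≤a i = lia 4 (λ Q E P A → Q ⊞ E ≐ P ⊞ A ⇒ P ≼ Q ⇒ [ 111 ]⊢ E ≼ A) (prefix (Θ′ (suc i)) (length β)) (ε i) (prefix (Θ′ i) (length β)) (pt a i)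
        (balance i (length β) ≤-refl) (prefix-mono (λ k → proj₁ (inner-strip i k)) (length β))

    a′ a″ : List ℕ
    a′ = applyUpTo ε n
    a″ = applyUpTo (λ k → pt a k ∸ ε k) n

    private
      pt-a′ : pt a′ ≗ ε
      pt-a′ = pt-applyUpTo ε n (λ k h → proj₁ (proj₂ (proj₂ (moved k))) h)

      pt-a″ : ∀ k → pt a″ k ≡ pt a k ∸ ε k
      pt-a″ = pt-applyUpTo (λ k → pt a k ∸ ε k) n (λ k h → trans (cong (_∸ ε k) (pt-vanish a k h)) (0∸n≡0 (ε k)))

    split : Splits a (a′ , a″)
    split = length-applyUpTo ε n , length-applyUpTo _ n , λ k → trans (cong₂ _+_ (pt-a′ k) (pt-a″ k)) (m+[n∸m]≡n (ε≤a k))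

    inner-chain : GTChain β a″ Θ′
    inner-chain = record
      { bottom = λ i → n≤0⇒n≡0 (≤-trans (proj₁ (proj₂ (good 0) i)) (≤-reflexive (bottom G i)))
      ; top = λ k h i → cong (λ f → f i) (Θ′-end k (≤-trans (≤-reflexive (sym (length-applyUpTo _ n))) h))
      ; weave = inner-strip
      ; weight = λ k N h → +-cancelʳ-≡ (ε k) _ _ (trans (balance k N h) (trans (cong (prefix (Θ′ k) N +_) (sym (trans (cong (_+ ε k) (pt-a″ k)) (m∸n+n≡m (ε≤a k))))) (sym (+-assoc (prefix (Θ′ k) N) _ _)))) }

    bumps : Bumps a′ Θ′ Θ
    bumps k = subst (λ e → Bump e (Θ′ k) (Θ′ (suc k)) (Θ k) (Θ (suc k))) (sym (pt-a′ k)) (proj₁ (proj₂ (proj₂ (proj₂ (moved k)))))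

    binary : ∀ p → size l ≡ size β + p → Binary p a′
    binary p e = (λ k → subst (_≤ 1) (sym (pt-a′ k)) (proj₁ (proj₂ (moved k)))) ,
      +-cancelˡ-≡ (size β) _ _ (trans (trans (+-comm (size β) _) (trans (cong (size a′ +_) (chain-size inner-chain)) (trans (size-splits a {a′} {a″} split) (sym (chain-size G))))) e)

  module Add (β : Part) (a a′ a″ : List ℕ) (Θ′ : ℕ → Fn) (G : GTChain β a″ Θ′) (s : Splits a (a′ , a″)) (a′≤1 : ∀ k → pt a′ k ≤ 1) where

    private
      n = length a

    -- In this direction the chain of λ is built from the smallest letters on, starting with the
    -- empty shape.
    Θ : ℕ → Fn
    Θ zero = λ _ → 0
    Θ (suc i) = Insertion.outer (pt a′ i) (Θ′ i) (Θ′ (suc i)) (Θ i)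

    private
      Good : ℕ → Set
      Good i = Decreasing (Θ i) × VanishesFrom (i + length β) (Θ i) × VStrip (Θ′ i) (Θ i)

      module I (i : ℕ) (g : Good i) =
        Insert (pt a′ i) (i + length β) (Θ′ i) (Θ′ (suc i)) (Θ i) (a′≤1 i) (proj₁ g) (proj₂ (proj₂ g)) (weave G i) (proj₁ (proj₂ g))

      good : ∀ i → Good i
      good zero = (λ _ → z≤n) , (λ _ _ → refl) , λ k → ≤-reflexive (bottom G k) , z≤n
      good (suc i) = HStrip-decʳ (I.hstrip i (good i)) , I.outer-end i (good i) , I.vstrip i (good i)

      inner-top : ∀ i → n ≤ i → Θ′ i ≗ pt β
      inner-top i h = top G i (≤-trans (≤-reflexive (proj₁ (proj₂ s))) h)

      -- Past the last letter nothing is inserted and the inner chain stands still. The idle square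
      -- is one solution of the local rule, and the rule has only one.
      idle : ∀ i → n ≤ i → Θ (suc i) ≗ Θ i
      idle i h = Bump-injective (I.bump i (good i))
        (Bump-cong (λ k → sym (inner-top i h k)) (λ k → sym (inner-top (suc i) (m≤n⇒m≤1+n h) k)) (λ _ → refl) (λ _ → refl)
          (subst (λ e → Bump e (pt β) (pt β) (Θ i) (Θ i)) (sym (pt-vanish a′ i (≤-trans (≤-reflexive (proj₁ s)) h)))
            (Bump-idle (VStrip-cong (inner-top i h) (λ _ → refl) (proj₂ (proj₂ (good i)))))))

      stable : ∀ i → n ≤ i → Θ i ≗ Θ n
      stable i h = subst (λ i → Θ i ≗ Θ n) (m∸n+n≡m h) (go (i ∸ n))
        where
        go : ∀ d → Θ (d + n) ≗ Θ n
        go zero k = refl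
        go (suc d) k = trans (idle (d + n) (m≤n+m n d) k) (go d k)

    l : Part
    l = fromFn (n + length β) (Θ n)

    l-IsP : IsP l
    l-IsP = fromFn-IsP (n + length β) (Θ n) (proj₁ (good n)) (proj₁ (proj₂ (good n)))

    private
      outer-top : ∀ k → n ≤ k → Θ k ≗ pt l
      outer-top k h i = trans (stable k h i) (sym (pt-fromFn (n + length β) (Θ n) (proj₁ (good n)) (proj₁ (proj₂ (good n))) i))

    bumps : Bumps a′ Θ′ Θ
    bumps i = I.bump i (good i)

    private
      bounded : ∀ i k → Θ i k ≤ pt l k
      bounded i k = ≤-trans (inc-≤ {λ i → Θ i k} (λ i → proj₁ (I.hstrip i (good i) k)) (m≤m+n i n)) (≤-reflexive (outer-top (i + n) (m≤n+m n i) k))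

      vanish′ : ∀ i → VanishesFrom (length l) (Θ i)
      vanish′ i k h = n≤0⇒n≡0 (≤-trans (bounded i k) (≤-reflexive (pt-vanish l k h)))

      balance : ∀ i N → length l ≤ N → prefix (Θ (suc i)) N ≡ prefix (Θ i) N + pt a i
      balance i N h = lia 11 (λ P′ P Q′ Q A′ A″ E A xM sN sN′ → Q ⊞ P′ ⊞ xM ≐ Q′ ⊞ P ⊞ A′ ⇒ xM ≐ K 0 ⇒ Q′ ≐ P′ ⊞ A″ ⇒ A′ ⊞ A″ ≐ A ⇒ sN′ ≐ Q ⇒ sN ≐ P ⇒ [ 100010101101 ∣ 1001101010011 ]⊢ sN′ ≐ sN ⊞ A)
        (prefix (Θ′ i) M) (prefix (Θ i) M) (prefix (Θ′ (suc i)) M) (prefix (Θ (suc i)) M) (pt a′ i) (pt a″ i) 0 (pt a i) (x b M) (prefix (Θ i) N) (prefix (Θ (suc i)) N)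
        (prefix-bump b M) (x-end b M (m≤n+m (limit b) _)) (weight G i M (≤-trans (m≤m+n _ _) (m≤m+n _ (limit b)))) (proj₂ (proj₂ s) i) (stop (suc i)) (stop i)
        where
        b = bumps i
        M = length β + N + limit b
        stop : ∀ i → prefix (Θ i) N ≡ prefix (Θ i) M
        stop i = trans (prefix-stop (vanish′ i) h) (sym (prefix-stop (vanish′ i) (≤-trans h (≤-trans (m≤n+m N (length β)) (m≤m+n _ (limit b))))))

    outer-chain : GTChain l a Θ
    outer-chain = record { bottom = λ _ → refl ; top = outer-top ; weave = λ k → I.hstrip k (good k) ; weight = balance }

    l-strip : VStrip (pt β) (pt l)
    l-strip = VStrip-cong (inner-top n ≤-refl) (outer-top n ≤-refl) (proj₂ (proj₂ (good n)))

    l-size : ∀ p → size a′ ≡ p → size l ≡ size β + p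
    l-size p e = trans (chain-size outer-chain) (trans (sym (size-splits a {a′} {a″} s)) (trans (cong₂ _+_ e (sym (chain-size G))) (+-comm p (size β))))

  IsStripTableau : Part → ℕ → List ℕ → Part × List ℕ → Set
  IsStripTableau β p a (l , vs) = ((IsP l × size l ≡ size β + p) × T (isVStrip l β p)) × Semi l a vs

  IsTableauPair : Part → ℕ → List ℕ → (List ℕ × List ℕ) × (List ℕ × List ℕ) → Set
  IsTableauPair β p a ((a′ , a″) , (us , ws)) = Splits a (a′ , a″) × (Semi (column p) a′ us × Semi β a″ ws)

  stripTableaux : Part → ℕ → List ℕ → List (Part × List ℕ)
  stripTableaux β p a = pairs (lambdas β p) (λ l → tableaux l a)

  tableauPairs : Part → ℕ → List ℕ → List ((List ℕ × List ℕ) × (List ℕ × List ℕ))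
  tableauPairs β p a = pairs (splits a) (λ s → pairs (tableaux (column p) (proj₁ s)) (λ _ → tableaux β (proj₂ s)))

  module _ (β : Part) (p : ℕ) (a : List ℕ) (pβ : IsP β) where

    private
      Related : Part × List ℕ → (List ℕ × List ℕ) × (List ℕ × List ℕ) → Set
      Related (l , vs) ((a′ , _) , (_ , ws)) = Bumps a′ (chainOf β ws) (chainOf l vs)

      to : ∀ {X} → IsStripTableau β p a X → ∃[ Y ] (IsTableauPair β p a Y × Related X Y)
      to {l , vs} (((pl , e) , t) , S) = _ , (R.split , proj₂ (column-Semi⇐ p R.a′ (R.binary p e)) , F.word-semi) ,
        Bumps-cong {R.a′} (λ k i → sym (F.word-chain k i)) (λ _ _ → refl) R.bumps
        where
        G = FromSemi.gt-chain l a vs pl S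
        module R = Remove l β a (chainOf l vs) G pβ (proj₁ (isVStrip⇒ l β p t))
        module F = FromChain β R.a″ pβ R.Θ′ R.inner-chain

      from : ∀ {Y} → IsTableauPair β p a Y → ∃[ X ] (IsStripTableau β p a X × Related X Y)
      from {(a′ , a″) , (us , ws)} (s , C , S) = _ , (((A.l-IsP , e) , ⇒isVStrip A.l β p A.l-strip
          (+-cancelʳ-≡ (size β) _ _ (trans (length-boxes A.l β pβ (λ k → proj₁ (A.l-strip k))) (trans e (+-comm (size β) p))))) , F.word-semi) ,
        Bumps-cong {a′} (λ _ _ → refl) (λ k i → sym (F.word-chain k i)) A.bumps
        where
        b = column-Semi⇒ p a′ C
        module A = Add β a a′ a″ (chainOf β ws) (FromSemi.gt-chain β a″ ws pβ S) s (proj₁ b)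
        module F = FromChain A.l a A.l-IsP A.Θ A.outer-chain
        e = A.l-size p (proj₂ b)

      functional : ∀ {X Y Y′} → IsStripTableau β p a X → IsTableauPair β p a Y → IsTableauPair β p a Y′ → Related X Y → Related X Y′ → Y ≡ Y′
      functional {l , vs} {(a₁ , b₁) , (us₁ , ws₁)} {(a₂ , b₂) , (us₂ , ws₂)} _ (s₁ , C₁ , S₁) (s₂ , C₂ , S₂) B₁ B₂ =
        finish ea (list-ext b₁ b₂ (trans (proj₁ (proj₂ s₁)) (sym (proj₁ (proj₂ s₂))))
          (λ k _ → +-cancelˡ-≡ (pt a₁ k) _ _ (trans (proj₂ (proj₂ s₁) k) (trans (sym (proj₂ (proj₂ s₂) k)) (cong (λ a → pt a k + pt b₂ k) (sym ea))))))
          C₁ C₂ (Semi-determined pβ S₁ S₂ same)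
        where
        n = length a
        G₁ = FromSemi.gt-chain β b₁ ws₁ pβ S₁
        G₂ = FromSemi.gt-chain β b₂ ws₂ pβ S₂
        step : ∀ k → chainOf β ws₁ (suc k) ≗ chainOf β ws₂ (suc k) → pt a₁ k ≡ pt a₂ k × chainOf β ws₁ k ≗ chainOf β ws₂ k
        step k e = Bump-functional (B₁ k) (Bump-cong (λ _ → refl) (λ i → sym (e i)) (λ _ → refl) (λ _ → refl) (B₂ k))
        below : ∀ d k → n ≤ d + k → chainOf β ws₁ k ≗ chainOf β ws₂ k
        below zero k h i = trans (top G₁ k (≤-trans (≤-reflexive (proj₁ (proj₂ s₁))) h) i) (sym (top G₂ k (≤-trans (≤-reflexive (proj₁ (proj₂ s₂))) h) i))
        below (suc d) k h = proj₂ (step k (below d (suc k) (subst (n ≤_) (sym (+-suc d k)) h)))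
        same : ∀ k → chainOf β ws₁ k ≗ chainOf β ws₂ k
        same k = below n k (m≤m+n n k)
        ea : a₁ ≡ a₂
        ea = list-ext a₁ a₂ (trans (proj₁ s₁) (sym (proj₁ s₂))) (λ k _ → proj₁ (step k (same (suc k))))
        finish : ∀ {a₁ a₂ b₁ b₂ us₁ us₂ ws₁ ws₂} → a₁ ≡ a₂ → b₁ ≡ b₂ → Semi (column p) a₁ us₁ → Semi (column p) a₂ us₂ → ws₁ ≡ ws₂ →
          ((a₁ , b₁) , (us₁ , ws₁)) ≡ ((a₂ , b₂) , (us₂ , ws₂))
        finish {a₁} refl refl C₁ C₂ refl = cong (λ us → _ , (us , _)) (column-Semi-unique p a₁ C₁ C₂)

      injective : ∀ {X X′ Y} → IsStripTableau β p a X → IsStripTableau β p a X′ → IsTableauPair β p a Y → Related X Y → Related X′ Y → X ≡ X′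
      injective {l₁ , vs₁} {l₂ , vs₂} {(a′ , _) , (_ , ws)} (((p₁ , _) , _) , S₁) (((p₂ , _) , _) , S₂) _ B₁ B₂ =
        finish (pt-injective l₁ l₂ p₁ p₂ (λ i → trans (sym (top G₁ n ≤-refl i)) (trans (same n i) (top G₂ n ≤-refl i)))) p₁ S₁ S₂ same
        where
        n = length a
        G₁ = FromSemi.gt-chain l₁ a vs₁ p₁ S₁
        G₂ = FromSemi.gt-chain l₂ a vs₂ p₂ S₂
        same : ∀ k → chainOf l₁ vs₁ k ≗ chainOf l₂ vs₂ k
        same zero i = trans (bottom G₁ i) (sym (bottom G₂ i))
        same (suc k) = Bump-injective (B₁ k) (Bump-cong (λ _ → refl) (λ _ → refl) (λ i → sym (same k i)) (λ _ → refl) (B₂ k))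
        finish : ∀ {l₁ l₂ vs₁ vs₂} → l₁ ≡ l₂ → IsP l₁ → Semi l₁ a vs₁ → Semi l₂ a vs₂ → (∀ k → chainOf l₁ vs₁ k ≗ chainOf l₂ vs₂ k) → (l₁ , vs₁) ≡ (l₂ , vs₂)
        finish refl p S₁ S₂ e = cong (_ ,_) (Semi-determined p S₁ S₂ e)

    pieri-count : ∑ (stripTableaux β p a) (λ _ → ℤ.+ 1) ≡ ∑ (tableauPairs β p a) (λ _ → ℤ.+ 1)
    pieri-count = ∑-match Related
      (enum-pairs (enum-filterB _ (enum-partitionsOf (size β + p))) (λ {l} _ → enum-tableaux l a))
      (enum-pairs (enum-splits a) (λ {s} _ → enum-pairs (enum-tableaux (column p) (proj₁ s)) (λ _ → enum-tableaux β (proj₂ s))))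
      to from functional injective (λ _ _ _ → refl)

    pieri : ∑ (lambdas β p) (λ l → ℤ.+ kostka l a) ≡ ∑ (splits a) (λ s → ℤ.+ kostka (column p) (proj₁ s) ℤ.* ℤ.+ kostka β (proj₂ s))
    pieri = trans (∑-cong (lambdas β p) (λ l _ → sym (∑-const-1 (tableaux l a)))) (trans (sym (∑-pairs (lambdas β p) (λ l → tableaux l a) (λ _ → ℤ.+ 1)))
      (trans pieri-count (trans (∑-pairs (splits a) (λ s → pairs (tableaux (column p) (proj₁ s)) (λ _ → tableaux β (proj₂ s))) (λ _ → ℤ.+ 1)) (∑-cong (splits a) (λ s _ → product (tableaux (column p) (proj₁ s)) (tableaux β (proj₂ s)))))))
      where
      product : ∀ (us ws : List (List ℕ)) → ∑ (pairs us (λ _ → ws)) (λ _ → ℤ.+ 1) ≡ ℤ.+ length us ℤ.* ℤ.+ length ws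
      product us ws = trans (∑-pairs us (λ _ → ws) (λ _ → ℤ.+ 1)) (trans (∑-cong us (λ _ _ → trans (∑-const-1 ws) (sym (ℤₚ.*-identityˡ _))))
        (trans (∑-*ʳ (ℤ.+ length ws) us (λ _ → ℤ.+ 1)) (cong (ℤ._* ℤ.+ length ws) (∑-const-1 us))))

-- Products of series and the induction for the product formula.

open ≡-Reasoning

open Enum
open Shape
open VerticalPairSums using (isVStrip⇒; ⇒isVStrip; Jlist)
open Arrows using (part₁; part₂; idArrows; enum-arrowsFrom; proper-smaller)
open ArrowsPastStrips using (arrows-past-strips)
open Column using (column-IsP)
open Pieri using (pieri)

sumS-map : ∀ {A : Set} (h : A → Series) xs a b → sumS (map h xs) a b ≡ ∑ xs (λ x → h x a b)
sumS-map h [] a b = refl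
sumS-map h (x ∷ xs) a b = cong (λ z → h x a b ℤ.+ z) (sumS-map h xs a b)

⊗-∑ : ∀ f g a b → (f ⊗ g) a b ≡ ∑ (splits a) (λ u → ∑ (splits b) (λ v → f (proj₁ u) (proj₁ v) ℤ.* g (proj₂ u) (proj₂ v)))
⊗-∑ f g a b = trans (sum-∑ (concatMap terms (splits a))) (trans (∑-concatMap terms (splits a) (λ z → z)) (∑-cong (splits a) (λ u _ → ∑-map (λ v → f (proj₁ u) (proj₁ v) ℤ.* g (proj₂ u) (proj₂ v)) (splits b) (λ z → z))))
  where
  terms : List ℕ × List ℕ → List ℤ
  terms u = map (λ v → f (proj₁ u) (proj₁ v) ℤ.* g (proj₂ u) (proj₂ v)) (splits b)
  sum-∑ : ∀ xs → foldr ℤ._+_ (ℤ.+ 0) xs ≡ ∑ xs (λ z → z)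
  sum-∑ [] = refl
  sum-∑ (x ∷ xs) = cong (λ z → x ℤ.+ z) (sum-∑ xs)

-- With `column 0` being the empty partition, the case p = 0 of the Pieri rule becomes s_∅ s_β =
-- s_β, which is the factor in the variables y.
lambdas-zero : ∀ β (f : Part → ℤ) → IsP β → ∑ (lambdas β 0) f ≡ f β
lambdas-zero β f pβ = trans (∑-match _≡_ (enum-filterB _ (enum-partitionsOf (size β + 0))) enum-[ β ]
  (λ {l} ((p , e) , t) → β , refl , sym (pt-injective β l pβ p (⊑-size-≡ β l (λ k → proj₁ (proj₁ (isVStrip⇒ l β 0 t) k)) (sym (trans e (+-identityʳ _))))))
  (λ { refl → β , ((pβ , sym (+-identityʳ _)) , ⇒isVStrip β β 0 (λ k → ≤-refl , n≤1+n _) (+-cancelʳ-≡ (size β) _ _ (length-boxes β β pβ (λ _ → ≤-refl)))) , refl })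
  (λ { _ _ _ refl e → e }) (λ { _ _ _ e refl → e }) (λ { _ _ refl → refl })) (ℤₚ.+-identityʳ (f β))

schur-pieri : ∀ p β₁ β₂ → IsP β₁ → IsP β₂ → ∀ a b →
  (schur₂ (column p) [] ⊗ schur₂ β₁ β₂) a b ≡ ∑ (lambdas β₁ p) (λ l → schur₂ l β₂ a b)
schur-pieri p β₁ β₂ p₁ p₂ a b = begin
  (schur₂ (column p) [] ⊗ schur₂ β₁ β₂) a b
    ≡⟨ ⊗-∑ (schur₂ (column p) []) (schur₂ β₁ β₂) a b ⟩
  ∑ (splits a) (λ u → ∑ (splits b) (λ v → C u ℤ.* N v ℤ.* (B₁ u ℤ.* B₂ v)))
    ≡⟨ ∑-cong (splits a) (λ u _ → trans (∑-cong (splits b) (λ v _ → interchange (C u) (N v) (B₁ u) (B₂ v))) (∑-*ˡ (C u ℤ.* B₁ u) (splits b) (λ v → N v ℤ.* B₂ v))) ⟩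
  ∑ (splits a) (λ u → C u ℤ.* B₁ u ℤ.* ∑ (splits b) (λ v → N v ℤ.* B₂ v))
    ≡⟨ ∑-*ʳ (∑ (splits b) (λ v → N v ℤ.* B₂ v)) (splits a) (λ u → C u ℤ.* B₁ u) ⟩
  ∑ (splits a) (λ u → C u ℤ.* B₁ u) ℤ.* ∑ (splits b) (λ v → N v ℤ.* B₂ v)
    ≡⟨ cong₂ ℤ._*_ (sym (pieri β₁ p a p₁)) (trans (sym (pieri β₂ 0 b p₂)) (lambdas-zero β₂ (λ l → ℤ.+ kostka l b) p₂)) ⟩
  ∑ (lambdas β₁ p) (λ l → ℤ.+ kostka l a) ℤ.* ℤ.+ kostka β₂ b
    ≡⟨ ∑-*ʳ (ℤ.+ kostka β₂ b) (lambdas β₁ p) (λ l → ℤ.+ kostka l a) ⟨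
  ∑ (lambdas β₁ p) (λ l → schur₂ l β₂ a b) ∎
  where
  C B₁ : List ℕ × List ℕ → ℤ
  C u = ℤ.+ kostka (column p) (proj₁ u)
  B₁ u = ℤ.+ kostka β₁ (proj₂ u)
  N B₂ : List ℕ × List ℕ → ℤ
  N v = ℤ.+ kostka [] (proj₁ v)
  B₂ v = ℤ.+ kostka β₂ (proj₂ v)
  interchange : ∀ x y z w → x ℤ.* y ℤ.* (z ℤ.* w) ≡ x ℤ.* z ℤ.* (y ℤ.* w)
  interchange = solve-∀

module _ (ρ : ℕ) where

  private
    r = suc ρ

    properArrows : Part → Part → List Arrow
    properArrows α₁ α₂ = filterB (λ a → rowRule r α₂ (proj₁ (proj₂ a)) (proj₂ (proj₂ a))) (arrowsFrom α₁ α₂)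

  -- Arrows decrease the size of the second partition, so any fuel exceeding it gives the same
  -- value. This reconciles the fuel left over from the source of an arrow with the fuel that `τ`
  -- takes for its target.
  enough-fuel : ∀ f g α₁ α₂ → IsP α₁ → IsP α₂ → size α₂ < f → size α₂ < g → ∀ a b → τF r f α₁ α₂ a b ≡ τF r g α₁ α₂ a b
  enough-fuel (suc f) (suc g) α₁ α₂ p₁ p₂ (s≤s h) (s≤s k) a b = cong (λ z → schur₂ α₁ α₂ a b ℤ.- z)
    (trans (sumS-map _ (properArrows α₁ α₂) a b) (trans (∑-cong (properArrows α₁ α₂) same) (sym (sumS-map _ (properArrows α₁ α₂) a b))))
    where
    same : ∀ t → t ∈ properArrows α₁ α₂ → τF r f (proj₁ t) (proj₁ (proj₂ t)) a b ≡ τF r g (proj₁ t) (proj₁ (proj₂ t)) a b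
    same t t∈ = let A = sound (enum-arrowsFrom ρ α₁ α₂ p₁ p₂) t∈ ; lt = proper-smaller ρ α₁ α₂ p₁ p₂ A in
      enough-fuel f g (proj₁ t) (proj₁ (proj₂ t)) (part₁ (proj₁ A)) (part₂ (proj₁ A)) (<-≤-trans lt h) (<-≤-trans lt k) a b

  schur-expand : ∀ α₁ α₂ → IsP α₁ → IsP α₂ → ∀ a b → schur₂ α₁ α₂ a b ≡ ∑ (idArrows r α₁ α₂) (λ t → τ r (proj₁ t) (proj₁ (proj₂ t)) a b)
  schur-expand α₁ α₂ p₁ p₂ a b = trans (restore (schur₂ α₁ α₂ a b) _) (cong (λ z → τ r α₁ α₂ a b ℤ.+ z)
      (trans (sumS-map _ (properArrows α₁ α₂) a b) (∑-cong (properArrows α₁ α₂) same)))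
    where
    restore : ∀ x y → x ≡ x ℤ.- y ℤ.+ y
    restore = solve-∀
    same : ∀ t → t ∈ properArrows α₁ α₂ → τF r (size α₂) (proj₁ t) (proj₁ (proj₂ t)) a b ≡ τ r (proj₁ t) (proj₁ (proj₂ t)) a b
    same t t∈ = let A = sound (enum-arrowsFrom ρ α₁ α₂ p₁ p₂) t∈ in
      enough-fuel _ _ (proj₁ t) (proj₁ (proj₂ t)) (part₁ (proj₁ A)) (part₂ (proj₁ A)) (proper-smaller ρ α₁ α₂ p₁ p₂ A) ≤-refl a b

  -- The second partition is empty and cannot become smaller, so only the trivial arrow starts here.
  τ-column : ∀ p a b → τ r (column p) [] a b ≡ schur₂ (column p) [] a b
  τ-column p a b = trans (sym (ℤₚ.+-identityʳ _)) (sym (trans (schur-expand (column p) [] (column-IsP p) _ a b) (cong (λ z → τ r (column p) [] a b ℤ.+ z)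
    (trans (∑-cong (properArrows (column p) []) {g = λ _ → ℤ.+ 0} (λ t t∈ → ⊥-elim (n≮0 (proper-smaller ρ (column p) [] (column-IsP p) _ (sound (enum-arrowsFrom ρ (column p) [] (column-IsP p) _) t∈)))))
      (∑-zero (properArrows (column p) []))))))

  module _ (p : ℕ) (a b : List ℕ) where

    private
      E : Series
      E = τ r (column p) []

      J : Part → Part → ℤ
      J δ₁ δ₂ = ∑ (Jlist r p δ₁ δ₂) (λ z → τ r (proj₁ (proj₂ z)) (proj₂ (proj₂ z)) a b)

    ⊗-distrib : ∀ {A : Set} (ts : List A) (g : Series) (h : A → Series) → (∀ a b → g a b ≡ ∑ ts (λ t → h t a b)) → (E ⊗ g) a b ≡ ∑ ts (λ t → (E ⊗ h t) a b)
    ⊗-distrib ts g h e = begin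
      (E ⊗ g) a b
        ≡⟨ ⊗-∑ E g a b ⟩
      ∑ (splits a) (λ u → ∑ (splits b) (λ v → E (proj₁ u) (proj₁ v) ℤ.* g (proj₂ u) (proj₂ v)))
        ≡⟨ ∑-cong (splits a) (λ u _ → trans (∑-cong (splits b) (λ v _ → trans (cong (E (proj₁ u) (proj₁ v) ℤ.*_) (e (proj₂ u) (proj₂ v))) (sym (∑-*ˡ (E (proj₁ u) (proj₁ v)) ts _)))) (∑-swap (splits b) ts _)) ⟩
      ∑ (splits a) (λ u → ∑ ts (λ t → ∑ (splits b) (λ v → E (proj₁ u) (proj₁ v) ℤ.* h t (proj₂ u) (proj₂ v))))
        ≡⟨ ∑-swap (splits a) ts _ ⟩
      ∑ ts (λ t → ∑ (splits a) (λ u → ∑ (splits b) (λ v → E (proj₁ u) (proj₁ v) ℤ.* h t (proj₂ u) (proj₂ v))))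
        ≡⟨ ∑-cong ts (λ t _ → sym (⊗-∑ E (h t) a b)) ⟩
      ∑ ts (λ t → (E ⊗ h t) a b) ∎

    -- the trivial arrow contributes the product formula
    arrow-sums : ∀ β₁ β₂ → IsP β₁ → IsP β₂ →
      ∑ (idArrows r β₁ β₂) (λ t → (E ⊗ τ r (proj₁ t) (proj₁ (proj₂ t))) a b) ≡ ∑ (idArrows r β₁ β₂) (λ t → J (proj₁ t) (proj₁ (proj₂ t)))
    arrow-sums β₁ β₂ p₁ p₂ = begin
      ∑ (idArrows r β₁ β₂) (λ t → (E ⊗ τ r (proj₁ t) (proj₁ (proj₂ t))) a b)
        ≡⟨ ⊗-distrib (idArrows r β₁ β₂) (schur₂ β₁ β₂) (λ t → τ r (proj₁ t) (proj₁ (proj₂ t))) (schur-expand β₁ β₂ p₁ p₂) ⟨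
      (E ⊗ schur₂ β₁ β₂) a b
        ≡⟨ trans (⊗-∑ E (schur₂ β₁ β₂) a b) (trans (∑-cong (splits a) (λ u _ → ∑-cong (splits b) (λ v _ →
             cong (ℤ._* schur₂ β₁ β₂ (proj₂ u) (proj₂ v)) (τ-column p (proj₁ u) (proj₁ v))))) (sym (⊗-∑ (schur₂ (column p) []) (schur₂ β₁ β₂) a b))) ⟩
      (schur₂ (column p) [] ⊗ schur₂ β₁ β₂) a b
        ≡⟨ schur-pieri p β₁ β₂ p₁ p₂ a b ⟩
      ∑ (lambdas β₁ p) (λ l → schur₂ l β₂ a b)
        ≡⟨ ∑-cong (lambdas β₁ p) (λ l l∈ → schur-expand l β₂ (proj₁ (proj₁ (sound (enum-filterB (λ l → isVStrip l β₁ p) (enum-partitionsOf (size β₁ + p))) l∈))) p₂ a b) ⟩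
      ∑ (lambdas β₁ p) (λ l → ∑ (idArrows r l β₂) (λ t → τ r (proj₁ t) (proj₁ (proj₂ t)) a b))
        ≡⟨ arrows-past-strips ρ p β₁ β₂ p₁ p₂ (λ γ₁ γ₂ → τ r γ₁ γ₂ a b) ⟩
      ∑ (idArrows r β₁ β₂) (λ t → J (proj₁ t) (proj₁ (proj₂ t))) ∎

    -- `arrow-sums` is the claim summed over the trivial arrow and all proper ones. The targets of
    -- proper arrows have a smaller second partition, so by induction their contributions agree on
    -- both sides and cancel.
    product-formula : ∀ n β₁ β₂ → size β₂ < n → IsP β₁ → IsP β₂ → (E ⊗ τ r β₁ β₂) a b ≡ J β₁ β₂
    product-formula (suc n) β₁ β₂ (s≤s h) p₁ p₂ = +-cancelʳ _ _ _ (trans (cong (λ z → (E ⊗ τ r β₁ β₂) a b ℤ.+ z) (sym (∑-cong (properArrows β₁ β₂) smaller))) (arrow-sums β₁ β₂ p₁ p₂))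
      where
      +-cancelʳ : ∀ x y z → x ℤ.+ z ≡ y ℤ.+ z → x ≡ y
      +-cancelʳ x y z e = trans (cancel x z) (trans (cong (ℤ._- z) e) (sym (cancel y z)))
        where
        cancel : ∀ x z → x ≡ x ℤ.+ z ℤ.- z
        cancel = solve-∀
      smaller : ∀ t → t ∈ properArrows β₁ β₂ → (E ⊗ τ r (proj₁ t) (proj₁ (proj₂ t))) a b ≡ J (proj₁ t) (proj₁ (proj₂ t))
      smaller t t∈ = let A = sound (enum-arrowsFrom ρ β₁ β₂ p₁ p₂) t∈ in
        product-formula n (proj₁ t) (proj₁ (proj₂ t)) (<-≤-trans (proper-smaller ρ β₁ β₂ p₁ p₂ A) h) (part₁ (proj₁ A)) (part₂ (proj₁ A))

mainTheorem8 : (r p : ℕ) → 1 ≤ r → 1 ≤ p → (β₁ β₂ : List ℕ)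
  → T (isPartition β₁) → T (isPartition β₂)
  → (a b : List ℕ)
  → (τ r (column p) [] ⊗ τ r β₁ β₂) a b
    ≡ sumS (map (λ l → τ r l β₂ ⊕ sumS (map (λ g → τ r (proj₁ g) (proj₂ g)) (innerPairs r β₁ β₂ l)))
                (lambdas β₁ p)) a b
mainTheorem8 (suc ρ) p _ _ β₁ β₂ p₁ p₂ a b = begin
  (τ (suc ρ) (column p) [] ⊗ τ (suc ρ) β₁ β₂) a b
    ≡⟨ product-formula ρ p a b (suc (size β₂)) β₁ β₂ ≤-refl p₁ p₂ ⟩
  ∑ (Jlist (suc ρ) p β₁ β₂) (λ z → τ (suc ρ) (proj₁ (proj₂ z)) (proj₂ (proj₂ z)) a b)
    ≡⟨ ∑-pairs (lambdas β₁ p) (λ l → (l , β₂) ∷ innerPairs (suc ρ) β₁ β₂ l) (λ z → τ (suc ρ) (proj₁ (proj₂ z)) (proj₂ (proj₂ z)) a b) ⟩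
  ∑ (lambdas β₁ p) (λ l → τ (suc ρ) l β₂ a b ℤ.+ ∑ (innerPairs (suc ρ) β₁ β₂ l) (λ g → τ (suc ρ) (proj₁ g) (proj₂ g) a b))
    ≡⟨ ∑-cong (lambdas β₁ p) (λ l _ → cong (λ z → τ (suc ρ) l β₂ a b ℤ.+ z) (sym (sumS-map (λ g → τ (suc ρ) (proj₁ g) (proj₂ g)) (innerPairs (suc ρ) β₁ β₂ l) a b))) ⟩
  ∑ (lambdas β₁ p) (λ l → (τ (suc ρ) l β₂ ⊕ sumS (map (λ g → τ (suc ρ) (proj₁ g) (proj₂ g)) (innerPairs (suc ρ) β₁ β₂ l))) a b)
    ≡⟨ sumS-map (λ l → τ (suc ρ) l β₂ ⊕ sumS (map (λ g → τ (suc ρ) (proj₁ g) (proj₂ g)) (innerPairs (suc ρ) β₁ β₂ l))) (lambdas β₁ p) a b ⟨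
  sumS (map (λ l → τ (suc ρ) l β₂ ⊕ sumS (map (λ g → τ (suc ρ) (proj₁ g) (proj₂ g)) (innerPairs (suc ρ) β₁ β₂ l))) (lambdas β₁ p)) a b ∎
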